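{- Let $B=B^{r_N,1}\otimes\cdots\otimes B^{r_1,1}$ be a tensor product of Kirillov--Reshetikhin crystals either of type $A_{n-1}^{(1)}$ (with $1\le r_i\le n-1$) or of type $C_n^{(1)}$ (with $1\le r_i\le n$), where $r_N\ge r_{N-1}\ge\cdots\ge r_1\ge 1$. Then for every $b\in B$, \[ D(b) = -\,\mathrm{charge}(b), \] where $D$ is the energy function and $\mathrm{charge}$ is the charge statistic (of type $A_{n-1}$, resp. $C_n$) described in the context.
   Context: Crystal conventions: for a crystal with operators $e_i,f_i$ (which may return $\emptyset$), $\varepsilon_i(b)=\max\{k: e_i^k(b)\neq\emptyset\}$, $\varphi_i(b)=\max\{k: f_i^k(b)\neq\emptyset\}$. On tensor products, $f_i(b_1\otimes b_2)=f_i(b_1)\otimes b_2$ if $\varepsilon_i(b_1)\ge\varphi_i(b_2)$ and $b_1\otimes f_i(b_2)$ otherwise; $e_i(b_1\otimes b_2)=e_i(b_1)\otimes b_2$ if $\varepsilon_i(b_1)>\varphi_i(b_2)$ and $b_1\otimes e_i(b_2)$ otherwise. Type $A_{n-1}^{(1)}$: for $1\le r\le n-1$, $B^{r,1}$ is the set of strictly increasing columns $b=(b(1)<\cdots<b(r))$ with entries in $\{1,\dots,n\}$. For $1\le i\le n-1$, $e_i,f_i$ are defined by identifying $b$ with $b(r)\otimes\cdots\otimes b(1)$, where on single letters $f_i(i)=i+1$, $e_i(i+1)=i$, and all other values are $\emptyset$. $f_0(b)$: if $b$ contains $n$ but not $1$, remove $n$, add $1$ and reorder increasingly; otherwise $\emptyset$.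 $e_0(b)$: if $b$ contains $1$ but not $n$, replace $1$ by $n$ and reorder; otherwise $\emptyset$. Type $C_n^{(1)}$: alphabet $1<2<\cdots<n<\bar n<\cdots<\bar 1$. For $1\le r\le n$, $B^{r,1}$ is the set of Kashiwara--Nakashima (KN) columns of height $r$: strictly increasing $b(1)<\cdots<b(r)$ such that there is no $z\in\{1,\dots,n\}$ with $z=b(p)$, $\bar z=b(q)$ and $q-p\le r-z$. For $1\le i\le n$, $e_i,f_i$ are defined via $b\mapsto b(r)\otimes\cdots\otimes b(1)$ with single-letter operators $f_i(i)=i+1$, $f_i(\overline{i+1})=\bar i$ for $i<n$, $f_n(n)=\bar n$ (and $e_i$ the inverse partial maps). $f_0(b)$: if $b$ contains $\bar 1$, replace it by $1$ and reorder; otherwise $\emptyset$. $e_0(b)$: if $b$ contains $1$, replace it by $\bar 1$ and reorder; otherwise $\emptyset$. Energy: for two such KR crystals $B_1=B^{s_1,1}$, $B_2=B^{s_2,1}$ of the same type, the combinatorial $R$-matrix $\sigma:B_2\otimes B_1\to B_1\otimes B_2$ is the unique bijection commuting with all $e_i,f_i$ (including $i=0$). The local energy $H=H_{B_2,B_1}:B_2\otimes B_1\to\mathbb Z$ is the unique function with $H(e_i(x))=H(x)-1$ if $i=0$ and $e_0$ acts on the left tensor factor in both $x$ and $\sigma(x)$, $H(e_i(x))=H(x)+1$ if $i=0$ and $e_0$ acts on the right factor in both $x$ and $\sigma(x)$, and $H(e_i(x))=H(x)$ otherwise (whenever $e_i(x)\ne\emptyset$), normalized by $H(v_2\otimes v_1)=0$,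 where $v_k$ is the column $(1,2,\dots,s_k)$. For $B=B^{r_N,1}\otimes\cdots\otimes B^{r_1,1}$, number tensor positions $1,\dots,N$ from the right; $\sigma_k$ applies the $R$-matrix to the factors in positions $k+1,k$ and $H_k$ evaluates the local energy of the factors in positions $k+1,k$. Then $D(b)=D^L_B(b)=\sum_{N\ge j>i\ge1}H_{j-1}\sigma_{j-2}\cdots\sigma_i(b)$ (maps composed right to left). Charge, type $A$: write $b=b_N\otimes\cdots\otimes b_1$ as the filling with columns $\beta_1,\dots,\beta_N$ from left to right, $\beta_j=b_{N+1-j}$ (weakly decreasing heights). For $a\in\{1,\dots,n\}$ let $\prec_a$ be the circular order $a\prec_a a+1\prec_a\cdots\prec_a n\prec_a 1\prec_a\cdots\prec_a a-1$. Define a filling $\gamma$: $\gamma_1=\beta_1$, and for $j\ge2$ and $i=1,\dots,|\beta_j|$, $\gamma_j(i)$ is the $\prec_{\gamma_{j-1}(i)}$-minimum of $\beta_j\setminus\{\gamma_j(1),\dots,\gamma_j(i-1)\}$. A cell $(i,j)$ is a descent if $\gamma_{j+1}(i)$ exists and $\gamma_j(i)>\gamma_{j+1}(i)$; its arm is the number of cells to its right in row $i$. $\mathrm{charge}(b)$ is the sum of the arms of all descents. Charge, type $C$: for a KN column $\beta$, let $I=\{z_1>\cdots>z_s\}$ be the unbarred $z$ with both $z,\bar z\in\beta$; let $t_1$ be the largest element of $\{1,\dots,n\}$ with $t_1<z_1$, $t_1\notin\beta$, $\bar t_1\notin\beta$, and for $k\ge2$ let $t_k$ be the largest with $t_k<\min(t_{k-1},z_k)$,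 $t_k\notin\beta$, $\bar t_k\notin\beta$. Then $\beta^R$ (resp. $\beta^L$) is obtained by replacing each $\bar z_k$ by $\bar t_k$ (resp. each $z_k$ by $t_k$) and reordering. Form the $2N$ columns $\delta=(\beta_1^L,\beta_1^R,\beta_2^L,\beta_2^R,\dots)$ and construct $\gamma$ from $\delta$ exactly as in type $A$, using circular orders $\prec_a$ on the cyclically ordered alphabet $1<\cdots<n<\bar n<\cdots<\bar1$. Descents and arms are defined as in type $A$ (in the $2N$-column diagram, using the linear order of the alphabet), and $\mathrm{charge}(b)=\frac12\sum_{\text{descents}}\mathrm{arm}$. -}

module Defs where

open import Data.Nat using (ℕ; zero; suc; _+_; _*_; _∸_; _≤_; _<_; _≡ᵇ_; _≤ᵇ_; _<ᵇ_)
open import Data.Bool using (Bool; true; false; if_then_else_; _∧_; _∨_; not; T)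
open import Data.List using (List; []; _∷_; length; reverse; map; concatMap; foldr; upTo; _++_; zip)
open import Data.List.Relation.Unary.All using (All)
open import Data.Vec using (Vec; []; _∷_; fromList; toList)
open import Data.Maybe using (Maybe; just; nothing) renaming (map to mapMaybe)
open import Data.Product using (_×_; _,_; proj₁; proj₂; Σ)
open import Data.Integer using (ℤ; +_; -_) renaming (_+_ to _+ℤ_)
open import Relation.Binary.PropositionalEquality using (_≡_)

-- Generic crystal operators and tensor products
--
-- e i, f i : partial operators (nothing = ∅).  'size' is an upper bound
-- for all ε_i, φ_i (used as fuel to compute the maxima exactly).

record Ops (X : Set) : Set where
  field
    e f  : ℕ → X → Maybe X
    size : X → ℕ
open Ops public

count : {X : Set} → ℕ → (X → Maybe X) → X → ℕ
count zero    g x = 0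
count (suc k) g x with g x
... | nothing = 0
... | just y  = suc (count k g y)

-- ε_i, φ_i (exact, since size bounds them)
εc : {X : Set} → Ops X → ℕ → X → ℕ
εc O i x = count (size O x) (e O i) x

φc : {X : Set} → Ops X → ℕ → X → ℕ
φc O i x = count (size O x) (f O i) x

-- tensor product  a ⊗ b  (pair (a , b) = a ⊗ b, a on the left)
pairOps : {A B : Set} → Ops A → Ops B → Ops (A × B)
e (pairOps OA OB) i (a , b) =
  if φc OB i b <ᵇ εc OA i a
  then mapMaybe (λ a' → (a' , b)) (e OA i a)
  else mapMaybe (λ b' → (a , b')) (e OB i b)
f (pairOps OA OB) i (a , b) =
  if φc OB i b ≤ᵇ εc OA i a
  then mapMaybe (λ a' → (a' , b)) (f OA i a)
  else mapMaybe (λ b' → (a , b')) (f OB i b)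
size (pairOps OA OB) (a , b) = size OA a + size OB b

vecOps : {X : Set} → Ops X → (m : ℕ) → Ops (Vec X m)
e (vecOps O zero) i v = nothing
f (vecOps O zero) i v = nothing
size (vecOps O zero) v = 0
e (vecOps O (suc m)) i (x ∷ xs) =
  mapMaybe (λ p → proj₁ p ∷ proj₂ p) (e (pairOps O (vecOps O m)) i (x , xs))
f (vecOps O (suc m)) i (x ∷ xs) =
  mapMaybe (λ p → proj₁ p ∷ proj₂ p) (f (pairOps O (vecOps O m)) i (x , xs))
size (vecOps O (suc m)) (x ∷ xs) = size (pairOps O (vecOps O m)) (x , xs)

-- Columns.  A column is a list b(1) … b(r) (increasing).
-- For i ≠ 0, e_i/f_i act via b ↦ b(r) ⊗ ⋯ ⊗ b(1); for i = 0 a special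
-- rule is supplied.

Column : Set
Column = List ℕ

colOps : Ops ℕ → (Column → Maybe Column) → (Column → Maybe Column) → Ops Column
e (colOps L e0 f0) zero b = e0 b
e (colOps L e0 f0) (suc i) b =
  mapMaybe (λ v → reverse (toList v)) (e (vecOps L (length (reverse b))) (suc i) (fromList (reverse b)))
f (colOps L e0 f0) zero b = f0 b
f (colOps L e0 f0) (suc i) b =
  mapMaybe (λ v → reverse (toList v)) (f (vecOps L (length (reverse b))) (suc i) (fromList (reverse b)))
size (colOps L e0 f0) b = length b

allB : {A : Set} → (A → Bool) → List A → Bool
allB p []       = true
allB p (x ∷ xs) = p x ∧ allB p xs

filterB : {A : Set} → (A → Bool) → List A → List A
filterB p []       = []
filterB p (x ∷ xs) = if p x then x ∷ filterB p xs else filterB p xs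

mem : ℕ → List ℕ → Bool
mem x []       = false
mem x (y ∷ ys) = (x ≡ᵇ y) ∨ mem x ys

dropLast : List ℕ → List ℕ
dropLast []           = []
dropLast (x ∷ [])     = []
dropLast (x ∷ y ∷ ys) = x ∷ dropLast (y ∷ ys)

tail : List ℕ → List ℕ
tail []       = []
tail (_ ∷ xs) = xs

strictInc : List ℕ → Bool
strictInc []           = true
strictInc (x ∷ [])     = true
strictInc (x ∷ y ∷ ys) = (x <ᵇ y) ∧ strictInc (y ∷ ys)

inRange : ℕ → ℕ → ℕ → Bool
inRange lo hi x = (lo ≤ᵇ x) ∧ (x ≤ᵇ hi)

enum : {A : Set} → List A → List (ℕ × A)
enum xs = zip (map suc (upTo (length xs))) xs

-- Type A_{n-1}^{(1)} : letters 1 … n, index set {0,…,n-1}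

letterA : ℕ → Ops ℕ
e (letterA n) i x = if inRange 1 (n ∸ 1) i ∧ (x ≡ᵇ suc i) then just i else nothing
f (letterA n) i x = if inRange 1 (n ∸ 1) i ∧ (x ≡ᵇ i) then just (suc i) else nothing
size (letterA n) x = 1

-- e_0 : contains 1 but not n ⇒ replace 1 by n and reorder
e0A : ℕ → Column → Maybe Column
e0A n b = if mem 1 b ∧ not (mem n b) then just (tail b ++ (n ∷ [])) else nothing

-- f_0 : contains n but not 1 ⇒ remove n, add 1, reorder
f0A : ℕ → Column → Maybe Column
f0A n b = if mem n b ∧ not (mem 1 b) then just (1 ∷ dropLast b) else nothing

colA : ℕ → Ops Column
colA n = colOps (letterA n) (e0A n) (f0A n)

validA : ℕ → ℕ → Column → Bool
validA n r b = (length b ≡ᵇ r) ∧ strictInc b ∧ allB (inRange 1 n) b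

heightOKA : ℕ → ℕ → Bool
heightOKA n r = inRange 1 (n ∸ 1) r

-- Type C_n^{(1)} : alphabet 1<⋯<n<n̄<⋯<1̄ encoded as 1,…,2n with
-- z̄ = 2n+1-z.  Index set {0,…,n}.

bar : ℕ → ℕ → ℕ
bar n z = suc (2 * n) ∸ z

letterC : ℕ → Ops ℕ
-- f_i(i) = i+1, f_i(overline{i+1}) = overline{i} (i<n), f_n(n) = n̄
e (letterC n) i x =
  if inRange 1 n i ∧ ((x ≡ᵇ suc i) ∨ (x ≡ᵇ bar n i)) then just (x ∸ 1) else nothing
f (letterC n) i x =
  if inRange 1 n i ∧ ((x ≡ᵇ i) ∨ (x ≡ᵇ bar n (suc i))) then just (suc x) else nothing
size (letterC n) x = 1

-- e_0 : contains 1 ⇒ replace by 1̄ (= 2n) and reorder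
e0C : ℕ → Column → Maybe Column
e0C n b = if mem 1 b then just (tail b ++ (bar n 1 ∷ [])) else nothing

-- f_0 : contains 1̄ ⇒ replace by 1 and reorder
f0C : ℕ → Column → Maybe Column
f0C n b = if mem (bar n 1) b then just (1 ∷ dropLast b) else nothing

colC : ℕ → Ops Column
colC n = colOps (letterC n) (e0C n) (f0C n)

knOK : ℕ → ℕ → Column → Bool
knOK n r b = allB (λ pz → allB (λ qw → not (bad pz qw)) (enum b)) (enum b)
  where
  bad : ℕ × ℕ → ℕ × ℕ → Bool
  bad (p , z) (q , w) = (z ≤ᵇ n) ∧ (w ≡ᵇ bar n z) ∧ (p <ᵇ q) ∧ ((q ∸ p) ≤ᵇ (r ∸ z))

validC : ℕ → ℕ → Column → Bool
validC n r b = (length b ≡ᵇ r) ∧ strictInc b ∧ allB (inRange 1 (2 * n)) b ∧ knOK n r b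

heightOKC : ℕ → ℕ → Bool
heightOKC n r = inRange 1 n r

-- Energy function D.
-- An element b = b_N ⊗ ⋯ ⊗ b_1 is represented by the list
-- [ b_1 , b_2 , … , b_N ] (tensor positions numbered from the right).

Pair : Set
Pair = Column × Column         -- (left factor , right factor)

-- σ at 0-based index m acts on positions m+2 (left) and m+1 (right),
-- i.e. σ_{m+1}
sigAt : (Pair → Pair) → ℕ → List Column → List Column
sigAt σ zero (r ∷ l ∷ rest) = proj₂ (σ (l , r)) ∷ proj₁ (σ (l , r)) ∷ rest
sigAt σ zero xs = xs
sigAt σ (suc m) [] = []
sigAt σ (suc m) (x ∷ xs) = x ∷ sigAt σ m xs

HAt : (Pair → ℤ) → ℕ → List Column → ℤ
HAt H zero (r ∷ l ∷ _) = H (l , r)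
HAt H zero _ = + 0
HAt H (suc m) [] = + 0
HAt H (suc m) (_ ∷ xs) = HAt H m xs

-- run σ H m d c = H_{m+d+1} σ_{m+d} ⋯ σ_{m+1} (c)
run : (Pair → Pair) → (Pair → ℤ) → ℕ → ℕ → List Column → ℤ
run σ H m zero c    = HAt H m c
run σ H m (suc d) c = run σ H (suc m) d (sigAt σ m c)

sumℤ : List ℤ → ℤ
sumℤ = foldr _+ℤ_ (+ 0)

-- D(b) = Σ_{N ≥ j > i ≥ 1} H_{j-1} σ_{j-2} ⋯ σ_i (b);  i = m+1, j = m+d+2
energyD : (Pair → Pair) → (Pair → ℤ) → List Column → ℤ
energyD σ H c = sumℤ (concatMap (λ m → concatMap (λ d →
    if (m + d + 2) ≤ᵇ length c then run σ H m d c ∷ [] else []) (upTo N)) (upTo N))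
  where N = length c

-- key in the circular order ≺_a on {1,…,M}
ckey : ℕ → ℕ → ℕ → ℕ
ckey M a x = if a ≤ᵇ x then x ∸ a else (x + M) ∸ a

argminKey : (ℕ → ℕ) → ℕ → List ℕ → ℕ
argminKey k best []       = best
argminKey k best (x ∷ xs) = argminKey k (if k x <ᵇ k best then x else best) xs

removeOne : ℕ → List ℕ → List ℕ
removeOne x []       = []
removeOne x (y ∷ ys) = if x ≡ᵇ y then ys else y ∷ removeOne x ys

nextCol : ℕ → List ℕ → List ℕ → List ℕ
nextCol M [] rem = []
nextCol M (a ∷ as) [] = []
nextCol M (a ∷ as) (y ∷ ys) =
  let x = argminKey (ckey M a) y ys in x ∷ nextCol M as (removeOne x (y ∷ ys))

gammaFrom : ℕ → List ℕ → List (List ℕ) → List (List ℕ)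
gammaFrom M prev []       = []
gammaFrom M prev (β ∷ βs) = let g = nextCol M prev β in g ∷ gammaFrom M g βs

gamma : ℕ → List (List ℕ) → List (List ℕ)
gamma M []       = []
gamma M (β ∷ βs) = β ∷ gammaFrom M β βs

countLongerThan : ℕ → List (List ℕ) → ℕ      -- number of columns with a cell in (0-based) row i
countLongerThan i cs = length (filterB (λ c → i <ᵇ length c) cs)

-- sum of arms of descents of a filling given as columns left to right
sumArms : List (List ℕ) → ℕ
sumArms []            = 0
sumArms (c ∷ [])      = 0
sumArms (c ∷ c' ∷ cs) =
  foldr _+_ 0 (map (λ t → descArm t) (zip (upTo (length c)) (zip c c')))
  + sumArms (c' ∷ cs)
  where
  descArm : ℕ × (ℕ × ℕ) → ℕ
  descArm (i , (x , y)) = if y <ᵇ x then countLongerThan i (c' ∷ cs) else 0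

-- type A: β_j = b_{N+1-j}, i.e. the reverse of our list representation
sumArmsA : ℕ → List Column → ℕ
sumArmsA n c = sumArms (gamma n (reverse c))

insertℕ : ℕ → List ℕ → List ℕ
insertℕ x []       = x ∷ []
insertℕ x (y ∷ ys) = if x ≤ᵇ y then x ∷ y ∷ ys else y ∷ insertℕ x ys

sortℕ : List ℕ → List ℕ
sortℕ = foldr insertℕ []

-- largest t with 1 ≤ t < bound and ok t (0 if none)
largestBelow : (ℕ → Bool) → ℕ → ℕ
largestBelow ok zero    = 0
largestBelow ok (suc k) = if (1 ≤ᵇ k) ∧ ok k then k else largestBelow ok k

minℕ : ℕ → ℕ → ℕ
minℕ a b = if a ≤ᵇ b then a else b

module _ (n : ℕ) (β : Column) where
  -- I = {z₁ > ⋯ > z_s}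
  zsOf : List ℕ
  zsOf = filterB (λ z → (z ≤ᵇ n) ∧ mem (bar n z) β) (reverse β)

  freeT : ℕ → Bool
  freeT t = (t ≤ᵇ n) ∧ not (mem t β) ∧ not (mem (bar n t) β)

  -- pairs (z_k , t_k); prev is t_{k-1} (initially n+1, no constraint)
  tsFrom : ℕ → List ℕ → List (ℕ × ℕ)
  tsFrom prev []       = []
  tsFrom prev (z ∷ zs) = let t = largestBelow freeT (minℕ prev z) in (z , t) ∷ tsFrom t zs

  zt : List (ℕ × ℕ)
  zt = tsFrom (suc n) zsOf

  lookupT : ℕ → List (ℕ × ℕ) → Maybe ℕ
  lookupT x [] = nothing
  lookupT x ((z , t) ∷ ps) = if x ≡ᵇ z then just t else lookupT x ps

  replL : ℕ → ℕ
  replL x with lookupT x zt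
  ... | just t  = if x ≤ᵇ n then t else x
  ... | nothing = x

  replR : ℕ → ℕ
  replR x with lookupT (bar n x) zt
  ... | just t  = if n <ᵇ x then bar n t else x
  ... | nothing = x

  colL colR : Column
  colL = sortℕ (map replL β)
  colR = sortℕ (map replR β)

splitLR : ℕ → List Column → List Column
splitLR n []       = []
splitLR n (β ∷ βs) = colL n β ∷ colR n β ∷ splitLR n βs

-- Σ arms in the 2N-column diagram (charge_C = this / 2)
sumArmsC : ℕ → List Column → ℕ
sumArmsC n c = sumArms (gamma (2 * n) (splitLR n (reverse c)))

record KRType : Set where
  field
    cops     : Ops Column
    heightOK : ℕ → Bool
    valid    : ℕ → Column → Bool
    armSum   : List Column → ℕ
    scale    : ℕ                   -- charge = armSum / scale
open KRType public

typeA : ℕ → KRType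
typeA n = record { cops = colA n ; heightOK = heightOKA n ; valid = validA n
                 ; armSum = sumArmsA n ; scale = 1 }

typeC : ℕ → KRType
typeC n = record { cops = colC n ; heightOK = heightOKC n ; valid = validC n
                 ; armSum = sumArmsC n ; scale = 2 }

module _ (K : KRType) where
  pairK : Ops Pair
  pairK = pairOps (cops K) (cops K)

  InPair : ℕ → ℕ → Pair → Set
  InPair s t (l , r) = T (valid K s l ∧ valid K t r)

  HeightOK : ℕ → Set
  HeightOK r = T (heightOK K r)

  IsRMatrix : (Pair → Pair) → Set
  IsRMatrix σ = ∀ s t → HeightOK s → HeightOK t →
      (∀ x → InPair s t x → InPair t s (σ x))
    × (∀ x y → InPair s t x → InPair s t y → σ x ≡ σ y → x ≡ y)
    × (∀ y → InPair t s y → Σ Pair (λ x → InPair s t x × σ x ≡ y))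
    × (∀ i x → InPair s t x → e pairK i (σ x) ≡ mapMaybe σ (e pairK i x))
    × (∀ i x → InPair s t x → f pairK i (σ x) ≡ mapMaybe σ (f pairK i x))

  e0Left : Pair → Bool
  e0Left (l , r) = φc (cops K) 0 r <ᵇ εc (cops K) 0 l

  deltaH : (Pair → Pair) → ℕ → Pair → ℤ
  deltaH σ zero x =
    if e0Left x ∧ e0Left (σ x) then - (+ 1)
    else if not (e0Left x) ∧ not (e0Left (σ x)) then + 1 else + 0
  deltaH σ (suc i) x = + 0

  vcol : ℕ → Column
  vcol s = map suc (upTo s)

  IsEnergy : (Pair → Pair) → (Pair → ℤ) → Set
  IsEnergy σ H = ∀ s t → HeightOK s → HeightOK t →
      (∀ i x y → InPair s t x → e pairK i x ≡ just y → H y ≡ H x +ℤ deltaH σ i x)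
    × (H (vcol s , vcol t) ≡ + 0)

  heightsInc : List Column → Bool
  heightsInc []           = true
  heightsInc (x ∷ [])     = true
  heightsInc (x ∷ y ∷ ys) = (length x ≤ᵇ length y) ∧ heightsInc (y ∷ ys)

  -- b = b_N ⊗ ⋯ ⊗ b_1 ∈ B^{r_N,1} ⊗ ⋯ ⊗ B^{r_1,1}, given as [b_1,…,b_N]
  InB : List Column → Set
  InB c = All (λ b → HeightOK (length b) × T (valid K (length b) b)) c × T (heightsInc c)

  -- D(b) = - charge(b), stated as  scale · D(b) = - armSum(b)
  EnergyIsMinusCharge : Set
  EnergyIsMinusCharge = ∀ (σ : Pair → Pair) (H : Pair → ℤ) →
    IsRMatrix σ → IsEnergy σ H →
    ∀ c → InB c → (+ scale K) Data.Integer.* energyD σ H c ≡ - (+ armSum K c)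

{-# OPTIONS --safe #-}
-- On the 0/1 words of two columns L ⊗ R the R-matrix is a pass: going once around the circle of letters, the letters
-- of R missing from L are picked up and dropped on the next free letters of L; minus the energy is the number of them
-- carried across the cut between 1 and M. This rule commutes with all e_i and changes the energy as required, so
-- connectedness and the pair {1,…,s} ⊗ {1,…,t} identify it with σ and H. In type C a column is replaced by
-- β^L ⊗ (β^R)* or (β^L)* ⊗ β^R, where x ∈ β* iff x̄ ∉ β, in type A on 2n letters, each e_i becoming a product of two
-- type A operators.
-- For charge, let N_X(a) be the number of letters ≤ a of X. With k descents, the column G that γ chooses in β after X
-- satisfies N_G ≤ N_X + k, and N_Z + k ≤ N_G + l for all Z ⊂ β with |Z| = |X| and N_Z ≤ N_X + l. If Y passes β with
-- winding number u and becomes Y', then N_Y ≤ N_Y' + u, and N_Y' + u ≤ N_Z + l for all Z ⊂ β with |Z| = |Y| and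
-- N_Y ≤ N_Z + l. Hence replacing X, β, Y by X, Y' lowers the number of descents by exactly u, and moving every column
-- to the far left in this way turns charge into −D. In type C, Y^L passes both β^R and β^L.
module Submission where

open import Defs
open import Data.Nat using (ℕ; zero; suc; _+_; _*_; _∸_; _≤_; _<_; _≡ᵇ_; _≤ᵇ_; _<ᵇ_; z≤n; s≤s; pred; >-nonZero)
open import Data.Nat.Properties
open import Data.Nat.Solver using (module +-*-Solver)
open import Data.Bool using (Bool; true; false; if_then_else_; _∧_; _∨_; not; T)
open import Data.List using (List; []; _∷_; length; reverse; map; concatMap; foldr; upTo; applyUpTo; _++_; zip; take)
open import Data.List.Properties using (unfold-reverse; reverse-involutive; reverse-++; length-reverse; length-++; ++-assoc; ++-identityʳ; map-++; upTo-∷ʳ; ∷-injectiveˡ; ∷-injectiveʳ)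
open import Data.List.Relation.Unary.All using (All; []; _∷_)
open import Data.Vec using (Vec; []; _∷_; fromList; toList)
open import Data.Vec.Properties using (toList∘fromList)
open import Data.Maybe using (Maybe; just; nothing) renaming (map to mapMaybe)
open import Data.Product using (_×_; _,_; proj₁; proj₂; ∃)
open import Data.Sum using (_⊎_; inj₁; inj₂)
open import Data.Empty using (⊥; ⊥-elim)
open import Function using (case_of_; _⟨_⟩_)
open import Data.Unit using (⊤; tt)
open import Relation.Nullary using (¬_; yes; no)
open import Algebra.Properties.CommutativeSemigroup +-commutativeSemigroup using (interchange; x∙yz≈y∙xz)
open import Relation.Binary.Definitions using (Tri; tri<; tri≈; tri>)
open import Relation.Binary.PropositionalEquality using (_≡_; _≢_; refl; sym; trans; cong; cong₂; subst; subst₂; module ≡-Reasoning)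

true≢false : ∀ {b} → b ≡ true → b ≡ false → ⊥
true≢false refl ()

T→≡ : ∀ {b} → T b → b ≡ true
T→≡ {true} _ = refl

≡→T : ∀ {b} → b ≡ true → T b
≡→T refl = tt

<ᵇ-yes : ∀ {m n} → m < n → (m <ᵇ n) ≡ true
<ᵇ-yes m<n = T→≡ (<⇒<ᵇ m<n)

<ᵇ-no : ∀ {m n} → n ≤ m → (m <ᵇ n) ≡ false
<ᵇ-no {m} {n} n≤m with m <ᵇ n in eq
... | false = refl
... | true  = ⊥-elim (<⇒≱ (<ᵇ⇒< m n (≡→T eq)) n≤m)

<ᵇ-elim : ∀ m n → (m <ᵇ n) ≡ true → m < n
<ᵇ-elim m n eq = <ᵇ⇒< m n (≡→T eq)

<ᵇ-elim-no : ∀ m n → (m <ᵇ n) ≡ false → n ≤ m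
<ᵇ-elim-no m n eq = ≮⇒≥ λ m<n → true≢false (<ᵇ-yes m<n) eq

≤ᵇ-yes : ∀ {m n} → m ≤ n → (m ≤ᵇ n) ≡ true
≤ᵇ-yes m≤n = T→≡ (≤⇒≤ᵇ m≤n)

≤ᵇ-no : ∀ {m n} → n < m → (m ≤ᵇ n) ≡ false
≤ᵇ-no {m} {n} n<m with m ≤ᵇ n in eq
... | false = refl
... | true  = ⊥-elim (<⇒≱ n<m (≤ᵇ⇒≤ m n (≡→T eq)))

≤ᵇ-elim : ∀ m n → (m ≤ᵇ n) ≡ true → m ≤ n
≤ᵇ-elim m n eq = ≤ᵇ⇒≤ m n (≡→T eq)

≤ᵇ-elim-no : ∀ m n → (m ≤ᵇ n) ≡ false → n < m
≤ᵇ-elim-no m n eq = ≰⇒> λ m≤n → true≢false (≤ᵇ-yes m≤n) eq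

≡ᵇ-yes : ∀ {m n} → m ≡ n → (m ≡ᵇ n) ≡ true
≡ᵇ-yes {m} {n} eq = T→≡ (≡⇒≡ᵇ m n eq)

≡ᵇ-no : ∀ {m n} → m ≢ n → (m ≡ᵇ n) ≡ false
≡ᵇ-no {m} {n} m≢n with m ≡ᵇ n in eq
... | false = refl
... | true  = ⊥-elim (m≢n (≡ᵇ⇒≡ m n (≡→T eq)))

≡ᵇ-elim : ∀ m n → (m ≡ᵇ n) ≡ true → m ≡ n
≡ᵇ-elim m n eq = ≡ᵇ⇒≡ m n (≡→T eq)

∧-elim : ∀ {a b} → (a ∧ b) ≡ true → a ≡ true × b ≡ true
∧-elim {true} {true} _ = refl , refl

∧-intro : ∀ {a b} → a ≡ true → b ≡ true → (a ∧ b) ≡ true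
∧-intro refl refl = refl

mapMaybe-∘ : ∀ {A B C : Set} (g : B → C) (h : A → B) m → mapMaybe g (mapMaybe h m) ≡ mapMaybe (λ x → g (h x)) m
mapMaybe-∘ g h (just _) = refl
mapMaybe-∘ g h nothing  = refl

just-inj : ∀ {A : Set} {x y : A} → just x ≡ just y → x ≡ y
just-inj refl = refl

count-exact : {X : Set} (g : X → Maybe X) (μ : X → ℕ)
  → (∀ x → μ x ≡ 0 → g x ≡ nothing)
  → (∀ x k → μ x ≡ suc k → ∃ λ y → g x ≡ just y × μ y ≡ k)
  → ∀ k x → μ x ≤ k → count k g x ≡ μ x
count-exact g μ stop step zero x μ≤ = sym (n≤0⇒n≡0 μ≤)
count-exact g μ stop step (suc k) x μ≤ with μ x in eq
... | zero rewrite stop x eq = refl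
... | suc j with step x j eq
... | y , gx , μy rewrite gx | count-exact g μ stop step k y (subst (_≤ k) (sym μy) (≤-pred μ≤)) = cong suc μy

record Sem {X : Set} (O : Ops X) (i : ℕ) (ep ph : X → ℕ) : Set where
  field
    e-stop : ∀ x → ep x ≡ 0 → e O i x ≡ nothing
    e-step : ∀ x k → ep x ≡ suc k → ∃ λ y → e O i x ≡ just y × ep y ≡ k × ph y ≡ suc (ph x)
    f-stop : ∀ x → ph x ≡ 0 → f O i x ≡ nothing
    f-step : ∀ x k → ph x ≡ suc k → ∃ λ y → f O i x ≡ just y × ph y ≡ k × ep y ≡ suc (ep x)
    bound : ∀ x → ep x + ph x ≤ size O x
  εc-≡ : ∀ x → εc O i x ≡ ep x
  εc-≡ x = count-exact (e O i) ep e-stop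
    (λ y k q → let (z , a , b , _) = e-step y k q in z , a , b)
    (size O x) x (≤-trans (m≤m+n _ _) (bound x))
  φc-≡ : ∀ x → φc O i x ≡ ph x
  φc-≡ x = count-exact (f O i) ph f-stop
    (λ y k q → let (z , a , b , _) = f-step y k q in z , a , b)
    (size O x) x (≤-trans (m≤n+m _ _) (bound x))

∸-swap-bound : ∀ a b → (a ∸ b) + (b ∸ a) ≤ a + b
∸-swap-bound a b = +-mono-≤ (m∸n≤m a b) (m∸n≤m b a)

Sem-pair : {A B : Set} {OA : Ops A} {OB : Ops B} {i : ℕ} {εA φA : A → ℕ} {εB φB : B → ℕ}
  → Sem OA i εA φA → Sem OB i εB φB
  → Sem (pairOps OA OB) i (λ z → εB (proj₂ z) + (εA (proj₁ z) ∸ φB (proj₂ z)))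
                          (λ z → φA (proj₁ z) + (φB (proj₂ z) ∸ εA (proj₁ z)))
Sem-pair {A} {B} {OA} {OB} {i} {εA} {φA} {εB} {φB} SA SB = record
  { e-stop = est ; e-step = ess ; f-stop = fst ; f-step = fss ; bound = bnd }
  where
  module a where
    open Sem SA public
    ep ph : A → ℕ
    ep = εA
    ph = φA
  module b where
    open Sem SB public
    ep ph : B → ℕ
    ep = εB
    ph = φB
  ε₂ φ₂ : A × B → ℕ
  ε₂ (x , y) = b.ep y + (a.ep x ∸ b.ph y)
  φ₂ (x , y) = a.ph x + (b.ph y ∸ a.ep x)
  est : ∀ z → ε₂ z ≡ 0 → e (pairOps OA OB) i z ≡ nothing
  est (x , y) eq rewrite b.φc-≡ y | a.εc-≡ x
    | <ᵇ-no {b.ph y} {a.ep x} (m∸n≡0⇒m≤n (m+n≡0⇒n≡0 (b.ep y) eq))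
    | b.e-stop y (m+n≡0⇒m≡0 (b.ep y) eq) = refl
  ess : ∀ z k → ε₂ z ≡ suc k → ∃ λ w → e (pairOps OA OB) i z ≡ just w × ε₂ w ≡ k × φ₂ w ≡ suc (φ₂ z)
  ess (x , y) k eq rewrite b.φc-≡ y | a.εc-≡ x with b.ph y <ᵇ a.ep x in c
  ... | true with a.ep x in ax
  ... | suc j with <⇒≤pred (<ᵇ-elim (b.ph y) (suc j) c) | a.e-step x j ax
  ... | lt | x' , ex , epx , phx rewrite ex = (x' , y) , refl ,
          trans (cong (λ h → b.ep y + (h ∸ b.ph y)) epx)
            (suc-injective (trans (sym (+-suc _ _)) (trans (cong (b.ep y +_) (sym (+-∸-assoc 1 lt))) eq))) ,
          trans (cong₂ (λ h h' → h + (b.ph y ∸ h')) phx epx)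
            (cong suc (cong (a.ph x +_) (trans (m≤n⇒m∸n≡0 lt) (sym (m≤n⇒m∸n≡0 (m≤n⇒m≤1+n lt))))))
  ess (x , y) k eq | false with <ᵇ-elim-no (b.ph y) (a.ep x) c
  ... | le with b.e-step y k (trans (sym (trans (cong (b.ep y +_) (m≤n⇒m∸n≡0 le)) (+-identityʳ _))) eq)
  ... | y' , ey , epy , phy rewrite ey = (x , y') , refl ,
          trans (cong₂ _+_ epy (trans (cong (a.ep x ∸_) phy) (m≤n⇒m∸n≡0 (m≤n⇒m≤1+n le)))) (+-identityʳ k) ,
          trans (cong (λ h → a.ph x + (h ∸ a.ep x)) phy)
            (trans (cong (a.ph x +_) (+-∸-assoc 1 le)) (+-suc _ _))
  fst : ∀ z → φ₂ z ≡ 0 → f (pairOps OA OB) i z ≡ nothing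
  fst (x , y) eq rewrite b.φc-≡ y | a.εc-≡ x
    | ≤ᵇ-yes {b.ph y} {a.ep x} (m∸n≡0⇒m≤n (m+n≡0⇒n≡0 (a.ph x) eq))
    | a.f-stop x (m+n≡0⇒m≡0 (a.ph x) eq) = refl
  fss : ∀ z k → φ₂ z ≡ suc k → ∃ λ w → f (pairOps OA OB) i z ≡ just w × φ₂ w ≡ k × ε₂ w ≡ suc (ε₂ z)
  fss (x , y) k eq rewrite b.φc-≡ y | a.εc-≡ x with b.ph y ≤ᵇ a.ep x in c
  ... | false with b.ph y in py
  ... | suc j with <⇒≤pred (≤ᵇ-elim-no (suc j) (a.ep x) c) | b.f-step y j py
  ... | lt | y' , fy , phy , epy rewrite fy = (x , y') , refl ,
          trans (cong (λ h → a.ph x + (h ∸ a.ep x)) phy)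
            (suc-injective (trans (sym (+-suc _ _)) (trans (cong (a.ph x +_) (sym (+-∸-assoc 1 lt))) eq))) ,
          trans (cong₂ (λ h h' → h + (a.ep x ∸ h')) epy phy)
            (cong suc (cong (b.ep y +_) (trans (m≤n⇒m∸n≡0 lt) (sym (m≤n⇒m∸n≡0 (m≤n⇒m≤1+n lt))))))
  fss (x , y) k eq | true with ≤ᵇ-elim (b.ph y) (a.ep x) c
  ... | le with a.f-step x k (trans (sym (trans (cong (a.ph x +_) (m≤n⇒m∸n≡0 le)) (+-identityʳ _))) eq)
  ... | x' , fx , phx , epx rewrite fx = (x' , y) , refl ,
          trans (cong₂ _+_ phx (trans (cong (b.ph y ∸_) epx) (m≤n⇒m∸n≡0 (m≤n⇒m≤1+n le)))) (+-identityʳ k) ,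
          trans (cong (λ h → b.ep y + (h ∸ b.ph y)) epx)
            (trans (cong (b.ep y +_) (+-∸-assoc 1 le)) (+-suc _ _))
  bnd : ∀ z → ε₂ z + φ₂ z ≤ size OA (proj₁ z) + size OB (proj₂ z)
  bnd (x , y) = begin
    (b.ep y + (a.ep x ∸ b.ph y)) + (a.ph x + (b.ph y ∸ a.ep x))
      ≡⟨ lem (b.ep y) (a.ep x ∸ b.ph y) (a.ph x) (b.ph y ∸ a.ep x) ⟩
    ((a.ep x ∸ b.ph y) + (b.ph y ∸ a.ep x)) + (a.ph x + b.ep y)
      ≤⟨ +-monoˡ-≤ _ (∸-swap-bound (a.ep x) (b.ph y)) ⟩
    (a.ep x + b.ph y) + (a.ph x + b.ep y)
      ≡⟨ lem₂ (a.ep x) (b.ph y) (a.ph x) (b.ep y) ⟩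
    (a.ep x + a.ph x) + (b.ep y + b.ph y) ≤⟨ +-mono-≤ (a.bound x) (b.bound y) ⟩
    size OA x + size OB y ∎
    where
    open ≤-Reasoning
    open +-*-Solver
    lem : ∀ p q r s → (p + q) + (r + s) ≡ (q + s) + (r + p)
    lem = solve 4 (λ p q r s → (p :+ q) :+ (r :+ s) := (q :+ s) :+ (r :+ p)) refl
    lem₂ : ∀ p q r s → (p + q) + (r + s) ≡ (p + r) + (s + q)
    lem₂ = solve 4 (λ p q r s → (p :+ q) :+ (r :+ s) := (p :+ r) :+ (s :+ q)) refl

module Fold {A : Set} (ε φ : A → ℕ) where
  mutual
    epF phF : List A → ℕ
    epF []      = 0
    epF (x ∷ w) = epF w + (ε x ∸ phF w)
    phF []      = 0
    phF (x ∷ w) = φ x + (phF w ∸ ε x)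

module Words {O : Ops ℕ} {i : ℕ} {ep ph : ℕ → ℕ} (S : Sem O i ep ph) where
  open Sem S
  open Fold ep ph

  Sem-vec : ∀ m → Sem (vecOps O m) i (λ v → epF (toList v)) (λ v → phF (toList v))
  Sem-vec zero = record
    { e-stop = λ _ _ → refl ; e-step = λ { [] k () } ; f-stop = λ _ _ → refl ; f-step = λ { [] k () }
    ; bound = λ { [] → z≤n } }
  Sem-vec (suc m) = record
    { e-stop = λ { (x ∷ v) q → cong (mapMaybe _) (P.e-stop (x , v) q) }
    ; e-step = λ { (x ∷ v) k q → let ((y , w) , a , b) = P.e-step (x , v) k q in (y ∷ w) , cong (mapMaybe _) a , b }
    ; f-stop = λ { (x ∷ v) q → cong (mapMaybe _) (P.f-stop (x , v) q) }
    ; f-step = λ { (x ∷ v) k q → let ((y , w) , a , b) = P.f-step (x , v) k q in (y ∷ w) , cong (mapMaybe _) a , b }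
    ; bound = λ { (x ∷ v) → P.bound (x , v) } }
    where module P = Sem (Sem-pair S (Sem-vec m))

  eL : List ℕ → Maybe (List ℕ)
  eL []      = nothing
  eL (x ∷ w) = if phF w <ᵇ ep x then mapMaybe (_∷ w) (e O i x) else mapMaybe (x ∷_) (eL w)

  eL-vec : ∀ m (v : Vec ℕ m) → mapMaybe toList (e (vecOps O m) i v) ≡ eL (toList v)
  eL-vec zero [] = refl
  eL-vec (suc m) (x ∷ v) rewrite Sem.φc-≡ (Sem-vec m) v | εc-≡ x with phF (toList v) <ᵇ ep x
  ... | true with e O i x
  ...   | just _  = refl
  ...   | nothing = refl
  eL-vec (suc m) (x ∷ v) | false rewrite sym (eL-vec m v) with e (vecOps O m) i v
  ...   | just _  = refl
  ...   | nothing = refl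

Sem-col : ∀ {O : Ops ℕ} {i e0 f0} {ep ph : ℕ → ℕ} → (∀ x → size O x ≡ 1) → Sem O (suc i) ep ph
  → Sem (colOps O e0 f0) (suc i) (λ b → Fold.epF ep ph (reverse b)) (λ b → Fold.phF ep ph (reverse b))
Sem-col {O} {i} {e0} {f0} {ep} {ph} sz1 S = record
  { e-stop = λ b q → cong (mapMaybe _) (V.e-stop (length (reverse b)) (fromList (reverse b)) (trans (cong epF (toList∘fromList (reverse b))) q))
  ; e-step = λ b k q → let (v , a , c , d) = V.e-step (length (reverse b)) (fromList (reverse b)) k (trans (cong epF (toList∘fromList (reverse b))) q) in
      reverse (toList v) , cong (mapMaybe _) a , trans (cong epF (reverse-involutive (toList v))) c ,
      trans (cong phF (reverse-involutive (toList v))) (trans d (cong (λ l → suc (phF l)) (toList∘fromList (reverse b))))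
  ; f-stop = λ b q → cong (mapMaybe _) (V.f-stop (length (reverse b)) (fromList (reverse b)) (trans (cong phF (toList∘fromList (reverse b))) q))
  ; f-step = λ b k q → let (v , a , c , d) = V.f-step (length (reverse b)) (fromList (reverse b)) k (trans (cong phF (toList∘fromList (reverse b))) q) in
      reverse (toList v) , cong (mapMaybe _) a , trans (cong phF (reverse-involutive (toList v))) c ,
      trans (cong epF (reverse-involutive (toList v))) (trans d (cong (λ l → suc (epF l)) (toList∘fromList (reverse b))))
  ; bound = λ b → bnd b }
  where
  open Sem S
  open Fold ep ph
  open Words S
  module V (m : ℕ) = Sem (Sem-vec m)
  bndW : ∀ w → epF w + phF w ≤ length w
  bndW w = subst₂ (λ l k → epF l + phF l ≤ k) (toList∘fromList w) (sz w) (V.bound (length w) (fromList w))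
    where
    sz : ∀ w → size (vecOps O (length w)) (fromList w) ≡ length w
    sz []      = refl
    sz (x ∷ w) = cong₂ _+_ (sz1 x) (sz w)
  bnd : ∀ b → epF (reverse b) + phF (reverse b) ≤ length b
  bnd b = subst (λ k → epF (reverse b) + phF (reverse b) ≤ k) (length-reverse b) (bndW (reverse b))

-- Crystal operators on columns

Bits : Set
Bits = ℕ → Bool

desc asc : ℕ → Bits → List ℕ
desc zero    c = []
desc (suc k) c = if c (suc k) then suc k ∷ desc k c else desc k c
asc zero     c = []
asc (suc k)  c = asc k c ++ (if c (suc k) then suc k ∷ [] else [])

reverse-asc : ∀ k c → reverse (asc k c) ≡ desc k c
reverse-asc zero c = refl
reverse-asc (suc k) c with c (suc k)
... | true  = trans (reverse-++ (asc k c) (suc k ∷ [])) (cong (suc k ∷_) (reverse-asc k c))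
... | false = trans (cong reverse (++-identityʳ (asc k c))) (reverse-asc k c)

reverse-desc : ∀ k c → reverse (desc k c) ≡ asc k c
reverse-desc k c = trans (cong reverse (sym (reverse-asc k c))) (reverse-involutive (asc k c))

desc-cong : ∀ k {c d} → (∀ x → 1 ≤ x → x ≤ k → c x ≡ d x) → desc k c ≡ desc k d
desc-cong zero eq = refl
desc-cong (suc k) eq rewrite eq (suc k) (s≤s z≤n) ≤-refl
  | desc-cong k (λ x a b → eq x a (m≤n⇒m≤1+n b)) = refl

asc-cong : ∀ k {c d} → (∀ x → 1 ≤ x → x ≤ k → c x ≡ d x) → asc k c ≡ asc k d
asc-cong zero eq = refl
asc-cong (suc k) eq rewrite eq (suc k) (s≤s z≤n) ≤-refl
  | asc-cong k (λ x a b → eq x a (m≤n⇒m≤1+n b)) = refl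

sw : ℕ → ℕ → Bits → Bits
sw p q c x = if x ≡ᵇ p then c q else (if x ≡ᵇ q then c p else c x)

sw-p : ∀ p q c → sw p q c p ≡ c q
sw-p p q c rewrite ≡ᵇ-yes {p} refl = refl

sw-q : ∀ p q c → sw p q c q ≡ c p
sw-q p q c with q ≡ᵇ p in eq
... | true  = cong c (≡ᵇ-elim q p eq)
... | false rewrite ≡ᵇ-yes {q} refl = refl

sw-other : ∀ p q c x → x ≢ p → x ≢ q → sw p q c x ≡ c x
sw-other p q c x x≢p x≢q rewrite ≡ᵇ-no x≢p | ≡ᵇ-no x≢q = refl

-- The bits of a column at the sites (q , p), where e moves a letter from q to p.
Two : Set
Two = Bool × Bool

at : ℕ → ℕ → Bits → Two
at p q c = c q , c p

b2n : Bool → ℕ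
b2n true  = 1
b2n false = 0

ε₁ φ₁ : Two → ℕ
ε₁ (q , p) = b2n (q ∧ not p)
φ₁ (q , p) = b2n (p ∧ not q)

module Block {O : Ops ℕ} {i : ℕ} {ep ph : ℕ → ℕ} (S : Sem O i ep ph) where
  open Fold ep ph
  open Words S

  record St (k : ℕ) (c : Bits) (E P : ℕ) (m : Maybe Bits) : Set where
    constructor st
    field
      epSt : epF (desc k c) ≡ E
      phSt : phF (desc k c) ≡ P
      eSt  : eL (desc k c) ≡ mapMaybe (desc k) m
      agree : ∀ {d} → m ≡ just d → ∀ x → k < x → d x ≡ c x

  St-zero : ∀ c → St 0 c 0 0 nothing
  St-zero c = st refl refl refl λ ()

  St-neutral : ∀ {k c E P m} → ep (suc k) ≡ 0 → ph (suc k) ≡ 0 → St k c E P m → St (suc k) c E P m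
  St-neutral {k} {c} {m = m} ep0 ph0 (st a b w ag) with c (suc k) in eq
  ... | false = st (trans (cong epF (skip eq)) a) (trans (cong phF (skip eq)) b)
                   (trans (cong eL (skip eq)) (trans w (sym (skipM m ag)))) λ q x lt → ag q x (<-trans ≤-refl lt)
    where
    skip : ∀ {d} → d (suc k) ≡ false → desc (suc k) d ≡ desc k d
    skip dk rewrite dk = refl
    skipM : ∀ m → (∀ {d} → m ≡ just d → ∀ x → k < x → d x ≡ c x) → mapMaybe (desc (suc k)) m ≡ mapMaybe (desc k) m
    skipM nothing ag = refl
    skipM (just d) ag = cong just (skip (trans (ag refl (suc k) ≤-refl) eq))
  ... | true = st (trans (cong epF (keep eq)) (trans (cong (λ h → epF (desc k c) + (h ∸ phF (desc k c))) ep0)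
                    (trans (cong (epF (desc k c) +_) (0∸n≡0 (phF (desc k c)))) (trans (+-identityʳ _) a))))
                  (trans (cong phF (keep eq)) (trans (cong₂ (λ h h' → h + (phF (desc k c) ∸ h')) ph0 ep0) b))
                  (trans (cong eL (keep eq)) (trans eLk (trans (cong (mapMaybe (suc k ∷_)) w) (keepM m ag)))) λ q x lt → ag q x (<-trans ≤-refl lt)
    where
    keep : ∀ {d} → d (suc k) ≡ true → desc (suc k) d ≡ suc k ∷ desc k d
    keep dk rewrite dk = refl
    keepM : ∀ m → (∀ {d} → m ≡ just d → ∀ x → k < x → d x ≡ c x) → mapMaybe (suc k ∷_) (mapMaybe (desc k) m) ≡ mapMaybe (desc (suc k)) m
    keepM nothing ag = refl
    keepM (just d) ag = cong just (sym (keep (trans (ag refl (suc k) ≤-refl) eq)))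
    eLk : eL (suc k ∷ desc k c) ≡ mapMaybe (suc k ∷_) (eL (desc k c))
    eLk rewrite ep0 = refl

  St-neutrals : ∀ {k c E P m} d → (∀ j → k < j → j ≤ d + k → ep j ≡ 0 × ph j ≡ 0) → St k c E P m → St (d + k) c E P m
  St-neutrals zero neu s = s
  St-neutrals {k} (suc d) neu s = let (a , b) = neu (suc (d + k)) (s≤s (m≤n+m k d)) ≤-refl in
    St-neutral a b (St-neutrals d (λ j lt le → neu j lt (m≤n⇒m≤1+n le)) s)

  St-block : ∀ {k c E P m} → let p = suc k ; q = suc (suc k) ; B = at p q c in
    ep p ≡ 0 → ph p ≡ 1 → ep q ≡ 1 → ph q ≡ 0 → e O i q ≡ just p
    → St k c E P m
    → St q c (E + (ε₁ B ∸ P)) (φ₁ B + (P ∸ ε₁ B)) (if P <ᵇ ε₁ B then just (sw p q c) else m)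
  St-block {k} {c} {E} {P} {m} epp php epq phq eq↓ (st refl refl w ag) = go (c (suc k)) (c (suc (suc k))) refl refl
    where
    p = suc k
    q = suc (suc k)
    D = desc k c
    E₀ = epF D
    P₀ = phF D
    desc₂ : ∀ d {x y} → d p ≡ x → d q ≡ y →
      desc q d ≡ (if y then q ∷ (if x then p ∷ desc k d else desc k d) else (if x then p ∷ desc k d else desc k d))
    desc₂ d refl refl = refl
    below : ∀ x → 1 ≤ x → x ≤ k → sw p q c x ≡ c x
    below x _ le = sw-other p q c x (<⇒≢ (s≤s le)) (<⇒≢ (s≤s (m≤n⇒m≤1+n le)))
    lift : ∀ {x y} (m : Maybe Bits) → c p ≡ x → c q ≡ y → (∀ {d} → m ≡ just d → ∀ z → k < z → d z ≡ c z) →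
      mapMaybe (desc q) m ≡ mapMaybe (λ l → if y then q ∷ (if x then p ∷ l else l) else (if x then p ∷ l else l)) (mapMaybe (desc k) m)
    lift nothing cp cq ag = refl
    lift (just d) cp cq ag = cong just (desc₂ d (trans (ag refl p ≤-refl) cp) (trans (ag refl q (s≤s (n≤1+n k))) cq))
    ag' : ∀ b {d} → (if b then just (sw p q c) else m) ≡ just d → ∀ x → q < x → d x ≡ c x
    ag' true refl x lt = sw-other p q c x (>⇒≢ (<-trans ≤-refl lt)) (>⇒≢ lt)
    ag' false eq x lt = ag eq x (<-trans (s≤s (n≤1+n k)) lt)
    eLp : ∀ l → eL (p ∷ l) ≡ mapMaybe (p ∷_) (eL l)
    eLp l rewrite epp = refl
    ∷∷ : ∀ (x y : ℕ) (m : Maybe (List ℕ)) → mapMaybe (x ∷_) (mapMaybe (y ∷_) m) ≡ mapMaybe (λ l → x ∷ y ∷ l) m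
    ∷∷ x y m = mapMaybe-∘ (x ∷_) (y ∷_) m
    idM : ∀ {A : Set} (m : Maybe A) → m ≡ mapMaybe (λ x → x) m
    idM nothing = refl
    idM (just _) = refl
    epP : ∀ l → epF (p ∷ l) ≡ epF l
    epP l rewrite epp | 0∸n≡0 (phF l) = +-identityʳ _
    phP : ∀ l → phF (p ∷ l) ≡ suc (phF l)
    phP l rewrite epp | php = refl
    epQ : ∀ l → epF (q ∷ l) ≡ epF l + (1 ∸ phF l)
    epQ l rewrite epq = refl
    phQ : ∀ l → phF (q ∷ l) ≡ phF l ∸ 1
    phQ l rewrite epq | phq = refl
    go : ∀ bp bq → c p ≡ bp → c q ≡ bq →
      St q c (E₀ + (ε₁ (bq , bp) ∸ P₀)) (φ₁ (bq , bp) + (P₀ ∸ ε₁ (bq , bp))) (if P₀ <ᵇ ε₁ (bq , bp) then just (sw p q c) else m)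
    go false false cp cq = st
      (trans (cong epF (desc₂ c cp cq)) (trans (sym (+-identityʳ E₀)) (cong (E₀ +_) (sym (0∸n≡0 P₀)))))
      (cong phF (desc₂ c cp cq))
      (trans (cong eL (desc₂ c cp cq)) (trans w (trans (idM _) (sym (lift m cp cq ag))))) (ag' false)
    go true false cp cq = st
      (trans (cong epF (desc₂ c cp cq)) (trans (epP D) (trans (sym (+-identityʳ E₀)) (cong (E₀ +_) (sym (0∸n≡0 P₀))))))
      (trans (cong phF (desc₂ c cp cq)) (phP D))
      (trans (cong eL (desc₂ c cp cq)) (trans (eLp D) (trans (cong (mapMaybe (p ∷_)) w) (sym (lift m cp cq ag))))) (ag' false)
    go true true cp cq = st
      (trans (cong epF (desc₂ c cp cq)) (trans (epQ (p ∷ D)) (trans (cong₂ (λ h h' → h + (1 ∸ h')) (epP D) (phP D)) (cong (E₀ +_) (trans (0∸n≡0 P₀) (sym (0∸n≡0 P₀)))))))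
      (trans (cong phF (desc₂ c cp cq)) (trans (phQ (p ∷ D)) (cong (_∸ 1) (phP D))))
      (trans (cong eL (desc₂ c cp cq)) (trans eLq (trans (cong (mapMaybe (q ∷_)) (trans (eLp D) (cong (mapMaybe (p ∷_)) w)))
        (trans (∷∷ q p (mapMaybe (desc k) m)) (sym (lift m cp cq ag)))))) (ag' false)
      where
      eLq : eL (q ∷ p ∷ D) ≡ mapMaybe (q ∷_) (eL (p ∷ D))
      eLq rewrite epp | php | epq = refl
    go false true cp cq = st
      (trans (cong epF (desc₂ c cp cq)) (epQ D))
      (trans (cong phF (desc₂ c cp cq)) (phQ D))
      (trans (cong eL (desc₂ c cp cq)) (eLq (P₀ <ᵇ 1) refl)) (ag' (P₀ <ᵇ 1))
      where
      eLq : ∀ b → (P₀ <ᵇ 1) ≡ b → eL (q ∷ D) ≡ mapMaybe (desc q) (if b then just (sw p q c) else m)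
      eLq true eq rewrite epq | eq | eq↓ = cong just (sym (trans (desc₂ (sw p q c) (trans (sw-p p q c) cq) (trans (sw-q p q c) cp))
        (cong (p ∷_) (desc-cong k below))))
      eLq false eq rewrite epq | eq | w = sym (lift m cp cq ag)

Sem-letter : ∀ {O : Ops ℕ} {i} (m p : ℕ → Bool)
  → (∀ x → e O i x ≡ (if m x then just (x ∸ 1) else nothing))
  → (∀ x → f O i x ≡ (if p x then just (suc x) else nothing))
  → (∀ x → m x ≡ true → p x ≡ false × p (x ∸ 1) ≡ true × m (x ∸ 1) ≡ false)
  → (∀ x → p x ≡ true → m x ≡ false × m (suc x) ≡ true × p (suc x) ≡ false)
  → (∀ x → size O x ≡ 1)
  → Sem O i (λ x → b2n (m x)) (λ x → b2n (p x))
Sem-letter {O} {i} m p eE eF M P sz = record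
  { e-stop = λ x q → trans (eE x) (stop q)
  ; e-step = λ x k q → let (mt , k0) = step q ; (a , b , c) = M x mt in
      (x ∸ 1) , trans (eE x) (ifT mt) , trans (cong b2n c) k0 , trans (cong b2n b) (cong (λ h → suc (b2n h)) (sym a))
  ; f-stop = λ x q → trans (eF x) (stop q)
  ; f-step = λ x k q → let (pt , k0) = step q ; (a , b , c) = P x pt in
      suc x , trans (eF x) (ifT pt) , trans (cong b2n c) k0 , trans (cong b2n b) (cong (λ h → suc (b2n h)) (sym a))
  ; bound = bnd }
  where
  stop : ∀ {A : Set} {b} {y : A} → b2n b ≡ 0 → (if b then just y else nothing) ≡ nothing
  stop {b = false} _ = refl
  step : ∀ {b k} → b2n b ≡ suc k → b ≡ true × 0 ≡ k
  step {true} q = refl , suc-injective q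
  ifT : ∀ {A : Set} {b} {y : A} → b ≡ true → (if b then just y else nothing) ≡ just y
  ifT refl = refl
  bnd : ∀ x → b2n (m x) + b2n (p x) ≤ size O x
  bnd x with m x in mx | p x in px
  ... | false | false = z≤n
  ... | false | true  = ≤-reflexive (sym (sz x))
  ... | true  | false = ≤-reflexive (sym (sz x))
  ... | true  | true  = ⊥-elim (true≢false px (proj₁ (M x mx)))

mem-++ : ∀ x xs ys → mem x (xs ++ ys) ≡ mem x xs ∨ mem x ys
mem-++ x [] ys = refl
mem-++ x (y ∷ xs) ys with x ≡ᵇ y
... | true  = refl
... | false = mem-++ x xs ys

mem-asc-high : ∀ k c x → k < x → mem x (asc k c) ≡ false
mem-asc-high zero c x lt = refl
mem-asc-high (suc k) c x lt rewrite mem-++ x (asc k c) (if c (suc k) then suc k ∷ [] else [])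
  | mem-asc-high k c x (<-trans ≤-refl lt) with c (suc k)
... | true rewrite ≡ᵇ-no (>⇒≢ lt) = refl
... | false = refl

mem-asc : ∀ k c x → 1 ≤ x → x ≤ k → mem x (asc k c) ≡ c x
mem-asc zero c (suc x) 1≤ ()
mem-asc (suc k) c x 1≤ le rewrite mem-++ x (asc k c) (if c (suc k) then suc k ∷ [] else []) with m≤n⇒m<n∨m≡n le
... | inj₁ (s≤s lt) rewrite mem-asc k c x 1≤ lt with c (suc k)
...   | true rewrite ≡ᵇ-no (<⇒≢ (s≤s lt)) = ∨-f (c x)
  where
  ∨-f : ∀ b → b ∨ false ≡ b
  ∨-f true = refl
  ∨-f false = refl
...   | false = ∨-f (c x)
  where
  ∨-f : ∀ b → b ∨ false ≡ b
  ∨-f true = refl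
  ∨-f false = refl
mem-asc (suc k) c .(suc k) 1≤ le | inj₂ refl rewrite mem-asc-high k c (suc k) ≤-refl with c (suc k)
... | true rewrite ≡ᵇ-yes {k} refl = refl
... | false = refl

asc-first : ∀ k c d → c 1 ≡ true → d 1 ≡ false → (∀ x → 2 ≤ x → x ≤ suc k → c x ≡ d x) → asc (suc k) c ≡ 1 ∷ asc (suc k) d
asc-first zero c d c1 d1 eq rewrite c1 | d1 = refl
asc-first (suc k) c d c1 d1 eq rewrite asc-first k c d c1 d1 (λ x a b → eq x a (m≤n⇒m≤1+n b))
  | eq (suc (suc k)) (s≤s (s≤s z≤n)) ≤-refl = refl

dropLast-snoc : ∀ xs y → dropLast (xs ++ y ∷ []) ≡ xs
dropLast-snoc [] y = refl
dropLast-snoc (x ∷ []) y = refl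
dropLast-snoc (x ∷ z ∷ xs) y = cong (x ∷_) (dropLast-snoc (z ∷ xs) y)

count-0 : ∀ {X : Set} k (g : X → Maybe X) x → g x ≡ nothing → count k g x ≡ 0
count-0 zero g x q = refl
count-0 (suc k) g x q rewrite q = refl

count-1 : ∀ {X : Set} k (g : X → Maybe X) x {y} → g x ≡ just y → g y ≡ nothing → 1 ≤ k → count k g x ≡ 1
count-1 (suc k) g x {y} q q' le rewrite q | count-0 k g y q' = refl

length-pos : ∀ x l → mem x l ≡ true → 1 ≤ length l
length-pos x (_ ∷ l) _ = s≤s z≤n

record ColSpec (O : Ops Column) (i M : ℕ) (c : Bits) (E P : ℕ) (m : Maybe Bits) : Set where
  constructor spec
  field
    εS : εc O i (asc M c) ≡ E
    φS : φc O i (asc M c) ≡ P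
    eS : e O i (asc M c) ≡ mapMaybe (asc M) m

eBit : Two → Maybe Bits → Maybe Bits
eBit B d = if 0 <ᵇ ε₁ B then d else nothing

module FromWords {O : Ops ℕ} {i : ℕ} {ep ph : ℕ → ℕ} (S : Sem O (suc i) ep ph) (sz : ∀ x → size O x ≡ 1) where
  open Block S
  open Words S
  open Fold ep ph
  e-col : ∀ {e0 f0} b → e (colOps O e0 f0) (suc i) b ≡ mapMaybe reverse (eL (reverse b))
  e-col b = trans (sym (mapMaybe-∘ reverse toList (e (vecOps O (length (reverse b))) (suc i) (fromList (reverse b)))))
    (cong (mapMaybe reverse) (trans (eL-vec _ (fromList (reverse b))) (cong eL (toList∘fromList (reverse b)))))
  toSpec : ∀ {e0 f0 M c E P m} → St M c E P m → ColSpec (colOps O e0 f0) (suc i) M c E P m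
  toSpec {e0} {f0} {M} {c} {E} {P} {m} (st a b w _) = spec
    (trans (Sem.εc-≡ SC (asc M c)) (trans (cong epF (reverse-asc M c)) a))
    (trans (Sem.φc-≡ SC (asc M c)) (trans (cong phF (reverse-asc M c)) b))
    (trans (e-col {e0} {f0} (asc M c)) (trans (cong (λ l → mapMaybe reverse (eL l)) (reverse-asc M c))
      (trans (cong (mapMaybe reverse) w) (trans (mapMaybe-∘ reverse (desc M) m) (rd m)))))
    where
    SC = Sem-col {e0 = e0} {f0 = f0} sz S
    rd : ∀ m → mapMaybe (λ x → reverse (desc M x)) m ≡ mapMaybe (asc M) m
    rd nothing = refl
    rd (just d) = cong just (reverse-desc M d)

mA pA : ℕ → ℕ → Bool
mA i x = x ≡ᵇ suc i
pA i x = x ≡ᵇ i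

Sem-letterA : ∀ n i → suc i < n → Sem (letterA n) (suc i) (λ x → b2n (mA (suc i) x)) (λ x → b2n (pA (suc i) x))
Sem-letterA n i lt = Sem-letter (mA (suc i)) (pA (suc i)) eE eF M P (λ _ → refl)
  where
  r : inRange 1 (n ∸ 1) (suc i) ≡ true
  r = ≤ᵇ-yes {suc i} {n ∸ 1} (∸-monoˡ-≤ 1 lt)
  eE : ∀ x → e (letterA n) (suc i) x ≡ (if mA (suc i) x then just (x ∸ 1) else nothing)
  eE x rewrite r with x ≡ᵇ suc (suc i) in eq
  ... | true rewrite ≡ᵇ-elim x (suc (suc i)) eq = refl
  ... | false = refl
  eF : ∀ x → f (letterA n) (suc i) x ≡ (if pA (suc i) x then just (suc x) else nothing)
  eF x rewrite r with x ≡ᵇ suc i in eq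
  ... | true rewrite ≡ᵇ-elim x (suc i) eq = refl
  ... | false = refl
  M : ∀ x → mA (suc i) x ≡ true → pA (suc i) x ≡ false × pA (suc i) (x ∸ 1) ≡ true × mA (suc i) (x ∸ 1) ≡ false
  M x q rewrite ≡ᵇ-elim x (suc (suc i)) q = ≡ᵇ-no {suc i} {i} (>⇒≢ ≤-refl) , ≡ᵇ-yes {suc i} refl , ≡ᵇ-no {i} {suc i} (<⇒≢ ≤-refl)
  P : ∀ x → pA (suc i) x ≡ true → mA (suc i) x ≡ false × mA (suc i) (suc x) ≡ true × pA (suc i) (suc x) ≡ false
  P x q rewrite ≡ᵇ-elim x (suc i) q = ≡ᵇ-no {i} {suc i} (<⇒≢ ≤-refl) , ≡ᵇ-yes {i} refl , ≡ᵇ-no {suc i} {i} (>⇒≢ ≤-refl)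

neutralAt : ∀ {x y} → x ≢ y → b2n (x ≡ᵇ y) ≡ 0
neutralAt ne = cong b2n (≡ᵇ-no ne)

hit : ∀ x → b2n (x ≡ᵇ x) ≡ 1
hit x = cong b2n (≡ᵇ-yes {x} refl)

colA-spec : ∀ n i c → suc i < n → let B = at (suc i) (suc (suc i)) c in
  ColSpec (colA n) (suc i) n c (ε₁ B) (φ₁ B) (eBit B (just (sw (suc i) (suc (suc i)) c)))
colA-spec n i c lt = toSpec {e0 = e0A n} {f0 = f0A n}
  (subst₂ (λ h h' → St n c (ε₁ B) h (eBit B h')) (trans (cong (φ₁ B +_) (0∸n≡0 (ε₁ B))) (+-identityʳ _)) refl
  (subst (λ k → St k c (ε₁ B) (φ₁ B + (0 ∸ ε₁ B)) (eBit B (just (sw (suc i) (suc (suc i)) c)))) (m∸n+n≡m lt)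
  (St-neutrals (n ∸ suc (suc i)) (λ j gt _ → neutralAt (>⇒≢ gt) , neutralAt (>⇒≢ (<-trans ≤-refl gt)))
  (St-block (neutralAt (<⇒≢ {suc i} ≤-refl)) (hit (suc i)) (hit (suc (suc i))) (neutralAt (>⇒≢ {suc (suc i)} ≤-refl))
    eq↓
  (subst (λ k → St k c 0 0 nothing) (+-identityʳ i)
  (St-neutrals i (λ j _ le → neutralAt (<⇒≢ (s≤s (≤-trans le (≤-trans (≤-reflexive (+-identityʳ i)) (n≤1+n i))))) ,
                             neutralAt (<⇒≢ (s≤s (≤-trans le (≤-reflexive (+-identityʳ i)))))) (St-zero c)))))))
  where
  B = at (suc i) (suc (suc i)) c
  open FromWords (Sem-letterA n i lt) (λ _ → refl)
  open Block (Sem-letterA n i lt)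
  eq↓ : e (letterA n) (suc i) (suc (suc i)) ≡ just (suc i)
  eq↓ rewrite ≤ᵇ-yes {suc i} {n ∸ 1} (∸-monoˡ-≤ 1 lt) | ≡ᵇ-yes {i} refl = refl

asc-with : ∀ k c → c (suc k) ≡ true → asc (suc k) c ≡ asc k c ++ (suc k ∷ [])
asc-with k c q rewrite q = refl

asc-without : ∀ k c → c (suc k) ≡ false → asc (suc k) c ≡ asc k c
asc-without k c q rewrite q = ++-identityʳ (asc k c)

e0-asc : ∀ k c → let M = suc (suc k) in c 1 ≡ true → c M ≡ false →
  tail (asc M c) ++ (M ∷ []) ≡ asc M (sw M 1 c)
e0-asc k c c1 cM = trans
  (cong (λ l → tail l ++ (M ∷ [])) (trans (asc-without (suc k) c cM)
    (asc-first k c d c1 (trans (sw-q M 1 c) cM) (λ x a b → sym (sw-other M 1 c x (<⇒≢ (s≤s b)) (>⇒≢ a))))))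
  (sym (asc-with (suc k) d (trans (sw-p M 1 c) c1)))
  where
  M = suc (suc k)
  d = sw M 1 c

∧-false : ∀ b → b ∧ false ≡ false
∧-false true = refl
∧-false false = refl

colA-spec0 : ∀ k c → let n = suc (suc k) ; B = at n 1 c in
  ColSpec (colA n) 0 n c (ε₁ B) (φ₁ B) (eBit B (just (sw n 1 c)))
colA-spec0 k c = go (c 1) (c n) refl refl
  where
  n = suc (suc k)
  l = length (asc n c)
  m1 = mem-asc n c 1 ≤-refl (s≤s z≤n)
  mn = mem-asc n c n (s≤s z≤n) ≤-refl
  go : ∀ x y → c 1 ≡ x → c n ≡ y → ColSpec (colA n) 0 n c (ε₁ (x , y)) (φ₁ (x , y)) (eBit (x , y) (just (sw n 1 c)))
  go true true p q = spec (count-0 l (e0A n) _ eN) (count-0 l (f0A n) _ fN) eN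
    where
    eN : e0A n (asc n c) ≡ nothing
    eN rewrite trans mn q | ∧-false (mem 1 (asc n c)) = refl
    fN : f0A n (asc n c) ≡ nothing
    fN rewrite trans m1 p | ∧-false (mem n (asc n c)) = refl
  go false false p q = spec (count-0 l (e0A n) _ eN) (count-0 l (f0A n) _ fN) eN
    where
    eN : e0A n (asc n c) ≡ nothing
    eN rewrite trans m1 p = refl
    fN : f0A n (asc n c) ≡ nothing
    fN rewrite trans mn q = refl
  go true false p q = spec (count-1 l (e0A n) _ eJ eN (length-pos 1 (asc n c) (trans m1 p))) (count-0 l (f0A n) _ fN) eJ
    where
    eJ : e0A n (asc n c) ≡ just (asc n (sw n 1 c))
    eJ rewrite trans m1 p | trans mn q = cong just (e0-asc k c p q)
    eN : e0A n (asc n (sw n 1 c)) ≡ nothing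
    eN rewrite trans (mem-asc n (sw n 1 c) n (s≤s z≤n) ≤-refl) (trans (sw-p n 1 c) p) | ∧-false (mem 1 (asc n (sw n 1 c))) = refl
    fN : f0A n (asc n c) ≡ nothing
    fN rewrite trans mn q = refl
  go false true p q = spec (count-0 l (e0A n) _ eN) (count-1 l (f0A n) _ fJ fN (length-pos n (asc n c) (trans mn q))) eN
    where
    eN : e0A n (asc n c) ≡ nothing
    eN rewrite trans m1 p = refl
    fJ : f0A n (asc n c) ≡ just (1 ∷ dropLast (asc n c))
    fJ rewrite trans m1 p | trans mn q = refl
    fN : f0A n (1 ∷ dropLast (asc n c)) ≡ nothing
    fN rewrite ∧-false (mem n (dropLast (asc n c))) = refl

mC pC : ℕ → ℕ → ℕ → Bool
mC n i x = (x ≡ᵇ suc i) ∨ (x ≡ᵇ bar n i)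
pC n i x = (x ≡ᵇ i) ∨ (x ≡ᵇ bar n (suc i))

bar-suc : ∀ n i → i ≤ n → bar n i ≡ suc (2 * n ∸ i)
bar-suc n i le = +-∸-assoc 1 (≤-trans le (m≤m+n n _))

double-∸ : ∀ n i → i ≤ n → i ≡ n × 2 * n ∸ i ≡ i ⊎ i < n × suc (suc i) ≤ 2 * n ∸ i
double-∸ n i le with m≤n⇒m<n∨m≡n le
... | inj₂ refl = inj₁ (refl , trans (m+n∸m≡n i (i + 0)) (+-identityʳ i))
... | inj₁ lt = inj₂ (lt , (begin
    suc (suc i)        ≤⟨ s≤s lt ⟩
    suc n              ≡⟨ cong suc (sym (+-identityʳ n)) ⟩
    suc (n + 0)        ≡⟨ +-comm 1 (n + 0) ⟩
    (n + 0) + 1        ≤⟨ +-monoʳ-≤ (n + 0) (m<n⇒0<n∸m lt) ⟩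
    (n + 0) + (n ∸ i)  ≡⟨ sym (+-∸-assoc (n + 0) le) ⟩
    (n + 0) + n ∸ i    ≡⟨ cong (_∸ i) (+-comm (n + 0) n) ⟩
    2 * n ∸ i          ∎))
  where open ≤-Reasoning

-- The letters moved by e_i and f_i: i, i+1 and u = 2n - i, u + 1.
module LetterC (n i : ℕ) (1≤i : 1 ≤ i) (i≤n : i ≤ n) (u : ℕ) (u≡ : 2 * n ∸ i ≡ u) where
  gap : u ≡ i ⊎ suc (suc i) ≤ u
  gap with double-∸ n i i≤n
  ... | inj₁ (_ , q) = inj₁ (trans (sym u≡) q)
  ... | inj₂ (_ , q) = inj₂ (subst (suc (suc i) ≤_) u≡ q)
  i≤u : i ≤ u
  i≤u with gap
  ... | inj₁ q = ≤-reflexive (sym q)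
  ... | inj₂ q = ≤-trans (n≤1+n i) (≤-trans (n≤1+n (suc i)) q)
  u≢si : u ≢ suc i
  u≢si with gap
  ... | inj₁ q = <⇒≢ (s≤s (≤-reflexive q))
  ... | inj₂ q = >⇒≢ q
  ms pl : ℕ → Bool
  ms x = (x ≡ᵇ suc i) ∨ (x ≡ᵇ suc u)
  pl x = (x ≡ᵇ i) ∨ (x ≡ᵇ u)
  m≡ : ∀ x → mC n i x ≡ ms x
  m≡ x = cong (λ h → (x ≡ᵇ suc i) ∨ (x ≡ᵇ h)) (trans (bar-suc n i i≤n) (cong suc u≡))
  p≡ : ∀ x → pC n i x ≡ pl x
  p≡ x = cong (λ h → (x ≡ᵇ i) ∨ (x ≡ᵇ h)) u≡
  ∨-elim : ∀ {a b} → (a ∨ b) ≡ true → a ≡ true ⊎ b ≡ true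
  ∨-elim {true} _ = inj₁ refl
  ∨-elim {false} q = inj₂ q
  ∨-no : ∀ x {a b} → x ≢ a → x ≢ b → (x ≡ᵇ a) ∨ (x ≡ᵇ b) ≡ false
  ∨-no x na nb rewrite ≡ᵇ-no na | ≡ᵇ-no nb = refl
  ∨-l : ∀ x {b} → (x ≡ᵇ x) ∨ b ≡ true
  ∨-l x rewrite ≡ᵇ-yes {x} refl = refl
  ∨-r : ∀ x {a} → a ∨ (x ≡ᵇ x) ≡ true
  ∨-r x {true} = refl
  ∨-r x {false} = ≡ᵇ-yes {x} refl
  M : ∀ x → ms x ≡ true → pl x ≡ false × pl (x ∸ 1) ≡ true × ms (x ∸ 1) ≡ false
  M x q with ∨-elim {x ≡ᵇ suc i} q
  ... | inj₁ q' rewrite ≡ᵇ-elim x (suc i) q' = ∨-no (suc i) (>⇒≢ ≤-refl) (λ h → u≢si (sym h)) , ∨-l i , ∨-no i (<⇒≢ ≤-refl) (<⇒≢ (s≤s i≤u))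
  ... | inj₂ q' rewrite ≡ᵇ-elim x (suc u) q' = ∨-no (suc u) (>⇒≢ (s≤s i≤u)) (>⇒≢ ≤-refl) , ∨-r u , ∨-no u u≢si (<⇒≢ ≤-refl)
  P : ∀ x → pl x ≡ true → ms x ≡ false × ms (suc x) ≡ true × pl (suc x) ≡ false
  P x q with ∨-elim {x ≡ᵇ i} q
  ... | inj₁ q' rewrite ≡ᵇ-elim x i q' = ∨-no i (<⇒≢ ≤-refl) (<⇒≢ (s≤s i≤u)) , ∨-l i , ∨-no (suc i) (>⇒≢ ≤-refl) (λ h → u≢si (sym h))
  ... | inj₂ q' rewrite ≡ᵇ-elim x u q' = ∨-no u u≢si (<⇒≢ ≤-refl) , ∨-r u , ∨-no (suc u) (>⇒≢ (s≤s i≤u)) (>⇒≢ ≤-refl)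
  r : inRange 1 n i ≡ true
  r = ∧-intro (≤ᵇ-yes 1≤i) (≤ᵇ-yes i≤n)
  eE : ∀ x → e (letterC n) i x ≡ (if ms x then just (x ∸ 1) else nothing)
  eE x rewrite r | m≡ x = refl
  eF : ∀ x → f (letterC n) i x ≡ (if pl x then just (suc x) else nothing)
  eF x rewrite r | p≡ x = refl
  S : Sem (letterC n) i (λ x → b2n (ms x)) (λ x → b2n (pl x))
  S = Sem-letter ms pl eE eF M P (λ _ → refl)
  isNeutral : ∀ x → x ≢ i → x ≢ suc i → x ≢ u → x ≢ suc u → b2n (ms x) ≡ 0 × b2n (pl x) ≡ 0
  isNeutral x a b c d = cong b2n (∨-no x b d) , cong b2n (∨-no x a c)
  mp : ∀ x → ms (suc x) ≡ true → e (letterC n) i (suc x) ≡ just x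
  mp x q = trans (eE (suc x)) (cong (λ b → if b then just x else nothing) q)

-- The signature of a C-column at i < n is that of the word (bits at u, u+1) ⊗ (bits at i, i+1).
eWord : Two → Two → Maybe Bits → Maybe Bits → Maybe Bits
eWord U X d d' = if φ₁ X <ᵇ ε₁ U then d else eBit X d'

colC-spec : ∀ n i c → let p = suc i ; u = 2 * n ∸ p ; U = at u (suc u) c ; X = at p (suc p) c in p < n →
  ColSpec (colC n) p (2 * n) c (ε₁ X + (ε₁ U ∸ φ₁ X)) (φ₁ U + (φ₁ X ∸ ε₁ U)) (eWord U X (just (sw u (suc u) c)) (just (sw p (suc p) c)))
colC-spec n i c lt with 2 * n ∸ suc i in u≡
... | u = goal
  where
  p = suc i
  open LetterC n p (s≤s z≤n) (<⇒≤ lt) u u≡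
  open FromWords S (λ _ → refl)
  open Block S
  U = at u (suc u) c
  X = at p (suc p) c
  gap' : suc (suc p) ≤ u
  gap' with double-∸ n p (<⇒≤ lt)
  ... | inj₁ (q , _) = ⊥-elim (<⇒≢ lt q)
  ... | inj₂ (_ , q) = subst (suc (suc p) ≤_) u≡ q
  su≤ : suc u ≤ 2 * n
  su≤ = subst (_≤ 2 * n) (cong suc u≡) (∸-monoʳ-< (s≤s z≤n) (≤-trans (<⇒≤ lt) (m≤m+n n _)))
  pu : suc (pred u) ≡ u
  pu = suc-pred u {{>-nonZero (≤-trans (s≤s z≤n) gap')}}
  s₁ : St (suc p) c (ε₁ X) (φ₁ X) (eBit X (just (sw p (suc p) c)))
  s₁ = subst (λ h → St (suc p) c (ε₁ X) h (eBit X (just (sw p (suc p) c)))) (trans (cong (φ₁ X +_) (0∸n≡0 (ε₁ X))) (+-identityʳ _))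
    (St-block (cong b2n (∨-no p (<⇒≢ ≤-refl) (<⇒≢ (s≤s i≤u)))) (cong b2n (∨-l p)) (cong b2n (∨-l (suc p)))
      (cong b2n (∨-no (suc p) (>⇒≢ ≤-refl) (λ h → u≢si (sym h)))) (mp p (∨-l (suc p)))
      (subst (λ k → St k c 0 0 nothing) (+-identityʳ i)
        (St-neutrals i (λ j _ le → let l = s≤s (≤-trans le (≤-reflexive (+-identityʳ i))) in
           isNeutral j (<⇒≢ l) (<⇒≢ (m<n⇒m<1+n l)) (<⇒≢ (<-≤-trans l i≤u)) (<⇒≢ (<-≤-trans l (m≤n⇒m≤1+n i≤u))))
          (St-zero c))))
  sp≤pu : suc p ≤ pred u
  sp≤pu = ≤-pred (subst (suc (suc p) ≤_) (sym pu) gap')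
  s₂ : St (pred u) c (ε₁ X) (φ₁ X) (eBit X (just (sw p (suc p) c)))
  s₂ = subst (λ k → St k c (ε₁ X) (φ₁ X) (eBit X (just (sw p (suc p) c)))) (m∸n+n≡m sp≤pu)
    (St-neutrals (pred u ∸ suc p) (λ j gt le → let l : j < u
                                                   l = subst (j <_) pu (s≤s (subst (j ≤_) (m∸n+n≡m sp≤pu) le)) in
      isNeutral j (>⇒≢ (<-trans ≤-refl gt)) (>⇒≢ gt) (<⇒≢ l) (<⇒≢ (m<n⇒m<1+n l))) s₁)
  s₃ : St (suc u) c (ε₁ X + (ε₁ U ∸ φ₁ X)) (φ₁ U + (φ₁ X ∸ ε₁ U)) (eWord U X (just (sw u (suc u) c)) (just (sw p (suc p) c)))
  s₃ = subst (λ v → let U = at v (suc v) c in St (suc v) c (ε₁ X + (ε₁ U ∸ φ₁ X)) (φ₁ U + (φ₁ X ∸ ε₁ U)) (eWord U X (just (sw v (suc v) c)) (just (sw p (suc p) c)))) pu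
    (St-block
      (cong b2n (subst (λ v → ms v ≡ false) (sym pu) (∨-no u u≢si (<⇒≢ ≤-refl))))
      (cong b2n (subst (λ v → pl v ≡ true) (sym pu) (∨-r u)))
      (cong b2n (subst (λ v → ms (suc v) ≡ true) (sym pu) (∨-r (suc u))))
      (cong b2n (subst (λ v → pl (suc v) ≡ false) (sym pu) (∨-no (suc u) (>⇒≢ (s≤s i≤u)) (>⇒≢ ≤-refl))))
      (subst (λ v → e (letterC n) p (suc v) ≡ just v) (sym pu) (mp u (∨-r (suc u)))) s₂)
  goal : ColSpec (colC n) p (2 * n) c (ε₁ X + (ε₁ U ∸ φ₁ X)) (φ₁ U + (φ₁ X ∸ ε₁ U)) (eWord U X (just (sw u (suc u) c)) (just (sw p (suc p) c)))
  goal = toSpec {e0 = e0C n} {f0 = f0C n} (subst (λ k → St k c (ε₁ X + (ε₁ U ∸ φ₁ X)) (φ₁ U + (φ₁ X ∸ ε₁ U)) (eWord U X (just (sw u (suc u) c)) (just (sw p (suc p) c)))) (m∸n+n≡m su≤)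
    (St-neutrals (2 * n ∸ suc u) (λ j gt _ → let g = <-trans ≤-refl gt in
      isNeutral j (>⇒≢ (≤-<-trans i≤u g)) (>⇒≢ (<-trans gap' g)) (>⇒≢ g) (>⇒≢ gt)) s₃))

colC-specN : ∀ n' c → let n = suc n' ; B = at n (suc n) c in
  ColSpec (colC n) n (2 * n) c (ε₁ B) (φ₁ B) (eBit B (just (sw n (suc n) c)))
colC-specN n' c = toSpec {e0 = e0C n} {f0 = f0C n}
  (subst (λ h → St (2 * n) c (ε₁ B) h res) (trans (cong (φ₁ B +_) (0∸n≡0 (ε₁ B))) (+-identityʳ _))
  (subst (λ k → St k c (ε₁ B) (φ₁ B + (0 ∸ ε₁ B)) res) (m∸n+n≡m sn≤)
  (St-neutrals (2 * n ∸ suc n) (λ j gt _ → let g = <-trans ≤-refl gt in isNeutral j (>⇒≢ g) (>⇒≢ gt) (>⇒≢ g) (>⇒≢ gt))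
  (St-block (cong b2n (∨-no n (<⇒≢ ≤-refl) (<⇒≢ ≤-refl))) (cong b2n (∨-l n)) (cong b2n (∨-l (suc n)))
    (cong b2n (∨-no (suc n) (>⇒≢ ≤-refl) (>⇒≢ ≤-refl))) (mp n (∨-l (suc n)))
  (subst (λ k → St k c 0 0 nothing) (+-identityʳ n')
  (St-neutrals n' (λ j _ le → let l = s≤s (≤-trans le (≤-reflexive (+-identityʳ n'))) ; l' = m<n⇒m<1+n l in
    isNeutral j (<⇒≢ l) (<⇒≢ l') (<⇒≢ l) (<⇒≢ l')) (St-zero c)))))))
  where
  n = suc n'
  B = at n (suc n) c
  res = eBit B (just (sw n (suc n) c))
  u≡ : 2 * n ∸ n ≡ n
  u≡ = trans (m+n∸m≡n n (n + 0)) (+-identityʳ n)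
  open LetterC n n (s≤s z≤n) ≤-refl n u≡
  open FromWords S (λ _ → refl)
  open Block S
  sn≤ : suc n ≤ 2 * n
  sn≤ = subst (suc n ≤_) (+-comm (n + 0) n) (subst (λ h → suc h ≤ (n + 0) + n) (+-identityʳ n) (≤-trans (≤-reflexive (+-comm 1 (n + 0))) (+-monoʳ-≤ (n + 0) (s≤s z≤n))))

colC-spec0 : ∀ n' c → let n = suc n' ; M = 2 * n ; B = at M 1 c in ¬ (c 1 ≡ true × c M ≡ true) →
  ColSpec (colC n) 0 M c (ε₁ B) (φ₁ B) (eBit B (just (sw M 1 c)))
colC-spec0 n' c nb = go (c 1) (c M) refl refl
  where
  n = suc n'
  k = n' + (n' + 0)
  M = 2 * n
  l = length (asc M c)
  M≡ : M ≡ suc (suc k)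
  M≡ = cong suc (+-suc n' (n' + 0))
  m1 = mem-asc M c 1 ≤-refl (s≤s z≤n)
  mM = mem-asc M c M (s≤s z≤n) ≤-refl
  go : ∀ x y → c 1 ≡ x → c M ≡ y → ColSpec (colC n) 0 M c (ε₁ (x , y)) (φ₁ (x , y)) (eBit (x , y) (just (sw M 1 c)))
  go true true p q = ⊥-elim (nb (p , q))
  go false false p q = spec (count-0 l (e0C n) _ eN) (count-0 l (f0C n) _ fN) eN
    where
    eN : e0C n (asc M c) ≡ nothing
    eN rewrite trans m1 p = refl
    fN : f0C n (asc M c) ≡ nothing
    fN rewrite trans mM q = refl
  go true false p q = spec (count-1 l (e0C n) _ eJ eN (length-pos 1 (asc M c) (trans m1 p))) (count-0 l (f0C n) _ fN) eJ
    where
    eJ : e0C n (asc M c) ≡ just (asc M (sw M 1 c))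
    eJ rewrite trans m1 p = cong just (subst (λ m → c m ≡ false → tail (asc m c) ++ (m ∷ []) ≡ asc m (sw m 1 c)) (sym M≡) (e0-asc k c p) q)
    eN : e0C n (asc M (sw M 1 c)) ≡ nothing
    eN rewrite trans (mem-asc M (sw M 1 c) 1 ≤-refl (s≤s z≤n)) (trans (sw-q M 1 c) q) = refl
    fN : f0C n (asc M c) ≡ nothing
    fN rewrite trans mM q = refl
  go false true p q = spec (count-0 l (e0C n) _ eN) (count-1 l (f0C n) _ fJ fN (length-pos M (asc M c) (trans mM q))) eN
    where
    eN : e0C n (asc M c) ≡ nothing
    eN rewrite trans m1 p = refl
    fJ : f0C n (asc M c) ≡ just (1 ∷ dropLast (asc M c))
    fJ rewrite trans mM q = refl
    M≢1 : M ≢ 1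
    M≢1 eq with trans (sym M≡) eq
    ... | ()
    dl : dropLast (asc M c) ≡ asc (suc k) c
    dl = subst (λ m → c m ≡ true → dropLast (asc m c) ≡ asc (suc k) c) (sym M≡)
      (λ h → trans (cong dropLast (asc-with (suc k) c h)) (dropLast-snoc (asc (suc k) c) (suc (suc k)))) q
    fN : f0C n (1 ∷ dropLast (asc M c)) ≡ nothing
    fN rewrite ≡ᵇ-no M≢1 | dl | mem-asc-high (suc k) c M (≤-reflexive (sym M≡)) = refl

-- The combinatorial R-matrix on bits

-- One site of the R-matrix L ⊗ R ↦ R' ⊗ L' on bits: sites are visited downwards, k counts the letters of R
-- carried along, and each is deposited on the next free letter of L.
data V : ℕ → Bool → Bool → Bool → Bool → ℕ → Set where
  nn   : ∀ {k} → V k false false false false k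
  pick : ∀ {k} → V k false true false true (suc k)
  stay : V 0 true false false true 0
  drop : ∀ {k} → V (suc k) true false true false k
  both : ∀ {k} → V k true true true true k

LV : ℕ → ℕ → ℕ → Two → Two → Two → Two → Set
LV k2 k1 k0 L R R' L' = V k2 (proj₁ L) (proj₁ R) (proj₁ R') (proj₁ L') k1 × V k1 (proj₂ L) (proj₂ R) (proj₂ R') (proj₂ L') k0

data Op : Set where
  E F : Op

cond : Op → ℕ → ℕ → Bool
cond E b x = b <ᵇ x
cond F b x = b ≤ᵇ x

open Fold ε₁ φ₁ public renaming (epF to epW; phF to phW)

pos : Op → List Two → ℕ
pos op []      = 0
pos op (c ∷ w) = if cond op (phW w) (ε₁ c) then 0 else suc (pos op w)

stat : Op → List Two → ℕ
stat E = epW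
stat F = phW

swIf : Bool → Two → Two
swIf true  (q , p) = p , q
swIf false c       = c

bump : Op → ℕ → ℕ → Set
bump E k k' = k' ≡ suc k
bump F k k' = k ≡ suc k'

-- How the positions acted upon before and after a pass at m determine the change of the carry.
data Rule (op : Op) (m : ℕ) : ℕ → ℕ → ℕ → ℕ → Set where
  ll  : ∀ {k k'} → bump op k k' → Rule op m m m k k'
  rr  : ∀ {k k'} → bump op k' k → Rule op m (suc m) (suc m) k k'
  lr  : ∀ {k} → Rule op m m (suc m) k k
  rl  : ∀ {k} → Rule op m (suc m) m k k
  out : ∀ {j k} → j ≢ m → j ≢ suc m → Rule op m j j k k

record Res (op : Op) (m j j' k2 k1 k0 : ℕ) (L R R' L' : Two) : Set where
  constructor res
  field
    k1'   : ℕ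
    rule  : Rule op m j j' k1 k1'
    lv    : LV k2 k1' k0 (swIf (j ≡ᵇ m) L) (swIf (j ≡ᵇ suc m) R) (swIf (j' ≡ᵇ m) R') (swIf (j' ≡ᵇ suc m) L')
    zero' : k1 ≡ 0 → k2 ≡ 0 ⊎ k0 ≡ 0 ⊎ k1' ≡ 0

loc : ∀ op {k2 k1 k0 L R R' L'} → LV k2 k1 k0 L R R' L' → 0 < stat op (L ∷ R ∷ [])
  → Res op 0 (pos op (L ∷ R ∷ [])) (pos op (R' ∷ L' ∷ [])) k2 k1 k0 L R R' L'
loc E (both , drop) _ = res _ (rr refl) (drop , both) λ ()
loc E (both , nn)   _ = res _ (ll refl) (pick , drop) inj₁
loc E (both , pick) _ = res _ (ll refl) (pick , both) inj₁
loc E (both , stay) _ = res _ rl (stay , both) inj₁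
loc E (drop , nn)   _ = res _ (ll refl) (nn , drop) λ q → inj₂ (inj₁ q)
loc E (pick , drop) _ = res _ (rr refl) (nn , both) λ ()
loc E (pick , nn)   _ = res _ (rr refl) (nn , pick) λ ()
loc E (stay , nn)   _ = res _ lr (nn , stay) inj₁
loc E (both , both) ()
loc E (drop , both) ()
loc E (drop , drop) ()
loc E (drop , pick) ()
loc E (drop , stay) ()
loc E (nn , both) ()
loc E (nn , drop) ()
loc E (nn , nn) ()
loc E (nn , pick) ()
loc E (nn , stay) ()
loc E (pick , both) ()
loc E (pick , pick) ()
loc E (stay , both) ()
loc E (stay , pick) ()
loc E (stay , stay) ()
loc F (drop , both) _ = res _ (rr refl) (both , drop) λ q → inj₂ (inj₁ q)
loc F (nn , both)   _ = res _ (rr refl) (pick , drop) inj₁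
loc F (nn , drop)   _ = res _ (ll refl) (drop , nn) λ ()
loc F (nn , pick)   _ = res _ (rr refl) (pick , nn) inj₁
loc F (nn , stay)   _ = res _ lr (stay , nn) inj₁
loc F (pick , both) _ = res _ (ll refl) (both , pick) λ ()
loc F (pick , drop) _ = res _ (ll refl) (both , nn) λ ()
loc F (stay , both) _ = res _ rl (both , stay) inj₁
loc F (both , both) ()
loc F (both , drop) ()
loc F (both , nn) ()
loc F (both , pick) ()
loc F (both , stay) ()
loc F (drop , drop) ()
loc F (drop , nn) ()
loc F (drop , pick) ()
loc F (drop , stay) ()
loc F (nn , nn) ()
loc F (pick , nn) ()
loc F (pick , pick) ()
loc F (stay , nn) ()
loc F (stay , pick) ()
loc F (stay , stay) ()

sig : ∀ {k2 k1 k0 L R R' L'} → LV k2 k1 k0 L R R' L' →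
  epW (L ∷ R ∷ []) ≡ epW (R' ∷ L' ∷ []) × phW (L ∷ R ∷ []) ≡ phW (R' ∷ L' ∷ [])
sig (nn , nn) = refl , refl
sig (nn , pick) = refl , refl
sig (nn , stay) = refl , refl
sig (nn , drop) = refl , refl
sig (nn , both) = refl , refl
sig (pick , nn) = refl , refl
sig (pick , pick) = refl , refl
sig (pick , drop) = refl , refl
sig (pick , both) = refl , refl
sig (stay , nn) = refl , refl
sig (stay , pick) = refl , refl
sig (stay , stay) = refl , refl
sig (stay , both) = refl , refl
sig (drop , nn) = refl , refl
sig (drop , pick) = refl , refl
sig (drop , stay) = refl , refl
sig (drop , drop) = refl , refl
sig (drop , both) = refl , refl
sig (both , nn) = refl , refl
sig (both , pick) = refl , refl
sig (both , stay) = refl , refl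
sig (both , drop) = refl , refl
sig (both , both) = refl , refl

∸-assoc-rule : ∀ x p a b → (a ∸ b) + (x ∸ (p + (b ∸ a))) ≡ (a + (x ∸ p)) ∸ b
∸-assoc-rule x p a b with ≤-total b a
... | inj₁ b≤a rewrite m≤n⇒m∸n≡0 b≤a | +-identityʳ p = sym (+-∸-comm (x ∸ p) b≤a)
... | inj₂ a≤b rewrite m≤n⇒m∸n≡0 a≤b = trans (sym (∸-+-assoc x p (b ∸ a)))
  (trans (sym ([m+n]∸[m+o]≡n∸o a (x ∸ p) (b ∸ a))) (cong (a + (x ∸ p) ∸_) (m+[n∸m]≡n a≤b)))

mutual
  epW-++ : ∀ u w → epW (u ++ w) ≡ epW w + (epW u ∸ phW w)
  epW-++ [] w = sym (trans (cong (epW w +_) (0∸n≡0 (phW w))) (+-identityʳ _))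
  epW-++ (x ∷ u) w rewrite phW-++ u w | epW-++ u w =
    trans (+-assoc (epW w) _ _) (cong (epW w +_) (∸-assoc-rule (ε₁ x) (phW u) (epW u) (phW w)))
  phW-++ : ∀ u w → phW (u ++ w) ≡ phW u + (phW w ∸ epW u)
  phW-++ [] w = refl
  phW-++ (x ∷ u) w rewrite phW-++ u w = trans
    (cong (φ₁ x +_) (sym (∸-assoc-rule (phW w) (epW u) (phW u) (ε₁ x)))) (sym (+-assoc (φ₁ x) _ _))

pos-zero : ∀ w → phW w ≡ 0 → pos F w ≡ 0
pos-zero [] _ = refl
pos-zero (c ∷ w) q rewrite ≤ᵇ-yes {phW w} {ε₁ c} (m∸n≡0⇒m≤n (m+n≡0⇒n≡0 (φ₁ c) q)) = refl

bool-≡ : ∀ {a b : Bool} → (a ≡ true → b ≡ true) → (b ≡ true → a ≡ true) → a ≡ b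
bool-≡ {true}  {true}  _ _ = refl
bool-≡ {true}  {false} h _ = sym (h refl)
bool-≡ {false} {true}  _ h = h refl
bool-≡ {false} {false} _ _ = refl

cond-left : ∀ op pu eu b x → cond op pu x ≡ true → cond op (pu + (b ∸ eu)) x ≡ cond op b (eu + (x ∸ pu))
cond-left E pu eu b x c = bool-≡
  (λ h → <ᵇ-yes (≰⇒> λ le → <⇒≱ (<ᵇ-elim (pu + (b ∸ eu)) x h) (begin
     x ≡⟨ sym (m+[n∸m]≡n (<⇒≤ (<ᵇ-elim pu x c))) ⟩
     pu + (x ∸ pu) ≤⟨ +-monoʳ-≤ pu (subst (_≤ b ∸ eu) (m+n∸m≡n eu _) (∸-monoˡ-≤ eu le)) ⟩
     pu + (b ∸ eu) ∎)))
  (λ h → <ᵇ-yes (≰⇒> λ le → let t : x ∸ pu ≤ b ∸ eu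
                                t = subst (x ∸ pu ≤_) (m+n∸m≡n pu _) (∸-monoˡ-≤ pu le) in
     <⇒≱ (<ᵇ-elim b (eu + (x ∸ pu)) h) (begin
       eu + (x ∸ pu) ≤⟨ +-monoʳ-≤ eu t ⟩
       eu + (b ∸ eu) ≡⟨ m+[n∸m]≡n {eu} (<⇒≤ (m∸n≢0⇒n<m λ z → <⇒≱ (m<n⇒0<n∸m (<ᵇ-elim pu x c)) (subst (x ∸ pu ≤_) z t))) ⟩
       b ∎)))
  where open ≤-Reasoning
cond-left F pu eu b x c = bool-≡
  (λ h → ≤ᵇ-yes (≤-trans (m≤n+m∸n b eu) (+-monoʳ-≤ eu
     (subst (_≤ x ∸ pu) (m+n∸m≡n pu _) (∸-monoˡ-≤ pu (≤ᵇ-elim (pu + (b ∸ eu)) x h))))))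
  (λ h → ≤ᵇ-yes (begin
     pu + (b ∸ eu) ≤⟨ +-monoʳ-≤ pu (subst (b ∸ eu ≤_) (m+n∸m≡n eu _) (∸-monoˡ-≤ eu (≤ᵇ-elim b (eu + (x ∸ pu)) h))) ⟩
     pu + (x ∸ pu) ≡⟨ m+[n∸m]≡n (≤ᵇ-elim pu x c) ⟩
     x ∎))
  where open ≤-Reasoning

cond-false : ∀ op pu x → cond op pu x ≡ false → x ≤ pu
cond-false E pu x c = <ᵇ-elim-no pu x c
cond-false F pu x c = <⇒≤ (≤ᵇ-elim-no pu x c)

cond-right : ∀ op pu d x → cond op pu x ≡ false → cond op (pu + d) x ≡ false
cond-right E pu d x c = <ᵇ-no (≤-trans (<ᵇ-elim-no pu x c) (m≤m+n pu d))
cond-right F pu d x c = ≤ᵇ-no (<-≤-trans (≤ᵇ-elim-no pu x c) (m≤m+n pu d))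

if-suc : ∀ a b {y z : ℕ} → a ≡ b → suc (if b then y else z) ≡ (if a then suc y else suc z)
if-suc true .true refl = refl
if-suc false .false refl = refl

pos-++ : ∀ op u w → pos op (u ++ w) ≡ (if cond op (phW w) (epW u) then pos op u else length u + pos op w)
pos-++ E [] w = refl
pos-++ F [] w with phW w in eq
... | zero = pos-zero w eq
... | suc _ = refl
pos-++ op (x ∷ u) w with cond op (phW u) (ε₁ x) in c
... | false rewrite pos-++ op u w | phW-++ u w | cond-right op (phW u) (phW w ∸ epW u) (ε₁ x) c =
  if-suc (cond op (phW w) (epW u + (ε₁ x ∸ phW u))) (cond op (phW w) (epW u))
    (cong (cond op (phW w)) (trans (cong (epW u +_) (m≤n⇒m∸n≡0 (cond-false op (phW u) (ε₁ x) c))) (+-identityʳ (epW u))))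
... | true rewrite phW-++ u w | cond-left op (phW u) (epW u) (phW w) (ε₁ x) c with cond op (phW w) (epW u + (ε₁ x ∸ phW u)) in d
...   | true = refl
...   | false = cong suc (trans (pos-++ op u w) (if-f (cond op (phW w) (epW u)) (cond-mono op (phW w) (epW u) (ε₁ x ∸ phW u) d)))
  where
  if-f : ∀ b {y z : ℕ} → b ≡ false → (if b then y else z) ≡ z
  if-f .false refl = refl
  cond-mono : ∀ op b y z → cond op b (y + z) ≡ false → cond op b y ≡ false
  cond-mono E b y z h = <ᵇ-no (≤-trans (m≤m+n y z) (<ᵇ-elim-no b (y + z) h))
  cond-mono F b y z h = ≤ᵇ-no (≤-<-trans (m≤m+n y z) (≤ᵇ-elim-no b (y + z) h))

-- The word w' arises from w by a pass of R through L at positions m, m+1.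
data Adj (L R R' L' : Two) : ℕ → List Two → List Two → Set where
  now  : ∀ {w} → Adj L R R' L' 0 (L ∷ R ∷ w) (R' ∷ L' ∷ w)
  skip : ∀ {c m w w'} → Adj L R R' L' m w w' → Adj L R R' L' (suc m) (c ∷ w) (c ∷ w')

sigAdj : ∀ {k2 k1 k0 L R R' L' m w w'} → LV k2 k1 k0 L R R' L' → Adj L R R' L' m w w' → epW w ≡ epW w' × phW w ≡ phW w'
sigAdj {L = L} {R} {R'} {L'} v (now {w}) with sig v
... | a , b = trans (epW-++ (L ∷ R ∷ []) w) (trans (cong (λ h → epW w + (h ∸ phW w)) a) (sym (epW-++ (R' ∷ L' ∷ []) w)))
            , trans (phW-++ (L ∷ R ∷ []) w) (trans (cong₂ (λ h h' → h + (phW w ∸ h')) b a) (sym (phW-++ (R' ∷ L' ∷ []) w)))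
sigAdj v (skip {c} A) with sigAdj v A
... | a , b = cong₂ (λ h h' → h + (ε₁ c ∸ h')) a b , cong (λ h → φ₁ c + (h ∸ ε₁ c)) b

Rule-skip : ∀ {op m j j' k k'} → Rule op m j j' k k' → Rule op (suc m) (suc j) (suc j') k k'
Rule-skip (ll b) = ll b
Rule-skip (rr b) = rr b
Rule-skip lr = lr
Rule-skip rl = rl
Rule-skip (out a b) = out (λ q → a (suc-injective q)) (λ q → b (suc-injective q))

enab-rest : ∀ op c w → 0 < stat op (c ∷ w) → cond op (phW w) (ε₁ c) ≡ false → 0 < stat op w
enab-rest E c w en q = subst (0 <_) (trans (cong (epW w +_) (m≤n⇒m∸n≡0 (<ᵇ-elim-no (phW w) (ε₁ c) q))) (+-identityʳ _)) en
enab-rest F c w en q = ≤-<-trans z≤n (≤ᵇ-elim-no (phW w) (ε₁ c) q)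

enab-block : ∀ op u w → 0 < stat op (u ++ w) → cond op (phW w) (epW u) ≡ true → 0 < stat op u
enab-block E u w en q = ≤-<-trans z≤n (<ᵇ-elim (phW w) (epW u) q)
enab-block F u w en q = subst (0 <_) (trans (phW-++ u w) (trans (cong (phW u +_) (m≤n⇒m∸n≡0 (≤ᵇ-elim (phW w) (epW u) q))) (+-identityʳ _))) en

move : ∀ op {k2 k1 k0 L R R' L' m w w'} → LV k2 k1 k0 L R R' L' → Adj L R R' L' m w w' → 0 < stat op w
  → Res op m (pos op w) (pos op w') k2 k1 k0 L R R' L'
move op {k2} {k1} {k0} {L} {R} {R'} {L'} v (now {w}) en
  rewrite pos-++ op (L ∷ R ∷ []) w | pos-++ op (R' ∷ L' ∷ []) w | proj₁ (sig v)
  with cond op (phW w) (epW (R' ∷ L' ∷ [])) in c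
... | true = loc op v (enab-block op (L ∷ R ∷ []) w en (trans (cong (cond op (phW w)) (proj₁ (sig v))) c))
... | false = res k1 (out (λ ()) (λ ())) v (λ q → inj₂ (inj₂ q))
move op v (skip {c} {w = w} {w' = w'} A) en rewrite sym (proj₂ (sigAdj v A)) with cond op (phW w) (ε₁ c) in q
... | true = res _ (out (λ ()) (λ ())) v (λ z → inj₂ (inj₂ z))
... | false with move op v A (enab-rest op c w en q)
... | res k r l z = res k (Rule-skip r) l z

-- Sites 1 … M lie on a circle; 0 is junk.
prd : ℕ → ℕ → ℕ
prd M zero          = zero
prd M (suc zero)    = M
prd M (suc (suc a)) = suc a

record Site (M p q : ℕ) : Set where
  constructor site
  field
    2≤M : 2 ≤ M
    1≤q : 1 ≤ q
    q≤M : q ≤ M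
    p≡  : p ≡ prd M q

site-0 : ∀ {M} → 2 ≤ M → Site M M 1
site-0 le = site le ≤-refl (<⇒≤ le) refl

site-suc : ∀ {M} i → suc (suc i) ≤ M → Site M (suc i) (suc (suc i))
site-suc i le = site (≤-trans (s≤s (s≤s z≤n)) le) (s≤s z≤n) le refl

prd-inj : ∀ M a b → 1 ≤ a → a ≤ M → 1 ≤ b → b ≤ M → prd M a ≡ prd M b → a ≡ b
prd-inj M (suc zero) (suc zero) _ _ _ _ _ = refl
prd-inj M (suc zero) (suc (suc b)) _ _ _ le eq = ⊥-elim (<⇒≢ le (sym eq))
prd-inj M (suc (suc a)) (suc zero) _ le _ _ eq = ⊥-elim (<⇒≢ le eq)
prd-inj M (suc (suc a)) (suc (suc b)) _ _ _ _ eq = cong suc eq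

prd≢ : ∀ M a → 2 ≤ M → 1 ≤ a → prd M a ≢ a
prd≢ M (suc zero) le _ eq = <⇒≢ le (sym eq)
prd≢ M (suc (suc a)) le _ eq = <⇒≢ ≤-refl eq

prd-range : ∀ M a → 1 ≤ a → a ≤ M → 1 ≤ prd M a × prd M a ≤ M
prd-range M (suc zero) _ le = le , ≤-refl
prd-range M (suc (suc a)) _ le = s≤s z≤n , <⇒≤ le

module SiteProps {M p q : ℕ} (s : Site M p q) where
  open Site s public
  p≢q : p ≢ q
  p≢q eq = prd≢ M q 2≤M 1≤q (trans (sym p≡) eq)
  1≤p : 1 ≤ p
  1≤p = subst (1 ≤_) (sym p≡) (proj₁ (prd-range M q 1≤q q≤M))
  p≤M : p ≤ M
  p≤M = subst (_≤ M) (sym p≡) (proj₂ (prd-range M q 1≤q q≤M))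

swB : Bool → ℕ → ℕ → Bits → Bits
swB b p q c = if b then sw p q c else c

at-swB : ∀ {p q} → p ≢ q → ∀ b c → at p q (swB b p q c) ≡ swIf b (at p q c)
at-swB {p} {q} ne false c = refl
at-swB {p} {q} ne true c = cong₂ _,_ (sw-q p q c) (sw-p p q c)

swB-other : ∀ b p q c x → x ≢ p → x ≢ q → swB b p q c x ≡ c x
swB-other false p q c x _ _ = refl
swB-other true p q c x a b = sw-other p q c x a b

-- The R-matrix L ⊗ R ↦ R' ⊗ L' on bits; u a is the carry entering site a, u M the winding number.
-- A vanishing carry makes the winding number minimal when L and R have the same height.
record Pass (M : ℕ) (L R R' L' : Bits) (u : ℕ → ℕ) : Set where
  constructor pass
  field
    vert : ∀ a → 1 ≤ a → a ≤ M → V (u a) (L a) (R a) (R' a) (L' a) (u (prd M a))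
    zer  : ∃ λ a → 1 ≤ a × a ≤ M × u a ≡ 0

V-cong : ∀ {k k' l l₂ r r₂ x x₂ y y₂ z z'} → k ≡ k' → l ≡ l₂ → r ≡ r₂ → x ≡ x₂ → y ≡ y₂ → z ≡ z' → V k l r x y z → V k' l₂ r₂ x₂ y₂ z'
V-cong refl refl refl refl refl refl v = v

Pass-cong : ∀ {M L R R' L' u K S S' K'} → (∀ a → 1 ≤ a → a ≤ M → L a ≡ K a) → (∀ a → 1 ≤ a → a ≤ M → R a ≡ S a)
  → (∀ a → 1 ≤ a → a ≤ M → R' a ≡ S' a) → (∀ a → 1 ≤ a → a ≤ M → L' a ≡ K' a) → Pass M L R R' L' u → Pass M K S S' K' u
Pass-cong f g h k (pass v z) = pass (λ a i j → V-cong refl (f a i j) (g a i j) (h a i j) (k a i j) refl (v a i j)) z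

LV-cong : ∀ {k2 k1 k0 l2 l1 l0 L R R' L' K S S' K'} → k2 ≡ l2 → k1 ≡ l1 → k0 ≡ l0
  → L ≡ K → R ≡ S → R' ≡ S' → L' ≡ K' → LV k2 k1 k0 L R R' L' → LV l2 l1 l0 K S S' K'
LV-cong refl refl refl refl refl refl refl v = v

upd : ℕ → ℕ → (ℕ → ℕ) → ℕ → ℕ
upd p k u a = if a ≡ᵇ p then k else u a

upd-at : ∀ p k u → upd p k u p ≡ k
upd-at p k u rewrite ≡ᵇ-yes {p} refl = refl

upd-other : ∀ p k u a → a ≢ p → upd p k u a ≡ u a
upd-other p k u a ne rewrite ≡ᵇ-no ne = refl

passMove : ∀ op {M p q L R R' L' u m w w'} → Site M p q → Pass M L R R' L' u
  → Adj (at p q L) (at p q R) (at p q R') (at p q L') m w w' → 0 < stat op w →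
  ∃ λ u' → Pass M (swB (pos op w ≡ᵇ m) p q L) (swB (pos op w ≡ᵇ suc m) p q R)
                  (swB (pos op w' ≡ᵇ m) p q R') (swB (pos op w' ≡ᵇ suc m) p q L') u'
         × Rule op m (pos op w) (pos op w') (u p) (u' p) × (∀ a → a ≢ p → u' a ≡ u a)
passMove op {M} {p} {q} {L} {R} {R'} {L'} {u} {m} {w} {w'} s (pass vt (z , 1≤z , z≤M , uz)) A en
  = u' , pass vt' zer' , subst (Rule op m (pos op w) (pos op w') (u p)) (sym (upd-at p k1' u)) rule , upd-other p k1' u
  where
  open SiteProps s
  lv : LV (u q) (u p) (u (prd M p)) (at p q L) (at p q R) (at p q R') (at p q L')
  lv = subst (λ h → V (u q) (L q) (R q) (R' q) (L' q) (u h)) (sym p≡) (vt q 1≤q q≤M) , vt p 1≤p p≤M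
  rs = move op lv A en
  open Res rs renaming (lv to lv'; zero' to zeroMid)
  u' = upd p k1' u
  prp≢p : prd M p ≢ p
  prp≢p = prd≢ M p 2≤M 1≤p
  q≢p : q ≢ p
  q≢p h = p≢q (sym h)
  at' : ∀ b c → at p q (swB b p q c) ≡ swIf b (at p q c)
  at' = at-swB p≢q
  j = pos op w
  j' = pos op w'
  two : LV (u' q) (u' p) (u' (prd M p)) (at p q (swB (j ≡ᵇ m) p q L)) (at p q (swB (j ≡ᵇ suc m) p q R))
           (at p q (swB (j' ≡ᵇ m) p q R')) (at p q (swB (j' ≡ᵇ suc m) p q L'))
  two = LV-cong (sym (upd-other p k1' u q q≢p)) (sym (upd-at p k1' u)) (sym (upd-other p k1' u (prd M p) prp≢p))
    (sym (at' (j ≡ᵇ m) L)) (sym (at' (j ≡ᵇ suc m) R)) (sym (at' (j' ≡ᵇ m) R')) (sym (at' (j' ≡ᵇ suc m) L')) lv'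
  vt' : ∀ a → 1 ≤ a → a ≤ M → V (u' a) (swB (j ≡ᵇ m) p q L a) (swB (j ≡ᵇ suc m) p q R a)
          (swB (j' ≡ᵇ m) p q R' a) (swB (j' ≡ᵇ suc m) p q L' a) (u' (prd M a))
  vt' a 1≤a a≤M with a Data.Nat.≟ p | a Data.Nat.≟ q
  ... | yes refl | _ = proj₂ two
  ... | no a≢p | yes refl = subst (λ h → V (u' q) (swB (j ≡ᵇ m) p q L q) (swB (j ≡ᵇ suc m) p q R q)
          (swB (j' ≡ᵇ m) p q R' q) (swB (j' ≡ᵇ suc m) p q L' q) (u' h)) p≡ (proj₁ two)
  ... | no a≢p | no a≢q = V-cong (sym (upd-other p k1' u a a≢p)) (o (j ≡ᵇ m) L) (o (j ≡ᵇ suc m) R) (o (j' ≡ᵇ m) R') (o (j' ≡ᵇ suc m) L')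
          (sym (upd-other p k1' u (prd M a) λ h → a≢q (prd-inj M a q 1≤a a≤M 1≤q q≤M (trans h p≡)))) (vt a 1≤a a≤M)
    where
    o : ∀ b c → c a ≡ swB b p q c a
    o b c = sym (swB-other b p q c a a≢p a≢q)
  zer' : ∃ λ a → 1 ≤ a × a ≤ M × u' a ≡ 0
  zer' with z Data.Nat.≟ p
  ... | no z≢p = z , 1≤z , z≤M , trans (upd-other p k1' u z z≢p) uz
  ... | yes refl with zeroMid uz
  ...   | inj₁ h = q , 1≤q , q≤M , trans (upd-other p k1' u q q≢p) h
  ...   | inj₂ (inj₁ h) = prd M p , proj₁ (prd-range M p 1≤p p≤M) , proj₂ (prd-range M p 1≤p p≤M) , trans (upd-other p k1' u _ prp≢p) h
  ...   | inj₂ (inj₂ h) = p , 1≤p , p≤M , trans (upd-at p k1' u) h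

act : Op → List Two → List Two
act op []      = []
act op (c ∷ w) = if cond op (phW w) (ε₁ c) then swIf true c ∷ w else c ∷ act op w

ε₁-pos : ∀ c → 0 < ε₁ c → c ≡ (true , false)
ε₁-pos (true , false) _ = refl
ε₁-pos (true , true) ()
ε₁-pos (false , _) ()

act-sig : ∀ w → 0 < epW w → suc (epW (act E w)) ≡ epW w × phW (act E w) ≡ suc (phW w) × pos F (act E w) ≡ pos E w
act-sig (c ∷ w) en with phW w <ᵇ ε₁ c in q
... | true with ε₁-pos c (≤-<-trans z≤n (<ᵇ-elim (phW w) (ε₁ c) q))
...   | refl with phW w
...     | zero = trans (cong suc (+-identityʳ (epW w))) (+-comm 1 (epW w)) , refl , refl
act-sig (c ∷ w) en | true | refl | suc _ with q
... | ()
act-sig (c ∷ w) en | false with <ᵇ-elim-no (phW w) (ε₁ c) q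
... | le with act-sig w (subst (0 <_) (trans (cong (epW w +_) (m≤n⇒m∸n≡0 le)) (+-identityʳ _)) en)
... | a , b , d rewrite b | m≤n⇒m∸n≡0 le | m≤n⇒m∸n≡0 (m≤n⇒m≤1+n le) | ≤ᵇ-no {suc (phW w)} {ε₁ c} (s≤s le) =
  trans (cong suc (+-identityʳ _)) (trans a (sym (+-identityʳ _))) ,
  trans (cong (φ₁ c +_) (+-∸-assoc 1 le)) (+-suc _ _) , cong suc d

swAt : ℕ → List Two → List Two
swAt j []             = []
swAt zero (c ∷ w)     = swIf true c ∷ w
swAt (suc j) (c ∷ w)  = c ∷ swAt j w

act-swAt : ∀ op w → act op w ≡ swAt (pos op w) w
act-swAt op [] = refl
act-swAt op (c ∷ w) with cond op (phW w) (ε₁ c)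
... | true  = refl
... | false = cong (c ∷_) (act-swAt op w)

χ : List ℕ → Bits
χ b x = mem x b

opt : Bool → ℕ → List ℕ
opt b x = if b then x ∷ [] else []

-- The letters lo + 1, …, lo + d of a column.
ascF : ℕ → ℕ → Bits → List ℕ
ascF lo zero    c = []
ascF lo (suc d) c = opt (c (suc lo)) (suc lo) ++ ascF (suc lo) d c

asc-++ : ∀ k d c → asc k c ++ ascF k d c ≡ asc (d + k) c
asc-++ k zero c = ++-identityʳ _
asc-++ k (suc d) c = trans (sym (++-assoc (asc k c) (opt (c (suc k)) (suc k)) _))
  (trans (asc-++ (suc k) d c) (cong (λ h → asc h c) (+-suc d k)))

asc≡ascF : ∀ M c → ascF 0 M c ≡ asc M c
asc≡ascF M c = trans (asc-++ 0 M c) (cong (λ h → asc h c) (+-identityʳ M))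

ascF-cong : ∀ lo d {c c'} → (∀ x → lo < x → x ≤ d + lo → c x ≡ c' x) → ascF lo d c ≡ ascF lo d c'
ascF-cong lo zero eq = refl
ascF-cong lo (suc d) eq = cong₂ _++_ (cong (λ h → opt h (suc lo)) (eq (suc lo) ≤-refl (s≤s (m≤n+m lo d))))
  (ascF-cong (suc lo) d (λ x a b → eq x (<⇒≤ a) (subst (x ≤_) (+-suc d lo) b)))

AllGt : ℕ → List ℕ → Set
AllGt lo []      = ⊤
AllGt lo (x ∷ l) = lo < x × AllGt lo l

AllGt-weaken : ∀ {a b} l → a ≤ b → AllGt b l → AllGt a l
AllGt-weaken [] le _ = tt
AllGt-weaken (x ∷ l) le (p , q) = ≤-<-trans le p , AllGt-weaken l le q

AllGt-tail : ∀ x l → strictInc (x ∷ l) ≡ true → AllGt x l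
AllGt-tail x [] _ = tt
AllGt-tail x (y ∷ l) si = let (a , b) = ∧-elim {x <ᵇ y} si ; lt = <ᵇ-elim x y a in
  lt , AllGt-weaken l (<⇒≤ lt) (AllGt-tail y l b)

strictInc-tail : ∀ x l → strictInc (x ∷ l) ≡ true → strictInc l ≡ true
strictInc-tail x [] _ = refl
strictInc-tail x (y ∷ l) si = proj₂ (∧-elim {x <ᵇ y} si)

strictInc-cons : ∀ x l → AllGt x l → strictInc l ≡ true → strictInc (x ∷ l) ≡ true
strictInc-cons x [] _ _ = refl
strictInc-cons x (y ∷ l) (lt , _) si = ∧-intro (<ᵇ-yes lt) si

mem-low : ∀ {lo} x l → AllGt lo l → x ≤ lo → mem x l ≡ false
mem-low x [] _ _ = refl
mem-low x (y ∷ l) (lt , g) le rewrite ≡ᵇ-no (<⇒≢ (≤-<-trans le lt)) = mem-low x l g le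

allB-head : ∀ {A : Set} (g : A → Bool) x l → allB g (x ∷ l) ≡ true → g x ≡ true × allB g l ≡ true
allB-head g x l q = ∧-elim {g x} q

ascF-decomp : ∀ lo d M b → M ≡ d + lo → strictInc b ≡ true → allB (inRange 1 M) b ≡ true → AllGt lo b
  → b ≡ ascF lo d (χ b)
ascF-decomp lo zero M [] eq si ir gt = refl
ascF-decomp lo zero M (x ∷ b) refl si ir (lt , gt) =
  ⊥-elim (<⇒≱ lt (≤ᵇ-elim x M (proj₂ (∧-elim {1 ≤ᵇ x} (proj₁ (allB-head (inRange 1 M) x b ir))))))
ascF-decomp lo (suc d) M [] eq si ir gt = ascF-decomp (suc lo) d M [] (trans eq (sym (+-suc d lo))) si ir gt
ascF-decomp lo (suc d) M (x ∷ b) eq si ir (lt , gt) with x Data.Nat.≟ suc lo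
... | yes refl rewrite ≡ᵇ-yes {lo} refl = cong (suc lo ∷_) (trans
        (ascF-decomp (suc lo) d M b (trans eq (sym (+-suc d lo))) (strictInc-tail (suc lo) b si) (proj₂ (allB-head (inRange 1 M) (suc lo) b ir)) (AllGt-tail (suc lo) b si))
        (ascF-cong (suc lo) d λ y a _ → cong (_∨ χ b y) (sym (≡ᵇ-no (>⇒≢ a)))))
... | no ne rewrite ≡ᵇ-no {suc lo} {x} (λ h → ne (sym h)) | mem-low (suc lo) b (AllGt-tail x b si) lt =
        ascF-decomp (suc lo) d M (x ∷ b) (trans eq (sym (+-suc d lo))) si ir (≤∧≢⇒< lt (λ h → ne (sym h)) , AllGt-weaken b lt (AllGt-tail x b si))

asc-decomp : ∀ M b → strictInc b ≡ true → allB (inRange 1 M) b ≡ true → b ≡ asc M (χ b)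
asc-decomp M b si ir = trans (ascF-decomp 0 M M b (sym (+-identityʳ M)) si ir (pos-all b ir)) (asc≡ascF M (χ b))
  where
  pos-all : ∀ b → allB (inRange 1 M) b ≡ true → AllGt 0 b
  pos-all [] _ = tt
  pos-all (x ∷ b) q = let (a , r) = allB-head (inRange 1 M) x b q in ≤ᵇ-elim 1 x (proj₁ (∧-elim {1 ≤ᵇ x} a)) , pos-all b r

ascF-gt : ∀ lo d c → AllGt lo (ascF lo d c)
ascF-gt lo zero c = tt
ascF-gt lo (suc d) c with c (suc lo)
... | true = ≤-refl , AllGt-weaken _ (n≤1+n lo) (ascF-gt (suc lo) d c)
... | false = AllGt-weaken _ (n≤1+n lo) (ascF-gt (suc lo) d c)

ascF-strict : ∀ lo d c → strictInc (ascF lo d c) ≡ true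
ascF-strict lo zero c = refl
ascF-strict lo (suc d) c with c (suc lo)
... | true = strictInc-cons (suc lo) _ (ascF-gt (suc lo) d c) (ascF-strict (suc lo) d c)
... | false = ascF-strict (suc lo) d c

asc-strict : ∀ M c → strictInc (asc M c) ≡ true
asc-strict M c = trans (cong strictInc (sym (asc≡ascF M c))) (ascF-strict 0 M c)

allB-++ : ∀ {A : Set} (g : A → Bool) xs ys → allB g xs ≡ true → allB g ys ≡ true → allB g (xs ++ ys) ≡ true
allB-++ g [] ys _ q = q
allB-++ g (x ∷ xs) ys p q = let (a , b) = allB-head g x xs p in ∧-intro a (allB-++ g xs ys b q)

asc-range : ∀ M k c → k ≤ M → allB (inRange 1 M) (asc k c) ≡ true
asc-range M zero c le = refl
asc-range M (suc k) c le = allB-++ (inRange 1 M) (asc k c) _ (asc-range M k c (<⇒≤ le)) (last (c (suc k)))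
  where
  last : ∀ b → allB (inRange 1 M) (opt b (suc k)) ≡ true
  last true = ∧-intro (<ᵇ-yes {k} le) refl
  last false = refl

cn : ℕ → Bits → ℕ
cn zero    c = 0
cn (suc k) c = b2n (c (suc k)) + cn k c

length-asc : ∀ M c → length (asc M c) ≡ cn M c
length-asc zero c = refl
length-asc (suc k) c = trans (length-++ (asc k c)) (trans (cong₂ _+_ (length-asc k c) (one (c (suc k)))) (+-comm (cn k c) _))
  where
  one : ∀ b → length (opt b (suc k)) ≡ b2n b
  one true = refl
  one false = refl

cn-cong : ∀ k {c d} → (∀ x → 1 ≤ x → x ≤ k → c x ≡ d x) → cn k c ≡ cn k d
cn-cong zero eq = refl
cn-cong (suc k) eq = cong₂ _+_ (cong b2n (eq (suc k) (s≤s z≤n) ≤-refl)) (cn-cong k λ x a b → eq x a (m≤n⇒m≤1+n b))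

cn-first : ∀ k c → cn (suc k) c ≡ b2n (c 1) + cn k (λ x → c (suc x))
cn-first zero c = refl
cn-first (suc k) c = trans (cong (b2n (c (suc (suc k))) +_) (cn-first k c)) (trans (sym (+-assoc (b2n (c (suc (suc k)))) (b2n (c 1)) _))
  (trans (cong (_+ cn k (λ x → c (suc x))) (+-comm (b2n (c (suc (suc k)))) (b2n (c 1)))) (+-assoc (b2n (c 1)) (b2n (c (suc (suc k)))) _)))

cn-sw-suc : ∀ i d c → cn (d + suc (suc i)) (sw (suc i) (suc (suc i)) c) ≡ cn (d + suc (suc i)) c
cn-sw-suc i zero c rewrite sw-q (suc i) (suc (suc i)) c | sw-p (suc i) (suc (suc i)) c
  | cn-cong i {sw (suc i) (suc (suc i)) c} {c} (λ x _ b → sw-other (suc i) (suc (suc i)) c x (<⇒≢ (s≤s b)) (<⇒≢ (s≤s (m≤n⇒m≤1+n b)))) =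
  trans (sym (+-assoc (b2n (c (suc i))) _ _)) (trans (cong (_+ cn i c) (+-comm (b2n (c (suc i))) _)) (+-assoc (b2n (c (suc (suc i)))) _ _))
cn-sw-suc i (suc d) c = cong₂ _+_ (cong b2n (sw-other (suc i) (suc (suc i)) c (suc (d + suc (suc i)))
  (>⇒≢ (s≤s (≤-trans (n≤1+n _) (m≤n+m _ d)))) (>⇒≢ (s≤s (m≤n+m _ d))))) (cn-sw-suc i d c)

cn-sw-0 : ∀ k c → let M = suc (suc k) in cn M (sw M 1 c) ≡ cn M c
cn-sw-0 k c = begin
  b2n (d M) + cn (suc k) d                       ≡⟨ cong₂ _+_ (cong b2n (sw-p M 1 c)) (cn-first k d) ⟩
  b2n (c 1) + (b2n (d 1) + cn k (λ x → d (suc x))) ≡⟨ cong (λ h → b2n (c 1) + (b2n h + cn k (λ x → d (suc x)))) (sw-q M 1 c) ⟩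
  b2n (c 1) + (b2n (c M) + cn k (λ x → d (suc x)))
    ≡⟨ cong (λ h → b2n (c 1) + (b2n (c M) + h)) (cn-cong k λ x a b → sw-other M 1 c (suc x) (<⇒≢ (s≤s (s≤s b))) (>⇒≢ (s≤s a))) ⟩
  b2n (c 1) + (b2n (c M) + cn k (λ x → c (suc x))) ≡⟨ sym (+-assoc (b2n (c 1)) _ _) ⟩
  (b2n (c 1) + b2n (c M)) + cn k (λ x → c (suc x)) ≡⟨ cong (_+ cn k (λ x → c (suc x))) (+-comm (b2n (c 1)) _) ⟩
  (b2n (c M) + b2n (c 1)) + cn k (λ x → c (suc x)) ≡⟨ +-assoc (b2n (c M)) _ _ ⟩
  b2n (c M) + (b2n (c 1) + cn k (λ x → c (suc x))) ≡⟨ cong (b2n (c M) +_) (sym (cn-first k c)) ⟩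
  b2n (c M) + cn (suc k) c ∎
  where
  open ≡-Reasoning
  M = suc (suc k)
  d = sw M 1 c

cn-sw : ∀ {M p q} → Site M p q → ∀ c → cn M (sw p q c) ≡ cn M c
cn-sw {suc zero} (site (s≤s ()) _ _ _) c
cn-sw {suc (suc k)} {q = suc zero} (site (s≤s (s≤s _)) _ _ refl) c = cn-sw-0 k c
cn-sw {M} {q = suc (suc i)} (site _ _ le refl) c = subst (λ h → cn h (sw (suc i) (suc (suc i)) c) ≡ cn h c) (m∸n+n≡m le) (cn-sw-suc i (M ∸ suc (suc i)) c)

tensorE : ∀ A B {X Y : Set} (x x' : X) (y y' : Y) →
  (if φ₁ B <ᵇ ε₁ A then mapMaybe (λ a → a , y) (if 0 <ᵇ ε₁ A then just x' else nothing)
                   else mapMaybe (λ b → x , b) (if 0 <ᵇ ε₁ B then just y' else nothing))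
  ≡ (if 0 <ᵇ epW (A ∷ B ∷ []) then just ((if pos E (A ∷ B ∷ []) ≡ᵇ 0 then x' else x) , (if pos E (A ∷ B ∷ []) ≡ᵇ 1 then y' else y)) else nothing)
tensorE (false , false) (false , false) x x' y y' = refl
tensorE (false , false) (false , true)  x x' y y' = refl
tensorE (false , false) (true , false)  x x' y y' = refl
tensorE (false , false) (true , true)   x x' y y' = refl
tensorE (false , true)  (false , false) x x' y y' = refl
tensorE (false , true)  (false , true)  x x' y y' = refl
tensorE (false , true)  (true , false)  x x' y y' = refl
tensorE (false , true)  (true , true)   x x' y y' = refl
tensorE (true , false)  (false , false) x x' y y' = refl
tensorE (true , false)  (false , true)  x x' y y' = refl
tensorE (true , false)  (true , false)  x x' y y' = refl
tensorE (true , false)  (true , true)   x x' y y' = refl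
tensorE (true , true)   (false , false) x x' y y' = refl
tensorE (true , true)   (false , true)  x x' y y' = refl
tensorE (true , true)   (true , false)  x x' y y' = refl
tensorE (true , true)   (true , true)   x x' y y' = refl

SimpleSpec : Ops Column → ℕ → ℕ → ℕ → ℕ → Bits → Set
SimpleSpec O i M p q c = ColSpec O i M c (ε₁ (at p q c)) (φ₁ (at p q c)) (eBit (at p q c) (just (sw p q c)))

pair-spec : ∀ {O i M p q} ca cb → SimpleSpec O i M p q ca → SimpleSpec O i M p q cb → let w = at p q ca ∷ at p q cb ∷ [] in
  e (pairOps O O) i (asc M ca , asc M cb) ≡
  (if 0 <ᵇ epW w then just (asc M (swB (pos E w ≡ᵇ 0) p q ca) , asc M (swB (pos E w ≡ᵇ 1) p q cb)) else nothing)
pair-spec {M = M} {p} {q} ca cb (spec εa φa ea) (spec εb φb eb) rewrite εa | φb | ea | eb = begin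
  (if φ₁ B <ᵇ ε₁ A then mapMaybe (λ a → a , asc M cb) (mapMaybe (asc M) (eBit A (just (sw p q ca))))
                   else mapMaybe (λ b → asc M ca , b) (mapMaybe (asc M) (eBit B (just (sw p q cb)))))
    ≡⟨ cong₂ (λ g h → if φ₁ B <ᵇ ε₁ A then mapMaybe (λ a → a , asc M cb) g else mapMaybe (λ b → asc M ca , b) h)
         (mm (0 <ᵇ ε₁ A)) (mm (0 <ᵇ ε₁ B)) ⟩
  _ ≡⟨ tensorE A B (asc M ca) (asc M (sw p q ca)) (asc M cb) (asc M (sw p q cb)) ⟩
  _ ≡⟨ cong₂ (λ g h → if 0 <ᵇ epW (A ∷ B ∷ []) then just (g , h) else nothing) (ascB (pos E (A ∷ B ∷ []) ≡ᵇ 0) ca) (ascB (pos E (A ∷ B ∷ []) ≡ᵇ 1) cb) ⟩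
  _ ∎
  where
  open ≡-Reasoning
  A = at p q ca
  B = at p q cb
  mm : ∀ b {d} → mapMaybe (asc M) (if b then just d else nothing) ≡ (if b then just (asc M d) else nothing)
  mm true = refl
  mm false = refl
  ascB : ∀ b c → (if b then asc M (sw p q c) else asc M c) ≡ asc M (swB b p q c)
  ascB true c = refl
  ascB false c = refl

if-just : ∀ {A : Set} {b} {x y : A} → (if b then just x else nothing) ≡ just y → b ≡ true × x ≡ y
if-just {b = true} refl = refl , refl

sw-sw : ∀ {M p q} → Site M p q → ∀ c x → sw p q (sw p q c) x ≡ c x
sw-sw {M} {p} {q} s c x with x Data.Nat.≟ p | x Data.Nat.≟ q
... | yes refl | _ = trans (sw-p p q (sw p q c)) (sw-q p q c)
... | no _ | yes refl = trans (sw-q p q (sw p q c)) (sw-p p q c)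
... | no a | no b = trans (sw-other p q (sw p q c) x a b) (sw-other p q c x a b)

swB-swB : ∀ {M p q} → Site M p q → ∀ b c x → swB b p q (swB b p q c) x ≡ c x
swB-swB s true c x = sw-sw s c x
swB-swB s false c x = refl

cn-swB : ∀ {M p q} → Site M p q → ∀ b c → cn M (swB b p q c) ≡ cn M c
cn-swB s true c = cn-sw s c
cn-swB s false c = refl

swAt-2 : ∀ j A B → swIf (j ≡ᵇ 0) A ∷ swIf (j ≡ᵇ 1) B ∷ [] ≡ swAt j (A ∷ B ∷ [])
swAt-2 zero A B = refl
swAt-2 (suc zero) A B = refl
swAt-2 (suc (suc j)) A B = refl

word-2 : ∀ {M p q} → Site M p q → ∀ ca cb → let w = at p q ca ∷ at p q cb ∷ [] ; j = pos E w in 0 < epW w →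
  let w' = at p q (swB (j ≡ᵇ 0) p q ca) ∷ at p q (swB (j ≡ᵇ 1) p q cb) ∷ [] in pos F w' ≡ j × 0 < phW w'
word-2 {M} {p} {q} s ca cb en = subst (λ v → pos F v ≡ pos E w × 0 < phW v) eq
    (let (_ , b , c) = act-sig w en in c , subst (0 <_) (sym b) (s≤s z≤n))
  where
  w = at p q ca ∷ at p q cb ∷ []
  j = pos E w
  ne = SiteProps.p≢q s
  eq : act E w ≡ at p q (swB (j ≡ᵇ 0) p q ca) ∷ at p q (swB (j ≡ᵇ 1) p q cb) ∷ []
  eq = trans (act-swAt E w) (trans (sym (swAt-2 j (at p q ca) (at p q cb)))
    (cong₂ (λ g h → g ∷ h ∷ []) (sym (at-swB ne (j ≡ᵇ 0) ca)) (sym (at-swB ne (j ≡ᵇ 1) cb))))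

χ-asc : ∀ M c x → 1 ≤ x → x ≤ M → χ (asc M c) x ≡ c x
χ-asc M c x a b = mem-asc M c x a b

record IsCol (M r : ℕ) (b : Column) : Set where
  constructor isCol
  field
    list : b ≡ asc M (χ b)
    size : cn M (χ b) ≡ r

IsCol-asc : ∀ {M r} c → cn M c ≡ r → IsCol M r (asc M c)
IsCol-asc {M} c q = isCol (asc-cong M λ x a b → sym (χ-asc M c x a b)) (trans (cn-cong M (χ-asc M c)) q)

-- Which position of a pair e₀ acts upon, in terms of the test used by the energy function.
left-pos : ∀ A B → (φ₁ B <ᵇ ε₁ A) ≡ (pos E (A ∷ B ∷ []) ≡ᵇ 0)
left-pos A (false , false) with 0 <ᵇ ε₁ A
... | true = refl
... | false = refl
left-pos A (false , true) with 1 <ᵇ ε₁ A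
... | true = refl
... | false = refl
left-pos A (true , false) with 0 <ᵇ ε₁ A
... | true = refl
... | false = refl
left-pos A (true , true) with 0 <ᵇ ε₁ A
... | true = refl
... | false = refl

pos-bound : ∀ op w → 0 < stat op w → pos op w < length w
pos-bound E [] ()
pos-bound F [] ()
pos-bound op (c ∷ w) en with cond op (phW w) (ε₁ c) in q
... | true = s≤s z≤n
... | false = s≤s (pos-bound op w (enab-rest op c w en q))

Rule-flip : ∀ {m j j' k k'} → Rule F m j j' k k' → Rule E m j j' k' k
Rule-flip (ll b) = ll b
Rule-flip (rr b) = rr b
Rule-flip lr = lr
Rule-flip rl = rl
Rule-flip (out a b) = out a b

stat-eq : ∀ op {w w'} → epW w ≡ epW w' × phW w ≡ phW w' → stat op w ≡ stat op w'
stat-eq E (a , _) = a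
stat-eq F (_ , b) = b

-- Embedding type C into type A

bar-range : ∀ n z → 1 ≤ z → z ≤ 2 * n → 1 ≤ bar n z × bar n z ≤ 2 * n
bar-range n (suc z) _ le = m<n⇒0<n∸m le , m∸n≤m (2 * n) z

bar-bar : ∀ n z → z ≤ suc (2 * n) → bar n (bar n z) ≡ z
bar-bar n z le = m∸[m∸n]≡n le

bar-inj : ∀ n x y → x ≤ suc (2 * n) → y ≤ suc (2 * n) → bar n x ≡ bar n y → x ≡ y
bar-inj n x y a b eq = trans (sym (bar-bar n x a)) (trans (cong (bar n) eq) (bar-bar n y b))

bar-high : ∀ n z → z ≤ n → n < bar n z
bar-high n z le = begin
  suc n ≡⟨ sym (m+n∸n≡m (suc n) n) ⟩
  suc n + n ∸ n ≤⟨ ∸-monoʳ-≤ (suc n + n) le ⟩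
  suc n + n ∸ z ≡⟨ cong (λ h → suc (n + h) ∸ z) (sym (+-identityʳ n)) ⟩
  bar n z ∎
  where open ≤-Reasoning

bar-low : ∀ n z → n < z → bar n z ≤ n
bar-low n z lt = ≤-trans (∸-monoʳ-≤ (suc (2 * n)) lt) (≤-reflexive (trans (m+n∸m≡n n (n + 0)) (+-identityʳ n)))

star : ℕ → Bits → Bits
star n c x = not (c (bar n x))

glue : ℕ → Bits → Bits → Bits
glue n f g x = if x ≤ᵇ n then f x else g x

glue-low : ∀ n f g x → x ≤ n → glue n f g x ≡ f x
glue-low n f g x le rewrite ≤ᵇ-yes le = refl

glue-high : ∀ n f g x → n < x → glue n f g x ≡ g x
glue-high n f g x lt rewrite ≤ᵇ-no lt = refl

swB-at : ∀ b p q {c d : Bits} x → c p ≡ d p → c q ≡ d q → c x ≡ d x → swB b p q c x ≡ swB b p q d x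
swB-at false p q x a b r = r
swB-at true p q x a b r with x ≡ᵇ p | x ≡ᵇ q
... | true  | _     = b
... | false | true  = a
... | false | false = r

-- The two halves of a Kashiwara–Nakashima column c: β^L has letters l on 1 … n and those of c on the barred
-- letters; β^R has those of c on 1 … n and the barred letters z̄ with g z = false. The carry w counts the
-- pairs z, z̄ whose t is still to be found.
record Split (n : ℕ) (c l g : Bits) (w : ℕ → ℕ) : Set where
  constructor split
  field
    vert : ∀ z → 1 ≤ z → z ≤ n → V (w z) (star n c z) (c z) (l z) (g z) (w (pred z))
    top  : w n ≡ 0
    bot  : w 0 ≡ 0

data Emb : Set where
  LR RL : Emb

-- β^L ⊗ (β^R)* and (β^L)* ⊗ β^R, where c* = {x : x̄ ∉ c}.
emb₁ emb₂ : Emb → ℕ → Bits → Bits → Bits → Bits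
emb₁ LR n c l g = glue n l c
emb₁ RL n c l g = glue n (star n c) (star n l)
emb₂ LR n c l g = glue n g (star n c)
emb₂ RL n c l g = glue n c (star n g)

st² : Two → Two
st² (q , p) = not p , not q

ε-st : ∀ c → ε₁ (st² c) ≡ ε₁ c
ε-st (false , false) = refl
ε-st (false , true) = refl
ε-st (true , false) = refl
ε-st (true , true) = refl

φ-st : ∀ c → φ₁ (st² c) ≡ φ₁ c
φ-st (false , false) = refl
φ-st (false , true) = refl
φ-st (true , false) = refl
φ-st (true , true) = refl

st-st : ∀ x → st² (st² x) ≡ x
st-st (false , false) = refl
st-st (false , true) = refl
st-st (true , false) = refl
st-st (true , true) = refl

data _~_ : List Two → List Two → Set where
  []  : [] ~ []
  con : ∀ {c d w v} → ε₁ c ≡ ε₁ d → φ₁ c ≡ φ₁ d → w ~ v → (c ∷ w) ~ (d ∷ v)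

keep : ∀ {c w v} → w ~ v → (c ∷ w) ~ (c ∷ v)
keep s = con refl refl s

flipSig : ∀ {c w v} → w ~ v → (st² c ∷ w) ~ (c ∷ v)
flipSig {c} s = con (ε-st c) (φ-st c) s

~-sig : ∀ {w v} → w ~ v → epW w ≡ epW v × phW w ≡ phW v
~-sig [] = refl , refl
~-sig (con a b s) with ~-sig s
... | x , y = cong₂ _+_ x (cong₂ _∸_ a y) , cong₂ _+_ b (cong₂ _∸_ y a)

~-pos : ∀ op {w v} → w ~ v → pos op w ≡ pos op v
~-pos op [] = refl
~-pos op (con a b s) rewrite ~-pos op s | a | proj₂ (~-sig s) = refl

~-stat : ∀ op {w v} → w ~ v → stat op w ≡ stat op v
~-stat op s = stat-eq op (~-sig s)

rule-other : ∀ {op m j j' k k'} → Rule op m j j' k k' → ∀ i → i ≢ m → i ≢ suc m → (j ≡ᵇ i) ≡ (j' ≡ᵇ i)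
rule-other (ll _) i a b = refl
rule-other (rr _) i a b = refl
rule-other lr i a b = trans (≡ᵇ-no (λ h → a (sym h))) (sym (≡ᵇ-no (λ h → b (sym h))))
rule-other rl i a b = trans (≡ᵇ-no (λ h → b (sym h))) (sym (≡ᵇ-no (λ h → a (sym h))))
rule-other (out _ _) i a b = refl

Quad : Set
Quad = Bits × Bits × Bits × Bits

atQ : ℕ → ℕ → Quad → List Two
atQ p q (a , b , c , d) = at p q a ∷ at p q b ∷ at p q c ∷ at p q d ∷ []

flipQ : ℕ → ℕ → ℕ → Quad → Quad
flipQ j p q (a , b , c , d) = swB (j ≡ᵇ 0) p q a , swB (j ≡ᵇ 1) p q b , swB (j ≡ᵇ 2) p q c , swB (j ≡ᵇ 3) p q d

_≗[_]_ : Bits → ℕ → Bits → Set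
c ≗[ M ] d = ∀ x → 1 ≤ x → x ≤ M → c x ≡ d x

data EqQ (M : ℕ) : Quad → Quad → Set where
  eqQ : ∀ {a b c d a' b' c' d'} → a ≗[ M ] a' → b ≗[ M ] b' → c ≗[ M ] c' → d ≗[ M ] d' → EqQ M (a , b , c , d) (a' , b' , c' , d')

-- Whether the sites of e_i see a half of the embedding as bits of the column (C) or of its split (S).
data Ty : Set where
  C S : Ty

low high : Emb → Ty
low LR = S
low RL = C
high LR = C
high RL = S

site⁺ : ∀ {M i} → 1 ≤ i → suc i ≤ M → Site M i (suc i)
site⁺ {i = suc i} _ le = site-suc i le

-- The sites of e_i for 0 < i < n: (p , q) = (i , i+1) and, barred, (u , u+1) = (bar (i+1) , bar i).
module Inner (n i : ℕ) (1≤i : 1 ≤ i) (i<n : i < n) where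
  p = i
  q = suc i
  u = 2 * n ∸ i
  su = suc u
  M = 2 * n
  i≤M : i ≤ M
  i≤M = ≤-trans (<⇒≤ i<n) (m≤m+n n _)
  bar-p : bar n p ≡ su
  bar-p = bar-suc n i (<⇒≤ i<n)
  bar-u : bar n u ≡ q
  bar-u = bar-bar n q (s≤s i≤M)
  bar-su : bar n su ≡ p
  bar-su = trans (cong (bar n) (sym bar-p)) (bar-bar n p (m≤n⇒m≤1+n i≤M))
  n<u : n < u
  n<u = bar-high n q i<n
  su≤M : su ≤ M
  su≤M = subst (_≤ M) bar-p (proj₂ (bar-range n p 1≤i i≤M))
  site-low : Site M p q
  site-low = site⁺ 1≤i (≤-trans i<n (m≤m+n n _))
  site-high : Site M u su
  site-high = site⁺ (≤-<-trans z≤n n<u) su≤M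
  p≢q : p ≢ q
  p≢q = SiteProps.p≢q site-low
  u≢su : u ≢ su
  u≢su = SiteProps.p≢q site-high

  at-star-low : ∀ c → at p q (star n c) ≡ st² (at u su c)
  at-star-low c = cong (λ h → not (c u) , not (c h)) bar-p
  at-star-high : ∀ c → at u su (star n c) ≡ st² (at p q c)
  at-star-high c = cong₂ (λ h h' → not (c h) , not (c h')) bar-su bar-u
  at-glue-low : ∀ f g → at p q (glue n f g) ≡ at p q f
  at-glue-low f g = cong₂ _,_ (glue-low n f g q i<n) (glue-low n f g p (<⇒≤ i<n))
  at-glue-high : ∀ f g → at u su (glue n f g) ≡ at u su g
  at-glue-high f g = cong₂ _,_ (glue-high n f g su (<-trans n<u ≤-refl)) (glue-high n f g u n<u)

  star-sw-high : ∀ b c x → n < x → x ≤ M → star n (swB b p q c) x ≡ swB b u su (star n c) x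
  star-sw-high false c x _ _ = refl
  star-sw-high true c x lt le with x Data.Nat.≟ u | x Data.Nat.≟ su
  ... | yes refl | _ = trans (cong not (trans (cong (sw p q c) bar-u) (sw-q p q c))) (trans (cong (λ h → not (c h)) (sym bar-su)) (sym (sw-p u su (star n c))))
  ... | no _ | yes refl = trans (cong not (trans (cong (sw p q c) bar-su) (sw-p p q c))) (trans (cong (λ h → not (c h)) (sym bar-u)) (sym (sw-q u su (star n c))))
  ... | no a | no b = trans (cong not (sw-other p q c (bar n x) (λ h → b (bar-inj n x su (m≤n⇒m≤1+n le) (m≤n⇒m≤1+n su≤M) (trans h (sym bar-su))))
        (λ h → a (bar-inj n x u (m≤n⇒m≤1+n le) (m≤n⇒m≤1+n (<⇒≤ su≤M)) (trans h (sym bar-u))))))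
        (sym (sw-other u su (star n c) x a b))

  star-sw-low : ∀ b c x → x ≤ n → star n (swB b u su c) x ≡ swB b p q (star n c) x
  star-sw-low false c x _ = refl
  star-sw-low true c x le with x Data.Nat.≟ p | x Data.Nat.≟ q
  ... | yes refl | _ = trans (cong not (trans (cong (sw u su c) bar-p) (sw-q u su c))) (sym (sw-p p q (star n c)))
  ... | no _ | yes refl = trans (cong not (sw-p u su c)) (trans (cong (λ h → not (c h)) (sym bar-p)) (sym (sw-q p q (star n c))))
  ... | no a | no b = trans (cong not (sw-other u su c (bar n x) (λ h → b (bar-inj n x q x≤ (s≤s i≤M) h))
        (λ h → a (bar-inj n x p x≤ (m≤n⇒m≤1+n i≤M) (trans h (sym bar-p))))))
        (sym (sw-other p q (star n c) x a b))
    where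
    x≤ : x ≤ suc M
    x≤ = m≤n⇒m≤1+n (≤-trans le (m≤m+n n _))

  glue-flip : ∀ b b' f g f' g' → (∀ x → 1 ≤ x → x ≤ n → f' x ≡ swB b p q f x) → (∀ x → n < x → x ≤ M → g' x ≡ swB b' u su g x)
    → glue n f' g' ≗[ M ] swB b' u su (swB b p q (glue n f g))
  glue-flip b b' f g f' g' hf hg x 1≤x x≤M with <-≤-connex n x
  ... | inj₂ le = trans (glue-low n f' g' x le) (trans (hf x 1≤x le) (trans
        (swB-at b p q x (sym (glue-low n f g p (<⇒≤ i<n))) (sym (glue-low n f g q i<n)) (sym (glue-low n f g x le)))
        (sym (swB-other b' u su (swB b p q (glue n f g)) x (<⇒≢ (≤-<-trans le n<u)) (<⇒≢ (≤-<-trans le (<-trans n<u ≤-refl)))))))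
  ... | inj₁ lt = trans (glue-high n f' g' x lt) (trans (hg x lt x≤M) (swB-at b' u su x (hi u n<u) (hi su (<-trans n<u ≤-refl)) (hi x lt)))
    where
    hi : ∀ y → n < y → g y ≡ swB b p q (glue n f g) y
    hi y lt = sym (trans (swB-other b p q (glue n f g) y (>⇒≢ (<-trans i<n lt)) (>⇒≢ (≤-<-trans i<n lt))) (glue-high n f g y lt))

  -- Column c' arises from c by moving a letter between u and su (if b₁) or between p and q (if b₂).
  module Moved (b₁ b₂ : Bool) (c c' : Bits) (h : c' ≗[ M ] swB b₁ u su (swB b₂ p q c)) where
    n≤M : n ≤ M
    n≤M = m≤m+n n _
    lowC : ∀ x → 1 ≤ x → x ≤ n → c' x ≡ swB b₂ p q c x
    lowC x l le = trans (h x l (≤-trans le n≤M)) (swB-other b₁ u su (swB b₂ p q c) x (<⇒≢ (≤-<-trans le n<u)) (<⇒≢ (≤-<-trans le (<-trans n<u ≤-refl))))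
    unmoved : ∀ y → n < y → swB b₂ p q c y ≡ c y
    unmoved y lt = swB-other b₂ p q c y (>⇒≢ (<-trans i<n lt)) (>⇒≢ (≤-<-trans i<n lt))
    highC : ∀ x → n < x → x ≤ M → c' x ≡ swB b₁ u su c x
    highC x lt le = trans (h x (≤-<-trans z≤n lt) le) (swB-at b₁ u su x (unmoved u n<u) (unmoved su (<-trans n<u ≤-refl)) (unmoved x lt))
    lowStar : ∀ x → 1 ≤ x → x ≤ n → star n c' x ≡ swB b₁ p q (star n c) x
    lowStar x l le = trans (cong not (highC (bar n x) (bar-high n x le) (proj₂ (bar-range n x l (≤-trans le n≤M))))) (star-sw-low b₁ c x le)
    highStar : ∀ x → n < x → x ≤ M → star n c' x ≡ swB b₂ u su (star n c) x
    highStar x lt le = trans (cong not (lowC (bar n x) (proj₁ (bar-range n x (≤-<-trans z≤n lt) le)) (bar-low n x lt))) (star-sw-high b₂ c x lt le)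

    newSplit : ∀ {l g w k} b₃ b₄ → Split n c l g w
      → LV (w q) k (w (pred p)) (swIf b₁ (at p q (star n c))) (swIf b₂ (at p q c)) (swIf b₃ (at p q l)) (swIf b₄ (at p q g))
      → Split n c' (swB b₃ p q l) (swB b₄ p q g) (upd p k w)
    newSplit {l} {g} {w} {k} b₃ b₄ (split vt tp bt) lv = split vt' (trans (upd-other p k w n (>⇒≢ i<n)) tp) (trans (upd-other p k w 0 (<⇒≢ 1≤i)) bt)
      where
      pred≢ : pred p ≢ p
      pred≢ = <⇒≢ (≤-reflexive (suc-pred p {{>-nonZero 1≤i}}))
      q≢p : q ≢ p
      q≢p h = p≢q (sym h)
      two : LV (upd p k w q) (upd p k w p) (upd p k w (pred p)) (at p q (swB b₁ p q (star n c))) (at p q (swB b₂ p q c)) (at p q (swB b₃ p q l)) (at p q (swB b₄ p q g))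
      two = LV-cong (sym (upd-other p k w q q≢p)) (sym (upd-at p k w)) (sym (upd-other p k w (pred p) pred≢))
        (sym (at-swB p≢q b₁ (star n c))) (sym (at-swB p≢q b₂ c)) (sym (at-swB p≢q b₃ l)) (sym (at-swB p≢q b₄ g)) lv
      vt' : ∀ z → 1 ≤ z → z ≤ n → V (upd p k w z) (star n c' z) (c' z) (swB b₃ p q l z) (swB b₄ p q g z) (upd p k w (pred z))
      vt' z l₁ le with z Data.Nat.≟ p | z Data.Nat.≟ q
      ... | yes refl | _ = V-cong refl (sym (lowStar p l₁ le)) (sym (lowC p l₁ le)) refl refl refl (proj₂ two)
      ... | no _ | yes refl = V-cong refl (sym (lowStar q l₁ le)) (sym (lowC q l₁ le)) refl refl refl (proj₁ two)
      ... | no a | no b = V-cong (sym (upd-other p k w z a))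
          (trans (sym (swB-other b₁ p q (star n c) z a b)) (sym (lowStar z l₁ le)))
          (trans (sym (swB-other b₂ p q c z a b)) (sym (lowC z l₁ le)))
          (sym (swB-other b₃ p q l z a b)) (sym (swB-other b₄ p q g z a b))
          (sym (upd-other p k w (pred z) λ e → b (trans (sym (suc-pred z {{>-nonZero l₁}})) (cong suc e)))) (vt z l₁ le)

    end₁ : ∀ φ {l g} (B₁ B₂ : Ty → Bool) → B₁ C ≡ b₁ → B₂ C ≡ b₂ →
      swB (B₁ (high φ)) u su (swB (B₁ (low φ)) p q (emb₁ φ n c l g)) ≗[ M ] emb₁ φ n c' (swB (B₁ S) p q l) (swB (B₂ S) p q g)
    end₁ LR {l} {g} B₁ B₂ refl refl x h₁ h₂ = sym (glue-flip (B₁ S) (B₁ C) l c (swB (B₁ S) p q l) c' (λ _ _ _ → refl) highC x h₁ h₂)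
    end₁ RL {l} {g} B₁ B₂ refl refl x h₁ h₂ = sym (glue-flip (B₁ C) (B₁ S) (star n c) (star n l) (star n c') (star n (swB (B₁ S) p q l))
      lowStar (λ x a b → star-sw-high (B₁ S) l x a b) x h₁ h₂)

    end₂ : ∀ φ {l g} (B₁ B₂ : Ty → Bool) → B₁ C ≡ b₁ → B₂ C ≡ b₂ →
      swB (B₂ (high φ)) u su (swB (B₂ (low φ)) p q (emb₂ φ n c l g)) ≗[ M ] emb₂ φ n c' (swB (B₁ S) p q l) (swB (B₂ S) p q g)
    end₂ LR {l} {g} B₁ B₂ refl refl x h₁ h₂ = sym (glue-flip (B₂ S) (B₂ C) g (star n c) (swB (B₂ S) p q g) (star n c') (λ _ _ _ → refl) highStar x h₁ h₂)
    end₂ RL {l} {g} B₁ B₂ refl refl x h₁ h₂ = sym (glue-flip (B₂ C) (B₂ S) c (star n g) c' (star n (swB (B₂ S) p q g)) lowC (λ x a b → star-sw-high (B₂ S) g x a b) x h₁ h₂)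

record Steps (op : Op) (M p q p' q' : ℕ) (G G' : Quad) : Set where
  G₁ = flipQ (pos op (atQ p q G)) p q G
  field
    en₁ : 0 < stat op (atQ p q G)
    en₂ : 0 < stat op (atQ p' q' G₁)
    end : EqQ M (flipQ (pos op (atQ p' q' G₁)) p' q' G₁) G'

record Spl (n : ℕ) (c : Bits) : Set where
  constructor spl
  field
    l g : Bits
    w : ℕ → ℕ
    isSplit : Split n c l g w

emq : Emb → Emb → ∀ n {a b} → Spl n a → Spl n b → Quad
emq φa φb n {a} {b} sa sb = emb₁ φa n a (Spl.l sa) (Spl.g sa) , emb₂ φa n a (Spl.l sa) (Spl.g sa) , emb₁ φb n b (Spl.l sb) (Spl.g sb) , emb₂ φb n b (Spl.l sb) (Spl.g sb)

module InnerStep (n i : ℕ) (1≤i : 1 ≤ i) (i<n : i < n) (op : Op) (a b a' b' : Bits) (sa : Spl n a) (sb : Spl n b) where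
  open Inner n i 1≤i i<n
  open Spl sa renaming (l to la; g to ga; w to wa; isSplit to spa)
  open Spl sb renaming (l to lb; g to gb; w to wb; isSplit to spb)

  CC : List Two
  CC = at u su a ∷ at p q a ∷ at u su b ∷ at p q b ∷ []
  j : ℕ
  j = pos op CC

  fst² snd² : Ty → Bits → Bits → Bits → Bits
  fst² C c l g = star n c
  fst² S c l g = l
  snd² C c l g = c
  snd² S c l g = g

  W : Ty → Ty → List Two
  W τ τ' = at p q (fst² τ a la ga) ∷ at p q (snd² τ a la ga) ∷ at p q (fst² τ' b lb gb) ∷ at p q (snd² τ' b lb gb) ∷ []
  J : Ty → Ty → ℕ
  J τ τ' = pos op (W τ τ')

  CC~ : W C C ~ CC
  CC~ rewrite at-star-low a | at-star-low b = flipSig (keep (flipSig (keep [])))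

  splitLV : ∀ {c l g w} → Split n c l g w → LV (w q) (w p) (w (pred p)) (at p q (star n c)) (at p q c) (at p q l) (at p q g)
  splitLV s = Split.vert s q (s≤s z≤n) i<n , Split.vert s p 1≤i (<⇒≤ i<n)

  lva = splitLV spa
  lvb = splitLV spb

  stats : ∀ τ τ' → stat op (W τ τ') ≡ stat op CC
  stats C C = ~-stat op CC~
  stats S C = trans (sym (stat-eq op {W C C} {W S C} (sigAdj {w = W C C} {w' = W S C} lva now))) (~-stat op CC~)
  stats C S = trans (sym (stat-eq op {W C C} {W C S} (sigAdj {w = W C C} {w' = W C S} lvb (skip (skip now))))) (~-stat op CC~)
  stats S S = trans (sym (stat-eq op {W C S} {W S S} (sigAdj {w = W C S} {w' = W S S} lva now)))
    (trans (sym (stat-eq op {W C C} {W C S} (sigAdj {w = W C C} {w' = W C S} lvb (skip (skip now))))) (~-stat op CC~))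

  module Enabled (en : 0 < stat op CC) (ha : a' ≗[ M ] swB (j ≡ᵇ 0) u su (swB (j ≡ᵇ 1) p q a)) (hb : b' ≗[ M ] swB (j ≡ᵇ 2) u su (swB (j ≡ᵇ 3) p q b)) where
    enW : ∀ τ τ' → 0 < stat op (W τ τ')
    enW τ τ' = subst (0 <_) (sym (stats τ τ')) en

    ra = move op lva (now {w = at p q (star n b) ∷ at p q b ∷ []}) (enW C C)
    rb = move op lvb (skip {c = at p q (star n a)} (skip {c = at p q a} (now {w = []}))) (enW C C)
    ra' = move op lva (now {w = at p q lb ∷ at p q gb ∷ []}) (enW C S)
    rb' = move op lvb (skip {c = at p q la} (skip {c = at p q ga} (now {w = []}))) (enW S C)

    J≡j : J C C ≡ j
    J≡j = ~-pos op CC~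

    mix₁ : ∀ τ τ' i → i ≢ 2 → i ≢ 3 → (J τ τ' ≡ᵇ i) ≡ (J τ C ≡ᵇ i)
    mix₁ τ C i _ _ = refl
    mix₁ C S i a b = sym (rule-other (Res.rule rb) i a b)
    mix₁ S S i a b = sym (rule-other (Res.rule rb') i a b)
    mix₂ : ∀ τ τ' i → i ≢ 0 → i ≢ 1 → (J τ τ' ≡ᵇ i) ≡ (J C τ' ≡ᵇ i)
    mix₂ C τ' i _ _ = refl
    mix₂ S C i a b = sym (rule-other (Res.rule ra) i a b)
    mix₂ S S i a b = sym (rule-other (Res.rule ra') i a b)

    module MA = Moved (j ≡ᵇ 0) (j ≡ᵇ 1) a a' ha
    module MB = Moved (j ≡ᵇ 2) (j ≡ᵇ 3) b b' hb

    B : ℕ → Ty → Bool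
    B k τ = J τ C ≡ᵇ k
    B' : ℕ → Ty → Bool
    B' k τ = J C τ ≡ᵇ k
    BC : ∀ k → B k C ≡ (j ≡ᵇ k)
    BC k = cong (_≡ᵇ k) J≡j

    sa' : Spl n a'
    sa' = spl (swB (B 0 S) p q la) (swB (B 1 S) p q ga) (upd p (Res.k1' ra) wa)
      (MA.newSplit (B 0 S) (B 1 S) spa (subst₂ (λ x y → LV (wa q) (Res.k1' ra) (wa (pred p)) (swIf x (at p q (star n a))) (swIf y (at p q a)) (swIf (B 0 S) (at p q la)) (swIf (B 1 S) (at p q ga))) (BC 0) (BC 1) (Res.lv ra)))
    sb' : Spl n b'
    sb' = spl (swB (B' 2 S) p q lb) (swB (B' 3 S) p q gb) (upd p (Res.k1' rb) wb)
      (MB.newSplit (B' 2 S) (B' 3 S) spb (subst₂ (λ x y → LV (wb q) (Res.k1' rb) (wb (pred p)) (swIf x (at p q (star n b))) (swIf y (at p q b)) (swIf (B' 2 S) (at p q lb)) (swIf (B' 3 S) (at p q gb))) (BC 2) (BC 3) (Res.lv rb)))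

    at-low₁ : ∀ φ c l g → at p q (emb₁ φ n c l g) ≡ at p q (fst² (low φ) c l g)
    at-low₁ LR c l g = at-glue-low l c
    at-low₁ RL c l g = at-glue-low (star n c) (star n l)
    at-low₂ : ∀ φ c l g → at p q (emb₂ φ n c l g) ≡ at p q (snd² (low φ) c l g)
    at-low₂ LR c l g = at-glue-low g (star n c)
    at-low₂ RL c l g = at-glue-low c (star n g)
    at-high₁ : ∀ φ c l g → st² (at u su (emb₁ φ n c l g)) ≡ at p q (fst² (high φ) c l g)
    at-high₁ LR c l g = trans (cong st² (at-glue-high l c)) (sym (at-star-low c))
    at-high₁ RL c l g = trans (cong st² (trans (at-glue-high (star n c) (star n l)) (at-star-high l))) (st-st (at p q l))
    at-high₂ : ∀ φ c l g → st² (at u su (emb₂ φ n c l g)) ≡ at p q (snd² (high φ) c l g)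
    at-high₂ LR c l g = trans (cong st² (trans (at-glue-high g (star n c)) (at-star-high c))) (st-st (at p q c))
    at-high₂ RL c l g = trans (cong st² (trans (at-glue-high c (star n g)) (at-star-high g))) (st-st (at p q g))

    ∷⁴ : ∀ {a b c d a' b' c' d' : Two} → a ≡ a' → b ≡ b' → c ≡ c' → d ≡ d' → _≡_ {A = List Two} (a ∷ b ∷ c ∷ d ∷ []) (a' ∷ b' ∷ c' ∷ d' ∷ [])
    ∷⁴ refl refl refl refl = refl

    steps : ∀ φa φb → Steps op M p q u su (emq φa φb n sa sb) (emq φa φb n sa' sb')
    steps φa φb = record
      { en₁ = subst (λ w → 0 < stat op w) (sym lowW) (enW (low φa) (low φb))
      ; en₂ = subst (0 <_) (trans (~-stat op highW) (cong (stat op) (sym disj))) (enW (high φa) (high φb))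
      ; end = eqQ (comp 0 ((λ ()) , λ ()) (MA.end₁ φa {la} {ga} (B 0) (B 1) (BC 0) (BC 1))) (comp 1 ((λ ()) , λ ()) (MA.end₂ φa {la} {ga} (B 0) (B 1) (BC 0) (BC 1)))
          (comp' 2 ((λ ()) , λ ()) (MB.end₁ φb {lb} {gb} (B' 2) (B' 3) (BC 2) (BC 3))) (comp' 3 ((λ ()) , λ ()) (MB.end₂ φb {lb} {gb} (B' 2) (B' 3) (BC 2) (BC 3))) }
      where
      G = emq φa φb n sa sb
      jA = pos op (atQ p q G)
      lowW : atQ p q G ≡ W (low φa) (low φb)
      lowW = ∷⁴ (at-low₁ φa a la ga) (at-low₂ φa a la ga) (at-low₁ φb b lb gb) (at-low₂ φb b lb gb)
      disj : atQ u su (flipQ jA p q G) ≡ atQ u su G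
      disj = ∷⁴ (d (jA ≡ᵇ 0) _) (d (jA ≡ᵇ 1) _) (d (jA ≡ᵇ 2) _) (d (jA ≡ᵇ 3) _)
        where
        d : ∀ x f → at u su (swB x p q f) ≡ at u su f
        d x f = cong₂ _,_ (swB-other x p q f su (>⇒≢ (<-trans i<n (<-trans n<u ≤-refl))) (>⇒≢ (≤-<-trans i<n (<-trans n<u ≤-refl))))
                          (swB-other x p q f u (>⇒≢ (<-trans i<n n<u)) (>⇒≢ (≤-<-trans i<n n<u)))
      jB = pos op (atQ u su (flipQ jA p q G))
      highW : W (high φa) (high φb) ~ atQ u su G
      highW = subst (_~ atQ u su G) (∷⁴ (at-high₁ φa a la ga) (at-high₂ φa a la ga) (at-high₁ φb b lb gb) (at-high₂ φb b lb gb))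
        (flipSig (flipSig (flipSig (flipSig []))))
      jA≡ : jA ≡ J (low φa) (low φb)
      jA≡ = cong (pos op) lowW
      jB≡ : jB ≡ J (high φa) (high φb)
      jB≡ = trans (cong (pos op) disj) (sym (~-pos op highW))
      comp : ∀ k {f f'} → k ≢ 2 × k ≢ 3 → swB (B k (high φa)) u su (swB (B k (low φa)) p q f) ≗[ M ] f' → swB (jB ≡ᵇ k) u su (swB (jA ≡ᵇ k) p q f) ≗[ M ] f'
      comp k {f} {f'} (k2 , k3) h = subst₂ (λ x y → swB x u su (swB y p q f) ≗[ M ] f')
        (sym (trans (cong (_≡ᵇ k) jB≡) (mix₁ (high φa) (high φb) k k2 k3))) (sym (trans (cong (_≡ᵇ k) jA≡) (mix₁ (low φa) (low φb) k k2 k3))) h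
      comp' : ∀ k {f f'} → k ≢ 0 × k ≢ 1 → swB (B' k (high φb)) u su (swB (B' k (low φb)) p q f) ≗[ M ] f' → swB (jB ≡ᵇ k) u su (swB (jA ≡ᵇ k) p q f) ≗[ M ] f'
      comp' k {f} {f'} (k2 , k3) h = subst₂ (λ x y → swB x u su (swB y p q f) ≗[ M ] f')
        (sym (trans (cong (_≡ᵇ k) jB≡) (mix₂ (high φa) (high φb) k k2 k3))) (sym (trans (cong (_≡ᵇ k) jA≡) (mix₂ (low φa) (low φb) k k2 k3))) h

-- A C-letter at the boundary sites (q , p) against the two letters of the embedding.
data Dbl : Two → Two → Two → Set where
  dm : Dbl (true , false) (true , false) (true , false)
  dp : Dbl (false , true) (false , true) (false , true)
  dz : ∀ {c A B} → ε₁ c ≡ 0 → φ₁ c ≡ 0 → epW (A ∷ B ∷ []) ≡ 0 → phW (A ∷ B ∷ []) ≡ 0 → Dbl c A B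

fstPos sndPos : Op → ℕ → ℕ
fstPos E zero    = 0
fstPos E (suc k) = 2
fstPos F zero    = 1
fstPos F (suc k) = 3
sndPos E zero    = 1
sndPos E (suc k) = 3
sndPos F zero    = 0
sndPos F (suc k) = 2

record DblSteps (op : Op) (k : ℕ) (w : List Two) : Set where
  constructor dbl
  field
    en₁  : 0 < stat op w
    pos₁ : pos op w ≡ fstPos op k
    en₂  : 0 < stat op (swAt (fstPos op k) w)
    pos₂ : pos op (swAt (fstPos op k) w) ≡ sndPos op k

pos-left : ∀ op u w → cond op (phW w) (epW u) ≡ true → pos op (u ++ w) ≡ pos op u
pos-left op u w q rewrite pos-++ op u w | q = refl

pos-right : ∀ op u w → cond op (phW w) (epW u) ≡ false → pos op (u ++ w) ≡ length u + pos op w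
pos-right op u w q rewrite pos-++ op u w | q = refl

0<stat : ∀ op u w → 0 < stat op u → cond op (phW w) (epW u) ≡ true → 0 < stat op (u ++ w)
0<stat E u w en c = subst (0 <_) (sym (epW-++ u w)) (≤-trans (m<n⇒0<n∸m (<ᵇ-elim (phW w) (epW u) c)) (m≤n+m _ (epW w)))
0<stat F u w en c = subst (0 <_) (sym (phW-++ u w)) (≤-trans en (m≤m+n _ _))

0<stat-right : ∀ op u w → 0 < stat op w → cond op (phW w) (epW u) ≡ false → 0 < stat op (u ++ w)
0<stat-right E u w en c = subst (0 <_) (sym (epW-++ u w)) (≤-trans en (m≤m+n _ _))
0<stat-right F u w en c = subst (0 <_) (sym (phW-++ u w)) (≤-trans (m<n⇒0<n∸m (≤ᵇ-elim-no (phW w) (epW u) c)) (m≤n+m _ (phW u)))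

dblSteps : ∀ op {cA A₁ A₂ cB B₁ B₂} → Dbl cA A₁ A₂ → Dbl cB B₁ B₂ → 0 < stat op (cA ∷ cB ∷ []) →
  DblSteps op (pos op (cA ∷ cB ∷ [])) (A₁ ∷ A₂ ∷ B₁ ∷ B₂ ∷ [])
dblSteps E dm dm _ = dbl (s≤s z≤n) refl (s≤s z≤n) refl
dblSteps E dm dp ()
dblSteps E {B₁ = B₁} {B₂} dm (dz ε0 φ0 e0 f0) _ rewrite ε0 | φ0 = dbl
  (0<stat E (m ∷ m ∷ []) w (s≤s z≤n) c₁) (pos-left E (m ∷ m ∷ []) w c₁) (0<stat E (p ∷ m ∷ []) w (s≤s z≤n) c₂) (pos-left E (p ∷ m ∷ []) w c₂)
  where
  w : List Two
  w = B₁ ∷ B₂ ∷ []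
  m p : Two
  m = true , false
  p = false , true
  c₁ : cond E (phW w) 2 ≡ true
  c₁ = cong (_<ᵇ 2) f0
  c₂ : cond E (phW w) 1 ≡ true
  c₂ = cong (_<ᵇ 1) f0
dblSteps E dp dm _ = dbl (s≤s z≤n) refl (s≤s z≤n) refl
dblSteps E dp dp ()
dblSteps E dp (dz ε0 φ0 e0 f0) en rewrite φ0 | ε0 = ⊥-elim (<⇒≱ en z≤n)
dblSteps E {A₁ = A₁} {A₂} (dz ε0 φ0 e0 f0) dm _ rewrite ε0 = dbl
  (0<stat-right E u (m ∷ m ∷ []) (s≤s z≤n) c) (pos-right E u (m ∷ m ∷ []) c) (0<stat-right E u (p ∷ m ∷ []) (s≤s z≤n) c₂) (pos-right E u (p ∷ m ∷ []) c₂)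
  where
  m p : Two
  m = true , false
  p = false , true
  u : List Two
  u = A₁ ∷ A₂ ∷ []
  c : cond E 0 (epW u) ≡ false
  c = cong (0 <ᵇ_) e0
  c₂ : cond E 1 (epW u) ≡ false
  c₂ = cong (1 <ᵇ_) e0
dblSteps E (dz ε0 φ0 e0 f0) dp en rewrite ε0 = ⊥-elim (<⇒≱ en z≤n)
dblSteps E (dz ε0 φ0 e0 f0) (dz ε0' φ0' e0' f0') en rewrite ε0 | ε0' | φ0' = ⊥-elim (<⇒≱ en z≤n)
dblSteps F dp dp _ = dbl (s≤s z≤n) refl (s≤s z≤n) refl
dblSteps F dp dm _ = dbl (s≤s z≤n) refl (s≤s z≤n) refl
dblSteps F {B₁ = B₁} {B₂} dp (dz ε0 φ0 e0 f0) _ rewrite ε0 | φ0 = dbl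
  (0<stat F (p ∷ p ∷ []) w (s≤s z≤n) c₁) (pos-left F (p ∷ p ∷ []) w c₁) (0<stat F (p ∷ m ∷ []) w (s≤s z≤n) c₂) (pos-left F (p ∷ m ∷ []) w c₂)
  where
  w : List Two
  w = B₁ ∷ B₂ ∷ []
  m p : Two
  m = true , false
  p = false , true
  c₁ : cond F (phW w) 0 ≡ true
  c₁ = cong (_≤ᵇ 0) f0
  c₂ : cond F (phW w) 1 ≡ true
  c₂ = cong (_≤ᵇ 1) f0
dblSteps F dm dp ()
dblSteps F dm dm ()
dblSteps F dm (dz ε0 φ0 e0 f0) en rewrite φ0 | ε0 = ⊥-elim (<⇒≱ en z≤n)
dblSteps F {A₁ = A₁} {A₂} (dz ε0 φ0 e0 f0) dp _ rewrite ε0 = dbl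
  (0<stat-right F u (p ∷ p ∷ []) (s≤s z≤n) c) (pos-right F u (p ∷ p ∷ []) c) (0<stat-right F u (p ∷ m ∷ []) (s≤s z≤n) c₂) (pos-right F u (p ∷ m ∷ []) c₂)
  where
  m p : Two
  m = true , false
  p = false , true
  u : List Two
  u = A₁ ∷ A₂ ∷ []
  c : cond F 2 (epW u) ≡ false
  c = cong (2 ≤ᵇ_) e0
  c₂ : cond F 1 (epW u) ≡ false
  c₂ = cong (1 ≤ᵇ_) e0
dblSteps F (dz ε0 φ0 e0 f0) dm en rewrite φ0 | ε0 = ⊥-elim (<⇒≱ en z≤n)
dblSteps F (dz ε0 φ0 e0 f0) (dz ε0' φ0' e0' f0') en rewrite ε0 | φ0 | φ0' | ε0' = ⊥-elim (<⇒≱ en z≤n)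

-- The sites of e_n and e_0; z is the unbarred one.
data Bd (n : ℕ) : ℕ → ℕ → ℕ → Set where
  bN : Bd n n (suc n) n
  b0 : Bd n (2 * n) 1 1

setB : Bool → ℕ → Bool → Bits → Bits
setB k z v l x = if k then (if x ≡ᵇ z then v else l x) else l x

setB-at : ∀ z v l → setB true z v l z ≡ v
setB-at z v l rewrite ≡ᵇ-yes {z} refl = refl

setB-other : ∀ k z v l x → x ≢ z → setB k z v l x ≡ l x
setB-other false z v l x ne = refl
setB-other true z v l x ne rewrite ≡ᵇ-no ne = refl

V-diag : ∀ {k} b → V k b b b b k
V-diag true = both
V-diag false = nn

V-diag⁻ : ∀ {k b l g k'} → V k b b l g k' → l ≡ b × g ≡ b × k ≡ k'
V-diag⁻ nn = refl , refl , refl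
V-diag⁻ both = refl , refl , refl

orient : ∀ {n p q z} → Bd n p q z → Two → Two
orient bN (x , y) = y , x
orient b0 (x , y) = x , y

bar-n : ∀ n → bar n n ≡ suc n
bar-n n = trans (bar-suc n n ≤-refl) (cong suc (trans (m+n∸m≡n n (n + 0)) (+-identityʳ n)))

Bd-range : ∀ {n p q z} → 1 ≤ n → Bd n p q z → 1 ≤ z × z ≤ n
Bd-range 1≤n bN = 1≤n , ≤-refl
Bd-range 1≤n b0 = ≤-refl , 1≤n

Bd-site : ∀ {n p q z} → 1 ≤ n → Bd n p q z → Site (2 * n) p q
Bd-site {n} 1≤n bd = go bd
  where
  sn≤M : suc n ≤ 2 * n
  sn≤M = ≤-trans (≤-reflexive (+-comm 1 n)) (+-monoʳ-≤ n (≤-trans 1≤n (≤-reflexive (sym (+-identityʳ n)))))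
  go : ∀ {p q z} → Bd n p q z → Site (2 * n) p q
  go bN = site⁺ 1≤n sn≤M
  go b0 = site-0 (≤-trans (s≤s 1≤n) sn≤M)

Bd-sw : ∀ {n p q z} → Bd n p q z → ∀ c → sw p q c z ≡ c (bar n z) × sw p q c (bar n z) ≡ c z
Bd-sw {n} bN c = trans (sw-p n (suc n) c) (cong c (sym (bar-n n))) , trans (cong (sw n (suc n) c) (bar-n n)) (sw-q n (suc n) c)
Bd-sw {n} b0 c = sw-q (2 * n) 1 c , sw-p (2 * n) 1 c

Bd-else : ∀ {n p q z} → Bd n p q z → ∀ b c x → x ≢ z → x ≢ bar n z → swB b p q c x ≡ c x
Bd-else {n} bN b c x a a' = swB-other b n (suc n) c x a (λ h → a' (trans h (sym (bar-n n))))
Bd-else {n} b0 b c x a a' = swB-other b (2 * n) 1 c x a' a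

Bd-at : ∀ {n p q z} (bd : Bd n p q z) → ∀ c → at p q c ≡ orient bd (c z , c (bar n z))
Bd-at {n} bN c = cong (λ h → c h , c n) (sym (bar-n n))
Bd-at b0 c = refl

Neutral : Two → Two → Set
Neutral A B = epW (A ∷ B ∷ []) ≡ 0 × phW (A ∷ B ∷ []) ≡ 0

-- Away from the single letters z, z̄ the two letters of the embedding cancel; one of the carries at z vanishes.
Bd-neutral : ∀ {n p q z} (bd : Bd n p q z) → 1 ≤ n → ∀ {c l g w v} → Split n c l g w → c z ≡ v → c (bar n z) ≡ v →
  Neutral (orient bd (l z , v)) (orient bd (g z , not v)) × Neutral (orient bd (not v , not (l z))) (orient bd (v , not (g z)))
Bd-neutral {n} bN 1≤n {c} {l} {g} {w} {v} (split vt tp bt) e e' =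
  go v (V-cong tp (cong not e') e refl refl refl (vt n 1≤n ≤-refl))
  where
  go : ∀ v {x y k} → V 0 (not v) v x y k → Neutral (v , x) (not v , y) × Neutral (not x , not v) (not y , v)
  go true pick = (refl , refl) , (refl , refl)
  go false stay = (refl , refl) , (refl , refl)
Bd-neutral {n} b0 1≤n {c} {l} {g} {w} {v} (split vt tp bt) e e' =
  go v (V-cong refl (cong not e') e refl refl bt (vt 1 ≤-refl 1≤n))
  where
  go : ∀ v {x y k} → V k (not v) v x y 0 → Neutral (x , v) (y , not v) × Neutral (not v , not x) (v , not y)
  go false drop = (refl , refl) , (refl , refl)
  go false stay = (refl , refl) , (refl , refl)
  go true ()

Bd-dbl : ∀ {n p q z} (bd : Bd n p q z) → Dbl (orient bd (true , false)) (orient bd (true , false)) (orient bd (true , false))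
Bd-dbl bN = dp
Bd-dbl b0 = dm

Bd-dbl' : ∀ {n p q z} (bd : Bd n p q z) → Dbl (orient bd (false , true)) (orient bd (false , true)) (orient bd (false , true))
Bd-dbl' bN = dm
Bd-dbl' b0 = dp

Bd-zero : ∀ {n p q z} (bd : Bd n p q z) v → ε₁ (orient bd (v , v)) ≡ 0 × φ₁ (orient bd (v , v)) ≡ 0
Bd-zero bN true = refl , refl
Bd-zero bN false = refl , refl
Bd-zero b0 true = refl , refl
Bd-zero b0 false = refl , refl

module Boundary (n p q z : ℕ) (1≤n : 1 ≤ n) (bd : Bd n p q z) where
  M z̄ : ℕ
  M = 2 * n
  z̄ = bar n z

  1≤z : 1 ≤ z
  1≤z = proj₁ (Bd-range 1≤n bd)
  z≤n' : z ≤ n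
  z≤n' = proj₂ (Bd-range 1≤n bd)
  n<z̄ : n < z̄
  n<z̄ = bar-high n z z≤n'
  z≤M : z ≤ M
  z≤M = ≤-trans z≤n' (m≤m+n n _)
  bar-z̄ : bar n z̄ ≡ z
  bar-z̄ = bar-bar n z (m≤n⇒m≤1+n z≤M)

  embAt₁ embAt₂ : Emb → Bits → Bits → Bits → Two
  embAt₁ LR c l g = l z , c z̄
  embAt₁ RL c l g = not (c z̄) , not (l z)
  embAt₂ LR c l g = g z , not (c z)
  embAt₂ RL c l g = c z , not (g z)

  emb₁-at : ∀ φ c l g → emb₁ φ n c l g z ≡ proj₁ (embAt₁ φ c l g) × emb₁ φ n c l g z̄ ≡ proj₂ (embAt₁ φ c l g)
  emb₁-at LR c l g = glue-low n l c z z≤n' , glue-high n l c z̄ n<z̄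
  emb₁-at RL c l g = glue-low n (star n c) (star n l) z z≤n' , trans (glue-high n (star n c) (star n l) z̄ n<z̄) (cong (λ h → not (l h)) bar-z̄)
  emb₂-at : ∀ φ c l g → emb₂ φ n c l g z ≡ proj₁ (embAt₂ φ c l g) × emb₂ φ n c l g z̄ ≡ proj₂ (embAt₂ φ c l g)
  emb₂-at LR c l g = glue-low n g (star n c) z z≤n' , trans (glue-high n g (star n c) z̄ n<z̄) (cong (λ h → not (c h)) bar-z̄)
  emb₂-at RL c l g = glue-low n c (star n g) z z≤n' , trans (glue-high n c (star n g) z̄ n<z̄) (cong (λ h → not (g h)) bar-z̄)

  diag-lg : ∀ {c l g w} → Split n c l g w → c z̄ ≡ not (c z) → l z ≡ c z × g z ≡ c z × w z ≡ w (pred z)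
  diag-lg {c} s e = V-diag⁻ (V-cong refl (trans (cong not e) (not-not (c z))) refl refl refl refl (Split.vert s z 1≤z z≤n'))
    where
    not-not : ∀ b → not (not b) ≡ b
    not-not true = refl
    not-not false = refl

  -- On a column containing exactly one of z, z̄ both halves of the embedding agree with it at these letters.
  diag₁ : ∀ φ {c l g w} → Split n c l g w → c z̄ ≡ not (c z) → emb₁ φ n c l g z ≡ c z × emb₁ φ n c l g z̄ ≡ c z̄
  diag₁ LR {c} {l} {g} s e = trans (proj₁ (emb₁-at LR c l g)) (proj₁ (diag-lg s e)) , proj₂ (emb₁-at LR c l g)
  diag₁ RL {c} {l} {g} s e = trans (proj₁ (emb₁-at RL c l g)) (trans (cong not e) (nn² (c z))) ,
      trans (proj₂ (emb₁-at RL c l g)) (trans (cong not (proj₁ (diag-lg s e))) (sym e))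
    where
    nn² : ∀ b → not (not b) ≡ b
    nn² true = refl
    nn² false = refl
  diag₂ : ∀ φ {c l g w} → Split n c l g w → c z̄ ≡ not (c z) → emb₂ φ n c l g z ≡ c z × emb₂ φ n c l g z̄ ≡ c z̄
  diag₂ LR {c} {l} {g} s e = trans (proj₁ (emb₂-at LR c l g)) (proj₁ (proj₂ (diag-lg s e))) , trans (proj₂ (emb₂-at LR c l g)) (sym e)
  diag₂ RL {c} {l} {g} s e = proj₁ (emb₂-at RL c l g) , trans (proj₂ (emb₂-at RL c l g)) (trans (cong not (proj₁ (proj₂ (diag-lg s e)))) (sym e))

  neutralAt₂ : ∀ φ {c l g w} → Split n c l g w → c z̄ ≡ c z → Neutral (orient bd (embAt₁ φ c l g)) (orient bd (embAt₂ φ c l g))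
  neutralAt₂ LR {c} {l} {g} s e = subst (λ h → Neutral (orient bd (l z , h)) (orient bd (g z , not (c z)))) (sym e) (proj₁ (Bd-neutral bd 1≤n s refl e))
  neutralAt₂ RL {c} {l} {g} s e = subst (λ h → Neutral (orient bd (not h , not (l z))) (orient bd (c z , not (g z)))) (sym e) (proj₂ (Bd-neutral bd 1≤n s refl e))

  dblAt : ∀ φ {c l g w} → Split n c l g w → Dbl (at p q c) (at p q (emb₁ φ n c l g)) (at p q (emb₂ φ n c l g))
  dblAt φ {c} {l} {g} s = subst₂ (λ A (B : Two × Two) → Dbl A (proj₁ B) (proj₂ B)) (sym (Bd-at bd c))
      (cong₂ _,_ (sym (trans (Bd-at bd (emb₁ φ n c l g)) refl)) (sym (Bd-at bd (emb₂ φ n c l g)))) (go (c z) (c z̄) refl refl)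
    where
    neutral : ∀ φ → c z̄ ≡ c z → Dbl (orient bd (c z , c z̄)) (orient bd (emb₁ φ n c l g z , emb₁ φ n c l g z̄)) (orient bd (emb₂ φ n c l g z , emb₂ φ n c l g z̄))
    neutral φ e = let (a , a') = emb₁-at φ c l g ; (d , d') = emb₂-at φ c l g ; (x , y) = neutralAt₂ φ s e ; (ε0 , φ0) = Bd-zero bd (c z) in
      subst₂ (λ A B → Dbl (orient bd (c z , c z̄)) (orient bd A) (orient bd B)) (sym (cong₂ _,_ a a')) (sym (cong₂ _,_ d d'))
        (subst (λ h → Dbl (orient bd (c z , h)) (orient bd (embAt₁ φ c l g)) (orient bd (embAt₂ φ c l g))) (sym e) (dz ε0 φ0 x y))
    go : ∀ x y → c z ≡ x → c z̄ ≡ y → Dbl (orient bd (c z , c z̄)) (orient bd (emb₁ φ n c l g z , emb₁ φ n c l g z̄)) (orient bd (emb₂ φ n c l g z , emb₂ φ n c l g z̄))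
    go true false e e' = let h = trans e' (cong not (sym e)) ; (a , a') = diag₁ φ s h ; (d , d') = diag₂ φ s h in
      subst₂ (λ A B → Dbl (orient bd (c z , c z̄)) (orient bd A) (orient bd B)) (sym (cong₂ _,_ a a')) (sym (cong₂ _,_ d d'))
        (subst (λ A → Dbl (orient bd A) (orient bd A) (orient bd A)) (sym (cong₂ _,_ e e')) (Bd-dbl bd))
    go false true e e' = let h = trans e' (cong not (sym e)) ; (a , a') = diag₁ φ s h ; (d , d') = diag₂ φ s h in
      subst₂ (λ A B → Dbl (orient bd (c z , c z̄)) (orient bd A) (orient bd B)) (sym (cong₂ _,_ a a')) (sym (cong₂ _,_ d d'))
        (subst (λ A → Dbl (orient bd A) (orient bd A) (orient bd A)) (sym (cong₂ _,_ e e')) (Bd-dbl' bd))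
    go true true e e' = neutral φ (trans e' (sym e))
    go false false e e' = neutral φ (trans e' (sym e))

acted : ∀ op c w → 0 < stat op (c ∷ w) → cond op (phW w) (ε₁ c) ≡ true → proj₂ c ≡ not (proj₁ c)
acted E c w en h with ε₁-pos c (≤-<-trans z≤n (<ᵇ-elim (phW w) (ε₁ c) h))
... | refl = refl
acted F (true , true) w en h = ⊥-elim (<⇒≱ en (≤-reflexive (m≤n⇒m∸n≡0 (≤ᵇ-elim (phW w) 0 h))))
acted F (false , false) w en h = ⊥-elim (<⇒≱ en (≤-reflexive (m≤n⇒m∸n≡0 (≤ᵇ-elim (phW w) 0 h))))
acted F (true , false) w en h = refl
acted F (false , true) w en h = refl

acted₂ : ∀ op A B → 0 < stat op (A ∷ B ∷ []) → (pos op (A ∷ B ∷ []) ≡ᵇ 0) ≡ true × proj₂ A ≡ not (proj₁ A) × (pos op (A ∷ B ∷ []) ≡ᵇ 1) ≡ false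
  ⊎ (pos op (A ∷ B ∷ []) ≡ᵇ 0) ≡ false × proj₂ B ≡ not (proj₁ B) × (pos op (A ∷ B ∷ []) ≡ᵇ 1) ≡ true
acted₂ op A B en with cond op (phW (B ∷ [])) (ε₁ A) in h
... | true = inj₁ (refl , acted op A (B ∷ []) en h , refl)
... | false with enab-rest op A (B ∷ []) en h
...   | en' with cond op 0 (ε₁ B) in h'
...     | true = inj₂ (refl , acted op B [] en' h' , refl)
acted₂ E A B en | false | en' | false = ⊥-elim (<⇒≱ en' (<ᵇ-elim-no 0 (ε₁ B) h'))
acted₂ F A B en | false | en' | false with h'
... | ()

not-swap : ∀ {x y} → x ≡ not y → y ≡ not x
not-swap {y = true} refl = refl
not-swap {y = false} refl = refl

Bd-differ : ∀ {n p q z} → Bd n p q z → ∀ (c : Bits) → c p ≡ not (c q) → c (bar n z) ≡ not (c z)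
Bd-differ {n} bN c e = trans (cong c (bar-n n)) (not-swap e)
Bd-differ b0 c e = e

swAt-atQ : ∀ {p q} → p ≢ q → ∀ j G → atQ p q (flipQ j p q G) ≡ swAt j (atQ p q G)
swAt-atQ {p} {q} ne j (a , b , c , d) with at-swB ne (j ≡ᵇ 0) a | at-swB ne (j ≡ᵇ 1) b | at-swB ne (j ≡ᵇ 2) c | at-swB ne (j ≡ᵇ 3) d
... | e₀ | e₁ | e₂ | e₃ = trans (cong₂ _∷_ e₀ (cong₂ _∷_ e₁ (cong₂ _∷_ e₂ (cong₂ _∷_ e₃ refl)))) (go j)
  where
  go : ∀ j {A B C D} → _≡_ {A = List Two} (swIf (j ≡ᵇ 0) A ∷ swIf (j ≡ᵇ 1) B ∷ swIf (j ≡ᵇ 2) C ∷ swIf (j ≡ᵇ 3) D ∷ []) (swAt j (A ∷ B ∷ C ∷ D ∷ []))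
  go 0 = refl
  go 1 = refl
  go 2 = refl
  go 3 = refl
  go (suc (suc (suc (suc j)))) = refl

-- Exactly one of the two steps acts on the i-th half if its column is selected (k), and none otherwise.
One : Op → ℕ → ℕ → Bool → Set
One op j i k = (sndPos op j ≡ᵇ i) ≡ k × (fstPos op j ≡ᵇ i) ≡ false ⊎ (sndPos op j ≡ᵇ i) ≡ false × (fstPos op j ≡ᵇ i) ≡ k

one₀ : ∀ op {j} → j < 2 → One op j 0 (j ≡ᵇ 0)
one₀ E {zero} _ = inj₂ (refl , refl)
one₀ E {suc zero} _ = inj₁ (refl , refl)
one₀ F {zero} _ = inj₁ (refl , refl)
one₀ F {suc zero} _ = inj₁ (refl , refl)
one₀ op {suc (suc j)} (s≤s (s≤s ()))

one₁ : ∀ op {j} → j < 2 → One op j 1 (j ≡ᵇ 0)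
one₁ E {zero} _ = inj₁ (refl , refl)
one₁ E {suc zero} _ = inj₁ (refl , refl)
one₁ F {zero} _ = inj₂ (refl , refl)
one₁ F {suc zero} _ = inj₁ (refl , refl)
one₁ op {suc (suc j)} (s≤s (s≤s ()))

one₂ : ∀ op {j} → j < 2 → One op j 2 (j ≡ᵇ 1)
one₂ E {zero} _ = inj₁ (refl , refl)
one₂ E {suc zero} _ = inj₂ (refl , refl)
one₂ F {zero} _ = inj₁ (refl , refl)
one₂ F {suc zero} _ = inj₁ (refl , refl)
one₂ op {suc (suc j)} (s≤s (s≤s ()))

one₃ : ∀ op {j} → j < 2 → One op j 3 (j ≡ᵇ 1)
one₃ E {zero} _ = inj₁ (refl , refl)
one₃ E {suc zero} _ = inj₁ (refl , refl)
one₃ F {zero} _ = inj₁ (refl , refl)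
one₃ F {suc zero} _ = inj₂ (refl , refl)
one₃ op {suc (suc j)} (s≤s (s≤s ()))

module BoundaryStep (n p q z : ℕ) (1≤n : 1 ≤ n) (bd : Bd n p q z) (op : Op) (a b a' b' : Bits) (sa : Spl n a) (sb : Spl n b)
  (en : 0 < stat op (at p q a ∷ at p q b ∷ []))
  (ha : a' ≗[ 2 * n ] swB (pos op (at p q a ∷ at p q b ∷ []) ≡ᵇ 0) p q a)
  (hb : b' ≗[ 2 * n ] swB (pos op (at p q a ∷ at p q b ∷ []) ≡ᵇ 1) p q b) where
  open Boundary n p q z 1≤n bd
  site₀ = Bd-site 1≤n bd
  p≢q = SiteProps.p≢q site₀
  j : ℕ
  j = pos op (at p q a ∷ at p q b ∷ [])

  module Col (k : Bool) (c c' : Bits) (s : Spl n c) (h : c' ≗[ M ] swB k p q c) (differ : k ≡ true → c z̄ ≡ not (c z)) where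
    open Spl s
    1≤z̄ : 1 ≤ z̄
    1≤z̄ = ≤-<-trans z≤n n<z̄
    z̄≤M : z̄ ≤ M
    z̄≤M = proj₂ (bar-range n z 1≤z z≤M)
    l' g' : Bits
    l' = setB k z (c' z) l
    g' = setB k z (c' z) g
    else' : ∀ x → 1 ≤ x → x ≤ M → x ≢ z → x ≢ z̄ → c' x ≡ c x
    else' x a b ne ne' = trans (h x a b) (Bd-else bd k c x ne ne')
    bar≢ : ∀ x → 1 ≤ x → x ≤ M → x ≢ z → bar n x ≢ z̄
    bar≢ x _ b ne e = ne (bar-inj n x z (m≤n⇒m≤1+n b) (m≤n⇒m≤1+n z≤M) e)
    bar≢' : ∀ x → 1 ≤ x → x ≤ M → x ≢ z̄ → bar n x ≢ z
    bar≢' x _ b ne e = ne (bar-inj n x z̄ (m≤n⇒m≤1+n b) (m≤n⇒m≤1+n z̄≤M) (trans e (sym bar-z̄)))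
    elseStar : ∀ x → 1 ≤ x → x ≤ M → x ≢ z → x ≢ z̄ → star n c' x ≡ star n c x
    elseStar x a b ne ne' = let (u , v) = bar-range n x a b in cong not (else' (bar n x) u v (bar≢' x a b ne') (bar≢ x a b ne))
    c'z : k ≡ true → c' z ≡ c z̄ × c' z̄ ≡ c z
    c'z refl = trans (h z 1≤z z≤M) (proj₁ (Bd-sw bd c)) , trans (h z̄ 1≤z̄ z̄≤M) (proj₂ (Bd-sw bd c))
    differ' : k ≡ true → c' z̄ ≡ not (c' z)
    differ' e = let (x , y) = c'z e in trans y (trans (not-swap (differ e)) (cong not (sym x)))

    vert' : ∀ x → 1 ≤ x → x ≤ n → V (w x) (star n c' x) (c' x) (l' x) (g' x) (w (pred x))
    vert' x a b with x Data.Nat.≟ z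
    ... | no ne = V-cong refl (sym (elseStar x a x≤M ne ne')) (sym (else' x a x≤M ne ne')) (sym (setB-other k z (c' z) l x ne)) (sym (setB-other k z (c' z) g x ne)) refl (Split.vert isSplit x a b)
      where
      x≤M = ≤-trans b (m≤m+n n _)
      ne' : x ≢ z̄
      ne' = <⇒≢ (≤-<-trans b n<z̄)
    ... | yes refl = go k refl
      where
      go : ∀ k' → k ≡ k' → V (w z) (star n c' z) (c' z) (l' z) (g' z) (w (pred z))
      go true refl = V-cong refl (trans (not-swap (differ' refl)) refl) refl (sym (setB-at z (c' z) l)) (sym (setB-at z (c' z) g))
        (proj₂ (proj₂ (diag-lg isSplit (differ refl)))) (V-diag (c' z))
      go false refl = V-cong refl (cong not (sym (h z̄ 1≤z̄ z̄≤M))) (sym (h z 1≤z z≤M)) refl refl refl (Split.vert isSplit z 1≤z z≤n')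

    newSpl : Spl n c'
    newSpl = spl l' g' w (split vert' (Split.top isSplit) (Split.bot isSplit))

    else₁ : ∀ φ x → 1 ≤ x → x ≤ M → x ≢ z → x ≢ z̄ → emb₁ φ n c' l' g' x ≡ emb₁ φ n c l g x
    else₁ LR x a b ne ne' = cong₂ (λ y t → if x ≤ᵇ n then y else t) (setB-other k z (c' z) l x ne) (else' x a b ne ne')
    else₁ RL x a b ne ne' = cong₂ (λ y t → if x ≤ᵇ n then y else not t) (elseStar x a b ne ne') (setB-other k z (c' z) l (bar n x) (bar≢' x a b ne'))
    else₂ : ∀ φ x → 1 ≤ x → x ≤ M → x ≢ z → x ≢ z̄ → emb₂ φ n c' l' g' x ≡ emb₂ φ n c l g x
    else₂ LR x a b ne ne' = cong₂ (λ y t → if x ≤ᵇ n then y else t) (setB-other k z (c' z) g x ne) (elseStar x a b ne ne')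
    else₂ RL x a b ne ne' = cong₂ (λ y t → if x ≤ᵇ n then y else not t) (else' x a b ne ne') (setB-other k z (c' z) g (bar n x) (bar≢' x a b ne'))

    flipped : ∀ (f f' : Bits) → (∀ x → 1 ≤ x → x ≤ M → x ≢ z → x ≢ z̄ → f' x ≡ f x)
      → (k ≡ true → (f z ≡ c z × f z̄ ≡ c z̄) × (f' z ≡ c' z × f' z̄ ≡ c' z̄)) → (k ≡ false → f' ≗[ M ] f) → swB k p q f ≗[ M ] f'
    flipped f f' els dg same x a b = go k refl
      where
      go : ∀ k' → k ≡ k' → swB k p q f x ≡ f' x
      go false refl = sym (same refl x a b)
      go true refl with x Data.Nat.≟ z | x Data.Nat.≟ z̄ | dg refl | c'z refl
      ... | yes refl | _ | (fz , fz̄) , (f'z , f'z̄) | (cz , cz̄) = trans (proj₁ (Bd-sw bd f)) (trans fz̄ (trans (sym cz) (sym f'z)))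
      ... | no _ | yes refl | (fz , fz̄) , (f'z , f'z̄) | (cz , cz̄) = trans (proj₂ (Bd-sw bd f)) (trans fz (trans (sym cz̄) (sym f'z̄)))
      ... | no ne | no ne' | _ | _ = trans (Bd-else bd true f x ne ne') (sym (els x a b ne ne'))

    same' : k ≡ false → c' ≗[ M ] c
    same' refl = h
    sameStar : k ≡ false → star n c' ≗[ M ] star n c
    sameStar e x a b = let (u , v) = bar-range n x a b in cong not (same' e (bar n x) u v)
    sameL : ∀ v f → k ≡ false → ∀ x → setB k z v f x ≡ f x
    sameL v f refl x = refl

    end₁ : ∀ φ → swB k p q (emb₁ φ n c l g) ≗[ M ] emb₁ φ n c' l' g'
    end₁ φ = flipped _ _ (else₁ φ) (λ e → diag₁ φ isSplit (differ e) , diag₁ φ (Spl.isSplit newSpl) (differ' e)) (sm φ)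
      where
      sm : ∀ φ → k ≡ false → emb₁ φ n c' l' g' ≗[ M ] emb₁ φ n c l g
      sm LR e x a b = cong₂ (λ y t → if x ≤ᵇ n then y else t) (sameL (c' z) l e x) (same' e x a b)
      sm RL e x a b = cong₂ (λ y t → if x ≤ᵇ n then y else not t) (sameStar e x a b) (sameL (c' z) l e (bar n x))
    end₂ : ∀ φ → swB k p q (emb₂ φ n c l g) ≗[ M ] emb₂ φ n c' l' g'
    end₂ φ = flipped _ _ (else₂ φ) (λ e → diag₂ φ isSplit (differ e) , diag₂ φ (Spl.isSplit newSpl) (differ' e)) (sm φ)
      where
      sm : ∀ φ → k ≡ false → emb₂ φ n c' l' g' ≗[ M ] emb₂ φ n c l g
      sm LR e x a b = cong₂ (λ y t → if x ≤ᵇ n then y else t) (sameL (c' z) g e x) (sameStar e x a b)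
      sm RL e x a b = cong₂ (λ y t → if x ≤ᵇ n then y else not t) (same' e x a b) (sameL (c' z) g e (bar n x))

  which = acted₂ op (at p q a) (at p q b) en
  differA : (j ≡ᵇ 0) ≡ true → a z̄ ≡ not (a z)
  differA e with which
  ... | inj₁ (_ , d , _) = Bd-differ bd a d
  ... | inj₂ (x , _ , _) = ⊥-elim (true≢false e x)
  differB : (j ≡ᵇ 1) ≡ true → b z̄ ≡ not (b z)
  differB e with which
  ... | inj₁ (_ , _ , x) = ⊥-elim (true≢false e x)
  ... | inj₂ (_ , d , _) = Bd-differ bd b d

  module CA = Col (j ≡ᵇ 0) a a' sa ha differA
  module CB = Col (j ≡ᵇ 1) b b' sb hb differB
  sa' = CA.newSpl
  sb' = CB.newSpl

  j<2 : j < 2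
  j<2 = pos-bound op (at p q a ∷ at p q b ∷ []) en

  module At (φa φb : Emb) where
    G : Quad
    G = emq φa φb n sa sb
    module D = DblSteps (dblSteps op (dblAt φa (Spl.isSplit sa)) (dblAt φb (Spl.isSplit sb)) en)
    j₁ j₂ : ℕ
    j₁ = pos op (atQ p q G)
    j₂ = pos op (atQ p q (flipQ j₁ p q G))
    w₁ : atQ p q (flipQ j₁ p q G) ≡ swAt (fstPos op j) (atQ p q G)
    w₁ = trans (swAt-atQ p≢q j₁ G) (cong (λ h → swAt h (atQ p q G)) D.pos₁)
    j₁≡ : j₁ ≡ fstPos op j
    j₁≡ = D.pos₁
    j₂≡ : j₂ ≡ sndPos op j
    j₂≡ = trans (cong (pos op) w₁) D.pos₂
    two : ∀ i {k f f'} → One op j i k → swB k p q f ≗[ M ] f' → swB (j₂ ≡ᵇ i) p q (swB (j₁ ≡ᵇ i) p q f) ≗[ M ] f'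
    two i {k} {f} {f'} o h = subst₂ (λ x y → swB (x ≡ᵇ i) p q (swB (y ≡ᵇ i) p q f) ≗[ M ] f') (sym j₂≡) (sym j₁≡) (go o)
      where
      go : One op j i k → swB (sndPos op j ≡ᵇ i) p q (swB (fstPos op j ≡ᵇ i) p q f) ≗[ M ] f'
      go (inj₁ (x , y)) rewrite x | y = h
      go (inj₂ (x , y)) rewrite x | y = h
    steps : Steps op M p q p q G (emq φa φb n sa' sb')
    steps = record
      { en₁ = D.en₁
      ; en₂ = subst (0 <_) (cong (stat op) (sym w₁)) D.en₂
      ; end = eqQ (two 0 (one₀ op j<2) (CA.end₁ φa)) (two 1 (one₁ op j<2) (CA.end₂ φa)) (two 2 (one₂ op j<2) (CB.end₁ φb)) (two 3 (one₃ op j<2) (CB.end₂ φb)) }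

-- (L₁ ⊗ L₂) ⊗ (R₁ ⊗ R₂) ↦ (S₁ ⊗ S₂) ⊗ (K₁ ⊗ K₂): first R₁ passes L₂ and L₁ (with winding numbers u₁ M, u₂ M), then R₂.
-- The last two passes are recorded in the inverse direction.
data Chain (M : ℕ) : Quad → Quad → (ℕ → ℕ) → (ℕ → ℕ) → Set where
  chain : ∀ {L₁ L₂ R₁ R₂ S₁ S₂ K₁ K₂ T₁ T₂ L₁' L₂' u₁ u₂ u₃ u₄}
    → Pass M L₂ R₁ T₁ L₂' u₁ → Pass M L₁ T₁ S₁ L₁' u₂ → Pass M T₂ K₂ L₂' R₂ u₃ → Pass M S₂ K₁ L₁' T₂ u₄
    → Chain M (L₁ , L₂ , R₁ , R₂) (S₁ , S₂ , K₁ , K₂) u₁ u₂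

data Rules (op : Op) (j j' k₁ k₁' k₂ k₂' : ℕ) : Set where
  rules : ∀ {j₁ j₂ j₃} {k k' h h' : ℕ} → Rule op 1 j j₁ k₁ k₁' → Rule op 0 j₁ j₂ k₂ k₂' → Rule op 2 j₃ j₂ k k' → Rule op 1 j' j₃ h h' → Rules op j j' k₁ k₁' k₂ k₂'

chainMove : ∀ op {M p q G G' u₁ u₂} → Site M p q → Chain M G G' u₁ u₂ → 0 < stat op (atQ p q G) →
  ∃ λ u₁' → ∃ λ u₂' → Chain M (flipQ (pos op (atQ p q G)) p q G) (flipQ (pos op (atQ p q G')) p q G') u₁' u₂'
    × Rules op (pos op (atQ p q G)) (pos op (atQ p q G')) (u₁ p) (u₁' p) (u₂ p) (u₂' p)
    × (∀ a → a ≢ p → u₁' a ≡ u₁ a × u₂' a ≡ u₂ a)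
    × 0 < stat op (atQ p q G')
chainMove op {M} {p} {q} s (chain {L₁} {L₂} {R₁} {R₂} {S₁} {S₂} {K₁} {K₂} {T₁} {T₂} {L₁'} {L₂'} {u₁} {u₂} {u₃} {u₄} P₁ P₂ P₃ P₄) en =
  go (passMove op s P₁ A₁ en) (passMove op s P₂ A₂ en₁) (passMove op s P₃ A₃ en₃) (passMove op s P₄ A₄ en₄)
  where
  open SiteProps s
  W₀ W₁ W₂ W₃ W₄ : List Two
  W₀ = at p q L₁ ∷ at p q L₂ ∷ at p q R₁ ∷ at p q R₂ ∷ []
  W₁ = at p q L₁ ∷ at p q T₁ ∷ at p q L₂' ∷ at p q R₂ ∷ []
  W₂ = at p q S₁ ∷ at p q L₁' ∷ at p q L₂' ∷ at p q R₂ ∷ []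
  W₃ = at p q S₁ ∷ at p q L₁' ∷ at p q T₂ ∷ at p q K₂ ∷ []
  W₄ = at p q S₁ ∷ at p q S₂ ∷ at p q K₁ ∷ at p q K₂ ∷ []
  A₁ : Adj (at p q L₂) (at p q R₁) (at p q T₁) (at p q L₂') 1 W₀ W₁
  A₁ = skip now
  A₂ : Adj (at p q L₁) (at p q T₁) (at p q S₁) (at p q L₁') 0 W₁ W₂
  A₂ = now
  A₃ : Adj (at p q T₂) (at p q K₂) (at p q L₂') (at p q R₂) 2 W₃ W₂
  A₃ = skip (skip now)
  A₄ : Adj (at p q S₂) (at p q K₁) (at p q L₁') (at p q T₂) 1 W₄ W₃
  A₄ = skip now
  lvOf : ∀ {L R R' L' u} → Pass M L R R' L' u → LV (u q) (u p) (u (prd M p)) (at p q L) (at p q R) (at p q R') (at p q L')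
  lvOf {L} {R} {R'} {L'} {u} P = subst (λ h → V (u q) (L q) (R q) (R' q) (L' q) (u h)) (sym p≡) (Pass.vert P q 1≤q q≤M) , Pass.vert P p 1≤p p≤M
  en₁ : 0 < stat op W₁
  en₁ = subst (0 <_) (stat-eq op (sigAdj (lvOf P₁) A₁)) en
  en₂ : 0 < stat op W₂
  en₂ = subst (0 <_) (stat-eq op (sigAdj (lvOf P₂) A₂)) en₁
  en₃ : 0 < stat op W₃
  en₃ = subst (0 <_) (sym (stat-eq op (sigAdj (lvOf P₃) A₃))) en₂
  en₄ : 0 < stat op W₄
  en₄ = subst (0 <_) (sym (stat-eq op (sigAdj (lvOf P₄) A₄))) en₃
  j₀ j₁ j₂ j₃ j₄ : ℕ
  j₀ = pos op W₀
  j₁ = pos op W₁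
  j₂ = pos op W₂
  j₃ = pos op W₃
  j₄ = pos op W₄
  same : ∀ {b b'} (c : Bits) → b ≡ b' → ∀ x → 1 ≤ x → x ≤ M → swB b p q c x ≡ swB b' p q c x
  same c refl x _ _ = refl
  idd : ∀ (c : Bits) → c ≗[ M ] c
  idd c x _ _ = refl
  go : (∃ λ u → Pass M (swB (j₀ ≡ᵇ 1) p q L₂) (swB (j₀ ≡ᵇ 2) p q R₁) (swB (j₁ ≡ᵇ 1) p q T₁) (swB (j₁ ≡ᵇ 2) p q L₂') u × Rule op 1 j₀ j₁ (u₁ p) (u p) × (∀ a → a ≢ p → u a ≡ u₁ a))
     → (∃ λ u → Pass M (swB (j₁ ≡ᵇ 0) p q L₁) (swB (j₁ ≡ᵇ 1) p q T₁) (swB (j₂ ≡ᵇ 0) p q S₁) (swB (j₂ ≡ᵇ 1) p q L₁') u × Rule op 0 j₁ j₂ (u₂ p) (u p) × (∀ a → a ≢ p → u a ≡ u₂ a))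
     → (∃ λ u → Pass M (swB (j₃ ≡ᵇ 2) p q T₂) (swB (j₃ ≡ᵇ 3) p q K₂) (swB (j₂ ≡ᵇ 2) p q L₂') (swB (j₂ ≡ᵇ 3) p q R₂) u × Rule op 2 j₃ j₂ (u₃ p) (u p) × (∀ a → a ≢ p → u a ≡ u₃ a))
     → (∃ λ u → Pass M (swB (j₄ ≡ᵇ 1) p q S₂) (swB (j₄ ≡ᵇ 2) p q K₁) (swB (j₃ ≡ᵇ 1) p q L₁') (swB (j₃ ≡ᵇ 2) p q T₂) u × Rule op 1 j₄ j₃ (u₄ p) (u p) × (∀ a → a ≢ p → u a ≡ u₄ a))
     → _
  go (v₁ , Q₁ , r₁ , o₁) (v₂ , Q₂ , r₂ , o₂) (v₃ , Q₃ , r₃ , o₃) (v₄ , Q₄ , r₄ , o₄) = v₁ , v₂ ,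
    chain
      (Pass-cong (idd _) (idd _) (idd _) (same L₂' (rule-other r₂ 2 (λ ()) (λ ()))) Q₁)
      (Pass-cong (same L₁ (sym (rule-other r₁ 0 (λ ()) (λ ())))) (idd _)
        (same S₁ (trans (sym (rule-other r₃ 0 (λ ()) (λ ()))) (sym (rule-other r₄ 0 (λ ()) (λ ()))))) (same L₁' (sym (rule-other r₃ 1 (λ ()) (λ ())))) Q₂)
      (Pass-cong (idd _) (same K₂ (sym (rule-other r₄ 3 (λ ()) (λ ())))) (idd _)
        (same R₂ (trans (sym (rule-other r₂ 3 (λ ()) (λ ()))) (sym (rule-other r₁ 3 (λ ()) (λ ()))))) Q₃)
      Q₄ ,
    rules r₁ r₂ r₃ r₄ , (λ a ne → o₁ a ne , o₂ a ne) , en₄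

-- The effect of one step on the total winding number of the two passes of R₁.
data Total (op : Op) : ℕ → ℕ → ℕ → ℕ → Set where
  tL₀  : ∀ {h h'} → bump op h h' → Total op 0 0 h h'
  tL₁  : ∀ {h h'} → bump op h h' → Total op 1 0 h h'
  tLR₀ : ∀ {j' h} → Total op 0 (suc j') h h
  tLR₁ : ∀ {j' h} → Total op 1 (suc j') h h
  tRL : ∀ {h} → Total op 2 0 h h
  tR  : ∀ {j' h h'} → bump op h' h → Total op 2 (suc j') h h'
  t3  : ∀ {j j' h} → Total op (suc (suc (suc j))) j' h h

bump-l : ∀ op {k k'} h → bump op k k' → bump op (k + h) (k' + h)
bump-l E h refl = refl
bump-l F h refl = refl

bump-r : ∀ op {k k'} h → bump op k k' → bump op (h + k) (h + k')
bump-r E {k} h refl = +-suc h k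
bump-r F {k' = k'} h refl = +-suc h k'

bump-cancel : ∀ op {k k' h h'} → bump op k k' → bump op h' h → k + h ≡ k' + h'
bump-cancel E {k} {h' = h'} refl refl = +-suc k h'
bump-cancel F {k' = k'} {h = h} refl refl = sym (+-suc k' h)

zero-first : ∀ {op j₂ j₃ j' k k' h h'} → Rule op 2 j₃ j₂ k k' → Rule op 1 j' j₃ h h' → (j' ≡ᵇ 0) ≡ (j₂ ≡ᵇ 0)
zero-first r₃ r₄ = trans (rule-other r₄ 0 (λ ()) (λ ())) (rule-other r₃ 0 (λ ()) (λ ()))

total : ∀ op {j j' k₁ k₁' k₂ k₂'} → Rules op j j' k₁ k₁' k₂ k₂' → Total op j j' (k₁ + k₂) (k₁' + k₂')
total op {j' = zero} {k₂ = k₂} (rules {j₂ = j₂} r₁ r₂ r₃ r₄) with j₂ | zero-first r₃ r₄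
total op {j' = zero} {k₁} {k₁'} {k₂} {k₂'} (rules (ll b) r₂ r₃ r₄) | zero | _ with r₂
... | rl = tL₁ (bump-l op k₂ b)
total op {j' = zero} {k₁} {k₁'} {k₂} {k₂'} (rules (rr b) r₂ r₃ r₄) | zero | _ with r₂
... | ()
total op {j' = zero} {k₁} {k₁'} {k₂} {k₂'} (rules lr r₂ r₃ r₄) | zero | _ with r₂
... | ()
total op {j' = zero} {k₁} {k₁'} {k₂} {k₂'} (rules rl r₂ r₃ r₄) | zero | _ with r₂
... | rl = tRL
total op {j' = zero} {k₁} {k₁'} {k₂} {k₂'} (rules (out a c) r₂ r₃ r₄) | zero | _ with r₂
... | ll b = tL₀ (bump-r op k₁ b)
... | rl = ⊥-elim (a refl)
... | out a' c' = ⊥-elim (a' refl)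
total op {j' = suc j'} {k₁} {k₁'} {k₂} {k₂'} (rules {j₂ = j₂} r₁ r₂ r₃ r₄) with j₂ | zero-first r₃ r₄
total op {j' = suc j'} {k₁} {k₁'} {k₂} {k₂'} (rules r₁ r₂ r₃ r₄) | suc i | _ with r₁ | r₂
... | ll b | rr b' = subst (Total op 1 (suc j') _) (bump-cancel op b b') tLR₁
... | ll b | out a c = ⊥-elim (c refl)
... | rr b | out a c = tR (bump-l op k₂ b)
... | lr | out a c = tLR₁
... | rl | rr b = tR (bump-r op k₁ b)
... | rl | out a c = ⊥-elim (c refl)
... | out a c | lr = tLR₀
... | out a c | rr b = ⊥-elim (a refl)
total op {suc zero} {suc j'} (rules r₁ r₂ r₃ r₄) | suc i | _ | out a c | out a' c' = ⊥-elim (a refl)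
total op {suc (suc zero)} {suc j'} (rules r₁ r₂ r₃ r₄) | suc i | _ | out a c | out a' c' = ⊥-elim (c refl)
total op {suc (suc (suc j))} {suc j'} (rules r₁ r₂ r₃ r₄) | suc i | _ | out a c | out a' c' = t3

numb : ℕ → List ℕ → List (ℕ × ℕ)
numb s []      = []
numb s (x ∷ l) = (s , x) ∷ numb (suc s) l

enum≡numb : ∀ b → enum b ≡ numb 1 b
enum≡numb b = go (λ i → i) 0 b λ i → refl
  where
  go : ∀ f s b → (∀ i → f i ≡ s + i) → zip (map suc (applyUpTo f (length b))) b ≡ numb (suc s) b
  go f s [] h = refl
  go f s (x ∷ b) h = cong₂ _∷_ (cong (λ k → suc k , x) (trans (h 0) (+-identityʳ s)))
    (go (λ i → f (suc i)) (suc s) b λ i → trans (h (suc i)) (+-suc s i))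

numb-all : ∀ {P : ℕ × ℕ → Bool} lo d c → allB P (numb (suc (cn lo c)) (ascF lo d c)) ≡ true
  → ∀ z → lo < z → z ≤ d + lo → c z ≡ true → P (cn z c , z) ≡ true
numb-all lo zero c h z lt le cz = ⊥-elim (<⇒≱ lt le)
numb-all {P} lo (suc d) c h z lt le cz with c (suc lo) in eq | m≤n⇒m<n∨m≡n lt
... | true | inj₂ refl rewrite eq = proj₁ (∧-elim {P (suc (cn lo c) , suc lo)} h)
... | true | inj₁ lt' = numb-all {P} (suc lo) d c (subst (λ k → allB P (numb (suc k) (ascF (suc lo) d c)) ≡ true) (sym (cong (λ b → b2n b + cn lo c) eq))
        (proj₂ (∧-elim {P (suc (cn lo c) , suc lo)} h))) z lt' (subst (z ≤_) (sym (+-suc d lo)) le) cz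
... | false | inj₂ refl = ⊥-elim (true≢false cz eq)
... | false | inj₁ lt' = numb-all {P} (suc lo) d c (subst (λ k → allB P (numb (suc k) (ascF (suc lo) d c)) ≡ true) (sym (cong (λ b → b2n b + cn lo c) eq)) h)
        z lt' (subst (z ≤_) (sym (+-suc d lo)) le) cz

all-numb : ∀ {P : ℕ × ℕ → Bool} lo d c → (∀ z → lo < z → z ≤ d + lo → c z ≡ true → P (cn z c , z) ≡ true)
  → allB P (numb (suc (cn lo c)) (ascF lo d c)) ≡ true
all-numb lo zero c h = refl
all-numb {P} lo (suc d) c h with c (suc lo) in eq
... | true = ∧-intro (subst (λ k → P (k , suc lo) ≡ true) (cong (λ b → b2n b + cn lo c) eq) (h (suc lo) ≤-refl (s≤s (m≤n+m lo d)) eq))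
    (subst (λ k → allB P (numb (suc k) (ascF (suc lo) d c)) ≡ true) (cong (λ b → b2n b + cn lo c) eq)
      (all-numb {P} (suc lo) d c λ z lt le cz → h z (<-trans ≤-refl lt) (subst (z ≤_) (+-suc d lo) le) cz))
... | false = subst (λ k → allB P (numb (suc k) (ascF (suc lo) d c)) ≡ true) (cong (λ b → b2n b + cn lo c) eq)
      (all-numb {P} (suc lo) d c λ z lt le cz → h z (<-trans ≤-refl lt) (subst (z ≤_) (+-suc d lo) le) cz)

enum-asc : ∀ M c → enum (asc M c) ≡ numb (suc (cn 0 c)) (ascF 0 M c)
enum-asc M c = trans (enum≡numb (asc M c)) (cong (numb 1) (sym (asc≡ascF M c)))

allB-enum : ∀ {P : ℕ × ℕ → Bool} M c → allB P (enum (asc M c)) ≡ true → ∀ z → 1 ≤ z → z ≤ M → c z ≡ true → P (cn z c , z) ≡ true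
allB-enum {P} M c h z a b cz = numb-all {P} 0 M c (subst (λ l → allB P l ≡ true) (enum-asc M c) h) z a (≤-trans b (≤-reflexive (sym (+-identityʳ M)))) cz

enum-allB : ∀ {P : ℕ × ℕ → Bool} M c → (∀ z → 1 ≤ z → z ≤ M → c z ≡ true → P (cn z c , z) ≡ true) → allB P (enum (asc M c)) ≡ true
enum-allB {P} M c h = subst (λ l → allB P l ≡ true) (sym (enum-asc M c)) (all-numb {P} 0 M c λ z a b → h z a (≤-trans b (≤-reflexive (+-identityʳ M))))

-- The number of letters z and z̄ with z ≤ a; in a KN column it is at most a.
Nn Nb : ℕ → Bits → ℕ → ℕ
Nb n c zero    = 0
Nb n c (suc a) = b2n (c (bar n (suc a))) + Nb n c a
Nn n c a = cn a c + Nb n c a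

KN : ℕ → Bits → Set
KN n c = ∀ z → 1 ≤ z → z ≤ n → c z ≡ true → c (bar n z) ≡ true → Nn n c z ≤ z

cn-mono : ∀ c {a b} → a ≤ b → cn a c ≤ cn b c
cn-mono c {zero} _ = z≤n
cn-mono c {suc a} {suc b} (s≤s le) with m≤n⇒m<n∨m≡n le
... | inj₂ refl = ≤-refl
... | inj₁ lt = ≤-trans (cn-mono c {suc a} {b} lt) (m≤n+m _ (b2n (c (suc b))))

Nb-sum : ∀ n c z → z ≤ 2 * n → cn (2 * n ∸ z) c + Nb n c z ≡ cn (2 * n) c
Nb-sum n c zero _ = +-identityʳ _
Nb-sum n c (suc z) le with 2 * n ∸ z in eq | Nb-sum n c z (<⇒≤ le)
... | zero | _ = ⊥-elim (m>n⇒m∸n≢0 le eq)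
... | suc k | ih = trans (cong (λ h → cn h c + (b2n (c (suc k)) + Nb n c z)) (trans (sym (pred[m∸n]≡m∸[1+n] (2 * n) z)) (cong pred eq)))
  (trans (sym (+-assoc (cn k c) _ _)) (trans (cong (_+ Nb n c z) (+-comm (cn k c) _)) ih))

cn-bar : ∀ n c z → 1 ≤ z → z ≤ 2 * n → c (bar n z) ≡ true → cn (bar n z) c + Nb n c z ≡ suc (cn (2 * n) c)
cn-bar n c z 1≤z le cz = trans (cong (λ h → cn h c + Nb n c z) (+-∸-assoc 1 le))
  (trans (cong (λ h → (b2n h + cn (2 * n ∸ z) c) + Nb n c z) (trans (cong c (sym (+-∸-assoc 1 le))) cz)) (cong suc (Nb-sum n c z le)))

KN⇒ : ∀ n c → knOK n (cn (2 * n) c) (asc (2 * n) c) ≡ true → KN n c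
KN⇒ n c ok z 1≤z z≤ₙ cz cz̄ = go (allB-enum M c (allB-enum M c ok z 1≤z z≤M cz) z̄ (proj₁ rg) (proj₂ rg) cz̄)
  where
  M = 2 * n
  r = cn M c
  z̄ = bar n z
  z≤M : z ≤ M
  z≤M = ≤-trans z≤ₙ (m≤m+n n _)
  rg = bar-range n z 1≤z z≤M
  go : not ((z ≤ᵇ n) ∧ (z̄ ≡ᵇ bar n z) ∧ (cn z c <ᵇ cn z̄ c) ∧ ((cn z̄ c ∸ cn z c) ≤ᵇ (r ∸ z))) ≡ true → Nn n c z ≤ z
  go h rewrite ≤ᵇ-yes z≤ₙ | ≡ᵇ-yes {z̄} refl = fin (not-elim (subst (λ b → not (b ∧ ((cn z̄ c ∸ cn z c) ≤ᵇ (r ∸ z))) ≡ true) lt h))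
    where
    not-elim : ∀ {b} → not b ≡ true → b ≡ false
    not-elim {false} _ = refl
    cbar : cn z̄ c + Nb n c z ≡ suc r
    cbar = cn-bar n c z 1≤z z≤M cz̄
    z<z̄ : z < z̄
    z<z̄ = ≤-<-trans z≤ₙ (bar-high n z z≤ₙ)
    lt : (cn z c <ᵇ cn z̄ c) ≡ true
    lt = <ᵇ-yes (subst (suc (cn z c) ≤_) (sym (trans (cong (λ h → cn h c) (+-∸-assoc 1 z≤M)) (cong (λ h → b2n h + cn (M ∸ z) c) (trans (cong c (sym (+-∸-assoc 1 z≤M))) cz̄))))
       (s≤s (cn-mono c (≤-pred (subst (z <_) (+-∸-assoc 1 z≤M) z<z̄)))))
    fin : ((cn z̄ c ∸ cn z c) ≤ᵇ (r ∸ z)) ≡ false → Nn n c z ≤ z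
    fin f = ≤-trans (subst (_≤ r ∸ (r ∸ z)) (m+n∸m≡n (r ∸ z) (Nn n c z)) (∸-monoˡ-≤ (r ∸ z) key)) (m∸∸ r z)
      where
      m∸∸ : ∀ a b → a ∸ (a ∸ b) ≤ b
      m∸∸ a b with ≤-total b a
      ... | inj₁ le = ≤-reflexive (m∸[m∸n]≡n le)
      ... | inj₂ le rewrite m≤n⇒m∸n≡0 le = le
      key : (r ∸ z) + Nn n c z ≤ r
      key = ≤-pred (begin
        suc ((r ∸ z) + (cn z c + Nb n c z)) ≡⟨ cong suc (sym (+-assoc (r ∸ z) _ _)) ⟩
        suc (r ∸ z) + cn z c + Nb n c z ≤⟨ +-monoˡ-≤ (Nb n c z) (begin
            suc (r ∸ z) + cn z c ≤⟨ +-monoˡ-≤ (cn z c) (≤ᵇ-elim-no (cn z̄ c ∸ cn z c) (r ∸ z) f) ⟩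
            (cn z̄ c ∸ cn z c) + cn z c ≡⟨ m∸n+n≡m (<⇒≤ (<ᵇ-elim (cn z c) (cn z̄ c) lt)) ⟩
            cn z̄ c ∎) ⟩
        cn z̄ c + Nb n c z ≡⟨ cbar ⟩
        suc r ∎)
        where open ≤-Reasoning

⇒KN : ∀ n c → (∀ z → z ≤ n → Nn n c z ≤ z) → knOK n (cn (2 * n) c) (asc (2 * n) c) ≡ true
⇒KN n c kn = enum-allB M c λ z 1≤z _ cz → enum-allB M c λ w _ _ cw → go z w 1≤z cw
  where
  M = 2 * n
  r = cn M c
  go : ∀ z w → 1 ≤ z → c w ≡ true → not ((z ≤ᵇ n) ∧ (w ≡ᵇ bar n z) ∧ (cn z c <ᵇ cn w c) ∧ ((cn w c ∸ cn z c) ≤ᵇ (r ∸ z))) ≡ true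
  go z w 1≤z cw with z ≤ᵇ n in zn | w ≡ᵇ bar n z in wz
  ... | false | _ = refl
  ... | true | false = refl
  ... | true | true with cn z c <ᵇ cn w c | ≡ᵇ-elim w (bar n z) wz
  ...   | false | _ = refl
  ...   | true | refl = cong not (≤ᵇ-no (m+n≤o⇒m≤o∸n (suc (r ∸ z)) key))
    where
    z≤n' = ≤ᵇ-elim z n zn
    z≤M : z ≤ M
    z≤M = ≤-trans z≤n' (m≤m+n n _)
    step : (r ∸ z) + Nn n c z ≤ r
    step with ≤-total z r
    ... | inj₁ le = ≤-trans (+-monoʳ-≤ (r ∸ z) (kn z z≤n')) (≤-reflexive (m∸n+n≡m le))
    ... | inj₂ le rewrite m≤n⇒m∸n≡0 le = ≤-trans (+-monoˡ-≤ (Nb n c z) (cn-mono c (≤-trans z≤n' (≤-trans (≤-reflexive (sym (trans (m+n∸m≡n n (n + 0)) (+-identityʳ n)))) (∸-monoʳ-≤ M z≤n')))))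
        (≤-reflexive (Nb-sum n c z z≤M))
    key : suc (r ∸ z) + cn z c ≤ cn (bar n z) c
    key = +-cancelʳ-≤ (Nb n c z) _ _ (begin
      suc (r ∸ z) + cn z c + Nb n c z ≡⟨ cong suc (+-assoc (r ∸ z) _ _) ⟩
      suc ((r ∸ z) + Nn n c z) ≤⟨ s≤s step ⟩
      suc r ≡⟨ sym (cn-bar n c z 1≤z z≤M cw) ⟩
      cn (bar n z) c + Nb n c z ∎)
      where open ≤-Reasoning

KN-all : ∀ n c → KN n c → ∀ z → z ≤ n → Nn n c z ≤ z
KN-all n c kn zero _ = z≤n
KN-all n c kn (suc z) le with c (suc z) in e | c (bar n (suc z)) in e'
... | true | true = subst (_≤ suc z) (cong₂ (λ x y → (b2n x + cn z c) + (b2n y + Nb n c z)) e e') (kn (suc z) (s≤s z≤n) le e e')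
... | true | false = s≤s (KN-all n c kn z (<⇒≤ le))
... | false | true = subst (_≤ suc z) (sym (+-suc (cn z c) (Nb n c z))) (s≤s (KN-all n c kn z (<⇒≤ le)))
... | false | false = m≤n⇒m≤1+n (KN-all n c kn z (<⇒≤ le))

vOut : ℕ → Bool → Bool → Bool × Bool × ℕ
vOut k       false false = false , false , k
vOut k       false true  = false , true , suc k
vOut zero    true  false = false , true , 0
vOut (suc k) true  false = true , false , k
vOut k       true  true  = true , true , k

V-vOut : ∀ k l r → V k l r (proj₁ (vOut k l r)) (proj₁ (proj₂ (vOut k l r))) (proj₂ (proj₂ (vOut k l r)))
V-vOut k       false false = nn
V-vOut k       false true  = pick
V-vOut zero    true  false = stay
V-vOut (suc k) true  false = drop
V-vOut zero    true  true  = both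
V-vOut (suc k) true  true  = both

V-count : ∀ {k y x l g k'} → V k (not y) x l g k' → (x ≡ false × y ≡ false × k ≡ 0 × k' ≡ 0) ⊎ (b2n x + b2n y + k ≡ suc k')
V-count {y = true} nn = inj₂ refl
V-count {y = true} pick = inj₂ refl
V-count {y = false} stay = inj₁ (refl , refl , refl , refl)
V-count {y = false} drop = inj₂ refl
V-count {y = false} both = inj₂ refl

rearr : ∀ a b x y k → (x + a) + (y + b) + k ≡ (a + b) + (x + y + k)
rearr = solve 5 (λ a b x y k → (x :+ a) :+ (y :+ b) :+ k := (a :+ b) :+ (x :+ y :+ k)) refl
  where
  open +-*-Solver

Split⇒KN : ∀ {n c l g w} → Split n c l g w → ∀ z → z ≤ n → Nn n c z ≤ z
Split⇒KN {n} {c} {l} {g} {w} s z le = ≤-trans (m≤m+n _ (w z)) (go z le)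
  where
  go : ∀ z → z ≤ n → Nn n c z + w z ≤ z
  go zero _ = ≤-reflexive (Split.bot s)
  go (suc z) le with V-count {y = c (bar n (suc z))} (Split.vert s (suc z) (s≤s z≤n) le)
  ... | inj₂ e = begin
      Nn n c (suc z) + w (suc z) ≡⟨ rearr (cn z c) (Nb n c z) (b2n (c (suc z))) (b2n (c (bar n (suc z)))) (w (suc z)) ⟩
      Nn n c z + (b2n (c (suc z)) + b2n (c (bar n (suc z))) + w (suc z)) ≡⟨ cong (Nn n c z +_) e ⟩
      Nn n c z + suc (w z) ≡⟨ +-suc _ _ ⟩
      suc (Nn n c z + w z) ≤⟨ s≤s (go z (<⇒≤ le)) ⟩
      suc z ∎
    where open ≤-Reasoning
  ... | inj₁ (x0 , y0 , k0 , _) = begin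
      Nn n c (suc z) + w (suc z) ≡⟨ rearr (cn z c) (Nb n c z) (b2n (c (suc z))) (b2n (c (bar n (suc z)))) (w (suc z)) ⟩
      Nn n c z + (b2n (c (suc z)) + b2n (c (bar n (suc z))) + w (suc z)) ≡⟨ cong (Nn n c z +_) (cong₂ _+_ (cong₂ (λ a b → b2n a + b2n b) x0 y0) k0) ⟩
      Nn n c z + 0 ≡⟨ +-identityʳ _ ⟩
      Nn n c z ≤⟨ m≤m+n _ (w z) ⟩
      Nn n c z + w z ≤⟨ go z (<⇒≤ le) ⟩
      z ≤⟨ n≤1+n z ⟩
      suc z ∎
    where open ≤-Reasoning

KN⇒Split : ∀ n c → (∀ z → z ≤ n → Nn n c z ≤ z) → Spl n c
KN⇒Split n c kn = spl l g w (split vt top' bot')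
  where
  cw : ℕ → ℕ
  cw zero    = 0
  cw (suc d) = proj₂ (proj₂ (vOut (cw d) (star n c (n ∸ d)) (c (n ∸ d))))
  w : ℕ → ℕ
  w z = cw (n ∸ z)
  l g : Bits
  l z = proj₁ (vOut (w z) (star n c z) (c z))
  g z = proj₁ (proj₂ (vOut (w z) (star n c z) (c z)))
  top' : w n ≡ 0
  top' = cong cw (n∸n≡0 n)
  vt : ∀ z → 1 ≤ z → z ≤ n → V (w z) (star n c z) (c z) (l z) (g z) (w (pred z))
  vt (suc z) _ le = V-cong refl refl refl refl refl
    (trans (cong (λ h → proj₂ (proj₂ (vOut (w (suc z)) (star n c h) (c h)))) (sym (m∸[m∸n]≡n le))) (cong cw (sym (+-∸-assoc 1 le))))
    (V-vOut (w (suc z)) (star n c (suc z)) (c (suc z)))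
  -- as long as no carry is discarded, Nn counts it
  go : ∀ a → a ≤ n → w 0 ≡ 0 ⊎ w 0 + a ≡ w a + Nn n c a
  go zero _ = inj₂ refl
  go (suc a) le with go a (<⇒≤ le)
  ... | inj₁ e = inj₁ e
  ... | inj₂ e with V-count {y = c (bar n (suc a))} (vt (suc a) (s≤s z≤n) le)
  ...   | inj₁ (_ , _ , _ , k0) = inj₁ (n≤0⇒n≡0 (+-cancelʳ-≤ a (w 0) 0 (≤-trans (≤-reflexive (trans e (cong (_+ Nn n c a) k0))) (kn a (<⇒≤ le)))))
  ...   | inj₂ e' = inj₂ (begin
      w 0 + suc a ≡⟨ +-suc (w 0) a ⟩
      suc (w 0 + a) ≡⟨ cong suc e ⟩
      suc (w a) + Nn n c a ≡⟨ cong (_+ Nn n c a) (sym e') ⟩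
      (b2n (c (suc a)) + b2n (c (bar n (suc a))) + w (suc a)) + Nn n c a ≡⟨ +-comm _ (Nn n c a) ⟩
      Nn n c a + (b2n (c (suc a)) + b2n (c (bar n (suc a))) + w (suc a)) ≡⟨ sym (rearr (cn a c) (Nb n c a) (b2n (c (suc a))) (b2n (c (bar n (suc a)))) (w (suc a))) ⟩
      Nn n c (suc a) + w (suc a) ≡⟨ +-comm (Nn n c (suc a)) _ ⟩
      w (suc a) + Nn n c (suc a) ∎)
    where open ≡-Reasoning
  bot' : w 0 ≡ 0
  bot' with go n ≤-refl
  ... | inj₁ e = e
  ... | inj₂ e = n≤0⇒n≡0 (+-cancelʳ-≤ n (w 0) 0 (≤-trans (≤-reflexive (trans e (cong (_+ Nn n c n) top'))) (kn n ≤-refl)))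

record IsColC (n r : ℕ) (b : Column) : Set where
  constructor isColC
  field
    col : IsCol (2 * n) r b
    sp  : Spl n (χ b)

toColC : ∀ n r b → T (validC n r b) → IsColC n r b
toColC n r b v = let (a , v') = ∧-elim {length b ≡ᵇ r} (T→≡ v)
                     (si , v'') = ∧-elim {strictInc b} v'
                     (ir , kn) = ∧-elim {allB (inRange 1 (2 * n)) b} v''
                     eq = asc-decomp (2 * n) b si ir
                     sz = trans (sym (length-asc (2 * n) (χ b))) (trans (cong length (sym eq)) (≡ᵇ-elim (length b) r a)) in
  isColC (isCol eq sz) (KN⇒Split n (χ b) (KN-all n (χ b) (KN⇒ n (χ b) (subst₂ (λ k l → knOK n k l ≡ true) (sym sz) eq kn))))

fromColC : ∀ n r b → IsColC n r b → T (validC n r b)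
fromColC n r b (isColC (isCol eq sz) sp) = ≡→T (subst (λ l → validC n r l ≡ true) (sym eq)
  (∧-intro (≡ᵇ-yes (trans (length-asc M (χ b)) sz)) (∧-intro (asc-strict M (χ b)) (∧-intro (asc-range M M (χ b) ≤-refl)
    (subst (λ k → knOK n k (asc M (χ b)) ≡ true) sz (⇒KN n (χ b) (Split⇒KN (Spl.isSplit sp))))))))
  where M = 2 * n

-- SD k c: the letters ≤ k + 1 of c (which avoids 1) moved down by one.
SD : ℕ → Bits → Bits
SD k c x = if x ≤ᵇ k then c (suc x) else (if x ≡ᵇ suc k then false else c x)

SD-low : ∀ k c x → x ≤ k → SD k c x ≡ c (suc x)
SD-low k c x le rewrite ≤ᵇ-yes le = refl

SD-gap : ∀ k c → SD k c (suc k) ≡ false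
SD-gap k c rewrite ≤ᵇ-no {suc k} {k} ≤-refl | ≡ᵇ-yes {k} refl = refl

SD-high : ∀ k c x → suc k < x → SD k c x ≡ c x
SD-high k c x lt rewrite ≤ᵇ-no {x} {k} (<-trans ≤-refl lt) | ≡ᵇ-no (>⇒≢ lt) = refl

SD-step : ∀ k c v → c (suc (suc k)) ≡ v → ∀ x → swB v (suc k) (suc (suc k)) (SD k c) x ≡ SD (suc k) c x
SD-step k c v cv x with <-cmp x (suc k)
... | tri< lt ne _ = trans (swB-other v (suc k) (suc (suc k)) (SD k c) x ne (<⇒≢ (m<n⇒m<1+n lt))) (trans (SD-low k c x (≤-pred lt)) (sym (SD-low (suc k) c x (<⇒≤ lt))))
... | tri≈ _ refl _ = trans (at₁ v cv) (trans (sym cv) (sym (SD-low (suc k) c (suc k) ≤-refl)))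
  where
  at₁ : ∀ v → c (suc (suc k)) ≡ v → swB v (suc k) (suc (suc k)) (SD k c) (suc k) ≡ v
  at₁ true e = trans (sw-p (suc k) (suc (suc k)) (SD k c)) (trans (SD-high k c (suc (suc k)) ≤-refl) e)
  at₁ false e = SD-gap k c
... | tri> _ _ gt with m≤n⇒m<n∨m≡n gt
...   | inj₂ refl = trans (at₂ v cv) (sym (SD-gap (suc k) c))
  where
  at₂ : ∀ v → c (suc (suc k)) ≡ v → swB v (suc k) (suc (suc k)) (SD k c) (suc (suc k)) ≡ false
  at₂ true e = trans (sw-q (suc k) (suc (suc k)) (SD k c)) (SD-gap k c)
  at₂ false e = trans (SD-high k c (suc (suc k)) ≤-refl) e
...   | inj₁ gt' = trans (swB-other v (suc k) (suc (suc k)) (SD k c) x (>⇒≢ gt) (>⇒≢ gt')) (trans (SD-high k c x gt) (sym (SD-high (suc k) c x gt')))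

SD-0 : ∀ c → c 1 ≡ false → ∀ x → 1 ≤ x → SD 0 c x ≡ c x
SD-0 c c1 (suc zero) _ = sym c1
SD-0 c c1 (suc (suc x)) _ = SD-high 0 c (suc (suc x)) (s≤s (s≤s z≤n))

-- The letters < m of a (which avoids m) moved up by one.
shiftUp : ℕ → Bits → Bits
shiftUp m a x = if x ≡ᵇ 1 then false else (if x ≤ᵇ m then a (x ∸ 1) else a x)

shiftUp-low : ∀ m a x → 1 ≤ x → suc x ≤ m → shiftUp m a (suc x) ≡ a x
shiftUp-low m a (suc x) _ le rewrite <ᵇ-yes {suc x} le = refl

shiftUp-high : ∀ m a x → 1 ≤ m → m < x → shiftUp m a x ≡ a x
shiftUp-high m a (suc zero) (s≤s _) (s≤s ())
shiftUp-high m a (suc (suc x)) 1≤m lt rewrite ≤ᵇ-no lt = refl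

SD-shiftUp : ∀ m a → a (suc m) ≡ false → ∀ x → 1 ≤ x → SD m (shiftUp (suc m) a) x ≡ a x
SD-shiftUp m a am x 1≤x with <-cmp x (suc m)
... | tri< lt _ _ = trans (SD-low m (shiftUp (suc m) a) x (≤-pred lt)) (shiftUp-low (suc m) a x 1≤x lt)
... | tri≈ _ refl _ = trans (SD-gap m (shiftUp (suc m) a)) (sym am)
... | tri> _ _ gt = trans (SD-high m (shiftUp (suc m) a) x gt) (shiftUp-high (suc m) a x (s≤s z≤n) gt)

mu : ℕ → Bits → ℕ
mu zero    c = 0
mu (suc k) c = (if c (suc k) then suc k else 0) + mu k c

mu-cong : ∀ k {c d : Bits} → (∀ x → 1 ≤ x → x ≤ k → c x ≡ d x) → mu k c ≡ mu k d
mu-cong zero h = refl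
mu-cong (suc k) h = cong₂ (λ b m → (if b then suc k else 0) + m) (h (suc k) (s≤s z≤n) ≤-refl) (mu-cong k λ x a b → h x a (m≤n⇒m≤1+n b))

mu-down : ∀ {M} i → 1 ≤ i → suc i ≤ M → ∀ c → c (suc i) ≡ true → c i ≡ false → suc (mu M (sw i (suc i) c)) ≡ mu M c
mu-down {suc M} (suc i) _ le c cq cp with m≤n⇒m<n∨m≡n le
... | inj₁ (s≤s lt) rewrite sw-other (suc i) (suc (suc i)) c (suc M) (>⇒≢ (≤-trans (n≤1+n _) (s≤s lt))) (>⇒≢ (s≤s lt)) =
  trans (sym (+-suc _ _)) (cong ((if c (suc M) then suc M else 0) +_) (mu-down (suc i) (s≤s z≤n) lt c cq cp))
... | inj₂ refl = trans (cong₂ (λ x y → suc (two x y (mu i d))) (trans (sw-q p q c) cp) (trans (sw-p p q c) cq))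
  (trans (cong (λ h → suc (suc (i + h))) (mu-cong i λ x _ b → sw-other p q c x (<⇒≢ (s≤s b)) (<⇒≢ (s≤s (m≤n⇒m≤1+n b)))))
    (sym (cong₂ (λ x y → two x y (mu i c)) cq cp)))
  where
  p = suc i
  q = suc p
  d = sw p q c
  two : Bool → Bool → ℕ → ℕ
  two x y h = (if x then q else 0) + ((if y then p else 0) + h)

cn-≤ : ∀ k c → cn k c ≤ k
cn-≤ zero c = z≤n
cn-≤ (suc k) c with c (suc k)
... | true = s≤s (cn-≤ k c)
... | false = m≤n⇒m≤1+n (cn-≤ k c)

-- Removing the gap m of a lowers the letter sum.
mu-shift : ∀ m a a₂ k → a (suc m) ≡ false → (∀ x → 1 ≤ x → x ≤ m → a₂ x ≡ a x) → (∀ x → m < x → x ≤ m + k → a₂ x ≡ a (suc x)) →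
  mu (m + k) a₂ + cn (suc (m + k)) a ≡ mu (suc (m + k)) a + cn (suc m) a
mu-shift m a a₂ zero am lo hi rewrite +-identityʳ m | am = cong (_+ cn m a) (mu-cong m lo)
mu-shift m a a₂ (suc k) am lo hi rewrite +-suc m k | hi (suc (m + k)) (s≤s (m≤m+n m k)) ≤-refl with a (suc (suc (m + k)))
... | false = mu-shift m a a₂ k am lo λ x l le → hi x l (m≤n⇒m≤1+n le)
... | true = trans (lem (suc (m + k)) (mu (m + k) a₂) (cn (suc (m + k)) a)) (cong (suc (suc (m + k)) +_) (mu-shift m a a₂ k am lo λ x l le → hi x l (m≤n⇒m≤1+n le)) ⟨ trans ⟩ sym (+-assoc (suc (suc (m + k))) _ _))
  where
  lem : ∀ x y z → (x + y) + suc z ≡ suc x + (y + z)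
  lem x y z = trans (+-suc (x + y) z) (cong suc (+-assoc x y z))

iv : ℕ → Bits
iv t x = x ≤ᵇ t

down-closed : ∀ N c t → (∀ i → 1 ≤ i → i < N → c (suc i) ≡ true → c i ≡ true) → cn N c ≡ t → ∀ x → 1 ≤ x → x ≤ N → c x ≡ iv t x
down-closed zero c t dc sz (suc x) _ ()
down-closed (suc N) c t dc sz x 1≤x le with c (suc N) in eq
... | true = trans (all x 1≤x le) (sym (≤ᵇ-yes (subst (x ≤_) (trans (sym (full (suc N) all)) (trans (cong (λ b → b2n b + cn N c) eq) sz)) le)))
  where
  from : ∀ d x → 1 ≤ x → d + x ≡ suc N → c x ≡ true
  from zero x _ refl = eq
  from (suc d) x 1≤x e = dc x 1≤x (s≤s (subst (x ≤_) (suc-injective e) (m≤n+m x d))) (from d (suc x) (s≤s z≤n) (trans (+-suc d x) e))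
  all : ∀ x → 1 ≤ x → x ≤ suc N → c x ≡ true
  all x a b = from (suc N ∸ x) x a (m∸n+n≡m b)
  full : ∀ k → (∀ x → 1 ≤ x → x ≤ k → c x ≡ true) → cn k c ≡ k
  full zero h = refl
  full (suc k) h rewrite h (suc k) (s≤s z≤n) ≤-refl = cong suc (full k λ x a b → h x a (m≤n⇒m≤1+n b))
... | false with m≤n⇒m<n∨m≡n le
...   | inj₁ (s≤s lt) = down-closed N c t (λ i a b → dc i a (m<n⇒m<1+n b)) sz x 1≤x lt
...   | inj₂ refl = trans eq (sym (≤ᵇ-no (s≤s (subst (_≤ N) sz (cn-≤ N c)))))

asc-iv : ∀ M s → s ≤ M → asc M (iv s) ≡ map suc (upTo s)
asc-iv zero zero le = refl
asc-iv (suc M) s le with m≤n⇒m<n∨m≡n le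
... | inj₁ (s≤s lt) = trans (asc-without' (≤ᵇ-no {suc M} {s} (s≤s lt))) (asc-iv M s lt)
  where
  asc-without' : iv s (suc M) ≡ false → asc (suc M) (iv s) ≡ asc M (iv s)
  asc-without' q rewrite q = ++-identityʳ _
... | inj₂ refl = trans (asc-with' (≤ᵇ-yes {suc M} ≤-refl)) (trans (cong (_++ (suc M ∷ [])) (trans (asc-cong M λ x _ b → trans (≤ᵇ-yes (m≤n⇒m≤1+n b)) (sym (≤ᵇ-yes b))) (asc-iv M M ≤-refl)))
     (trans (sym (map-++ suc (upTo M) (M ∷ []))) (cong (map suc) (upTo-∷ʳ M))))
  where
  asc-with' : iv (suc M) (suc M) ≡ true → asc (suc M) (iv (suc M)) ≡ asc M (iv (suc M)) ++ (suc M ∷ [])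
  asc-with' q rewrite q = refl

cn-iv : ∀ M s → s ≤ M → cn M (iv s) ≡ s
cn-iv zero zero _ = refl
cn-iv (suc M) s le with m≤n⇒m<n∨m≡n le
... | inj₁ (s≤s lt) rewrite ≤ᵇ-no {suc M} {s} (s≤s lt) = cn-iv M s lt
... | inj₂ refl rewrite ≤ᵇ-yes {suc M} ≤-refl = cong suc (trans (cn-cong M λ x _ b → trans (≤ᵇ-yes (m≤n⇒m≤1+n b)) (sym (≤ᵇ-yes b))) (cn-iv M M ≤-refl))

search : (f : ℕ → Bool) (k : ℕ) → (∃ λ i → 1 ≤ i × i ≤ k × f i ≡ true) ⊎ (∀ i → 1 ≤ i → i ≤ k → f i ≡ false)
search f zero = inj₂ λ { (suc i) _ () }
search f (suc k) with f (suc k) in eq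
... | true = inj₁ (suc k , s≤s z≤n , ≤-refl , eq)
... | false with search f k
...   | inj₁ (i , a , b , c) = inj₁ (i , a , m≤n⇒m≤1+n b , c)
...   | inj₂ h = inj₂ λ i a b → last i a (m≤n⇒m<n∨m≡n b)
  where
  last : ∀ i → 1 ≤ i → i < suc k ⊎ i ≡ suc k → f i ≡ false
  last i a (inj₁ (s≤s lt)) = h i a lt
  last i a (inj₂ refl) = eq

SD-size : ∀ N c K → suc K ≤ N → c 1 ≡ false → cn N (SD K c) ≡ cn N c
SD-size N c zero _ c1 = cn-cong N λ x a _ → SD-0 c c1 x a
SD-size N c (suc K) lt c1 = trans (cn-cong N λ x _ _ → sym (SD-step K c (c (suc (suc K))) refl x))
  (trans (cn-swB (site-suc K lt) (c (suc (suc K))) (SD K c)) (SD-size N c K (<⇒≤ lt) c1))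

-- a avoids m + 1; a₂ is a with this gap removed.
module GapData (N' : ℕ) (a : Bits) (m t : ℕ) (sm≤t : suc m ≤ t) (m≤N' : m ≤ N') (am : a (suc m) ≡ false) where
  a₁ a₂ : Bits
  a₁ = shiftUp (suc m) a
  a₂ = SD N' a₁
  size₁ : cn (suc N') a₁ ≡ cn (suc N') a
  size₁ = trans (sym (SD-size (suc N') a₁ m (s≤s m≤N') refl)) (cn-cong (suc N') λ x l _ → SD-shiftUp m a am x l)
  size₂ : cn (suc N') a₂ ≡ cn (suc N') a
  size₂ = trans (SD-size (suc N') a₁ N' ≤-refl refl) size₁

  no-minus : (∀ i → t < i → i < suc N' → a (suc i) ≡ true → a i ≡ true) → ∀ i → t ≤ i → i < N' → ε₁ (at i (suc i) a₂) ≡ 0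
  no-minus closed i le lt = go (a₂ (suc i)) (a₂ i) refl refl
    where
    go : ∀ x y → a₂ (suc i) ≡ x → a₂ i ≡ y → ε₁ (x , y) ≡ 0
    go false y _ _ = refl
    go true true _ _ = refl
    go true false h h' = ⊥-elim (true≢false
      (closed (suc i) (s≤s le) (s≤s lt) (trans (sym (trans (SD-low N' a₁ (suc i) lt) (shiftUp-high (suc m) a (suc (suc i)) (s≤s z≤n) (s≤s (≤-trans sm≤t (≤-trans le (n≤1+n i))))))) h))
      (trans (sym (trans (SD-low N' a₁ i (<⇒≤ lt)) (shiftUp-high (suc m) a (suc i) (s≤s z≤n) (s≤s (≤-trans sm≤t le))))) h'))

  smaller : ∀ s → cn (suc N') a ≡ s → suc m ≤ s → mu (suc N') a₂ < mu (suc N') a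
  smaller s sa sm≤s = +-cancelʳ-< s (mu N a₂) (mu N a) (begin-strict
      mu N a₂ + s ≡⟨ cong (λ b → (if b then N else 0) + mu N' a₂ + s) (SD-gap N' a₁) ⟩
      mu N' a₂ + s ≡⟨ cong (mu N' a₂ +_) (sym sa) ⟩
      mu N' a₂ + cn N a ≡⟨ subst (λ h → mu h a₂ + cn (suc h) a ≡ mu (suc h) a + cn (suc m) a) (m+[n∸m]≡n m≤N') shifted ⟩
      mu N a + cn (suc m) a <⟨ +-monoʳ-< (mu N a) (≤-<-trans (subst (λ b → b2n b + cn m a ≤ m) (sym am) (cn-≤ m a)) sm≤s) ⟩
      mu N a + s ∎)
    where
    open ≤-Reasoning
    N = suc N'
    shifted = mu-shift m a a₂ (N' ∸ m) am
      (λ x l le → trans (SD-low N' a₁ x (≤-trans le m≤N')) (shiftUp-low (suc m) a x l (s≤s le)))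
      (λ x lt le → trans (SD-low N' a₁ x (subst (x ≤_) (m+[n∸m]≡n m≤N') le)) (shiftUp-high (suc m) a (suc x) (s≤s z≤n) (s≤s lt)))

-- The column {1, …, t - 1} ∪ {y}
travel : ℕ → ℕ → Bits
travel t y x = (x <ᵇ t) ∨ (x ≡ᵇ y)

travel-gap : ∀ t y x → t ≤ x → x ≢ y → travel t y x ≡ false
travel-gap t y x le ne rewrite <ᵇ-no le = ≡ᵇ-no ne

travel-at : ∀ t y → travel t y y ≡ true
travel-at t y with y <ᵇ t
... | true = refl
... | false = ≡ᵇ-yes {y} refl

travel-low : ∀ t y x → x ≢ y → travel t y x ≡ (x <ᵇ t)
travel-low t y x ne = trans (cong ((x <ᵇ t) ∨_) (≡ᵇ-no ne)) (∨-f (x <ᵇ t))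
  where
  ∨-f : ∀ b → b ∨ false ≡ b
  ∨-f true = refl
  ∨-f false = refl

travel-sw : ∀ t y → t ≤ y → ∀ x → sw y (suc y) (travel t (suc y)) x ≡ travel t y x
travel-sw t y le x with x Data.Nat.≟ y | x Data.Nat.≟ suc y
... | yes refl | _ = trans (sw-p y (suc y) (travel t (suc y))) (trans (travel-at t (suc y)) (sym (travel-at t y)))
... | no _ | yes refl = trans (sw-q y (suc y) (travel t (suc y))) (trans (travel-gap t (suc y) y le (<⇒≢ ≤-refl)) (sym (travel-gap t y (suc y) (m≤n⇒m≤1+n le) (>⇒≢ ≤-refl))))
... | no a | no b = trans (sw-other y (suc y) (travel t (suc y)) x a b) (cong ((x <ᵇ t) ∨_) (trans (≡ᵇ-no b) (sym (≡ᵇ-no a))))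

travel-iv : ∀ t x → 1 ≤ x → travel t t x ≡ iv t x
travel-iv t (suc x) _ with <-cmp (suc x) t
... | tri< lt _ _ rewrite <ᵇ-yes lt = sym (≤ᵇ-yes {suc x} (<⇒≤ lt))
... | tri≈ _ refl _ = trans (travel-at t (suc x)) (sym (≤ᵇ-yes {suc x} ≤-refl))
... | tri> _ ne gt = trans (travel-gap t t (suc x) (<⇒≤ gt) ne) (sym (≤ᵇ-no gt))

-- travel t y for y running down from Y to t, in the form needed by iterⁱ
travel-size : ∀ M t Y → 1 ≤ t → Y ≤ M → cn M (travel t Y) ≡ t → ∀ d → d + t ≤ Y → cn M (travel t (Y ∸ d)) ≡ t
travel-size M t Y 1≤t Y≤M h zero _ = h
travel-size M t (suc Y) 1≤t Y≤M h (suc d) (s≤s le) = trans (cn-cong M λ x _ _ → sym (travel-sw t (Y ∸ d) t≤ x))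
  (trans (cn-sw (site⁺ (≤-trans 1≤t t≤) (≤-trans (s≤s (m∸n≤m Y d)) Y≤M)) (travel t (suc (Y ∸ d))))
    (trans (cong (λ h → cn M (travel t h)) (sym (+-∸-assoc 1 (≤-trans (m≤m+n d t) le)))) (travel-size M t (suc Y) 1≤t Y≤M h d (m≤n⇒m≤1+n le))))
  where
  t≤ : t ≤ Y ∸ d
  t≤ = subst (_≤ Y ∸ d) (m+n∸m≡n d t) (∸-monoˡ-≤ d le)

-- The greedy filling

sumBy : (ℕ → ℕ) → List ℕ → ℕ
sumBy g []       = 0
sumBy g (x ∷ xs) = g x + sumBy g xs

mult below : ℕ → List ℕ → ℕ
mult x  = sumBy λ y → b2n (x ≡ᵇ y)
below a = sumBy λ y → b2n (y ≤ᵇ a)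

size' : List ℕ → ℕ
size' = sumBy λ _ → 1

size'-length : ∀ xs → size' xs ≡ length xs
size'-length [] = refl
size'-length (x ∷ xs) = cong suc (size'-length xs)

mult-self : ∀ x xs → 1 ≤ mult x (x ∷ xs)
mult-self x xs rewrite ≡ᵇ-yes {x} refl = s≤s z≤n

mult-tail : ∀ x y xs → 1 ≤ mult x xs → 1 ≤ mult x (y ∷ xs)
mult-tail x y xs h = ≤-trans h (m≤n+m _ (b2n (x ≡ᵇ y)))

sumBy-remove : ∀ g x ys → 1 ≤ mult x ys → sumBy g ys ≡ g x + sumBy g (removeOne x ys)
sumBy-remove g x (y ∷ ys) h with x ≡ᵇ y in q
... | true = cong (λ v → g v + sumBy g ys) (sym (≡ᵇ-elim x y q))
... | false = trans (cong (λ v → g y + v) (sumBy-remove g x ys h)) (x∙yz≈y∙xz (g y) (g x) _)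

sumBy-map : ∀ g f xs → sumBy g (map f xs) ≡ sumBy (λ x → g (f x)) xs
sumBy-map g f [] = refl
sumBy-map g f (x ∷ xs) = cong (λ v → g (f x) + v) (sumBy-map g f xs)

sumBy-insert : ∀ g x xs → sumBy g (insertℕ x xs) ≡ g x + sumBy g xs
sumBy-insert g x [] = refl
sumBy-insert g x (y ∷ ys) with x ≤ᵇ y
... | true = refl
... | false = trans (cong (λ v → g y + v) (sumBy-insert g x ys)) (x∙yz≈y∙xz (g y) (g x) _)

sumBy-sort : ∀ g xs → sumBy g (sortℕ xs) ≡ sumBy g xs
sumBy-sort g [] = refl
sumBy-sort g (x ∷ xs) = trans (sumBy-insert g x (sortℕ xs)) (cong (λ v → g x + v) (sumBy-sort g xs))

_⊑_ : List ℕ → List ℕ → Set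
xs ⊑ ys = ∀ x → mult x xs ≤ mult x ys

Bounded : ℕ → List ℕ → Set
Bounded M xs = ∀ x → 1 ≤ mult x xs → 1 ≤ x × x ≤ M

Bounded-⊑ : ∀ {M} xs ys → xs ⊑ ys → Bounded M ys → Bounded M xs
Bounded-⊑ xs ys s b x h = b x (≤-trans h (s x))

Bounded-tail : ∀ {M} x xs → Bounded M (x ∷ xs) → Bounded M xs
Bounded-tail y xs b x h = b x (mult-tail x y xs h)

remove-⊑ : ∀ x ys → removeOne x ys ⊑ ys
remove-⊑ x [] y = z≤n
remove-⊑ x (z ∷ ys) y with x ≡ᵇ z
... | true = m≤n+m _ (b2n (y ≡ᵇ z))
... | false = +-monoʳ-≤ (b2n (y ≡ᵇ z)) (remove-⊑ x ys y)

below-gap : ∀ zs a b → (∀ y → 1 ≤ mult y zs → y ≤ a → y ≤ b) → below a zs ≤ below b zs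
below-gap [] a b h = z≤n
below-gap (z ∷ zs) a b h = +-mono-≤ head' (below-gap zs a b λ y m → h y (mult-tail y z zs m))
  where
  head' : b2n (z ≤ᵇ a) ≤ b2n (z ≤ᵇ b)
  head' with z ≤ᵇ a in q
  ... | false = z≤n
  ... | true rewrite ≤ᵇ-yes {z} {b} (h z (mult-self z zs) (≤ᵇ-elim z a q)) = ≤-refl

below-≤size : ∀ a zs → below a zs ≤ size' zs
below-≤size a [] = z≤n
below-≤size a (z ∷ zs) = +-mono-≤ (b≤1 (z ≤ᵇ a)) (below-≤size a zs)
  where
  b≤1 : ∀ b → b2n b ≤ 1
  b≤1 true = ≤-refl
  b≤1 false = z≤n

size-≤below : ∀ a zs → (∀ y → 1 ≤ mult y zs → y ≤ a) → size' zs ≤ below a zs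
size-≤below a [] h = z≤n
size-≤below a (z ∷ zs) h rewrite ≤ᵇ-yes {z} {a} (h z (mult-self z zs)) = s≤s (size-≤below a zs λ y m → h y (mult-tail y z zs m))

below-zero : ∀ a zs → (∀ y → 1 ≤ mult y zs → a < y) → below a zs ≡ 0
below-zero a [] h = refl
below-zero a (z ∷ zs) h rewrite ≤ᵇ-no {z} {a} (h z (mult-self z zs)) = below-zero a zs λ y m → h y (mult-tail y z zs m)

argmin-mem : ∀ (k : ℕ → ℕ) b xs → argminKey k b xs ≡ b ⊎ 1 ≤ mult (argminKey k b xs) xs
argmin-mem k b [] = inj₁ refl
argmin-mem k b (x ∷ xs) with k x <ᵇ k b
... | true with argmin-mem k x xs
...   | inj₁ h = inj₂ (subst (λ v → 1 ≤ mult v (x ∷ xs)) (sym h) (mult-self x xs))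
...   | inj₂ h = inj₂ (mult-tail (argminKey k x xs) x xs h)
argmin-mem k b (x ∷ xs) | false with argmin-mem k b xs
...   | inj₁ h = inj₁ h
...   | inj₂ h = inj₂ (mult-tail (argminKey k b xs) x xs h)

argmin-least : ∀ (k : ℕ → ℕ) b xs → k (argminKey k b xs) ≤ k b × (∀ y → 1 ≤ mult y xs → k (argminKey k b xs) ≤ k y)
argmin-least k b [] = ≤-refl , λ y ()
argmin-least k b (x ∷ xs) with k x <ᵇ k b in q
... | true = let (h , r) = argmin-least k x xs in ≤-trans h (<⇒≤ (<ᵇ-elim (k x) (k b) q)) , λ y m → case y m h r
  where
  case : ∀ y → 1 ≤ mult y (x ∷ xs) → k (argminKey k x xs) ≤ k x → (∀ y → 1 ≤ mult y xs → k (argminKey k x xs) ≤ k y) → k (argminKey k x xs) ≤ k y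
  case y m h r with y ≡ᵇ x in p
  ... | true = subst (λ v → k (argminKey k x xs) ≤ k v) (sym (≡ᵇ-elim y x p)) h
  ... | false = r y m
... | false = let (h , r) = argmin-least k b xs in h , λ y m → case y m h r
  where
  case : ∀ y → 1 ≤ mult y (x ∷ xs) → k (argminKey k b xs) ≤ k b → (∀ y → 1 ≤ mult y xs → k (argminKey k b xs) ≤ k y) → k (argminKey k b xs) ≤ k y
  case y m h r with y ≡ᵇ x in p
  ... | true = subst (λ v → k (argminKey k b xs) ≤ k v) (sym (≡ᵇ-elim y x p)) (≤-trans h (<ᵇ-elim-no (k x) (k b) q))
  ... | false = r y m

cmin : ℕ → ℕ → ℕ → List ℕ → ℕ
cmin M a y ys = argminKey (ckey M a) y ys

cmin-mem : ∀ M a y ys → 1 ≤ mult (cmin M a y ys) (y ∷ ys)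
cmin-mem M a y ys with argmin-mem (ckey M a) y ys
... | inj₁ h = subst (λ v → 1 ≤ mult v (y ∷ ys)) (sym h) (mult-self y ys)
... | inj₂ h = mult-tail (cmin M a y ys) y ys h

cmin-least : ∀ M a y ys z → 1 ≤ mult z (y ∷ ys) → ckey M a (cmin M a y ys) ≤ ckey M a z
cmin-least M a y ys z h with z ≡ᵇ y in p
... | true = subst (λ v → ckey M a (cmin M a y ys) ≤ ckey M a v) (sym (≡ᵇ-elim z y p)) (proj₁ (argmin-least (ckey M a) y ys))
... | false = proj₂ (argmin-least (ckey M a) y ys) z h

-- x precedes y in the circular order from a.
record Prec (a x y : ℕ) : Set where
  constructor prec
  field
    up   : a ≤ x → a ≤ y → x ≤ y
    wrap : x < a → y < a × x ≤ y

ckey-Prec : ∀ M a x y → 1 ≤ a → a ≤ M → 1 ≤ x → y ≤ M → ckey M a x ≤ ckey M a y → Prec a x y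
ckey-Prec M a x y 1≤a a≤M 1≤x y≤M h = prec (λ p q → subst₂ _≤_ (hi p) (hi q) h') wrap'
  where
  h' : ckey M a x + a ≤ ckey M a y + a
  h' = +-monoˡ-≤ a h
  hi : ∀ {x} → a ≤ x → ckey M a x + a ≡ x
  hi p rewrite ≤ᵇ-yes p = m∸n+n≡m p
  lo : ∀ {x} → x < a → ckey M a x + a ≡ x + M
  lo {x} p rewrite ≤ᵇ-no p = m∸n+n≡m (≤-trans a≤M (m≤n+m M x))
  wrap' : x < a → y < a × x ≤ y
  wrap' p with <-≤-connex y a
  ... | inj₂ q = ⊥-elim (<⇒≱ (≤-trans (s≤s y≤M) (+-monoˡ-≤ M 1≤x)) (subst₂ _≤_ (lo p) (hi q) h'))
  ... | inj₁ q = q , +-cancelʳ-≤ M x y (subst₂ _≤_ (lo p) (lo q) h')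

Prec-antisym : ∀ {a x y} → Prec a x y → Prec a y x → x ≡ y
Prec-antisym {a} {x} {y} p q with <-≤-connex x a | <-≤-connex y a
... | inj₁ l | _ = let (y<a , x≤y) = Prec.wrap p l in ≤-antisym x≤y (proj₂ (Prec.wrap q y<a))
... | inj₂ _ | inj₁ l = let (x<a , y≤x) = Prec.wrap q l in ≤-antisym (proj₂ (Prec.wrap p x<a)) y≤x
... | inj₂ g | inj₂ l = ≤-antisym (Prec.up p g l) (Prec.up q l g)

desc# : List ℕ → List ℕ → ℕ
desc# (x ∷ xs) (y ∷ ys) = b2n (y <ᵇ x) + desc# xs ys
desc# _ _ = 0

-- Reaching Z from X costs at most l descents.
Reach : ℕ → List ℕ → List ℕ → Set
Reach l X Z = ∀ a → below a Z ≤ below a X + l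

nextCol-size : ∀ M X β → size' X ≤ size' β → size' (nextCol M X β) ≡ size' X
nextCol-size M [] β h = refl
nextCol-size M (a ∷ X) (y ∷ ys) (s≤s h) = cong suc (nextCol-size M X _ (≤-trans h (≤-reflexive (suc-injective (sumBy-remove (λ _ → 1) (cmin M a y ys) (y ∷ ys) (cmin-mem M a y ys))))))

nextCol-⊑ : ∀ M X β → nextCol M X β ⊑ β
nextCol-⊑ M [] β x = z≤n
nextCol-⊑ M (a ∷ X) [] x = z≤n
nextCol-⊑ M (a ∷ X) (y ∷ ys) x = ≤-trans (+-monoʳ-≤ (b2n (x ≡ᵇ cmin M a y ys)) (nextCol-⊑ M X _ x))
  (≤-reflexive (sym (sumBy-remove (λ v → b2n (x ≡ᵇ v)) (cmin M a y ys) (y ∷ ys) (cmin-mem M a y ys))))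

nextCol-reach : ∀ M X β → size' X ≤ size' β → Reach (desc# X (nextCol M X β)) X (nextCol M X β)
nextCol-reach M [] β h a = z≤n
nextCol-reach M (x ∷ X) (y ∷ ys) (s≤s h) a = ≤-trans (+-mono-≤ (one g x a) (nextCol-reach M X _ (≤-trans h (≤-reflexive (suc-injective (sumBy-remove (λ _ → 1) g (y ∷ ys) (cmin-mem M x y ys))))) a))
    (≤-reflexive (interchange (b2n (x ≤ᵇ a)) (b2n (g <ᵇ x)) (below a X) _))
  where
  g = cmin M x y ys
  one : ∀ g x a → b2n (g ≤ᵇ a) ≤ b2n (x ≤ᵇ a) + b2n (g <ᵇ x)
  one g x a with g ≤ᵇ a in p | x ≤ᵇ a in q
  ... | false | _ = z≤n
  ... | true | true = s≤s z≤n
  ... | true | false rewrite <ᵇ-yes (≤-<-trans (≤ᵇ-elim g a p) (≤ᵇ-elim-no x a q)) = ≤-refl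

-- Exchange: matching x with the first z of Z loses nothing.
exchange : ∀ b X Z z l → 1 ≤ mult z Z → (∀ y → 1 ≤ mult y Z → Prec (suc b) z y) → size' Z ≡ suc (size' X) → Reach l (suc b ∷ X) Z
  → ∃ λ l' → l ≡ b2n (z <ᵇ suc b) + l' × Reach l' X (removeOne z Z)
exchange b X Z z l mz first sz R = go (<-≤-connex z (suc b))
  where
  Z' = removeOne z Z
  Z≡ : ∀ a → below a Z ≡ b2n (z ≤ᵇ a) + below a Z'
  Z≡ a = sumBy-remove (λ y → b2n (y ≤ᵇ a)) z Z mz
  Rb : below b Z ≤ below b X + l
  Rb = subst (λ h → below b Z ≤ b2n h + below b X + l) (≤ᵇ-no {suc b} {b} ≤-refl) (R b)
  mono : ∀ {a b} → a ≤ b → ∀ xs → below a xs ≤ below b xs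
  mono le xs = below-gap xs _ _ λ _ _ h → ≤-trans h le
  go : _ → ∃ λ l' → l ≡ b2n (z <ᵇ suc b) + l' × Reach l' X Z'
  go (inj₂ ge) = l , cong (λ h → b2n h + l) (sym (<ᵇ-no ge)) , reach
    where
    reach : Reach l X Z'
    reach a with <-≤-connex a z
    ... | inj₂ z≤a = ≤-pred (subst₂ _≤_ (trans (Z≡ a) (cong (λ h → b2n h + below a Z') (≤ᵇ-yes z≤a))) (cong (λ h → b2n h + below a X + l) (≤ᵇ-yes (≤-trans ge z≤a))) (R a))
    ... | inj₁ a<z = ≤-trans (≤-trans (≤-reflexive (sym (trans (Z≡ a) (cong (λ h → b2n h + below a Z') (≤ᵇ-no a<z))))) (fin (<-≤-connex b a))) (≤-refl)
      where
      fin : _ → below a Z ≤ below a X + l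
      fin (inj₂ a≤b) = subst (λ h → below a Z ≤ b2n h + below a X + l) (≤ᵇ-no (s≤s a≤b)) (R a)
      fin (inj₁ b<a) = ≤-trans (below-gap Z a b λ y m y≤a → small y m y≤a) (≤-trans Rb (+-monoˡ-≤ l (mono (<⇒≤ b<a) X)))
        where
        small : ∀ y → 1 ≤ mult y Z → y ≤ a → y ≤ b
        small y m y≤a with <-≤-connex y (suc b)
        ... | inj₁ (s≤s h) = h
        ... | inj₂ h = ⊥-elim (<⇒≱ a<z (≤-trans (Prec.up (first y m) ge h) y≤a))
  go (inj₁ lt) = wrapped l refl
    where
    all< : ∀ y → 1 ≤ mult y Z → y ≤ b
    all< y m = ≤-pred (proj₁ (Prec.wrap (first y m) lt))
    full : suc (size' X) ≤ below b X + l
    full = ≤-trans (≤-reflexive (sym sz)) (≤-trans (size-≤below b Z all<) Rb)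
    wrapped : ∀ k → l ≡ k → ∃ λ l' → l ≡ b2n (z <ᵇ suc b) + l' × Reach l' X Z'
    wrapped zero e = ⊥-elim (<⇒≱ (≤-trans full (≤-reflexive (trans (cong (λ h → below b X + h) e) (+-identityʳ _)))) (below-≤size b X))
    wrapped (suc l') e = l' , trans e (cong (λ h → b2n h + l') (sym (<ᵇ-yes lt))) , reach
      where
      reach : Reach l' X Z'
      reach a with <-≤-connex a z
      ... | inj₁ a<z = subst (_≤ below a X + l') (sym (trans (sym (cong (λ h → b2n h + below a Z') (≤ᵇ-no a<z))) (trans (sym (Z≡ a)) (below-zero a Z λ y m → <-≤-trans a<z (proj₂ (Prec.wrap (first y m) lt)))))) z≤n
      ... | inj₂ z≤a = ≤-pred (≤-trans (≤-reflexive (sym (trans (Z≡ a) (cong (λ h → b2n h + below a Z') (≤ᵇ-yes z≤a)))))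
          (≤-trans (fin (<-≤-connex b a)) (≤-reflexive (trans (cong (λ h → below a X + h) e) (+-suc _ l')))))
        where
        fin : _ → below a Z ≤ below a X + l
        fin (inj₂ a≤b) = subst (λ h → below a Z ≤ b2n h + below a X + l) (≤ᵇ-no (s≤s a≤b)) (R a)
        fin (inj₁ b<a) = ≤-trans (below-gap Z a b λ y m _ → all< y m) (≤-trans Rb (+-monoˡ-≤ l (mono (<⇒≤ b<a) X)))

⊑-remove : ∀ Z β z x → Z ⊑ β → 1 ≤ mult z Z → 1 ≤ mult x β → (1 ≤ mult x Z → z ≡ x) → removeOne z Z ⊑ removeOne x β
⊑-remove Z β z x sub mz mx same y with y Data.Nat.≟ x
... | no ne = ≤-trans (remove-⊑ z Z y) (≤-trans (sub y) (≤-reflexive (trans (sumBy-remove (λ v → b2n (y ≡ᵇ v)) x β mx) (cong (λ h → b2n h + mult y (removeOne x β)) (≡ᵇ-no ne)))))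
... | yes refl with mult x Z in q
...   | zero = ≤-trans (remove-⊑ z Z x) (≤-trans (≤-reflexive q) z≤n)
...   | suc _ with same (s≤s z≤n)
...     | refl = +-cancelˡ-≤ (b2n (x ≡ᵇ x)) _ _ (subst₂ _≤_ (sumBy-remove (λ v → b2n (x ≡ᵇ v)) x Z mz) (sumBy-remove (λ v → b2n (x ≡ᵇ v)) x β mx) (sub x))

nextCol-least : ∀ M X β → Bounded M X → Bounded M β → ∀ Z l → Z ⊑ β → size' Z ≡ size' X → Reach l X Z
  → ∀ a → below a Z + desc# X (nextCol M X β) ≤ below a (nextCol M X β) + l
nextCol-least M [] β bX bβ [] l sub sz R a = z≤n
nextCol-least M (x ∷ X) [] bX bβ (z ∷ Z) l sub sz R a = ⊥-elim (<⇒≱ (mult-self z Z) (sub z))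
nextCol-least M (zero ∷ X) (y ∷ ys) bX bβ (z ∷ Z) l sub sz R a with proj₁ (bX 0 (mult-self 0 X))
... | ()
nextCol-least M (suc b ∷ X) (y ∷ ys) bX bβ (z₀ ∷ Z₀) l sub sz R a with exchange b X (z₀ ∷ Z₀) (cmin M (suc b) z₀ Z₀) l (cmin-mem M (suc b) z₀ Z₀) first sz R
  where
  bx = bX (suc b) (mult-self (suc b) X)
  bZ : Bounded M (z₀ ∷ Z₀)
  bZ = Bounded-⊑ (z₀ ∷ Z₀) (y ∷ ys) sub bβ
  first : ∀ y → 1 ≤ mult y (z₀ ∷ Z₀) → Prec (suc b) (cmin M (suc b) z₀ Z₀) y
  first y m = ckey-Prec M (suc b) _ y (proj₁ bx) (proj₂ bx) (proj₁ (bZ _ (cmin-mem M (suc b) z₀ Z₀))) (proj₂ (bZ y m)) (cmin-least M (suc b) z₀ Z₀ y m)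
... | l' , refl , R' = begin
    below a Z + (b2n (g <ᵇ suc b) + k) ≡⟨ cong (λ h → h + (b2n (g <ᵇ suc b) + k)) (sumBy-remove (λ y → b2n (y ≤ᵇ a)) z Z (cmin-mem M (suc b) z₀ Z₀)) ⟩
    (b2n (z ≤ᵇ a) + below a Z') + (b2n (g <ᵇ suc b) + k) ≡⟨ interchange (b2n (z ≤ᵇ a)) (below a Z') (b2n (g <ᵇ suc b)) k ⟩
    (b2n (z ≤ᵇ a) + b2n (g <ᵇ suc b)) + (below a Z' + k) ≤⟨ +-mono-≤ (compare pr) (nextCol-least M X β' (Bounded-tail (suc b) X bX) (Bounded-⊑ β' (y ∷ ys) (remove-⊑ g (y ∷ ys)) bβ) Z' l'
        (⊑-remove Z (y ∷ ys) z g sub (cmin-mem M (suc b) z₀ Z₀) (cmin-mem M (suc b) y ys) λ m → Prec-antisym (first g m) pr)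
        (suc-injective (trans (sym (sumBy-remove (λ _ → 1) z Z (cmin-mem M (suc b) z₀ Z₀))) sz)) R' a) ⟩
    (b2n (g ≤ᵇ a) + b2n (z <ᵇ suc b)) + (below a G' + l') ≡⟨ sym (interchange (b2n (g ≤ᵇ a)) (below a G') (b2n (z <ᵇ suc b)) l') ⟩
    (b2n (g ≤ᵇ a) + below a G') + (b2n (z <ᵇ suc b) + l') ∎
  where
  open ≤-Reasoning
  Z = z₀ ∷ Z₀
  z = cmin M (suc b) z₀ Z₀
  Z' = removeOne z Z
  g = cmin M (suc b) y ys
  β' = removeOne g (y ∷ ys)
  G' = nextCol M X β'
  k = desc# X G'
  bx = bX (suc b) (mult-self (suc b) X)
  bZ : Bounded M Z
  bZ = Bounded-⊑ Z (y ∷ ys) sub bβ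
  first : ∀ y → 1 ≤ mult y Z → Prec (suc b) z y
  first y m = ckey-Prec M (suc b) _ y (proj₁ bx) (proj₂ bx) (proj₁ (bZ _ (cmin-mem M (suc b) z₀ Z₀))) (proj₂ (bZ y m)) (cmin-least M (suc b) z₀ Z₀ y m)
  zβ : 1 ≤ mult z (y ∷ ys)
  zβ = ≤-trans (cmin-mem M (suc b) z₀ Z₀) (sub z)
  pr : Prec (suc b) g z
  pr = ckey-Prec M (suc b) g z (proj₁ bx) (proj₂ bx) (proj₁ (bβ g (cmin-mem M (suc b) y ys))) (proj₂ (bβ z zβ)) (cmin-least M (suc b) y ys z zβ)
  compare : ∀ {x z} → Prec (suc b) x z → b2n (z ≤ᵇ a) + b2n (x <ᵇ suc b) ≤ b2n (x ≤ᵇ a) + b2n (z <ᵇ suc b)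
  compare {x} {z} p with <-≤-connex x (suc b) | <-≤-connex z (suc b)
  ... | inj₁ l | _ rewrite <ᵇ-yes l | <ᵇ-yes (proj₁ (Prec.wrap p l)) = +-monoˡ-≤ 1 (le (proj₂ (Prec.wrap p l)))
    where
    le : ∀ {x z} → x ≤ z → b2n (z ≤ᵇ a) ≤ b2n (x ≤ᵇ a)
    le {x} {z} h with z ≤ᵇ a in q
    ... | false = z≤n
    ... | true rewrite ≤ᵇ-yes (≤-trans h (≤ᵇ-elim z a q)) = ≤-refl
  ... | inj₂ r | inj₁ l rewrite <ᵇ-no r | <ᵇ-yes l with z ≤ᵇ a
  ...   | true = m≤n+m 1 (b2n (x ≤ᵇ a))
  ...   | false = z≤n
  compare {x} {z} p | inj₂ r | inj₂ l rewrite <ᵇ-no r | <ᵇ-no l = +-monoˡ-≤ 0 (le (Prec.up p r l))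
    where
    le : ∀ {x z} → x ≤ z → b2n (z ≤ᵇ a) ≤ b2n (x ≤ᵇ a)
    le {x} {z} h with z ≤ᵇ a in q
    ... | false = z≤n
    ... | true rewrite ≤ᵇ-yes (≤-trans h (≤ᵇ-elim z a q)) = ≤-refl

below-size : ∀ {M} xs → Bounded M xs → ∀ {a} → M ≤ a → below a xs ≡ size' xs
below-size xs b {a} le = ≤-antisym (below-≤size a xs) (size-≤below a xs λ y m → ≤-trans (proj₂ (b y m)) le)

below-suc : ∀ a zs → below (suc a) zs ≡ mult (suc a) zs + below a zs
below-suc a [] = refl
below-suc a (z ∷ zs) = trans (cong₂ _+_ (one z) (below-suc a zs)) (interchange (b2n (suc a ≡ᵇ z)) (b2n (z ≤ᵇ a)) (mult (suc a) zs) (below a zs))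
  where
  one : ∀ z → b2n (z ≤ᵇ suc a) ≡ b2n (suc a ≡ᵇ z) + b2n (z ≤ᵇ a)
  one z with <-cmp z (suc a)
  ... | tri< (s≤s lt) ne _ rewrite ≤ᵇ-yes (m≤n⇒m≤1+n lt) | ≡ᵇ-no (λ e → ne (sym e)) | ≤ᵇ-yes lt = refl
  ... | tri≈ _ refl _ rewrite ≤ᵇ-yes (≤-refl {suc a}) | ≡ᵇ-yes {a} refl | <ᵇ-no (≤-refl {a}) = refl
  ... | tri> _ ne gt rewrite ≤ᵇ-no gt | ≡ᵇ-no (λ e → ne (sym e)) | ≤ᵇ-no (<-trans ≤-refl gt) = refl

sumTo : ℕ → (ℕ → ℕ) → ℕ
sumTo zero    g = 0
sumTo (suc k) g = g (suc k) + sumTo k g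

sumTo-cong : ∀ k {g h} → (∀ x → 1 ≤ x → x ≤ k → g x ≡ h x) → sumTo k g ≡ sumTo k h
sumTo-cong zero e = refl
sumTo-cong (suc k) e = cong₂ _+_ (e (suc k) (s≤s z≤n) ≤-refl) (sumTo-cong k λ x a b → e x a (m≤n⇒m≤1+n b))

when : Bool → ℕ → ℕ
when b x = if b then x else 0

when-1 : ∀ b → when b 1 ≡ b2n b
when-1 true = refl
when-1 false = refl

-- xs lists the letters of c (in some order).
record Lists (M : ℕ) (c : Bits) (xs : List ℕ) : Set where
  constructor lists
  field
    sums : ∀ g → sumBy g xs ≡ sumTo M λ x → when (c x) (g x)

sumBy-++ : ∀ g xs ys → sumBy g (xs ++ ys) ≡ sumBy g xs + sumBy g ys
sumBy-++ g [] ys = refl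
sumBy-++ g (x ∷ xs) ys = trans (cong (λ v → g x + v) (sumBy-++ g xs ys)) (sym (+-assoc (g x) _ _))

asc-sum : ∀ M (c : Bits) g → sumBy g (asc M c) ≡ sumTo M (λ x → when (c x) (g x))
asc-sum zero c g = refl
asc-sum (suc M) c g = trans (sumBy-++ g (asc M c) _) (trans (+-comm (sumBy g (asc M c)) _) (cong₂ _+_ top (asc-sum M c g)))
  where
  top : sumBy g (if c (suc M) then suc M ∷ [] else []) ≡ when (c (suc M)) (g (suc M))
  top with c (suc M)
  ... | true = +-identityʳ _
  ... | false = refl

asc-lists : ∀ M c → Lists M c (asc M c)
asc-lists M c = lists (asc-sum M c)

sumTo-below : ∀ M (c : Bits) a → a ≤ M → sumTo M (λ x → when (c x) (b2n (x ≤ᵇ a))) ≡ cn a c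
sumTo-below zero c zero _ = refl
sumTo-below (suc M) c a le with m≤n⇒m<n∨m≡n le
... | inj₁ (s≤s lt) rewrite ≤ᵇ-no (s≤s lt) = trans (cong (λ h → h + sumTo M (λ x → when (c x) (b2n (x ≤ᵇ a)))) (none (c (suc M)))) (sumTo-below M c a lt)
  where
  none : ∀ b → when b 0 ≡ 0
  none true = refl
  none false = refl
... | inj₂ refl = all-in (suc M) ≤-refl
  where
  all-in : ∀ k → k ≤ suc M → sumTo k (λ x → when (c x) (b2n (x ≤ᵇ suc M))) ≡ cn k c
  all-in zero _ = refl
  all-in (suc k) le rewrite ≤ᵇ-yes le = cong₂ _+_ (when-1 (c (suc k))) (all-in k (<⇒≤ le))

sumTo-mult-out : ∀ M (c : Bits) x → (∀ y → 1 ≤ y → y ≤ M → x ≢ y) → sumTo M (λ y → when (c y) (b2n (x ≡ᵇ y))) ≡ 0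
sumTo-mult-out zero c x h = refl
sumTo-mult-out (suc M) c x h rewrite ≡ᵇ-no (h (suc M) (s≤s z≤n) ≤-refl) with c (suc M)
... | true = sumTo-mult-out M c x λ y a b → h y a (m≤n⇒m≤1+n b)
... | false = sumTo-mult-out M c x λ y a b → h y a (m≤n⇒m≤1+n b)

sumTo-mult : ∀ M (c : Bits) x → 1 ≤ x → x ≤ M → sumTo M (λ y → when (c y) (b2n (x ≡ᵇ y))) ≡ b2n (c x)
sumTo-mult zero c (suc x) _ ()
sumTo-mult (suc M) c x 1≤x le with m≤n⇒m<n∨m≡n le
... | inj₂ refl rewrite ≡ᵇ-yes {M} refl = trans (cong₂ _+_ (when-1 (c (suc M))) (sumTo-mult-out M c (suc M) λ y _ b e → <⇒≢ (s≤s b) (sym e))) (+-identityʳ _)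
... | inj₁ (s≤s lt) rewrite ≡ᵇ-no (<⇒≢ (s≤s lt)) with c (suc M)
...   | true = sumTo-mult M c x 1≤x lt
...   | false = sumTo-mult M c x 1≤x lt

module ListsProps {M c xs} (r : Lists M c xs) where
  multAt : ∀ x → 1 ≤ x → x ≤ M → mult x xs ≡ b2n (c x)
  multAt x a b = trans (Lists.sums r (λ y → b2n (x ≡ᵇ y))) (sumTo-mult M c x a b)
  belowAt : ∀ a → a ≤ M → below a xs ≡ cn a c
  belowAt a le = trans (Lists.sums r (λ y → b2n (y ≤ᵇ a))) (sumTo-below M c a le)
  bounded : Bounded M xs
  bounded x m with 1 ≤? x | x ≤? M
  ... | yes a | yes b = a , b
  ... | no a | _ = ⊥-elim (<⇒≱ m (≤-reflexive (trans (Lists.sums r (λ y → b2n (x ≡ᵇ y))) (sumTo-mult-out M c x λ y p _ e → a (subst (1 ≤_) (sym e) p)))))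
  ... | yes _ | no b = ⊥-elim (<⇒≱ m (≤-reflexive (trans (Lists.sums r (λ y → b2n (x ≡ᵇ y))) (sumTo-mult-out M c x λ y _ q e → b (subst (_≤ M) (sym e) q)))))
  sizeAt : size' xs ≡ cn M c
  sizeAt = trans (sym (below-size xs bounded ≤-refl)) (belowAt M ≤-refl)

lists-⊑ : ∀ {M c d xs ys} → Lists M c xs → Lists M d ys → (∀ x → 1 ≤ x → x ≤ M → c x ≡ true → d x ≡ true) → xs ⊑ ys
lists-⊑ {M} {c} {d} {xs} {ys} r r' h x with mult x xs in q
... | zero = z≤n
... | suc m = let (a , b) = ListsProps.bounded r x (subst (1 ≤_) (sym q) (s≤s z≤n)) in
  subst₂ _≤_ (trans (sym (ListsProps.multAt r x a b)) q) (sym (ListsProps.multAt r' x a b)) (imp (c x) (d x) (h x a b))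
  where
  imp : ∀ b d → (b ≡ true → d ≡ true) → b2n b ≤ b2n d
  imp false d _ = z≤n
  imp true d h rewrite h refl = ≤-refl

-- The R-matrix replaces Y by Y' ⊂ β at cost k.
record Step (M h : ℕ) (β Y Y' : List ℕ) (k : ℕ) : Set where
  field
    inside : Y' ⊑ β
    bβ : Bounded M β
    bY : Bounded M Y
    big : h ≤ size' β
    sizeY : size' Y ≡ h
    sizeY' : size' Y' ≡ h
    reach : Reach k Y' Y
    least : ∀ Z l → Z ⊑ β → size' Z ≡ h → Reach l Z Y → ∀ a → below a Y' + k ≤ below a Z + l

everywhere : ∀ {M} xs ys p q → Bounded M xs → Bounded M ys → (∀ a → a ≤ M → below a xs + p ≤ below a ys + q) → ∀ a → below a xs + p ≤ below a ys + q
everywhere {M} xs ys p q bx by h a with ≤-total a M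
... | inj₁ le = h a le
... | inj₂ ge = subst₂ (λ u v → u + p ≤ v + q) (cap xs bx) (cap ys by) (h M ≤-refl)
  where
  cap : ∀ xs → Bounded M xs → below M xs ≡ below a xs
  cap xs b = trans (below-size xs b ≤-refl) (sym (below-size xs b ge))

passStep : ∀ {M L R R' L' u b β Y Y'} → Pass M L R R' L' u → Lists M b β → Lists M R Y → Lists M R' Y'
  → (∀ x → 1 ≤ x → x ≤ M → b x ≡ true → L x ≡ true) → (∀ x → 1 ≤ x → x ≤ M → R' x ≡ true → b x ≡ true) → cn M R ≤ cn M b → Step M (cn M R) β Y Y' (u M)
passStep {M} {L} {R} {R'} {L'} {u} {b} {β} {Y} {Y'} (pass vt (z , 1≤z , z≤M , uz)) rβ rY rY' bL R'b bigger = record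
  { inside = lists-⊑ rY' rβ R'b ; bβ = ListsProps.bounded rβ ; bY = ListsProps.bounded rY
  ; big = ≤-trans bigger (≤-reflexive (sym (ListsProps.sizeAt rβ))) ; sizeY = ListsProps.sizeAt rY
  ; sizeY' = trans (ListsProps.sizeAt rY') sameSize
  ; reach = λ a → subst (_≤ below a Y' + u M) (+-identityʳ _) (everywhere Y Y' 0 (u M) (ListsProps.bounded rY) (ListsProps.bounded rY') reach₀ a)
  ; least = λ Z l sub sz R → everywhere Y' Z (u M) l (ListsProps.bounded rY') (Bounded-⊑ Z β sub (ListsProps.bounded rβ)) (λ a le → least₀ Z l sub sz R a le) }
  where
  -- the carry leaving site a + 1
  û : ℕ → ℕ
  û zero    = u M
  û (suc a) = u (suc a)
  û-prd : ∀ a → u (prd M (suc a)) ≡ û a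
  û-prd zero = refl
  û-prd (suc a) = refl
  v : ∀ a → suc a ≤ M → V (û (suc a)) (L (suc a)) (R (suc a)) (R' (suc a)) (L' (suc a)) (û a)
  v a le = subst (V (u (suc a)) (L (suc a)) (R (suc a)) (R' (suc a)) (L' (suc a))) (û-prd a) (vt (suc a) (s≤s z≤n) le)
  û-z : û z ≡ 0
  û-z = go z 1≤z uz
    where
    go : ∀ z → 1 ≤ z → u z ≡ 0 → û z ≡ 0
    go (suc z) _ h = h
  flow : ∀ a → a ≤ M → u M + cn a R' ≡ û a + cn a R
  flow zero _ = refl
  flow (suc a) le = step (v a le) (flow a (<⇒≤ le))
    where
    step : ∀ {k k' l r r' l'} → V k l r r' l' k' → u M + cn a R' ≡ k' + cn a R → u M + (b2n r' + cn a R') ≡ k + (b2n r + cn a R)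
    step nn h = h
    step {k} pick h = trans h (sym (+-suc k (cn a R)))
    step stay h = h
    step drop h = trans (+-suc (u M) (cn a R')) (cong suc h)
    step {k} both h = trans (+-suc (u M) (cn a R')) (trans (cong suc h) (sym (+-suc k (cn a R))))
  sameSize : cn M R' ≡ cn M R
  sameSize = +-cancelˡ-≡ (u M) _ _ (trans (flow M ≤-refl) (cong (λ h → h + cn M R) (ûM M refl)))
    where
    ûM : ∀ k → k ≡ M → û k ≡ u M
    ûM zero e = refl
    ûM (suc k) e = cong u e
  reach₀ : ∀ a → a ≤ M → below a Y + 0 ≤ below a Y' + u M
  reach₀ a le = begin
    below a Y + 0 ≡⟨ +-identityʳ _ ⟩
    below a Y ≡⟨ ListsProps.belowAt rY a le ⟩
    cn a R ≤⟨ m≤n+m _ (û a) ⟩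
    û a + cn a R ≡⟨ sym (flow a le) ⟩
    u M + cn a R' ≡⟨ +-comm (u M) _ ⟩
    cn a R' + u M ≡⟨ cong (λ h → h + u M) (sym (ListsProps.belowAt rY' a le)) ⟩
    below a Y' + u M ∎
    where open ≤-Reasoning
  least₀ : ∀ Z l → Z ⊑ β → size' Z ≡ cn M R → Reach l Z Y → ∀ a → a ≤ M → below a Y' + u M ≤ below a Z + l
  least₀ Z l sub sz rch a le = begin
    below a Y' + u M ≡⟨ cong (λ h → h + u M) (ListsProps.belowAt rY' a le) ⟩
    cn a R' + u M ≡⟨ +-comm _ (u M) ⟩
    u M + cn a R' ≡⟨ flow a le ⟩
    û a + cn a R ≤⟨ from (M ∸ a) a (≤-reflexive (m∸n+n≡m le)) fromTop ⟩
    below a Z + l ∎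
    where
    open ≤-Reasoning
    bZ : Bounded M Z
    bZ = Bounded-⊑ Z β sub (ListsProps.bounded rβ)
    Inv : ℕ → Set
    Inv a = û a + cn a R ≤ below a Z + l
    rch' : ∀ a → a ≤ M → cn a R ≤ below a Z + l
    rch' a le = subst (_≤ below a Z + l) (ListsProps.belowAt rY a le) (rch a)
    few : ∀ a → suc a ≤ M → mult (suc a) Z ≤ b2n (L (suc a))
    few a le = ≤-trans (sub (suc a)) (≤-trans (≤-reflexive (ListsProps.multAt rβ (suc a) (s≤s z≤n) le)) (imp (b (suc a)) (L (suc a)) (bL (suc a) (s≤s z≤n) le)))
      where
      imp : ∀ b d → (b ≡ true → d ≡ true) → b2n b ≤ b2n d
      imp false d _ = z≤n
      imp true d h rewrite h refl = ≤-refl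
    down : ∀ a → suc a ≤ M → Inv (suc a) → Inv a
    down a le h = step (v a le) (few a le) (subst (λ s → û (suc a) + cn (suc a) R ≤ s + l) (below-suc a Z) h)
      where
      step : ∀ {k k' x r r' l'} → V k x r r' l' k' → mult (suc a) Z ≤ b2n x → k + (b2n r + cn a R) ≤ (mult (suc a) Z + below a Z) + l → k' + cn a R ≤ below a Z + l
      step nn m h = ≤-trans h (+-monoˡ-≤ l (+-monoˡ-≤ (below a Z) m))
      step {k} pick m h = ≤-trans (≤-reflexive (sym (+-suc k (cn a R)))) (≤-trans h (+-monoˡ-≤ l (+-monoˡ-≤ (below a Z) m)))
      step stay m h = rch' a (<⇒≤ le)
      step drop m h = ≤-pred (≤-trans h (+-monoˡ-≤ l (+-monoˡ-≤ (below a Z) m)))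
      step {k} both m h = ≤-pred (≤-trans (≤-reflexive (sym (+-suc k (cn a R)))) (≤-trans h (+-monoˡ-≤ l (+-monoˡ-≤ (below a Z) m))))
    from : ∀ d a → d + a ≤ M → Inv (d + a) → Inv a
    from zero a le h = h
    from (suc d) a le h = from d a (<⇒≤ le) (down (d + a) le h)
    topBound : u M ≤ l
    topBound = subst₂ _≤_ (+-identityʳ (u M)) (cong (λ h → h + l) (below-zero 0 Z λ y m → proj₁ (bZ y m)))
      (from z 0 (≤-trans (≤-reflexive (+-identityʳ z)) z≤M) (subst Inv (sym (+-identityʳ z)) (subst (λ h → h + cn z R ≤ below z Z + l) (sym û-z) (rch' z z≤M))))
    fromTop : Inv (M ∸ a + a)
    fromTop = subst Inv (sym (m∸n+n≡m le)) (subst (λ h → h ≤ below M Z + l) (flow M ≤-refl)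
      (≤-trans (≤-reflexive (+-comm (u M) (cn M R'))) (+-mono-≤ (≤-reflexive (trans sameSize (trans (sym sz) (sym (below-size Z bZ ≤-refl))))) topBound)))

⊑-full : ∀ xs ys → xs ⊑ ys → size' xs ≡ size' ys → ∀ g → sumBy g xs ≡ sumBy g ys
⊑-full [] [] s e g = refl
⊑-full (x ∷ xs) ys s e g = trans (cong (λ v → g x + v) (⊑-full xs (removeOne x ys) sub (suc-injective (trans e (sumBy-remove (λ _ → 1) x ys mx))) g)) (sym (sumBy-remove g x ys mx))
  where
  mx : 1 ≤ mult x ys
  mx = ≤-trans (mult-self x xs) (s x)
  sub : xs ⊑ removeOne x ys
  sub y = +-cancelˡ-≤ (b2n (y ≡ᵇ x)) _ _ (≤-trans (s y) (≤-reflexive (sumBy-remove (λ v → b2n (y ≡ᵇ v)) x ys mx)))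

cost : ℕ → List ℕ → List ℕ → ℕ
cost M G Y = desc# G (nextCol M G Y)

nextCol-all : ∀ M G Y → size' G ≡ size' Y → ∀ g → sumBy g (nextCol M G Y) ≡ sumBy g Y
nextCol-all M G Y e = ⊑-full (nextCol M G Y) Y (nextCol-⊑ M G Y) (trans (nextCol-size M G Y (≤-reflexive e)) e)

cost-reach : ∀ M G Y → size' G ≡ size' Y → Reach (cost M G Y) G Y
cost-reach M G Y e a = subst (_≤ below a G + cost M G Y) (nextCol-all M G Y e (λ y → b2n (y ≤ᵇ a))) (nextCol-reach M G Y (≤-reflexive e) a)

cancel-size : ∀ {M} xs ys {p q} → Bounded M xs → Bounded M ys → size' xs ≡ size' ys → below M xs + p ≤ below M ys + q → p ≤ q
cancel-size {M} xs ys {p} {q} bx by e h = +-cancelˡ-≤ (below M xs) p q (subst (λ v → below M xs + p ≤ v + q) (trans (below-size ys by ≤-refl) (trans (sym e) (sym (below-size xs bx ≤-refl)))) h)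

cost-least : ∀ M G Y l → Bounded M G → Bounded M Y → size' G ≡ size' Y → Reach l G Y → cost M G Y ≤ l
cost-least M G Y l bG bY e R = cancel-size Y (nextCol M G Y) bY (Bounded-⊑ (nextCol M G Y) Y (nextCol-⊑ M G Y) bY) (sym (nextCol-all M G Y e (λ _ → 1)))
  (nextCol-least M G Y bG bY Y l (λ _ → ≤-refl) (sym e) R M)

record Col (M h : ℕ) (β : List ℕ) : Set where
  field
    bounded : Bounded M β
    big     : h ≤ size' β
    first   : ∀ Z → Z ⊑ β → size' Z ≡ h → ∀ a → below a Z ≤ below a (take h β)

-- The columns are listed from right to left; arr is the rightmost column of the filling γ, cut below row h, and
-- adj the number of descents among the first h rows.
arr : ℕ → ℕ → List (List ℕ) → List ℕ
arr M h []             = []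
arr M h (β ∷ [])       = take h β
arr M h (β ∷ (α ∷ cs)) = nextCol M (arr M h (α ∷ cs)) β

adj : ℕ → ℕ → List (List ℕ) → ℕ
adj M h []             = 0
adj M h (β ∷ [])       = 0
adj M h (β ∷ (α ∷ cs)) = adj M h (α ∷ cs) + desc# (arr M h (α ∷ cs)) (arr M h (β ∷ (α ∷ cs)))

take-⊑ : ∀ h xs → take h xs ⊑ xs
take-⊑ zero xs x = z≤n
take-⊑ (suc h) [] x = z≤n
take-⊑ (suc h) (y ∷ xs) x = +-monoʳ-≤ (b2n (x ≡ᵇ y)) (take-⊑ h xs x)

take-size : ∀ h xs → h ≤ size' xs → size' (take h xs) ≡ h
take-size zero xs _ = refl
take-size (suc h) (x ∷ xs) (s≤s le) = cong suc (take-size h xs le)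

data Cols (M h : ℕ) : List (List ℕ) → Set where
  []  : Cols M h []
  _∷_ : ∀ {β cs} → Col M h β → Cols M h cs → Cols M h (β ∷ cs)

arr-ok : ∀ {M h} β cs → Cols M h (β ∷ cs) → size' (arr M h (β ∷ cs)) ≡ h × Bounded M (arr M h (β ∷ cs))
arr-ok {M} {h} β [] (c ∷ _) = take-size h β (Col.big c) , Bounded-⊑ (take h β) β (take-⊑ h β) (Col.bounded c)
arr-ok {M} {h} β (α ∷ cs) (c ∷ ok) = let (s , _) = arr-ok α cs ok in
  trans (nextCol-size M (arr M h (α ∷ cs)) β (≤-trans (≤-reflexive s) (Col.big c))) s ,
  Bounded-⊑ (nextCol M (arr M h (α ∷ cs)) β) β (nextCol-⊑ M (arr M h (α ∷ cs)) β) (Col.bounded c)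

≤-split : ∀ {a b} → a ≤ b → ∃ λ m → b ≡ a + m
≤-split {a} {b} le = b ∸ a , sym (m+[n∸m]≡n le)

cancelMiddle : ∀ {x y} k {m} → x + k ≤ y + (k + m) → x ≤ y + m
cancelMiddle {x} {y} k {m} h = +-cancelʳ-≤ k x (y + m) (≤-trans h (≤-reflexive (trans (cong (λ v → y + v) (+-comm k m)) (sym (+-assoc y m k)))))

swap-step : ∀ {M h β Y Y' k} cs → Step M h β Y Y' k → Cols M h (β ∷ cs) → adj M h (Y ∷ β ∷ cs) ≡ adj M h (Y' ∷ cs) + k
swap-step {M} {h} {β} {Y} {Y'} {k} [] p (c ∷ []) = ≤-antisym
    (cost-least M G Y k bG P.bY (trans sG (sym P.sizeY)) λ a → ≤-trans (P.reach a) (+-monoˡ-≤ k (Col.first c Y' P.inside P.sizeY' a)))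
    (cancel-size Y' G (Bounded-⊑ Y' β P.inside P.bβ) bG (trans P.sizeY' (sym sG)) (P.least G (cost M G Y) (take-⊑ h β) sG (cost-reach M G Y (trans sG (sym P.sizeY))) M))
  where
  module P = Step p
  G = take h β
  sG = take-size h β (Col.big c)
  bG = Bounded-⊑ G β (take-⊑ h β) (Col.bounded c)
swap-step {M} {h} {β} {Y} {Y'} {k} (α ∷ cs) p (c ∷ ok) = trans (+-assoc A k₁ k₂) (trans (cong (λ v → A + v) (≤-antisym upper lower)) (sym (+-assoc A k₃ k)))
  where
  module P = Step p
  A = adj M h (α ∷ cs)
  X = arr M h (α ∷ cs)
  sX = proj₁ (arr-ok α cs ok)
  bX = proj₂ (arr-ok α cs ok)
  G = nextCol M X β
  sG = proj₁ (arr-ok β (α ∷ cs) (c ∷ ok))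
  bG = proj₂ (arr-ok β (α ∷ cs) (c ∷ ok))
  bY' = Bounded-⊑ Y' β P.inside P.bβ
  k₁ = desc# X G
  k₂ = cost M G Y
  k₃ = cost M X Y'
  Xβ : size' X ≤ size' β
  Xβ = ≤-trans (≤-reflexive sX) (Col.big c)
  GY = trans sG (sym P.sizeY)
  XY' = trans sX (sym P.sizeY')
  upper : k₁ + k₂ ≤ k₃ + k
  upper with ≤-split (cancel-size Y' G bY' bG (trans P.sizeY' (sym sG)) (greedy M))
    where
    greedy : ∀ a → below a Y' + k₁ ≤ below a G + k₃
    greedy = nextCol-least M X β bX (Col.bounded c) Y' k₃ P.inside (sym XY') (cost-reach M X Y' XY')
  ... | m , e = ≤-trans (+-monoʳ-≤ k₁ (cost-least M G Y (m + k) bG P.bY GY λ a → ≤-trans (P.reach a)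
          (≤-trans (+-monoˡ-≤ k (cancelMiddle {below a Y'} {below a G} k₁ (subst (λ v → below a Y' + k₁ ≤ below a G + v) e (greedy a)))) (≤-reflexive (+-assoc (below a G) m k)))))
        (≤-reflexive (trans (sym (+-assoc k₁ m k)) (cong (λ v → v + k) (sym e))))
    where
    greedy : ∀ a → below a Y' + k₁ ≤ below a G + k₃
    greedy = nextCol-least M X β bX (Col.bounded c) Y' k₃ P.inside (sym XY') (cost-reach M X Y' XY')
  lower : k₃ + k ≤ k₁ + k₂
  lower with ≤-split (cancel-size Y' G bY' bG (trans P.sizeY' (sym sG)) (P.least G k₂ (nextCol-⊑ M X β) sG (cost-reach M G Y GY) M))
  ... | m , e = ≤-trans (+-monoˡ-≤ k (cost-least M X Y' (k₁ + m) bX bY' XY' λ a → ≤-trans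
          (cancelMiddle {below a Y'} {below a G} k (subst (λ v → below a Y' + k ≤ below a G + v) e (P.least G k₂ (nextCol-⊑ M X β) sG (cost-reach M G Y GY) a)))
          (≤-trans (+-monoˡ-≤ m (nextCol-reach M X β Xβ a)) (≤-reflexive (+-assoc (below a X) k₁ m)))))
        (≤-reflexive (trans (+-assoc k₁ m k) (cong (λ v → k₁ + v) (trans (+-comm m k) (sym e)))))

-- The halves of a Kashiwara–Nakashima column

sumTo-first : ∀ k u → sumTo (suc k) u ≡ u 1 + sumTo k (λ x → u (suc x))
sumTo-first zero u = refl
sumTo-first (suc k) u = trans (cong (λ h → u (suc (suc k)) + h) (sumTo-first k u)) (x∙yz≈y∙xz (u (suc (suc k))) (u 1) _)

sumTo-rev : ∀ k u → sumTo k (λ x → u (suc k ∸ x)) ≡ sumTo k u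
sumTo-rev zero u = refl
sumTo-rev (suc k) u = trans (cong₂ _+_ (cong u (m+n∸n≡m 1 k)) (trans (sumTo-cong k λ x _ b → cong u (+-∸-assoc 1 (m≤n⇒m≤1+n b))) (sumTo-rev k (λ x → u (suc x))))) (sym (sumTo-first k u))

sumTo-+ : ∀ k u v → sumTo k (λ x → u x + v x) ≡ sumTo k u + sumTo k v
sumTo-+ zero u v = refl
sumTo-+ (suc k) u v = trans (cong (λ h → (u (suc k) + v (suc k)) + h) (sumTo-+ k u v)) (interchange (u (suc k)) (v (suc k)) (sumTo k u) (sumTo k v))

sumTo-top : ∀ n M u → n ≤ M → (∀ x → n < x → u x ≡ 0) → sumTo M u ≡ sumTo n u
sumTo-top n zero u z≤n h = refl
sumTo-top n (suc M) u le h with m≤n⇒m<n∨m≡n le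
... | inj₂ refl = refl
... | inj₁ (s≤s lt) rewrite h (suc M) (s≤s lt) = sumTo-top n M u lt h

filter-desc : ∀ P k (c : Bits) → filterB P (desc k c) ≡ desc k (λ z → c z ∧ P z)
filter-desc P zero c = refl
filter-desc P (suc k) c with c (suc k)
... | false = filter-desc P k c
... | true with P (suc k)
...   | true = cong (λ h → suc k ∷ h) (filter-desc P k c)
...   | false = filter-desc P k c

desc-top : ∀ n M (c : Bits) → n ≤ M → (∀ x → n < x → c x ≡ false) → desc M c ≡ desc n c
desc-top n zero c z≤n h = refl
desc-top n (suc M) c le h with m≤n⇒m<n∨m≡n le
... | inj₂ refl = refl
... | inj₁ (s≤s lt) rewrite h (suc M) (s≤s lt) = desc-top n M c lt h

largestBelow-≡ : ∀ ok m k → 1 ≤ m → m < k → ok m ≡ true → (∀ t → m < t → t < k → ok t ≡ false) → largestBelow ok k ≡ m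
largestBelow-≡ ok m (suc k) 1≤m (s≤s le) om none with m≤n⇒m<n∨m≡n le
... | inj₂ refl rewrite ≤ᵇ-yes 1≤m | om = refl
... | inj₁ lt rewrite none k lt ≤-refl | ≤ᵇ-yes (≤-trans 1≤m (<⇒≤ lt)) = largestBelow-≡ ok m k 1≤m lt om λ t a b → none t a (m<n⇒m<1+n b)

minℕ-above : ∀ {m} a b → m < a → m < b → m < minℕ a b
minℕ-above a b p q with a ≤ᵇ b
... | true = p
... | false = q

minℕ-below : ∀ {m} a b → m < minℕ a b → m < a × m < b
minℕ-below a b h with a ≤ᵇ b in q
... | true = h , <-≤-trans h (≤ᵇ-elim a b q)
... | false = <-trans h (≤ᵇ-elim-no a b q) , h

get : Maybe ℕ → ℕ
get (just t) = t
get nothing  = 0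

module _ (n : ℕ) (β : Column) where
  lk : ℕ → List (ℕ × ℕ) → Maybe ℕ
  lk = lookupT n β

  ts-keys : ∀ prev zs → map proj₁ (tsFrom n β prev zs) ≡ zs
  ts-keys prev [] = refl
  ts-keys prev (z ∷ zs) = cong (λ h → z ∷ h) (ts-keys _ zs)

  lk-skip : ∀ {x z t ps} → x ≢ z → lk x ((z , t) ∷ ps) ≡ lk x ps
  lk-skip ne rewrite ≡ᵇ-no ne = refl
  lk-here : ∀ {x t ps} → lk x ((x , t) ∷ ps) ≡ just t
  lk-here {x} rewrite ≡ᵇ-yes {x} refl = refl

  lk-none : ∀ (J : Bits) k ps → map proj₁ ps ≡ desc k J → ∀ x → (x ≤ k → J x ≡ false) → 1 ≤ x → lk x ps ≡ nothing
  lk-none J zero [] e x h _ = refl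
  lk-none J (suc k) ps e x h 1≤x with J (suc k) in q
  ... | false = lk-none J k ps e x (λ le → h (m≤n⇒m≤1+n le)) 1≤x
  lk-none J (suc k) ((z , t) ∷ ps) e x h 1≤x | true = trans (lk-skip {x} {z} {t} {ps} λ x≡z → let x≡k = trans x≡z (∷-injectiveˡ e) in true≢false q (trans (cong J (sym x≡k)) (h (≤-reflexive x≡k)))) (lk-none J k ps (∷-injectiveʳ e) x (λ le → h (m≤n⇒m≤1+n le)) 1≤x)

  lk-some : ∀ (J : Bits) k ps → map proj₁ ps ≡ desc k J → ∀ x → 1 ≤ x → x ≤ k → J x ≡ true → lk x ps ≡ just (get (lk x ps))
  lk-some J zero ps e (suc x) _ () jx
  lk-some J (suc k) ps e x 1≤x le jx with J (suc k) in q | m≤n⇒m<n∨m≡n le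
  ... | false | inj₁ (s≤s lt) = lk-some J k ps e x 1≤x lt jx
  ... | false | inj₂ refl = ⊥-elim (true≢false jx q)
  lk-some J (suc k) ((z , t) ∷ ps) e x 1≤x le jx | true | inj₂ refl with ∷-injectiveˡ e
  ... | refl = trans (lk-here {x} {t} {ps}) (cong (λ m → just (get m)) (sym (lk-here {x} {t} {ps})))
  lk-some J (suc k) ((z , t) ∷ ps) e x 1≤x le jx | true | inj₁ (s≤s lt) = trans sk (trans (lk-some J k ps (∷-injectiveʳ e) x 1≤x lt jx) (cong (λ m → just (get m)) (sym sk)))
    where
    sk = lk-skip {x} {z} {t} {ps} λ x≡z → <⇒≢ (s≤s lt) (trans x≡z (∷-injectiveˡ e))

  lk-sum : ∀ (J : Bits) k ps → map proj₁ ps ≡ desc k J → ∀ h → sumBy h (map proj₂ ps) ≡ sumTo k (λ x → when (J x) (h (get (lk x ps))))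
  lk-sum J zero [] e h = refl
  lk-sum J (suc k) ps e h with J (suc k)
  ... | false = lk-sum J k ps e h
  lk-sum J (suc k) ((z , t) ∷ ps) e h | true with ∷-injectiveˡ e
  ... | refl = cong₂ _+_ (cong (λ m → h (get m)) (sym (lk-here {suc k} {t} {ps})))
    (trans (lk-sum J k ps (∷-injectiveʳ e) h) (sumTo-cong k λ x _ b → cong (λ m → when (J x) (h (get m))) (sym (lk-skip {x} {suc k} {t} {ps} (<⇒≢ (s≤s b))))))

-- V at a site z of a column, in terms of the letters z̄ and z
data SiteV : ℕ → Bool → Bool → Bool → Bool → ℕ → Set where
  nn   : ∀ {k} → SiteV k true false false false k
  pick : ∀ {k} → SiteV k true true false true (suc k)
  stay : SiteV 0 false false false true 0
  drop : ∀ {k} → SiteV (suc k) false false true false k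
  both : ∀ {k} → SiteV k false true true true k

fromV : ∀ {k y l g k'} x → V k (not x) y l g k' → SiteV k x y l g k'
fromV true nn = nn
fromV true pick = pick
fromV false stay = stay
fromV false drop = drop
fromV false both = both

module Halves (n : ℕ) (β : Column) (isAsc : β ≡ asc (2 * n) (χ β)) (l g : Bits) (w : ℕ → ℕ) (isSplit : Split n (χ β) l g w) where
  M : ℕ
  M = 2 * n
  n≤M : n ≤ M
  n≤M = m≤m+n n _
  c J D free : Bits
  c = χ β
  J z = c z ∧ ((z ≤ᵇ n) ∧ c (bar n z))
  free = freeT n β
  D z = free z ∧ (0 <ᵇ w z)

  J-high : ∀ x → n < x → J x ≡ false
  J-high x lt rewrite ≤ᵇ-no lt with c x
  ... | true = refl
  ... | false = refl
  D-high : ∀ x → n < x → D x ≡ false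
  D-high x lt rewrite ≤ᵇ-no lt = refl

  keys : zsOf n β ≡ desc n J
  keys = trans (cong (filterB (λ z → (z ≤ᵇ n) ∧ c (bar n z))) (trans (cong reverse isAsc) (trans (cong reverse (sym (reverse-desc M c))) (reverse-involutive (desc M c)))))
    (trans (filter-desc (λ z → (z ≤ᵇ n) ∧ c (bar n z)) M c) (desc-top n M J n≤M J-high))

  ts : ℕ → List ℕ → List (ℕ × ℕ)
  ts = tsFrom n β

  siteAt : ∀ z → 1 ≤ z → z ≤ n → SiteV (w z) (c (bar n z)) (c z) (l z) (g z) (w (pred z))
  siteAt z a b = fromV (c (bar n z)) (Split.vert isSplit z a b)

  J-at : ∀ {z x y} → z ≤ n → c (bar n z) ≡ x → c z ≡ y → J z ≡ y ∧ x
  J-at {z} le refl refl = cong (λ t → c z ∧ (t ∧ c (bar n z))) (≤ᵇ-yes le)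
  free-at : ∀ {z x y} → z ≤ n → c (bar n z) ≡ x → c z ≡ y → free z ≡ not y ∧ not x
  free-at {z} le refl refl = cong (λ t → t ∧ not (c z) ∧ not (c (bar n z))) (≤ᵇ-yes le)
  D-at : ∀ {z x y k} → z ≤ n → c (bar n z) ≡ x → c z ≡ y → w z ≡ k → D z ≡ (not y ∧ not x) ∧ (0 <ᵇ k)
  D-at le a b e = cong₂ (λ f k → f ∧ (0 <ᵇ k)) (free-at le a b) e

  NoFree : ℕ → ℕ → List ℕ → Set
  NoFree a prev []       = ⊤
  NoFree a prev (z ∷ hi) = ∀ t → a < t → t < prev → t < z → free t ≡ false

  -- The greedy choice of the t_k, visiting the sites downwards: hi lists the z still waiting, prev is the last t chosen.
  greedy : ∀ a → a ≤ n → ∀ prev hi → a < prev → (∀ z → 1 ≤ mult z hi → a < z) → length hi ≡ w a → NoFree a prev hi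
    → ∀ h → sumBy h (map proj₂ (ts prev (hi ++ desc a J))) ≡ sumTo a (λ x → when (D x) (h x))
  greedy zero _ prev [] _ _ _ _ h = refl
  greedy zero _ prev (z ∷ hi) _ _ len _ h = ⊥-elim (1+n≢0 (trans len (Split.bot isSplit)))
  greedy (suc b) le prev hi b<prev above len nf h = go (siteAt (suc b) (s≤s z≤n) le) refl refl refl refl
    where
    ih = greedy b (<⇒≤ le)
    Goal : List ℕ → Set
    Goal hi = sumBy h (map proj₂ (ts prev (hi ++ desc (suc b) J))) ≡ sumTo (suc b) (λ x → when (D x) (h x))
    passOver : J (suc b) ≡ false → D (suc b) ≡ false → sumBy h (map proj₂ (ts prev (hi ++ desc b J))) ≡ sumTo b (λ x → when (D x) (h x)) → Goal hi
    passOver j d e = trans (cong (λ q → sumBy h (map proj₂ (ts prev (hi ++ (if q then suc b ∷ desc b J else desc b J))))) j)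
      (trans e (cong (λ q → when q (h (suc b)) + sumTo b (λ x → when (D x) (h x))) (sym d)))
    same : free (suc b) ≡ false → w b ≡ w (suc b) → sumBy h (map proj₂ (ts prev (hi ++ desc b J))) ≡ sumTo b (λ x → when (D x) (h x))
    same f e = ih prev hi (<⇒≤ b<prev) (λ z m → <⇒≤ (above z m)) (trans len (sym e)) (nf' hi nf) h
      where
      nf' : ∀ hi → NoFree (suc b) prev hi → NoFree b prev hi
      nf' [] _ = tt
      nf' (z ∷ _) nf t lt p q with m≤n⇒m<n∨m≡n lt
      ... | inj₁ lt' = nf t lt' p q
      ... | inj₂ refl = f
    waiting : ∀ hi → length hi ≡ 0 → w b ≡ 0 → sumBy h (map proj₂ (ts prev (hi ++ desc b J))) ≡ sumTo b (λ x → when (D x) (h x))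
    waiting [] _ e' = ih prev [] (<⇒≤ b<prev) (λ _ ()) (sym e') tt h
    go : ∀ {k x y l g k'} → SiteV k x y l g k' → w (suc b) ≡ k → c (bar n (suc b)) ≡ x → c (suc b) ≡ y → w b ≡ k' → Goal hi
    go nn wz cx cy wb = passOver (J-at le cx cy) (D-at le cx cy wz) (same (free-at le cx cy) (trans wb (sym wz)))
    go both wz cx cy wb = passOver (J-at le cx cy) (D-at le cx cy wz) (same (free-at le cx cy) (trans wb (sym wz)))
    go stay wz cx cy wb = passOver (J-at le cx cy) (D-at le cx cy wz) (waiting hi (trans len wz) wb)
    go pick wz cx cy wb = subst₂ (λ j f → sumBy h (map proj₂ (ts prev (hi ++ (if j then suc b ∷ desc b J else desc b J)))) ≡ when (f ∧ (0 <ᵇ w (suc b))) (h (suc b)) + sumTo b (λ x → when (D x) (h x)))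
        (sym (J-at le cx cy)) (sym (free-at le cx cy))
        (subst (λ ks → sumBy h (map proj₂ (ts prev ks)) ≡ _) (++-assoc hi (suc b ∷ []) (desc b J))
          (ih prev (hi ++ suc b ∷ []) (<⇒≤ b<prev) above' (trans (length-++ hi) (trans (+-comm (length hi) 1) (trans (cong suc (trans len wz)) (sym wb)))) (nf' hi nf) h))
      where
      above' : ∀ z → 1 ≤ mult z (hi ++ suc b ∷ []) → b < z
      above' z m with mult z hi in q
      ... | suc _ = <⇒≤ (above z (subst (1 ≤_) (sym q) (s≤s z≤n)))
      ... | zero with z ≡ᵇ suc b in e
      ...   | true = ≤-reflexive (sym (≡ᵇ-elim z (suc b) e))
      ...   | false = ⊥-elim (<⇒≱ m (≤-reflexive (trans (sumBy-++ (λ v → b2n (z ≡ᵇ v)) hi (suc b ∷ [])) (cong₂ (λ p r → p + (b2n r + 0)) q e))))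
      nf' : ∀ hi → NoFree (suc b) prev hi → NoFree b prev (hi ++ suc b ∷ [])
      nf' [] _ t lt p r = ⊥-elim (<⇒≱ r lt)
      nf' (z ∷ _) nf t lt p r with m≤n⇒m<n∨m≡n lt
      ... | inj₁ lt' = nf t lt' p r
      ... | inj₂ refl = free-at le cx cy
    go drop wz cx cy wb = dropped hi len above nf
      where
      dropped : ∀ hi → length hi ≡ w (suc b) → (∀ z → 1 ≤ mult z hi → suc b < z) → NoFree (suc b) prev hi → Goal hi
      dropped [] len _ _ = ⊥-elim (1+n≢0 (sym (trans len wz)))
      dropped (z ∷ hi) len above nf = trans (cong (λ q → sumBy h (map proj₂ (ts prev ((z ∷ hi) ++ (if q then suc b ∷ desc b J else desc b J))))) (J-at le cx cy))
        (trans (cong (λ t → h t + sumBy h (map proj₂ (ts t (hi ++ desc b J)))) (largestBelow-≡ free (suc b) (minℕ prev z) (s≤s z≤n) (minℕ-above prev z b<prev (above z (mult-self z hi))) (free-at le cx cy)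
            (λ t a r → let (p , q) = minℕ-below prev z r in nf t a p q)))
          (trans (cong (λ k → h (suc b) + k) (ih (suc b) hi ≤-refl (λ y m → <⇒≤ (above y (mult-tail y z hi m))) (trans (suc-injective (trans len wz)) (sym wb)) (vac hi) h))
            (cong (λ q → when q (h (suc b)) + sumTo b (λ x → when (D x) (h x))) (sym (D-at le cx cy wz)))))
        where
        vac : ∀ hi → NoFree b (suc b) hi
        vac [] = tt
        vac (_ ∷ _) t lt p _ = ⊥-elim (<⇒≱ p lt)

  chosen : ∀ h → sumBy h (map proj₂ (zt n β)) ≡ sumTo M (λ x → when (D x) (h x))
  chosen h = trans (cong (λ k → sumBy h (map proj₂ (ts (suc n) k))) keys)
    (trans (greedy n ≤-refl (suc n) [] ≤-refl (λ _ ()) (sym (Split.top isSplit)) tt h)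
      (sym (sumTo-top n M (λ x → when (D x) (h x)) n≤M λ x lt → cong (λ d → when d (h x)) (D-high x lt))))

  ps : List (ℕ × ℕ)
  ps = zt n β

  ps-keys : map proj₁ ps ≡ desc n J
  ps-keys = trans (ts-keys n β (suc n) (zsOf n β)) keys

  t# : ℕ → ℕ
  t# x = get (lk n β x ps)

  replaced : ∀ h → sumTo M (λ x → when (J x) (h (t# x))) ≡ sumTo M (λ x → when (D x) (h x))
  replaced h = trans (sumTo-top n M _ n≤M λ x lt → cong (λ d → when d (h (t# x))) (J-high x lt)) (trans (sym (lk-sum n β J n ps ps-keys h)) (chosen h))

  lk-J : ∀ x → 1 ≤ x → J x ≡ true → lk n β x ps ≡ just (t# x)
  lk-J x 1≤x j with <-≤-connex n x
  ... | inj₁ lt = ⊥-elim (true≢false j (J-high x lt))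
  ... | inj₂ le = lk-some n β J n ps ps-keys x 1≤x le j

  lk-notJ : ∀ x → 1 ≤ x → J x ≡ false → lk n β x ps ≡ nothing
  lk-notJ x 1≤x j = lk-none n β J n ps ps-keys x (λ _ → j) 1≤x

  J-low : ∀ x → J x ≡ true → x ≤ n × c x ≡ true × c (bar n x) ≡ true
  J-low x j = let (a , b) = ∧-elim {c x} j ; (a' , b') = ∧-elim {x ≤ᵇ n} b in ≤ᵇ-elim x n a' , a , b'

  replL-at : ∀ x → 1 ≤ x → ∀ b → J x ≡ b → replL n β x ≡ (if b then t# x else x)
  replL-at x 1≤x true j rewrite lk-J x 1≤x j | ≤ᵇ-yes (proj₁ (J-low x j)) = refl
  replL-at x 1≤x false j rewrite lk-notJ x 1≤x j = refl

  replR-at : ∀ x → 1 ≤ x → x ≤ M → ∀ b → J (bar n x) ≡ b → replR n β x ≡ (if b then bar n (t# (bar n x)) else x)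
  replR-at x 1≤x x≤M true j rewrite lk-J (bar n x) (proj₁ (bar-range n x 1≤x x≤M)) j
    | <ᵇ-yes {n} {x} (subst (n <_) (bar-bar n x (m≤n⇒m≤1+n x≤M)) (bar-high n (bar n x) (proj₁ (J-low (bar n x) j)))) = refl
  replR-at x 1≤x x≤M false j rewrite lk-notJ (bar n x) (proj₁ (bar-range n x 1≤x x≤M)) j = refl

  separate : ∀ (b j : Bool) p q → (j ≡ true → b ≡ true) → (h : ℕ → ℕ) → when b (h (if j then p else q)) ≡ when j (h p) + when (b ∧ not j) (h q)
  separate true true p q _ h = sym (+-identityʳ _)
  separate true false p q _ h = refl
  separate false false p q _ h = refl
  separate false true p q i h with i refl
  ... | ()

  colL-lists : Lists M (glue n l c) (colL n β)
  colL-lists = lists λ h → begin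
    sumBy h (colL n β) ≡⟨ sumBy-sort h (map (replL n β) β) ⟩
    sumBy h (map (replL n β) β) ≡⟨ sumBy-map h (replL n β) β ⟩
    sumBy (λ x → h (replL n β x)) β ≡⟨ cong (sumBy λ x → h (replL n β x)) isAsc ⟩
    sumBy (λ x → h (replL n β x)) (asc M c) ≡⟨ asc-sum M c (λ x → h (replL n β x)) ⟩
    sumTo M (λ x → when (c x) (h (replL n β x)))
      ≡⟨ sumTo-cong M (λ x a _ → trans (cong (λ r → when (c x) (h r)) (replL-at x a (J x) refl)) (separate (c x) (J x) (t# x) x (λ j → proj₁ (proj₂ (J-low x j))) h)) ⟩
    sumTo M (λ x → when (J x) (h (t# x)) + when (c x ∧ not (J x)) (h x)) ≡⟨ sumTo-+ M _ _ ⟩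
    sumTo M (λ x → when (J x) (h (t# x))) + sumTo M (λ x → when (c x ∧ not (J x)) (h x)) ≡⟨ cong (λ k → k + sumTo M (λ x → when (c x ∧ not (J x)) (h x))) (replaced h) ⟩
    sumTo M (λ x → when (D x) (h x)) + sumTo M (λ x → when (c x ∧ not (J x)) (h x)) ≡⟨ sym (sumTo-+ M _ _) ⟩
    sumTo M (λ x → when (D x) (h x) + when (c x ∧ not (J x)) (h x)) ≡⟨ sumTo-cong M (λ x a _ → result x a (h x)) ⟩
    sumTo M (λ x → when (glue n l c x) (h x)) ∎
    where
    open ≡-Reasoning
    result : ∀ x → 1 ≤ x → ∀ v → when (D x) v + when (c x ∧ not (J x)) v ≡ when (glue n l c x) v
    result x a v with <-≤-connex n x
    ... | inj₁ lt rewrite D-high x lt | J-high x lt | glue-high n l c x lt with c x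
    ...   | true = refl
    ...   | false = refl
    result x a v | inj₂ le = trans (go (siteAt x a le) refl refl refl) (cong (λ b → when b v) (sym (glue-low n l c x le)))
      where
      go : ∀ {k p y l' g' k'} → SiteV k p y l' g' k' → w x ≡ k → c (bar n x) ≡ p → c x ≡ y → when (D x) v + when (c x ∧ not (J x)) v ≡ when l' v
      go s wx p y rewrite D-at le p y wx | J-at le p y | y = fin s
        where
        fin : ∀ {k p y l' g' k'} → SiteV k p y l' g' k' → when ((not y ∧ not p) ∧ (0 <ᵇ k)) v + when (y ∧ not (y ∧ p)) v ≡ when l' v
        fin nn = refl
        fin pick = refl
        fin stay = refl
        fin drop = +-identityʳ v
        fin both = refl

  colR-lists : Lists M (glue n c (star n g)) (colR n β)
  colR-lists = lists λ h → begin
    sumBy h (colR n β) ≡⟨ sumBy-sort h (map (replR n β) β) ⟩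
    sumBy h (map (replR n β) β) ≡⟨ sumBy-map h (replR n β) β ⟩
    sumBy (λ x → h (replR n β x)) β ≡⟨ cong (sumBy λ x → h (replR n β x)) isAsc ⟩
    sumBy (λ x → h (replR n β x)) (asc M c) ≡⟨ asc-sum M c (λ x → h (replR n β x)) ⟩
    sumTo M (λ x → when (c x) (h (replR n β x)))
      ≡⟨ sumTo-cong M (λ x a b → trans (cong (λ r → when (c x) (h r)) (replR-at x a b (J (bar n x)) refl)) (separate (c x) (J (bar n x)) (bar n (t# (bar n x))) x (λ j → both-in x b j) h)) ⟩
    sumTo M (λ x → when (J (bar n x)) (h (bar n (t# (bar n x)))) + when (c x ∧ not (J (bar n x))) (h x)) ≡⟨ sumTo-+ M _ _ ⟩
    sumTo M (λ x → when (J (bar n x)) (h (bar n (t# (bar n x))))) + sumTo M (λ x → when (c x ∧ not (J (bar n x))) (h x))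
      ≡⟨ cong (λ k → k + sumTo M (λ x → when (c x ∧ not (J (bar n x))) (h x))) (trans (sumTo-rev M (λ z → when (J z) (h (bar n (t# z)))))
          (trans (replaced (λ t → h (bar n t))) (trans (sym (sumTo-rev M (λ z → when (D z) (h (bar n z)))))
            (sumTo-cong M λ x a b → cong (λ y → when (D (bar n x)) (h y)) (bar-bar n x (m≤n⇒m≤1+n b)))))) ⟩
    sumTo M (λ x → when (D (bar n x)) (h x)) + sumTo M (λ x → when (c x ∧ not (J (bar n x))) (h x)) ≡⟨ sym (sumTo-+ M _ _) ⟩
    sumTo M (λ x → when (D (bar n x)) (h x) + when (c x ∧ not (J (bar n x))) (h x)) ≡⟨ sumTo-cong M (λ x a b → result x a b (h x)) ⟩
    sumTo M (λ x → when (glue n c (star n g) x) (h x)) ∎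
    where
    open ≡-Reasoning
    both-in : ∀ x → x ≤ M → J (bar n x) ≡ true → c x ≡ true
    both-in x b j = trans (cong c (sym (bar-bar n x (m≤n⇒m≤1+n b)))) (proj₂ (proj₂ (J-low (bar n x) j)))
    result : ∀ x → 1 ≤ x → x ≤ M → ∀ v → when (D (bar n x)) v + when (c x ∧ not (J (bar n x))) v ≡ when (glue n c (star n g) x) v
    result x a b v with <-≤-connex n x
    ... | inj₂ le rewrite D-high (bar n x) (bar-high n x le) | J-high (bar n x) (bar-high n x le) | glue-low n c (star n g) x le with c x
    ...   | true = refl
    ...   | false = refl
    result x a b v | inj₁ lt = trans (go (siteAt z (proj₁ zr) z≤n') refl (cong c x≡) refl refl) (cong (λ q → when q v) (sym (glue-high n c (star n g) x lt)))
      where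
      z = bar n x
      zr = bar-range n x a b
      z≤n' = bar-low n x lt
      x≡ : bar n z ≡ x
      x≡ = bar-bar n x (m≤n⇒m≤1+n b)
      go : ∀ {k p y l' g' k'} → SiteV k p y l' g' k' → w z ≡ k → p ≡ c x → c z ≡ y → g' ≡ g z → when (D z) v + when (c x ∧ not (J z)) v ≡ when (not (g z)) v
      go s wx refl y refl rewrite D-at z≤n' (cong c x≡) y wx | J-at z≤n' (cong c x≡) y = fin s
        where
        fin : ∀ {k p y l' g' k'} → SiteV k p y l' g' k' → when ((not y ∧ not p) ∧ (0 <ᵇ k)) v + when (p ∧ not (y ∧ p)) v ≡ when (not g') v
        fin nn = refl
        fin pick = refl
        fin stay = refl
        fin drop = +-identityʳ v
        fin both = refl

open import Data.Integer using (ℤ; +_; -_) renaming (_+_ to _+ℤ_)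
import Data.Integer.Properties as ℤₚ
open import Algebra.Properties.AbelianGroup ℤₚ.+-0-abelianGroup using () renaming (∙-cancelʳ to ℤ-cancelʳ)

-- Propagation of the R-matrix and the energy along arrows

ΔH : Bool → Bool → ℤ
ΔH a b = if a ∧ b then - (+ 1) else if not a ∧ not b then + 1 else + 0

suc-neg : ∀ k → - (+ k) +ℤ - (+ 1) ≡ - (+ suc k)
suc-neg k = trans (sym (ℤₚ.neg-distrib-+ (+ k) (+ 1))) (cong (λ h → - (+ h)) (+-comm k 1))

pred-neg : ∀ k → - (+ suc k) +ℤ + 1 ≡ - (+ k)
pred-neg zero = refl
pred-neg (suc k) = refl

rule-ΔH : ∀ {j j' k k'} → Rule E 0 j j' k k' → j < 2 → - (+ k) +ℤ ΔH (j ≡ᵇ 0) (j' ≡ᵇ 0) ≡ - (+ k')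
rule-ΔH {k = k} (ll refl) _ = suc-neg k
rule-ΔH {k' = k'} (rr refl) _ = pred-neg k'
rule-ΔH lr _ = ℤₚ.+-identityʳ _
rule-ΔH rl _ = ℤₚ.+-identityʳ _
rule-ΔH {zero} (out a b) _ = ⊥-elim (a refl)
rule-ΔH {suc zero} (out a b) _ = ⊥-elim (b refl)
rule-ΔH {suc (suc j)} (out a b) (s≤s (s≤s ()))

record Arrow (M p q : ℕ) (x y : Pair) : Set where
  field
    en : 0 < epW (at p q (χ (proj₁ x)) ∷ at p q (χ (proj₂ x)) ∷ [])
    new₁ : proj₁ y ≡ asc M (swB (pos E (at p q (χ (proj₁ x)) ∷ at p q (χ (proj₂ x)) ∷ []) ≡ᵇ 0) p q (χ (proj₁ x)))
    new₂ : proj₂ y ≡ asc M (swB (pos E (at p q (χ (proj₁ x)) ∷ at p q (χ (proj₂ x)) ∷ []) ≡ᵇ 1) p q (χ (proj₂ x)))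

arrow : ∀ {O i M p q l r y} → l ≡ asc M (χ l) → r ≡ asc M (χ r) → SimpleSpec O i M p q (χ l) → SimpleSpec O i M p q (χ r)
  → e (pairOps O O) i (l , r) ≡ just y → Arrow M p q (l , r) y
arrow {O} {i} {M} {p} {q} {l} {r} el er sl sr eq = record
  { en = <ᵇ-elim 0 _ (proj₁ ij) ; new₁ = sym (cong proj₁ (proj₂ ij)) ; new₂ = sym (cong proj₂ (proj₂ ij)) }
  where
  ij = if-just (trans (sym (pair-spec (χ l) (χ r) sl sr)) (trans (cong₂ (λ g h → e (pairOps O O) i (g , h)) (sym el) (sym er)) eq))

module TypeA (k : ℕ) (σ : Pair → Pair) (H : Pair → ℤ) (isR : IsRMatrix (typeA (suc (suc k))) σ) (isE : IsEnergy (typeA (suc (suc k))) σ H) where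
  n = suc (suc k)
  K = typeA n

  data Idx : ℕ → ℕ → ℕ → Set where
    i0 : Idx 0 n 1
    i+ : ∀ {i} → suc (suc i) ≤ n → Idx (suc i) (suc i) (suc (suc i))

  idx-site : ∀ {i p q} → Idx i p q → Site n p q
  idx-site i0 = site-0 (s≤s (s≤s z≤n))
  idx-site (i+ le) = site-suc _ le

  idx-spec : ∀ {i p q} → Idx i p q → ∀ c → SimpleSpec (colA n) i n p q c
  idx-spec i0 c = colA-spec0 k c
  idx-spec (i+ {i} le) c = colA-spec n i c le

  toCol : ∀ r b → T (validA n r b) → IsCol n r b
  toCol r b v = let (a , v') = ∧-elim {length b ≡ᵇ r} (T→≡ v) ; (si , ir) = ∧-elim {strictInc b} v'
                    eq = asc-decomp n b si ir in
    isCol eq (trans (sym (length-asc n (χ b))) (trans (cong length (sym eq)) (≡ᵇ-elim (length b) r a)))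

  fromCol : ∀ r b → IsCol n r b → T (validA n r b)
  fromCol r b (isCol eq sz) = ≡→T (subst (λ l → validA n r l ≡ true) (sym eq)
    (∧-intro (≡ᵇ-yes (trans (length-asc n (χ b)) sz)) (∧-intro (asc-strict n (χ b)) (asc-range n n (χ b) ≤-refl))))

  toPair : ∀ s t x → InPair K s t x → IsCol n s (proj₁ x) × IsCol n t (proj₂ x)
  toPair s t (l , r) v = let (a , b) = ∧-elim {validA n s l} (T→≡ v) in toCol s l (≡→T a) , toCol t r (≡→T b)

  fromPair : ∀ s t x → IsCol n s (proj₁ x) → IsCol n t (proj₂ x) → InPair K s t x
  fromPair s t (l , r) a b = ≡→T (∧-intro (T→≡ (fromCol s l a)) (T→≡ (fromCol t r b)))

  Inv : Pair → Set
  Inv x = ∃ λ u → Pass n (χ (proj₁ x)) (χ (proj₂ x)) (χ (proj₁ (σ x))) (χ (proj₂ (σ x))) u × H x ≡ - (+ u n)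

  e0Left-pos : ∀ {s t} z → IsCol n s (proj₁ z) × IsCol n t (proj₂ z) → e0Left K z ≡ (pos E (at n 1 (χ (proj₁ z)) ∷ at n 1 (χ (proj₂ z)) ∷ []) ≡ᵇ 0)
  e0Left-pos (l , r) (isCol el _ , isCol er _) = trans
    (cong₂ _<ᵇ_ (trans (cong (φc (colA n) 0) er) (ColSpec.φS (colA-spec0 k (χ r)))) (trans (cong (εc (colA n) 0) el) (ColSpec.εS (colA-spec0 k (χ l)))))
    (left-pos (at n 1 (χ l)) (at n 1 (χ r)))

  energy-change : ∀ {i p q} → Idx i p q → ∀ {s t} x → IsCol n s (proj₁ x) × IsCol n t (proj₂ x) → IsCol n t (proj₁ (σ x)) × IsCol n s (proj₂ (σ x)) →
    let j = pos E (at p q (χ (proj₁ x)) ∷ at p q (χ (proj₂ x)) ∷ []) ; j' = pos E (at p q (χ (proj₁ (σ x))) ∷ at p q (χ (proj₂ (σ x))) ∷ []) in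
    ∀ {u u' : ℕ → ℕ} → j < 2 → Rule E 0 j j' (u p) (u' p) → (∀ a → a ≢ p → u' a ≡ u a) → - (+ u n) +ℤ deltaH K σ i x ≡ - (+ u' n)
  energy-change (i+ le) x c c' j<2 rule oth = trans (ℤₚ.+-identityʳ _) (cong (λ h → - (+ h)) (sym (oth n (>⇒≢ le))))
  energy-change i0 x c c' {u} j<2 rule oth = trans (cong (- (+ u n) +ℤ_) (cong₂ ΔH (e0Left-pos x c) (e0Left-pos (σ x) c'))) (rule-ΔH rule j<2)

  module Prop {s t} (hs : HeightOK K s) (ht : HeightOK K t) {i p q} (ix : Idx i p q) (x y : Pair)
    (vx : InPair K s t x) (ey : e (pairK K) i x ≡ just y) where
    st = idx-site ix
    open SiteProps st
    R = isR s t hs ht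
    vσ = proj₁ R x vx
    eσ : e (pairK K) i (σ x) ≡ just (σ y)
    eσ = trans (proj₁ (proj₂ (proj₂ (proj₂ R))) i x vx) (cong (mapMaybe σ) ey)
    A : Arrow n p q x y
    A = let (a , b) = toPair s t x vx in arrow (IsCol.list a) (IsCol.list b) (idx-spec ix _) (idx-spec ix _) ey
    A' : Arrow n p q (σ x) (σ y)
    A' = let (a , b) = toPair t s (σ x) vσ in arrow (IsCol.list a) (IsCol.list b) (idx-spec ix _) (idx-spec ix _) eσ
    module A = Arrow A
    module A' = Arrow A'
    ca cb da db : Bits
    ca = χ (proj₁ x)
    cb = χ (proj₂ x)
    da = χ (proj₁ (σ x))
    db = χ (proj₂ (σ x))
    w w' : List Two
    w = at p q ca ∷ at p q cb ∷ []
    w' = at p q da ∷ at p q db ∷ []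
    j j' : ℕ
    j = pos E w
    j' = pos E w'
    n₁ : ∀ a → 1 ≤ a → a ≤ n → χ (proj₁ y) a ≡ swB (j ≡ᵇ 0) p q ca a
    n₁ a l h rewrite A.new₁ = χ-asc n (swB (j ≡ᵇ 0) p q ca) a l h
    n₂ : ∀ a → 1 ≤ a → a ≤ n → χ (proj₂ y) a ≡ swB (j ≡ᵇ 1) p q cb a
    n₂ a l h rewrite A.new₂ = χ-asc n (swB (j ≡ᵇ 1) p q cb) a l h
    m₁ : ∀ a → 1 ≤ a → a ≤ n → χ (proj₁ (σ y)) a ≡ swB (j' ≡ᵇ 0) p q da a
    m₁ a l h rewrite A'.new₁ = χ-asc n (swB (j' ≡ᵇ 0) p q da) a l h
    m₂ : ∀ a → 1 ≤ a → a ≤ n → χ (proj₂ (σ y)) a ≡ swB (j' ≡ᵇ 1) p q db a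
    m₂ a l h rewrite A'.new₂ = χ-asc n (swB (j' ≡ᵇ 1) p q db) a l h
    Hy : H y ≡ H x +ℤ deltaH K σ i x
    Hy = proj₁ (isE s t hs ht) i x y vx ey
    energy : ∀ {u u' : ℕ → ℕ} → Rule E 0 j j' (u p) (u' p) → (∀ a → a ≢ p → u' a ≡ u a) → - (+ u n) +ℤ deltaH K σ i x ≡ - (+ u' n)
    energy {u} {u'} = energy-change ix x (toPair s t x vx) (toPair t s (σ x) vσ) {u} {u'} (pos-bound E w A.en)

    forward : Inv x → Inv y
    forward (u , ps , h) with passMove E st ps (now {w = []}) A.en
    ... | u' , ps' , rule , oth = u' ,
      Pass-cong (λ a l h → sym (n₁ a l h)) (λ a l h → sym (n₂ a l h)) (λ a l h → sym (m₁ a l h)) (λ a l h → sym (m₂ a l h)) ps' ,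
      trans Hy (trans (cong (_+ℤ deltaH K σ i x) h) (energy {u} {u'} rule oth))

    backward : Inv y → Inv x
    backward (u , ps , h) = go {pos F (at p q L ∷ at p q R₀ ∷ [])} {pos F (at p q R' ∷ at p q L' ∷ [])} (proj₁ W) (proj₁ W')
      (passMove F {L = L} {R = R₀} {R' = R'} {L' = L'} {m = 0} st ps' (now {w = []}) (proj₂ W))
      where
      L = swB (j ≡ᵇ 0) p q ca
      R₀ = swB (j ≡ᵇ 1) p q cb
      R' = swB (j' ≡ᵇ 0) p q da
      L' = swB (j' ≡ᵇ 1) p q db
      ps' : Pass n (swB (j ≡ᵇ 0) p q ca) (swB (j ≡ᵇ 1) p q cb) (swB (j' ≡ᵇ 0) p q da) (swB (j' ≡ᵇ 1) p q db) u
      ps' = Pass-cong n₁ n₂ m₁ m₂ ps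
      W = word-2 st ca cb A.en
      W' = word-2 st da db A'.en
      go : ∀ {J J'} → J ≡ j → J' ≡ j' → (∃ λ u' →
        Pass n (swB (J ≡ᵇ 0) p q (swB (j ≡ᵇ 0) p q ca)) (swB (J ≡ᵇ 1) p q (swB (j ≡ᵇ 1) p q cb))
               (swB (J' ≡ᵇ 0) p q (swB (j' ≡ᵇ 0) p q da)) (swB (J' ≡ᵇ 1) p q (swB (j' ≡ᵇ 1) p q db)) u'
        × Rule F 0 J J' (u p) (u' p) × (∀ a → a ≢ p → u' a ≡ u a)) → Inv x
      go refl refl (u' , ps'' , rule , oth) = u' ,
        Pass-cong (λ a _ _ → swB-swB st (j ≡ᵇ 0) ca a) (λ a _ _ → swB-swB st (j ≡ᵇ 1) cb a)
                  (λ a _ _ → swB-swB st (j' ≡ᵇ 0) da a) (λ a _ _ → swB-swB st (j' ≡ᵇ 1) db a) ps'' ,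
        ℤ-cancelʳ (deltaH K σ i x) (H x) (- (+ u' n))
          (trans (sym Hy) (trans h (sym (energy {u'} {u} (Rule-flip rule) (λ a ne → sym (oth a ne))))))

Chain-cong : ∀ {M G G' H H' u₁ u₂} → EqQ M G H → EqQ M G' H' → Chain M G G' u₁ u₂ → Chain M H H' u₁ u₂
Chain-cong (eqQ a b c d) (eqQ a' b' c' d') (chain P₁ P₂ P₃ P₄) =
  chain (Pass-cong b c idd idd P₁) (Pass-cong a idd a' idd P₂) (Pass-cong idd d' idd d P₃) (Pass-cong b' c' idd idd P₄)
  where
  idd : ∀ {M} {c : Bits} → c ≗[ M ] c
  idd x _ _ = refl

word-CC : ℕ → ℕ → Bits → Bits → List Two
word-CC n i a b = at (2 * n ∸ i) (suc (2 * n ∸ i)) a ∷ at i (suc i) a ∷ at (2 * n ∸ i) (suc (2 * n ∸ i)) b ∷ at i (suc i) b ∷ []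

data CArrow (op : Op) (n : ℕ) (a b a' b' : Bits) : ℕ → Set where
  inner : ∀ {i} → 1 ≤ i → i < n → let u = 2 * n ∸ i ; j = pos op (word-CC n i a b) in
    0 < stat op (word-CC n i a b)
    → a' ≗[ 2 * n ] swB (j ≡ᵇ 0) u (suc u) (swB (j ≡ᵇ 1) i (suc i) a) → b' ≗[ 2 * n ] swB (j ≡ᵇ 2) u (suc u) (swB (j ≡ᵇ 3) i (suc i) b)
    → CArrow op n a b a' b' i
  last : let j = pos op (at n (suc n) a ∷ at n (suc n) b ∷ []) in
    0 < stat op (at n (suc n) a ∷ at n (suc n) b ∷ []) → a' ≗[ 2 * n ] swB (j ≡ᵇ 0) n (suc n) a → b' ≗[ 2 * n ] swB (j ≡ᵇ 1) n (suc n) b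
    → CArrow op n a b a' b' n
  affine : let j = pos op (at (2 * n) 1 a ∷ at (2 * n) 1 b ∷ []) in
    0 < stat op (at (2 * n) 1 a ∷ at (2 * n) 1 b ∷ []) → a' ≗[ 2 * n ] swB (j ≡ᵇ 0) (2 * n) 1 a → b' ≗[ 2 * n ] swB (j ≡ᵇ 1) (2 * n) 1 b
    → CArrow op n a b a' b' 0

unB : ∀ {M p q} → Site M p q → ∀ k {c c' : Bits} → c' ≗[ M ] swB k p q c → c ≗[ M ] swB k p q c'
unB {p = p} {q} s k {c} {c'} h x a b = trans (sym (swB-swB s k c x)) (swB-at k p q x (sym (h p 1≤p p≤M)) (sym (h q 1≤q q≤M)) (sym (h x a b)))
  where open SiteProps s

at-cong : ∀ {M p q} → Site M p q → ∀ {c d : Bits} → c ≗[ M ] d → at p q c ≡ at p q d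
at-cong s h = cong₂ _,_ (h _ 1≤q q≤M) (h _ 1≤p p≤M)
  where open SiteProps s

swAt-4 : ∀ j {A B C D : Two} → _≡_ {A = List Two} (swIf (j ≡ᵇ 0) A ∷ swIf (j ≡ᵇ 1) B ∷ swIf (j ≡ᵇ 2) C ∷ swIf (j ≡ᵇ 3) D ∷ []) (swAt j (A ∷ B ∷ C ∷ D ∷ []))
swAt-4 0 = refl
swAt-4 1 = refl
swAt-4 2 = refl
swAt-4 3 = refl
swAt-4 (suc (suc (suc (suc j)))) = refl

opp : Op → Op
opp E = F
opp F = E

act-sigF : ∀ w → 0 < phW w → suc (phW (act F w)) ≡ phW w × epW (act F w) ≡ suc (epW w) × pos E (act F w) ≡ pos F w
act-sigF (c ∷ w) en with phW w ≤ᵇ ε₁ c in q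
act-sigF ((true , true) ∷ w) en | true = ⊥-elim (<⇒≱ en (≤-reflexive (m≤n⇒m∸n≡0 (≤ᵇ-elim (phW w) 0 q))))
act-sigF ((false , false) ∷ w) en | true = ⊥-elim (<⇒≱ en (≤-reflexive (m≤n⇒m∸n≡0 (≤ᵇ-elim (phW w) 0 q))))
act-sigF ((true , false) ∷ w) en | true = ⊥-elim (<⇒≱ en (≤-reflexive (m≤n⇒m∸n≡0 (≤ᵇ-elim (phW w) 1 q))))
act-sigF ((false , true) ∷ w) en | true with phW w | ≤ᵇ-elim (phW w) 0 q
... | zero | _ = refl , trans (+-comm (epW w) 1) (cong suc (sym (+-identityʳ (epW w)))) , refl
act-sigF (c ∷ w) en | false with ≤ᵇ-elim-no (phW w) (ε₁ c) q
... | lt with act-sigF w (≤-<-trans z≤n lt)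
... | a , b , d = go (≤-pred (subst (suc (ε₁ c) ≤_) (sym a) lt))
  where
  go : ε₁ c ≤ phW (act F w) → suc (phW (c ∷ act F w)) ≡ phW (c ∷ w) × epW (c ∷ act F w) ≡ suc (epW (c ∷ w)) × pos E (c ∷ act F w) ≡ suc (pos F w)
  go le rewrite sym a | b | <ᵇ-no le | m≤n⇒m∸n≡0 le | m≤n⇒m∸n≡0 (m≤n⇒m≤1+n le) =
    trans (sym (+-suc (φ₁ c) _)) (cong (λ h → φ₁ c + h) (sym (+-∸-assoc 1 le))) , refl , cong suc d

undo : ∀ op w w' → 0 < stat op w → w' ≡ swAt (pos op w) w → pos (opp op) w' ≡ pos op w × 0 < stat (opp op) w'
undo E w w' en eq = let (_ , b , c) = act-sig w en ; eq' = trans eq (sym (act-swAt E w)) in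
  trans (cong (pos F) eq') c , subst (0 <_) (sym (trans (cong phW eq') b)) (s≤s z≤n)
undo F w w' en eq = let (_ , b , c) = act-sigF w en ; eq' = trans eq (sym (act-swAt F w)) in
  trans (cong (pos E) eq') c , subst (0 <_) (sym (trans (cong epW eq') b)) (s≤s z≤n)

undo-2 : ∀ op {M p q} → Site M p q → ∀ a b {a' b' : Bits} → let w = at p q a ∷ at p q b ∷ [] ; w' = at p q a' ∷ at p q b' ∷ [] in
  0 < stat op w → a' ≗[ M ] swB (pos op w ≡ᵇ 0) p q a → b' ≗[ M ] swB (pos op w ≡ᵇ 1) p q b → pos (opp op) w' ≡ pos op w × 0 < stat (opp op) w'
undo-2 op {p = p} {q} s a b {a'} {b'} en ha hb = undo op w (at p q a' ∷ at p q b' ∷ []) en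
  (trans (cong₂ (λ g h → g ∷ h ∷ []) (trans (at-cong s ha) (at-swB ne (pos op w ≡ᵇ 0) a)) (trans (at-cong s hb) (at-swB ne (pos op w ≡ᵇ 1) b))) (swAt-2 (pos op w) (at p q a) (at p q b)))
  where
  w : List Two
  w = at p q a ∷ at p q b ∷ []
  ne = SiteProps.p≢q s

reverseArrow : ∀ op {n a b a' b' i} → 1 ≤ n → CArrow op n a b a' b' i → CArrow (opp op) n a' b' a b i
reverseArrow op {n} {a} {b} {a'} {b'} 1≤n (last en ha hb) with undo-2 op (Bd-site 1≤n bN) a b en ha hb
... | e , en' = last en' (subst (λ j → a ≗[ 2 * n ] swB (j ≡ᵇ 0) n (suc n) a') (sym e) (unB (Bd-site 1≤n bN) (pos op (at n (suc n) a ∷ at n (suc n) b ∷ []) ≡ᵇ 0) ha))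
                         (subst (λ j → b ≗[ 2 * n ] swB (j ≡ᵇ 1) n (suc n) b') (sym e) (unB (Bd-site 1≤n bN) (pos op (at n (suc n) a ∷ at n (suc n) b ∷ []) ≡ᵇ 1) hb))
reverseArrow op {n} {a} {b} {a'} {b'} 1≤n (affine en ha hb) with undo-2 op (Bd-site 1≤n b0) a b en ha hb
... | e , en' = affine en' (subst (λ j → a ≗[ 2 * n ] swB (j ≡ᵇ 0) (2 * n) 1 a') (sym e) (unB (Bd-site 1≤n b0) (pos op (at (2 * n) 1 a ∷ at (2 * n) 1 b ∷ []) ≡ᵇ 0) ha))
                           (subst (λ j → b ≗[ 2 * n ] swB (j ≡ᵇ 1) (2 * n) 1 b') (sym e) (unB (Bd-site 1≤n b0) (pos op (at (2 * n) 1 a ∷ at (2 * n) 1 b ∷ []) ≡ᵇ 1) hb))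
reverseArrow op {n} {a} {b} {a'} {b'} {i} _ (inner 1≤i i<n en ha hb) =
  inner 1≤i i<n (proj₂ U) (back ha (proj₁ U)) (back' hb (proj₁ U))
  where
  open Inner n i 1≤i i<n
  w w' : List Two
  w = word-CC n i a b
  w' = word-CC n i a' b'
  j : ℕ
  j = pos op w
  module MA = Moved (j ≡ᵇ 0) (j ≡ᵇ 1) a a' ha
  module MB = Moved (j ≡ᵇ 2) (j ≡ᵇ 3) b b' hb
  n<su : n < su
  n<su = <-trans n<u ≤-refl
  atU : ∀ {k c c'} → (∀ x → n < x → x ≤ M → c' x ≡ swB k u su c x) → at u su c' ≡ swIf k (at u su c)
  atU {k} {c} h = trans (cong₂ _,_ (h su n<su su≤M) (h u n<u (<⇒≤ su≤M))) (at-swB u≢su k c)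
  atX : ∀ {k c c'} → (∀ x → 1 ≤ x → x ≤ n → c' x ≡ swB k p q c x) → at p q c' ≡ swIf k (at p q c)
  atX {k} {c} h = trans (cong₂ _,_ (h q (s≤s z≤n) i<n) (h p 1≤i (<⇒≤ i<n))) (at-swB p≢q k c)
  w'≡ : w' ≡ swAt j w
  w'≡ = trans (cong₂ _∷_ (atU {j ≡ᵇ 0} {a} MA.highC) (cong₂ _∷_ (atX {j ≡ᵇ 1} {a} MA.lowC) (cong₂ _∷_ (atU {j ≡ᵇ 2} {b} MB.highC) (cong₂ _∷_ (atX {j ≡ᵇ 3} {b} MB.lowC) refl))))
    (swAt-4 j)
  U = undo op w w' en w'≡
  swap : ∀ {k k' c c'} → c' ≗[ M ] swB k u su (swB k' p q c) → c ≗[ M ] swB k u su (swB k' p q c')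
  swap {k} {k'} {c} {c'} h x l le with <-≤-connex n x
  ... | inj₁ lt = trans (trans (sym (swB-swB site-high k c x)) (swB-at k u su x (sym (hC u n<u (<⇒≤ su≤M))) (sym (hC su n<su su≤M)) (sym (hC x lt le))))
                    (swB-at k u su {c'} {swB k' p q c'} x (sym (um u n<u)) (sym (um su n<su)) (sym (um x lt)))
    where
    hC = Moved.highC k k' c c' h
    um : ∀ y → n < y → swB k' p q c' y ≡ c' y
    um y lt = swB-other k' p q c' y (>⇒≢ (<-trans i<n lt)) (>⇒≢ (≤-<-trans i<n lt))
  ... | inj₂ le' = trans (trans (sym (swB-swB site-low k' c x)) (swB-at k' p q x (sym (lC p 1≤i (<⇒≤ i<n))) (sym (lC q (s≤s z≤n) i<n)) (sym (lC x l le'))))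
                    (sym (swB-other k u su (swB k' p q c') x (<⇒≢ (≤-<-trans le' n<u)) (<⇒≢ (≤-<-trans le' n<su))))
    where lC = Moved.lowC k k' c c' h
  back : a' ≗[ M ] swB (j ≡ᵇ 0) u su (swB (j ≡ᵇ 1) p q a) → ∀ {J} → J ≡ j → a ≗[ M ] swB (J ≡ᵇ 0) u su (swB (J ≡ᵇ 1) p q a')
  back h refl = swap {j ≡ᵇ 0} {j ≡ᵇ 1} h
  back' : b' ≗[ M ] swB (j ≡ᵇ 2) u su (swB (j ≡ᵇ 3) p q b) → ∀ {J} → J ≡ j → b ≗[ M ] swB (J ≡ᵇ 2) u su (swB (J ≡ᵇ 3) p q b')
  back' h refl = swap {j ≡ᵇ 2} {j ≡ᵇ 3} h

affinePos : Op → ℕ → Bits → Bits → ℕ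
affinePos op n a b = pos op (at (2 * n) 1 a ∷ at (2 * n) 1 b ∷ [])

ΔTotal : Op → Bool → Bool → ℕ → ℕ → Set
ΔTotal E x y h h' = - (+ h) +ℤ ΔH x y ≡ - (+ h')
ΔTotal F x y h h' = - (+ h') +ℤ ΔH x y ≡ - (+ h)

twoTotals : ∀ op {j j' h h₁ h₂} → j < 2 → j' < 2 → Total op (fstPos op j) (fstPos op j') h h₁ → Total op (sndPos op j) (sndPos op j') h₁ h₂
  → ΔTotal op (j ≡ᵇ 0) (j' ≡ᵇ 0) h h₂
twoTotals E {zero} {zero} {h} _ _ (tL₀ refl) tLR₁ = suc-neg h
twoTotals E {zero} {suc zero} _ _ tLR₀ tLR₁ = ℤₚ.+-identityʳ _
twoTotals E {suc zero} {zero} _ _ tRL t3 = ℤₚ.+-identityʳ _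
twoTotals E {suc zero} {suc zero} {h₁ = h₁} _ _ (tR refl) t3 = pred-neg h₁
twoTotals F {zero} {zero} {h₂ = h₂} _ _ tLR₁ (tL₀ refl) = suc-neg h₂
twoTotals F {zero} {suc zero} _ _ tLR₁ tLR₀ = ℤₚ.+-identityʳ _
twoTotals F {suc zero} {zero} _ _ t3 tRL = ℤₚ.+-identityʳ _
twoTotals F {suc zero} {suc zero} {h = h} _ _ t3 (tR refl) = pred-neg h
twoTotals op {suc (suc j)} (s≤s (s≤s ())) _ _ _
twoTotals op {j} {suc (suc j')} _ (s≤s (s≤s ())) _ _

record Pushed (op : Op) (M p q p' q' : ℕ) (G G' H H' : Quad) (u₁ u₂ : ℕ → ℕ) : Set where
  j₁ = pos op (atQ p q G)
  j₁' = pos op (atQ p q G')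
  j₂ = pos op (atQ p' q' (flipQ j₁ p q G))
  j₂' = pos op (atQ p' q' (flipQ j₁' p q G'))
  field
    v₁ v₂ x₁ x₂ : ℕ → ℕ
    isChain : Chain M H H' v₁ v₂
    rules₁ : Rules op j₁ j₁' (u₁ p) (x₁ p) (u₂ p) (x₂ p)
    rules₂ : Rules op j₂ j₂' (x₁ p') (v₁ p') (x₂ p') (v₂ p')
    off₁ : ∀ a → a ≢ p → x₁ a ≡ u₁ a × x₂ a ≡ u₂ a
    off₂ : ∀ a → a ≢ p' → v₁ a ≡ x₁ a × v₂ a ≡ x₂ a

chainPush : ∀ op {M p q p' q' G G' H H' u₁ u₂} → Site M p q → Site M p' q' → Steps op M p q p' q' G H → Steps op M p q p' q' G' H'
  → Chain M G G' u₁ u₂ → Pushed op M p q p' q' G G' H H' u₁ u₂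
chainPush op s s' t t' c =
  case chainMove op s c (Steps.en₁ t) of λ { (x₁ , x₂ , c₁ , r₁ , o₁ , _) →
  case chainMove op s' c₁ (Steps.en₂ t) of λ { (v₁ , v₂ , c₂ , r₂ , o₂ , _) → record
    { v₁ = v₁ ; v₂ = v₂ ; x₁ = x₁ ; x₂ = x₂ ; isChain = Chain-cong (Steps.end t) (Steps.end t') c₂
    ; rules₁ = r₁ ; rules₂ = r₂ ; off₁ = o₁ ; off₂ = o₂ } } }

data Elem (op : Op) (n : ℕ) (a b c d : Bits) (h h' : ℕ) : ℕ → Set where
  classical : ∀ {i} → h' ≡ h → Elem op n a b c d h h' (suc i)
  affine    : ΔTotal op (affinePos op n a b ≡ᵇ 0) (affinePos op n c d ≡ᵇ 0) h h' → Elem op n a b c d h h' 0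

record Inv₄ (φ : Emb) (n : ℕ) (a b c d : Bits) (h : ℕ) : Set where
  constructor inv₄
  field
    sa : Spl n a
    sb : Spl n b
    sc : Spl n c
    sd : Spl n d
    u₁ u₂ : ℕ → ℕ
    isChain : Chain (2 * n) (emq φ LR n sa sb) (emq LR φ n sc sd) u₁ u₂
    energy : u₁ (2 * n) + u₂ (2 * n) ≡ h

pushC : ∀ op φ {n a b c d a' b' c' d' i h} → 1 ≤ n → CArrow op n a b a' b' i → CArrow op n c d c' d' i → Inv₄ φ n a b c d h
  → ∃ λ h' → Inv₄ φ n a' b' c' d' h' × Elem op n a b c d h h' i
pushC op φ {n} {a} {b} {c} {d} {a'} {b'} {c'} {d'} {i} 1≤n (inner 1≤i i<n en ha hb) (inner _ _ en' hc hd) (inv₄ sa sb sc sd u₁ u₂ ch refl) =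
  P.v₁ M + P.v₂ M , inv₄ A.sa' A.sb' C'.sa' C'.sb' P.v₁ P.v₂ P.isChain refl , el 1≤i (cong₂ _+_ (trans (proj₁ o₂) (proj₁ o₁)) (trans (proj₂ o₂) (proj₂ o₁)))
  where
  open Inner n i 1≤i i<n
  module A = InnerStep.Enabled n i 1≤i i<n op a b a' b' sa sb en ha hb
  module C' = InnerStep.Enabled n i 1≤i i<n op c d c' d' sc sd en' hc hd
  module P = Pushed (chainPush op site-low site-high (A.steps φ LR) (C'.steps LR φ) ch)
  o₁ = P.off₁ M (>⇒≢ (<-≤-trans i<n (m≤m+n n _)))
  o₂ = P.off₂ M (>⇒≢ su≤M)
  el : ∀ {i h h'} → 1 ≤ i → h' ≡ h → Elem op n a b c d h h' i
  el {suc i} _ e = classical e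
pushC op φ {suc n'} {a} {b} {c} {d} {a'} {b'} {c'} {d'} 1≤n (last en ha hb) (last en' hc hd) (inv₄ sa sb sc sd u₁ u₂ ch refl) =
  P.v₁ M + P.v₂ M , inv₄ A.sa' A.sb' C'.sa' C'.sb' P.v₁ P.v₂ P.isChain refl , classical (cong₂ _+_ (trans (proj₁ o₂) (proj₁ o₁)) (trans (proj₂ o₂) (proj₂ o₁)))
  where
  n = suc n'
  M = 2 * n
  module A = BoundaryStep n n (suc n) n 1≤n bN op a b a' b' sa sb en ha hb
  module C' = BoundaryStep n n (suc n) n 1≤n bN op c d c' d' sc sd en' hc hd
  module P = Pushed (chainPush op (Bd-site 1≤n bN) (Bd-site 1≤n bN) (A.At.steps φ LR) (C'.At.steps LR φ) ch)
  M≢n : M ≢ n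
  M≢n = >⇒≢ (Site.q≤M (Bd-site 1≤n bN))
  o₁ = P.off₁ M M≢n
  o₂ = P.off₂ M M≢n
pushC op φ {n} {a} {b} {c} {d} {a'} {b'} {c'} {d'} 1≤n (affine en ha hb) (affine en' hc hd) (inv₄ sa sb sc sd u₁ u₂ ch refl) =
  P.v₁ M + P.v₂ M , inv₄ A.sa' A.sb' C'.sa' C'.sb' P.v₁ P.v₂ P.isChain refl ,
  affine (twoTotals op A.j<2 C'.j<2
    (subst₂ (λ j j' → Total op j j' (u₁ M + u₂ M) (P.x₁ M + P.x₂ M)) (A.At.j₁≡ φ LR) (C'.At.j₁≡ LR φ) (total op P.rules₁))
    (subst₂ (λ j j' → Total op j j' (P.x₁ M + P.x₂ M) (P.v₁ M + P.v₂ M)) (A.At.j₂≡ φ LR) (C'.At.j₂≡ LR φ) (total op P.rules₂)))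
  where
  M = 2 * n
  module A = BoundaryStep n M 1 1 1≤n b0 op a b a' b' sa sb en ha hb
  module C' = BoundaryStep n M 1 1 1≤n b0 op c d c' d' sc sd en' hc hd
  module P = Pushed (chainPush op (Bd-site 1≤n b0) (Bd-site 1≤n b0) (A.At.steps φ LR) (C'.At.steps LR φ) ch)
pushC op φ 1≤n (inner _ i<n _ _ _) (last _ _ _) _ = ⊥-elim (<-irrefl refl i<n)
pushC op φ 1≤n (last _ _ _) (inner _ i<n _ _ _) _ = ⊥-elim (<-irrefl refl i<n)
pushC op φ 1≤n (inner () _ _ _ _) (affine _ _ _) _
pushC op φ 1≤n (affine _ _ _) (inner () _ _ _ _) _
pushC op φ () (last _ _ _) (affine _ _ _) _
pushC op φ () (affine _ _ _) (last _ _ _) _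

colWord : ∀ U X {A : Set} (d d' : A) → (if φ₁ X <ᵇ ε₁ U then just d else (if 0 <ᵇ ε₁ X then just d' else nothing))
    ≡ (if 0 <ᵇ epW (U ∷ X ∷ []) then just (if pos E (U ∷ X ∷ []) ≡ᵇ 0 then d else d') else nothing)
  × ε₁ X + (ε₁ U ∸ φ₁ X) ≡ epW (U ∷ X ∷ []) × φ₁ U + (φ₁ X ∸ ε₁ U) ≡ phW (U ∷ X ∷ [])
colWord (false , false) (false , false) d d' = refl , refl , refl
colWord (false , false) (false , true)  d d' = refl , refl , refl
colWord (false , false) (true , false)  d d' = refl , refl , refl
colWord (false , false) (true , true)   d d' = refl , refl , refl
colWord (false , true)  (false , false) d d' = refl , refl , refl
colWord (false , true)  (false , true)  d d' = refl , refl , refl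
colWord (false , true)  (true , false)  d d' = refl , refl , refl
colWord (false , true)  (true , true)   d d' = refl , refl , refl
colWord (true , false)  (false , false) d d' = refl , refl , refl
colWord (true , false)  (false , true)  d d' = refl , refl , refl
colWord (true , false)  (true , false)  d d' = refl , refl , refl
colWord (true , false)  (true , true)   d d' = refl , refl , refl
colWord (true , true)   (false , false) d d' = refl , refl , refl
colWord (true , true)   (false , true)  d d' = refl , refl , refl
colWord (true , true)   (true , false)  d d' = refl , refl , refl
colWord (true , true)   (true , true)   d d' = refl , refl , refl

pairWord : ∀ u w {X Y : Set} (x : X) (y : Y) (gx : ℕ → X) (gy : ℕ → Y) → length u ≡ 2 →
  (if phW w <ᵇ epW u then mapMaybe (λ a → a , y) (if 0 <ᵇ epW u then just (gx (pos E u)) else nothing)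
                     else mapMaybe (λ b → x , b) (if 0 <ᵇ epW w then just (gy (pos E w)) else nothing))
  ≡ (if 0 <ᵇ epW (u ++ w) then just ((if pos E (u ++ w) <ᵇ 2 then gx (pos E (u ++ w)) else x) , (if pos E (u ++ w) <ᵇ 2 then y else gy (pos E (u ++ w) ∸ 2))) else nothing)
pairWord u w x y gx gy len rewrite pos-++ E u w | epW-++ u w with phW w <ᵇ epW u in q
... | true rewrite <ᵇ-yes {0} {epW u} (≤-<-trans z≤n (<ᵇ-elim (phW w) (epW u) q))
    | <ᵇ-yes {0} {epW w + (epW u ∸ phW w)} (≤-trans (m<n⇒0<n∸m (<ᵇ-elim (phW w) (epW u) q)) (m≤n+m _ (epW w)))
    | <ᵇ-yes {pos E u} {2} (subst (pos E u <_) len (pos-bound E u (≤-<-trans z≤n (<ᵇ-elim (phW w) (epW u) q)))) = refl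
... | false rewrite len | m≤n⇒m∸n≡0 (<ᵇ-elim-no (phW w) (epW u) q) | +-identityʳ (epW w) with 0 <ᵇ epW w
...   | true = refl
...   | false = refl

no-pair-1 : ∀ {n c} → 1 ≤ n → Spl n c → ¬ (c 1 ≡ true × c (2 * n) ≡ true)
no-pair-1 {n} {c} 1≤n s (e , e') = <⇒≱ (s≤s (s≤s z≤n)) (subst (_≤ 1) (cong₂ (λ x y → (b2n x + 0) + (b2n y + 0)) e e') (Split⇒KN (Spl.isSplit s) 1 1≤n))

module TypeC (n' : ℕ) (σ : Pair → Pair) (H : Pair → ℤ) (isR : IsRMatrix (typeC (suc n')) σ) (isE : IsEnergy (typeC (suc n')) σ H) where
  n M : ℕ
  n = suc n'
  M = 2 * n
  K : KRType
  K = typeC n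

  toPair : ∀ s t x → InPair K s t x → IsColC n s (proj₁ x) × IsColC n t (proj₂ x)
  toPair s t (l , r) v = let (a , b) = ∧-elim {validC n s l} (T→≡ v) in toColC n s l (≡→T a) , toColC n t r (≡→T b)

  fromPair : ∀ s t x → IsColC n s (proj₁ x) → IsColC n t (proj₂ x) → InPair K s t x
  fromPair s t (l , r) a b = ≡→T (∧-intro (T→≡ (fromColC n s l a)) (T→≡ (fromColC n t r b)))

  EArrow : ℕ → Pair → Pair → Set
  EArrow i x y = CArrow E n (χ (proj₁ x)) (χ (proj₂ x)) (χ (proj₁ y)) (χ (proj₂ y)) i

  fromSimple : ∀ {p q x y} (A : Arrow M p q x y) → let j = pos E (at p q (χ (proj₁ x)) ∷ at p q (χ (proj₂ x)) ∷ []) in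
    χ (proj₁ y) ≗[ M ] swB (j ≡ᵇ 0) p q (χ (proj₁ x)) × χ (proj₂ y) ≗[ M ] swB (j ≡ᵇ 1) p q (χ (proj₂ x))
  fromSimple {p} {q} {x} {y} A = (λ a l h → trans (cong (λ b → χ b a) (Arrow.new₁ A)) (χ-asc M _ a l h)) , (λ a l h → trans (cong (λ b → χ b a) (Arrow.new₂ A)) (χ-asc M _ a l h))

  module InnerPair (i : ℕ) (1≤i : 1 ≤ i) (i<n : i < n) (a b : Bits) where
    u su q : ℕ
    u = 2 * n ∸ i
    su = suc u
    q = suc i
    colWordSpec : ∀ c → ColSpec (colC n) i M c (epW (at u su c ∷ at i q c ∷ [])) (phW (at u su c ∷ at i q c ∷ []))
      (if 0 <ᵇ epW (at u su c ∷ at i q c ∷ []) then just (if pos E (at u su c ∷ at i q c ∷ []) ≡ᵇ 0 then sw u su c else sw i q c) else nothing)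
    colWordSpec c = go i 1≤i i<n
      where
      go : ∀ i → 1 ≤ i → i < n → let u = 2 * n ∸ i in ColSpec (colC n) i M c (epW (at u (suc u) c ∷ at i (suc i) c ∷ [])) (phW (at u (suc u) c ∷ at i (suc i) c ∷ []))
        (if 0 <ᵇ epW (at u (suc u) c ∷ at i (suc i) c ∷ []) then just (if pos E (at u (suc u) c ∷ at i (suc i) c ∷ []) ≡ᵇ 0 then sw u (suc u) c else sw i (suc i) c) else nothing)
      go (suc i) _ lt with colC-spec n i c lt | colWord (at (2 * n ∸ suc i) (suc (2 * n ∸ suc i)) c) (at (suc i) (suc (suc i)) c) (sw (2 * n ∸ suc i) (suc (2 * n ∸ suc i)) c) (sw (suc i) (suc (suc i)) c)
      ... | spec x y z | e , f , g = spec (trans x f) (trans y g) (trans z (cong (mapMaybe (asc M)) e))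
    A B W : List Two
    A = at u su a ∷ at i q a ∷ []
    B = at u su b ∷ at i q b ∷ []
    W = word-CC n i a b
    ga gb : ℕ → Column
    ga k = asc M (if k ≡ᵇ 0 then sw u su a else sw i q a)
    gb k = asc M (if k ≡ᵇ 0 then sw u su b else sw i q b)
    pairSpec : e (pairK K) i (asc M a , asc M b) ≡
      (if 0 <ᵇ epW W then just ((if pos E W <ᵇ 2 then ga (pos E W) else asc M a) , (if pos E W <ᵇ 2 then asc M b else gb (pos E W ∸ 2))) else nothing)
    pairSpec with colWordSpec a | colWordSpec b
    ... | spec εa φa ea | spec εb φb eb rewrite εa | φb | ea | eb = trans
      (cong₂ (λ g h → if phW B <ᵇ epW A then mapMaybe (λ a' → a' , asc M b) g else mapMaybe (λ b' → asc M a , b') h) (mm (0 <ᵇ epW A)) (mm (0 <ᵇ epW B)))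
      (pairWord A B (asc M a) (asc M b) ga gb refl)
      where
      mm : ∀ t {d} → mapMaybe (asc M) (if t then just d else nothing) ≡ (if t then just (asc M d) else nothing)
      mm true = refl
      mm false = refl
    pick₁ : ∀ j → (if j <ᵇ 2 then ga j else asc M a) ≡ asc M (swB (j ≡ᵇ 0) u su (swB (j ≡ᵇ 1) i q a))
    pick₁ 0 = refl
    pick₁ 1 = refl
    pick₁ (suc (suc j)) = refl
    pick₂ : ∀ j → j < 4 → (if j <ᵇ 2 then asc M b else gb (j ∸ 2)) ≡ asc M (swB (j ≡ᵇ 2) u su (swB (j ≡ᵇ 3) i q b))
    pick₂ 0 _ = refl
    pick₂ 1 _ = refl
    pick₂ 2 _ = refl
    pick₂ 3 _ = refl
    pick₂ (suc (suc (suc (suc j)))) (s≤s (s≤s (s≤s (s≤s ()))))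

  toArrow : ∀ i → i ≤ n → ∀ {s t} x y → IsColC n s (proj₁ x) → IsColC n t (proj₂ x) → e (pairK K) i x ≡ just y → EArrow i x y
  toArrow zero _ x y (isColC (isCol el _) sl) (isColC (isCol er _) sr) ey =
    let A = arrow el er (colC-spec0 n' _ (no-pair-1 (s≤s z≤n) sl)) (colC-spec0 n' _ (no-pair-1 (s≤s z≤n) sr)) ey
        (a , b) = fromSimple A in affine (Arrow.en A) a b
  toArrow (suc i) le x y (isColC (isCol el _) sl) (isColC (isCol er _) sr) ey with m≤n⇒m<n∨m≡n le
  ... | inj₂ refl = let A = arrow el er (colC-specN n' _) (colC-specN n' _) ey ; (a , b) = fromSimple A in last (Arrow.en A) a b
  ... | inj₁ lt = inner (s≤s z≤n) lt (<ᵇ-elim 0 _ (proj₁ ij))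
      (λ a l h → trans (cong (λ b → χ b a) (trans (sym (cong proj₁ (proj₂ ij))) (pick₁ (pos E W)))) (χ-asc M _ a l h))
      (λ a l h → trans (cong (λ b → χ b a) (trans (sym (cong proj₂ (proj₂ ij))) (pick₂ (pos E W) (pos-bound E W (<ᵇ-elim 0 _ (proj₁ ij)))))) (χ-asc M _ a l h))
    where
    open InnerPair (suc i) (s≤s z≤n) lt (χ (proj₁ x)) (χ (proj₂ x))
    ij = if-just (trans (sym pairSpec) (trans (cong₂ (λ g h → e (pairK K) (suc i) (g , h)) (sym el) (sym er)) ey))

  Inv : Emb → Pair → Set
  Inv φ x = ∃ λ h → Inv₄ φ n (χ (proj₁ x)) (χ (proj₂ x)) (χ (proj₁ (σ x))) (χ (proj₂ (σ x))) h × H x ≡ - (+ h)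

  e0Left-pos : ∀ {s t} z → IsColC n s (proj₁ z) → IsColC n t (proj₂ z) → e0Left K z ≡ (affinePos E n (χ (proj₁ z)) (χ (proj₂ z)) ≡ᵇ 0)
  e0Left-pos (l , r) (isColC (isCol el _) sl) (isColC (isCol er _) sr) = trans
    (cong₂ _<ᵇ_ (trans (cong (φc (colC n) 0) er) (ColSpec.φS (colC-spec0 n' (χ r) (no-pair-1 (s≤s z≤n) sr))))
                (trans (cong (εc (colC n) 0) el) (ColSpec.εS (colC-spec0 n' (χ l) (no-pair-1 (s≤s z≤n) sl)))))
    (left-pos (at M 1 (χ l)) (at M 1 (χ r)))

  module Prop {s t} (hs : HeightOK K s) (ht : HeightOK K t) {i} (i≤n : i ≤ n) (x y : Pair)
    (vx : InPair K s t x) (ey : e (pairK K) i x ≡ just y) where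
    R = isR s t hs ht
    vσ = proj₁ R x vx
    eσ : e (pairK K) i (σ x) ≡ just (σ y)
    eσ = trans (proj₁ (proj₂ (proj₂ (proj₂ R))) i x vx) (cong (mapMaybe σ) ey)
    cx = toPair s t x vx
    cσ = toPair t s (σ x) vσ
    A : EArrow i x y
    A = toArrow i i≤n x y (proj₁ cx) (proj₂ cx) ey
    A' : EArrow i (σ x) (σ y)
    A' = toArrow i i≤n (σ x) (σ y) (proj₁ cσ) (proj₂ cσ) eσ
    Hy : H y ≡ H x +ℤ deltaH K σ i x
    Hy = proj₁ (isE s t hs ht) i x y vx ey
    Δ≡ : deltaH K σ 0 x ≡ ΔH (affinePos E n (χ (proj₁ x)) (χ (proj₂ x)) ≡ᵇ 0) (affinePos E n (χ (proj₁ (σ x))) (χ (proj₂ (σ x))) ≡ᵇ 0)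
    Δ≡ = cong₂ ΔH (e0Left-pos x (proj₁ cx) (proj₂ cx)) (e0Left-pos (σ x) (proj₁ cσ) (proj₂ cσ))

    forward : ∀ φ → Inv φ x → Inv φ y
    forward φ (h , iv , Hx) = go (pushC E φ (s≤s z≤n) A A' iv)
      where
      Δ : ℕ → Set
      Δ h' = Elem E n (χ (proj₁ x)) (χ (proj₂ x)) (χ (proj₁ (σ x))) (χ (proj₂ (σ x))) h h' i
      fin : ∀ {h'} → Δ h' → - (+ h) +ℤ deltaH K σ i x ≡ - (+ h')
      fin (classical refl) = ℤₚ.+-identityʳ _
      fin (affine d) = trans (cong (- (+ h) +ℤ_) Δ≡) d
      go : (∃ λ h' → Inv₄ φ n (χ (proj₁ y)) (χ (proj₂ y)) (χ (proj₁ (σ y))) (χ (proj₂ (σ y))) h' × Δ h') → Inv φ y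
      go (h' , iv' , el) = h' , iv' , trans Hy (trans (cong (_+ℤ deltaH K σ i x) Hx) (fin el))

    backPos : ∀ {a b a' b'} → CArrow E n a b a' b' 0 → affinePos F n a' b' ≡ affinePos E n a b
    backPos {a} {b} (affine en ha hb) = proj₁ (undo-2 E (Bd-site (s≤s z≤n) b0) a b en ha hb)
    backPos (inner () _ _ _ _)

    backward : ∀ φ → Inv φ y → Inv φ x
    backward φ (h , iv , Hy') = go (pushC F φ (s≤s z≤n) (reverseArrow E (s≤s z≤n) A) (reverseArrow E (s≤s z≤n) A') iv)
      where
      Δ : ℕ → Set
      Δ h' = Elem F n (χ (proj₁ y)) (χ (proj₂ y)) (χ (proj₁ (σ y))) (χ (proj₂ (σ y))) h h' i
      fin : ∀ {h'} → EArrow i x y → EArrow i (σ x) (σ y) → Δ h' → - (+ h') +ℤ deltaH K σ i x ≡ - (+ h)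
      fin _ _ (classical refl) = ℤₚ.+-identityʳ _
      fin {h'} A A' (affine d) = trans (cong (- (+ h') +ℤ_) (trans Δ≡ (cong₂ (λ j j' → ΔH (j ≡ᵇ 0) (j' ≡ᵇ 0)) (sym (backPos A)) (sym (backPos A'))))) d
      go : (∃ λ h' → Inv₄ φ n (χ (proj₁ x)) (χ (proj₂ x)) (χ (proj₁ (σ x))) (χ (proj₂ (σ x))) h' × Δ h') → Inv φ x
      go (h' , iv' , el) = h' , iv' , ℤ-cancelʳ (deltaH K σ i x) (H x) (- (+ h')) (trans (sym Hy) (trans Hy' (sym (fin A A' el))))

-- Connectedness, type A

_⟺_ : Set → Set → Set
A ⟺ B = (A → B) × (B → A)

_⟫_ : ∀ {A B C : Set} → A ⟺ B → B ⟺ C → A ⟺ C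
(f , g) ⟫ (h , k) = (λ x → h (f x)) , (λ x → g (k x))

idⁱ : ∀ {A : Set} → A ⟺ A
idⁱ = (λ x → x) , (λ x → x)

≡⟺ : ∀ {A B : Set} → A ≡ B → A ⟺ B
≡⟺ refl = idⁱ

iterⁱ : ∀ (P : ℕ → Set) K → (∀ k → k < K → P k ⟺ P (suc k)) → P 0 ⟺ P K
iterⁱ P zero h = idⁱ
iterⁱ P (suc K) h = iterⁱ P K (λ k lt → h k (m<n⇒m<1+n lt)) ⟫ h K ≤-refl

module ConnectA (k : ℕ) (σ : Pair → Pair) (H : Pair → ℤ) (isR : IsRMatrix (typeA (suc (suc k))) σ) (isE : IsEnergy (typeA (suc (suc k))) σ H)
  (s t : ℕ) (hs : HeightOK (typeA (suc (suc k))) s) (ht : HeightOK (typeA (suc (suc k))) t) (t≤s : t ≤ s) where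
  open TypeA k σ H isR isE

  s<n : s < n
  s<n = s≤s (≤ᵇ-elim s (suc k) (proj₂ (∧-elim {1 ≤ᵇ s} (T→≡ hs))))
  1≤t : 1 ≤ t
  1≤t = ≤ᵇ-elim 1 t (proj₁ (∧-elim {1 ≤ᵇ t} (T→≡ ht)))
  t<n : t < n
  t<n = ≤-<-trans t≤s s<n

  Q : Bits → Bits → Set
  Q a b = Inv (asc n a , asc n b)

  Sizes : Bits → Bits → Set
  Sizes a b = cn n a ≡ s × cn n b ≡ t

  Q-cong : ∀ {a a' b b'} → (∀ x → 1 ≤ x → x ≤ n → a x ≡ a' x) → (∀ x → 1 ≤ x → x ≤ n → b x ≡ b' x) → Q a b ⟺ Q a' b'
  Q-cong h h' = ≡⟺ (cong₂ (λ x y → Inv (x , y)) (asc-cong n h) (asc-cong n h'))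

  rule : ∀ {i p q} (ix : Idx i p q) a b w → at p q a ∷ at p q b ∷ [] ≡ w → 0 < epW w → Sizes a b →
    let j = pos E w in Q a b ⟺ Q (swB (j ≡ᵇ 0) p q a) (swB (j ≡ᵇ 1) p q b)
  rule {i} {p} {q} ix a b w refl en (sa , sb) = P.forward , P.backward
    where
    j = pos E w
    x y : Pair
    x = asc n a , asc n b
    y = asc n (swB (j ≡ᵇ 0) p q a) , asc n (swB (j ≡ᵇ 1) p q b)
    ey : e (pairK K) i x ≡ just y
    ey = trans (pair-spec a b (idx-spec ix a) (idx-spec ix b)) (cong (λ c → if c then just y else nothing) (<ᵇ-yes en))
    module P = Prop hs ht ix x y (fromPair s t x (IsCol-asc a sa) (IsCol-asc b sb)) ey

  sizes-sw : ∀ {i p q} (ix : Idx i p q) {a b} u v → Sizes a b → Sizes (swB u p q a) (swB v p q b)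
  sizes-sw ix {a} {b} u v (sa , sb) = trans (cn-swB (idx-site ix) u a) sa , trans (cn-swB (idx-site ix) v b) sb

  ruleL : ∀ {i p q} (ix : Idx i p q) {a b} v B → a q ≡ v → a p ≡ false → at p q b ≡ B → φ₁ B ≡ 0 → Sizes a b → Q a b ⟺ Q (swB v p q a) b
  ruleL ix false B _ _ _ _ _ = idⁱ
  ruleL {i} {p} {q} ix {a} {b} true B aq ap bB φ0 sz = subst (λ j → Q a b ⟺ Q (swB (j ≡ᵇ 0) p q a) (swB (j ≡ᵇ 1) p q b)) p0
      (rule ix a b ((true , false) ∷ B ∷ []) (cong₂ (λ x y → x ∷ y ∷ []) (cong₂ _,_ aq ap) bB) en sz)
    where
    w₀ : phW (B ∷ []) ≡ 0
    w₀ = trans (cong (_+ (0 ∸ ε₁ B)) φ0) (0∸n≡0 (ε₁ B))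
    p0 : pos E ((true , false) ∷ B ∷ []) ≡ 0
    p0 rewrite w₀ = refl
    en : 0 < epW ((true , false) ∷ B ∷ [])
    en rewrite w₀ = m≤n+m 1 (epW (B ∷ []))

  ruleR : ∀ {i p q} (ix : Idx i p q) {a b} v A → b q ≡ v → b p ≡ false → at p q a ≡ A → ε₁ A ≡ 0 → Sizes a b → Q a b ⟺ Q a (swB v p q b)
  ruleR ix false A _ _ _ _ _ = idⁱ
  ruleR {i} {p} {q} ix {a} {b} true A bq bp aA ε0 sz = subst (λ j → Q a b ⟺ Q (swB (j ≡ᵇ 0) p q a) (swB (j ≡ᵇ 1) p q b)) p0
      (rule ix a b (A ∷ (true , false) ∷ []) (cong₂ (λ x y → x ∷ y ∷ []) aA (cong₂ _,_ bq bp)) (s≤s z≤n) sz)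
    where
    p0 : pos E (A ∷ (true , false) ∷ []) ≡ 1
    p0 rewrite ε0 = refl

  module Reduce (base : Q (iv s) (iv t)) where
    Good : ℕ → Set
    Good N = ∀ a b → mu n a + mu n b < N → Sizes a b → Q a b

    -- L avoids m ≤ t while R = {1, …, t}: shift the letters of L below m up, apply e_0 to R, and let e_1, …, e_{n-1} shift everything down.
    module Gap (a : Bits) (m : ℕ) (sm≤t : suc m ≤ t) (am : a (suc m) ≡ false) (sa : cn n a ≡ s)
      (closed : ∀ i → t < i → i < n → a (suc i) ≡ true → a i ≡ true) where
      m≤k : m ≤ suc k
      m≤k = ≤-trans (≤-trans (n≤1+n m) sm≤t) (≤-pred t<n)
      open GapData (suc k) a m t sm≤t m≤k am
      b₀ : Bits
      b₀ = sw n 1 (iv t)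
      iv1 : iv t 1 ≡ true
      iv1 = ≤ᵇ-yes 1≤t
      ivn : iv t n ≡ false
      ivn = ≤ᵇ-no t<n
      b₀1 : b₀ 1 ≡ false
      b₀1 = trans (sw-q n 1 (iv t)) ivn
      sa₁ : cn n a₁ ≡ s
      sa₁ = trans size₁ sa
      sizeSD : ∀ c K → K ≤ suc k → c 1 ≡ false → cn n (SD K c) ≡ cn n c
      sizeSD c K le c1 = SD-size n c K (s≤s le) c1
      st : cn n (iv t) ≡ t
      st = cn-iv n t (<⇒≤ t<n)
      sb₀ : cn n b₀ ≡ t
      sb₀ = trans (cn-sw (site-0 (s≤s (s≤s z≤n))) (iv t)) st

      phase₁ : Q a₁ (iv t) ⟺ Q a (iv t)
      phase₁ = Q-cong (λ x l _ → sym (SD-0 a₁ refl x l)) (λ _ _ _ → refl)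
        ⟫ (iterⁱ (λ K → Q (SD K a₁) (iv t)) m (λ K lt → let K<n = s≤s (≤-trans lt m≤k) in
             ruleL (i+ K<n) (a₁ (suc (suc K))) (true , true) (SD-high K a₁ (suc (suc K)) ≤-refl) (SD-gap K a₁)
               (cong₂ _,_ (≤ᵇ-yes (≤-trans (s≤s lt) sm≤t)) (≤ᵇ-yes (≤-trans (s≤s (<⇒≤ lt)) sm≤t))) refl (trans (sizeSD a₁ K (≤-trans (<⇒≤ lt) m≤k) refl) sa₁ , st)
             ⟫ Q-cong (λ x _ _ → SD-step K a₁ (a₁ (suc (suc K))) refl x) (λ _ _ _ → refl))
        ⟫ Q-cong (λ x l _ → SD-shiftUp m a am x l) (λ _ _ _ → refl))

      phase₂ : Q a₁ (iv t) ⟺ Q a₁ b₀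
      phase₂ = ruleR i0 true (false , a₁ n) iv1 ivn refl refl (sa₁ , st)

      phase₃ : Q a₁ b₀ ⟺ Q a₂ (SD (suc k) b₀)
      phase₃ = Q-cong (λ x l _ → sym (SD-0 a₁ refl x l)) (λ x l _ → sym (SD-0 b₀ b₀1 x l))
        ⟫ iterⁱ (λ K → Q (SD K a₁) (SD K b₀)) (suc k) (λ K lt →
            let sA = trans (sizeSD a₁ K (<⇒≤ lt) refl) sa₁ ; sB = trans (sizeSD b₀ K (<⇒≤ lt) b₀1) sb₀ ; ix = i+ {K} (s≤s lt)
                v = a₁ (suc (suc K)) ; v' = b₀ (suc (suc K))
                sA' = trans (sizeSD a₁ (suc K) lt refl) sa₁ in
            (ruleL ix v (v' , false) (SD-high K a₁ (suc (suc K)) ≤-refl) (SD-gap K a₁) (cong₂ _,_ (SD-high K b₀ (suc (suc K)) ≤-refl) (SD-gap K b₀)) refl (sA , sB)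
             ⟫ Q-cong (λ x _ _ → SD-step K a₁ v refl x) (λ _ _ _ → refl))
            ⟫ (ruleR ix v' (false , SD (suc K) a₁ (suc K)) (SD-high K b₀ (suc (suc K)) ≤-refl) (SD-gap K b₀) (cong (_, SD (suc K) a₁ (suc K)) (SD-gap (suc K) a₁)) refl (sA' , sB)
             ⟫ Q-cong (λ _ _ _ → refl) (λ x _ _ → SD-step K b₀ v' refl x)))

      B : ℕ → Bits
      B = travel t
      B-end : ∀ x → 1 ≤ x → x ≤ n → SD (suc k) b₀ x ≡ B (suc k) x
      B-end (suc x) _ le with <-cmp (suc x) (suc k)
      ... | tri< lt ne _ = trans (SD-low (suc k) b₀ (suc x) (<⇒≤ lt)) (trans (sw-other n 1 (iv t) (suc (suc x)) (<⇒≢ (s≤s lt)) (λ ()))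
              (sym (travel-low t (suc k) (suc x) ne)))
      ... | tri≈ _ refl _ = trans (SD-low (suc k) b₀ (suc k) ≤-refl) (trans (trans (sw-p n 1 (iv t)) iv1) (sym (travel-at t (suc k))))
      ... | tri> _ ne gt = trans (subst (λ y → SD (suc k) b₀ y ≡ false) (≤-antisym gt le) (SD-gap (suc k) b₀)) (sym (travel-gap t (suc k) (suc x) (≤-trans (≤-pred t<n) (<⇒≤ gt)) ne))

      sa₂ : cn n a₂ ≡ s
      sa₂ = trans size₂ sa

      phase₄ : Q a₂ (SD (suc k) b₀) ⟺ Q a₂ (iv t)
      phase₄ = Q-cong (λ _ _ _ → refl) B-end ⟫ (iterⁱ (λ d → Q a₂ (B (suc k ∸ d))) (suc k ∸ t) stp
          ⟫ Q-cong (λ _ _ _ → refl) λ x l _ → trans (cong (λ h → B h x) (m∸[m∸n]≡n (≤-pred t<n))) (travel-iv t x l))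
        where
        size₀ : cn n (B (suc k)) ≡ t
        size₀ = trans (cn-cong n λ x l h → sym (B-end x l h)) (trans (sizeSD b₀ (suc k) ≤-refl b₀1) sb₀)
        stp : ∀ d → d < suc k ∸ t → Q a₂ (B (suc k ∸ d)) ⟺ Q a₂ (B (suc k ∸ suc d))
        stp d lt = ≡⟺ (cong (λ h → Q a₂ (B h)) e≡) ⟫ (ruleR (ix y≥1 (s≤s (≤-trans (m∸n≤m k d) (n≤1+n k)))) true (at y (suc y) a₂) (travel-at t (suc y)) (travel-gap t (suc y) y t≤y (<⇒≢ ≤-refl)) refl
            (no-minus closed y t≤y (s≤s (m∸n≤m k d))) (sa₂ , trans (cong (λ h → cn n (B h)) (sym e≡)) (travel-size n t (suc k) 1≤t (n≤1+n _) size₀ d (<⇒≤ d+t<)))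
            ⟫ Q-cong (λ _ _ _ → refl) (λ x _ _ → travel-sw t y t≤y x))
          where
          y = k ∸ d
          d+t< : d + t < suc k
          d+t< = subst (suc (d + t) ≤_) (m∸n+n≡m (≤-pred t<n)) (+-monoˡ-≤ t lt)
          e≡ : suc k ∸ d ≡ suc y
          e≡ = +-∸-assoc 1 (≤-trans (m≤m+n d t) (≤-pred d+t<))
          t≤y : t ≤ y
          t≤y = subst (_≤ y) (m+n∸m≡n d t) (∸-monoˡ-≤ d (≤-pred d+t<))
          y≥1 : 1 ≤ y
          y≥1 = ≤-trans 1≤t t≤y
          ix : ∀ {y'} → 1 ≤ y' → suc y' ≤ n → Idx y' y' (suc y')
          ix {suc y'} _ le = i+ le

      reduce : Q a (iv t) ⟺ Q a₂ (iv t)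
      reduce = ((λ x → proj₂ phase₁ x) , proj₁ phase₁) ⟫ (phase₂ ⟫ (phase₃ ⟫ phase₄))

    test : Bits → Bits → ℕ → Bool
    test a b i = 0 <ᵇ epW (at i (suc i) a ∷ at i (suc i) b ∷ [])

    run-mu : ∀ {i} → 1 ≤ i → suc i ≤ n → ∀ a b → let w = at i (suc i) a ∷ at i (suc i) b ∷ [] in 0 < epW w →
      suc (mu n (swB (pos E w ≡ᵇ 0) i (suc i) a) + mu n (swB (pos E w ≡ᵇ 1) i (suc i) b)) ≡ mu n a + mu n b
    run-mu {i} 1≤i le a b en with φ₁ (at i (suc i) b) + (0 ∸ ε₁ (at i (suc i) b)) <ᵇ ε₁ (at i (suc i) a) in q
    ... | true with ε₁-pos (at i (suc i) a) (≤-<-trans z≤n (<ᵇ-elim _ _ q))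
    ...   | e = cong (_+ mu n b) (mu-down i 1≤i le a (cong proj₁ e) (cong proj₂ e))
    run-mu {i} 1≤i le a b en | false with enab-rest E (at i (suc i) a) (at i (suc i) b ∷ []) en q
    ... | en' with 0 <ᵇ ε₁ (at i (suc i) b) in q'
    ...   | true with ε₁-pos (at i (suc i) b) (<ᵇ-elim _ _ q')
    ...     | e = trans (sym (+-suc (mu n a) _)) (cong (λ h → mu n a + h) (mu-down i 1≤i le b (cong proj₁ e) (cong proj₂ e)))
    run-mu {i} 1≤i le a b en | false | en' | false = ⊥-elim (<⇒≱ en' (<ᵇ-elim-no 0 _ q'))

    ε-closed : ∀ {c : Bits} {i} → ε₁ (at i (suc i) c) ≡ 0 → c (suc i) ≡ true → c i ≡ true
    ε-closed {c} {i} e h with c (suc i) | c i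
    ... | true | true = refl
    ε-closed {c} {i} () h | true | false
    ε-closed e () | false | _

    good : ∀ N → Good N
    good (suc N) a b le (sa , sb) with search (test a b) (suc k)
    ... | inj₁ (suc i , _ , i≤ , en) = proj₂ (rule (i+ (s≤s i≤)) a b w refl (<ᵇ-elim 0 (epW w) en) (sa , sb))
          (good N (swB (pos E w ≡ᵇ 0) (suc i) (suc (suc i)) a) (swB (pos E w ≡ᵇ 1) (suc i) (suc (suc i)) b)
            (subst (_≤ N) (sym (run-mu (s≤s z≤n) (s≤s i≤) a b (<ᵇ-elim 0 (epW w) en))) (≤-pred le))
            (sizes-sw (i+ (s≤s i≤)) {a} {b} (pos E w ≡ᵇ 0) (pos E w ≡ᵇ 1) (sa , sb)))
      where
      w : List Two
      w = at (suc i) (suc (suc i)) a ∷ at (suc i) (suc (suc i)) b ∷ []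
    ... | inj₂ none = go (search (λ m → not (a m)) t)
      where
      hw : ∀ i → 1 ≤ i → i < n → epW (at i (suc i) a ∷ at i (suc i) b ∷ []) ≡ 0
      hw i l lt = n≤0⇒n≡0 (<ᵇ-elim-no 0 _ (none i l (≤-pred lt)))
      εb : ∀ i → 1 ≤ i → i < n → ε₁ (at i (suc i) b) ≡ 0
      εb i l lt = m+n≡0⇒m≡0 (ε₁ (at i (suc i) b)) (hw i l lt)
      b≗ : ∀ x → 1 ≤ x → x ≤ n → b x ≡ iv t x
      b≗ = down-closed n b t (λ i l lt → ε-closed {b} (εb i l lt)) sb
      εa : ∀ i → 1 ≤ i → i < n → b i ≡ b (suc i) → ε₁ (at i (suc i) a) ≡ 0
      εa i l lt e = n≤0⇒n≡0 (≤-trans (m∸n≡0⇒m≤n (m+n≡0⇒n≡0 (ε₁ (at i (suc i) b)) (hw i l lt)))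
          (≤-reflexive (trans (cong₂ (λ x y → x + (0 ∸ y)) (φ0 (b (suc i)) (b i) e) (εb i l lt)) refl)))
        where
        φ0 : ∀ x y → y ≡ x → φ₁ (x , y) ≡ 0
        φ0 true .true refl = refl
        φ0 false .false refl = refl
      above : ∀ i → t < i → i < n → a (suc i) ≡ true → a i ≡ true
      above i lt i<n = ε-closed {a} (εa i (≤-trans (s≤s z≤n) lt) i<n
        (trans (b≗ i (≤-trans (s≤s z≤n) lt) (<⇒≤ i<n)) (trans (≤ᵇ-no lt) (sym (trans (b≗ (suc i) (s≤s z≤n) i<n) (≤ᵇ-no (m<n⇒m<1+n lt)))))))
      go : _ → Q a b
      go (inj₂ all) = proj₂ (Q-cong (down-closed n a s dc sa) b≗) base
        where
        full : ∀ x → 1 ≤ x → x ≤ t → a x ≡ true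
        full x l le with a x | all x l le
        ... | true | _ = refl
        dc : ∀ i → 1 ≤ i → i < n → a (suc i) ≡ true → a i ≡ true
        dc i l lt h with i ≤ᵇ t in q
        ... | true = full i l (≤ᵇ-elim i t q)
        ... | false = above i (≤ᵇ-elim-no i t q) lt h
      go (inj₁ (suc m , _ , le' , am)) = proj₂ (Q-cong (λ _ _ _ → refl) b≗ ⟫ G.reduce)
          (good N G.a₂ (iv t) (<-≤-trans (+-monoˡ-< (mu n (iv t)) (G.smaller s sa (≤-trans le' t≤s))) (≤-trans (≤-reflexive (cong (λ h → mu n a + h) (mu-cong n λ x l h → sym (b≗ x l h)))) (≤-pred le)))
            (G.sa₂ , G.st))
        where
        not⁻ : ∀ {b} → not b ≡ true → b ≡ false
        not⁻ {false} _ = refl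
        module G where
          open Gap a m le' (not⁻ am) sa above public
          open GapData (suc k) a m t le' m≤k (not⁻ am) public using (a₂; smaller)

    connected : ∀ a b → Sizes a b → Q a b
    connected a b sz = good (suc (mu n a + mu n b)) a b ≤-refl sz

just≢nothing : ∀ {A : Set} {x : A} {m : Maybe A} → m ≡ just x → m ≡ nothing → ⊥
just≢nothing refl ()

full-size : ∀ N c t → t ≤ N → (∀ x → 1 ≤ x → x ≤ t → c x ≡ true) → cn N c ≡ t → ∀ x → 1 ≤ x → x ≤ N → c x ≡ iv t x
full-size zero c t _ _ _ (suc x) _ ()
full-size (suc N) c t le h sz x 1≤x x≤ with m≤n⇒m<n∨m≡n le
... | inj₂ refl = trans (h x 1≤x x≤) (sym (≤ᵇ-yes x≤))
... | inj₁ (s≤s lt) with c (suc N) in eq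
...   | true = ⊥-elim (<⇒≱ (s≤s (cn-full t ≤-refl lt)) (≤-reflexive sz))
  where
  cn-full : ∀ j → j ≤ t → ∀ {N} → j ≤ N → j ≤ cn N c
  cn-full zero _ _ = z≤n
  cn-full (suc j) le {suc N} (s≤s lt) with m≤n⇒m<n∨m≡n lt
  ... | inj₂ refl rewrite h (suc j) (s≤s z≤n) le = s≤s (cn-full j (<⇒≤ le) {j} ≤-refl)
  ... | inj₁ lt' = ≤-trans (cn-full (suc j) le {N} lt') (m≤n+m _ _)
...   | false with m≤n⇒m<n∨m≡n x≤
...     | inj₁ (s≤s x≤N) = full-size N c t lt h sz x 1≤x x≤N
...     | inj₂ refl = trans eq (sym (≤ᵇ-no (s≤s lt)))

module Strings {K : KRType} {σ : Pair → Pair} (isR : IsRMatrix K σ) {s t} (hs : HeightOK K s) (ht : HeightOK K t)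
  {i : ℕ} {ep ph : Column → ℕ} (SK : Sem (cops K) i ep ph) where
  O = cops K
  module SP = Sem (Sem-pair SK SK)
  φ₂ : Pair → ℕ
  φ₂ (l , r) = φc O i l + (φc O i r ∸ εc O i l)
  φ₂≡ : ∀ x → φ₂ x ≡ ph (proj₁ x) + (ph (proj₂ x) ∸ ep (proj₁ x))
  φ₂≡ (l , r) = cong₂ _+_ (Sem.φc-≡ SK l) (cong₂ _∸_ (Sem.φc-≡ SK r) (Sem.εc-≡ SK l))

  f-null : ∀ x → InPair K s t x → φ₂ x ≡ 0 → φ₂ (σ x) ≡ 0
  f-null x vx q with φ₂ (σ x) in eq
  ... | zero = refl
  ... | suc k = ⊥-elim (just≢nothing (proj₁ (proj₂ (SP.f-step (σ x) k (trans (sym (φ₂≡ (σ x))) eq))))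
    (trans (proj₂ (proj₂ (proj₂ (proj₂ (isR s t hs ht)))) i x vx) (cong (mapMaybe σ) (SP.f-stop x (trans (sym (φ₂≡ x)) q)))))

  φ-up : ∀ x y → e (pairK K) i x ≡ just y → φ₂ y ≡ suc (φ₂ x)
  φ-up x y ey = go _ refl
    where
    go : ∀ m → m ≡ ep (proj₂ x) + (ep (proj₁ x) ∸ ph (proj₂ x)) → φ₂ y ≡ suc (φ₂ x)
    go zero q = ⊥-elim (just≢nothing ey (SP.e-stop x (sym q)))
    go (suc k) q with SP.e-step x k (sym q)
    ... | y' , ey' , _ , py = trans (cong φ₂ (just-inj (trans (sym ey) ey'))) (trans (φ₂≡ y') (trans py (cong suc (sym (φ₂≡ x)))))

  f-once : ∀ x y → InPair K s t y → φ₂ y ≡ 0 → e (pairK K) i y ≡ just x → φ₂ (σ x) ≡ 1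
  f-once x y vy q ey = trans (φ-up (σ y) (σ x) (trans (proj₁ (proj₂ (proj₂ (proj₂ (isR s t hs ht)))) i y vy) (cong (mapMaybe σ) ey)))
    (cong suc (f-null y vy q))

two-minus : ∀ A B → 1 < epW (A ∷ B ∷ []) → proj₁ A ≡ true × proj₁ B ≡ true
two-minus (true , false) (true , false) _ = refl , refl
two-minus (false , false) (true , false) (s≤s ())
two-minus (false , true) (true , false) (s≤s ())
two-minus (true , true) (true , false) (s≤s ())
two-minus (true , false) (false , false) (s≤s ())
two-minus (true , false) (true , true) (s≤s ())
two-minus (true , false) (false , true) ()
two-minus (true , true) (true , true) ()
two-minus (true , true) (false , false) ()
two-minus (true , true) (false , true) ()
two-minus (false , false) (true , true) ()
two-minus (false , false) (false , false) ()
two-minus (false , false) (false , true) ()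
two-minus (false , true) (true , true) ()
two-minus (false , true) (false , false) ()
two-minus (false , true) (false , true) ()

twice : ∀ {M p q} → Site M p q → ∀ {x y z} → Arrow M p q x y → Arrow M p q y z → χ (proj₁ x) q ≡ true × χ (proj₂ x) q ≡ true
twice {M} {p} {q} s {x} {y} A A' = two-minus (at p q a) (at p q b) (subst (1 <_) (proj₁ (act-sig w (Arrow.en A))) (s≤s (subst (λ v → 0 < epW v) w'≡ (Arrow.en A'))))
  where
  open SiteProps s
  a b : Bits
  a = χ (proj₁ x)
  b = χ (proj₂ x)
  w : List Two
  w = at p q a ∷ at p q b ∷ []
  j = pos E w
  at≡ : ∀ k (c d : Bits) l → l ≡ asc M (swB k p q c) → at p q (χ l) ≡ swIf k (at p q c)
  at≡ k c d l refl = trans (cong₂ _,_ (χ-asc M (swB k p q c) q 1≤q q≤M) (χ-asc M (swB k p q c) p 1≤p p≤M)) (at-swB p≢q k c)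
  w'≡ : at p q (χ (proj₁ y)) ∷ at p q (χ (proj₂ y)) ∷ [] ≡ act E w
  w'≡ = trans (cong₂ (λ g h → g ∷ h ∷ []) (at≡ (j ≡ᵇ 0) a a (proj₁ y) (Arrow.new₁ A)) (at≡ (j ≡ᵇ 1) b b (proj₂ y) (Arrow.new₂ A)))
    (trans (swAt-2 j (at p q a) (at p q b)) (sym (act-swAt E w)))

iv-eps : ∀ t i → ε₁ (at i (suc i) (iv t)) ≡ 0
iv-eps t i with <-cmp i t
... | tri< lt _ _ rewrite ≤ᵇ-yes {i} (<⇒≤ lt) = ∧-f (iv t (suc i))
  where
  ∧-f : ∀ b → b2n (b ∧ false) ≡ 0
  ∧-f true = refl
  ∧-f false = refl
... | tri≈ _ refl _ rewrite ≤ᵇ-no {suc i} {i} ≤-refl = refl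
... | tri> _ _ gt rewrite ≤ᵇ-no {suc i} {t} (m<n⇒m<1+n gt) = refl

iv-phi : ∀ t i → i ≢ t → φ₁ (at i (suc i) (iv t)) ≡ 0
iv-phi t i ne with <-cmp i t
... | tri< lt _ _ rewrite ≤ᵇ-yes {suc i} lt | ≤ᵇ-yes {i} (<⇒≤ lt) = refl
... | tri≈ _ e _ = ⊥-elim (ne e)
... | tri> _ _ gt rewrite ≤ᵇ-no {i} {t} gt = refl

φ₁-0 : ∀ {c : Bits} {i} → φ₁ (at i (suc i) c) ≡ 0 → c i ≡ true → c (suc i) ≡ true
φ₁-0 {c} {i} q h with c i | c (suc i)
... | true | true = refl
φ₁-0 () h | true | false
φ₁-0 q () | false | _

module BaseA (k : ℕ) (σ : Pair → Pair) (H : Pair → ℤ) (isR : IsRMatrix (typeA (suc (suc k))) σ) (isE : IsEnergy (typeA (suc (suc k))) σ H)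
  (s t : ℕ) (hs : HeightOK (typeA (suc (suc k))) s) (ht : HeightOK (typeA (suc (suc k))) t) (t≤s : t ≤ s) where
  open TypeA k σ H isR isE
  open ConnectA k σ H isR isE s t hs ht t≤s using (s<n; 1≤t; t<n)

  x₀ : Pair
  x₀ = asc n (iv s) , asc n (iv t)
  v₀ : InPair K s t x₀
  v₀ = fromPair s t x₀ (IsCol-asc (iv s) (cn-iv n s (<⇒≤ s<n))) (IsCol-asc (iv t) (cn-iv n t (<⇒≤ t<n)))
  c d : Bits
  c = χ (proj₁ (σ x₀))
  d = χ (proj₂ (σ x₀))
  vσ : InPair K t s (σ x₀)
  vσ = proj₁ (isR s t hs ht) x₀ v₀
  cols = toPair t s (σ x₀) vσ

  ivs1 : iv s 1 ≡ true
  ivs1 = ≤ᵇ-yes (≤-trans 1≤t t≤s)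
  ivt1 : iv t 1 ≡ true
  ivt1 = ≤ᵇ-yes 1≤t
  ivsn : iv s n ≡ false
  ivsn = ≤ᵇ-no s<n
  ivtn : iv t n ≡ false
  ivtn = ≤ᵇ-no t<n
  a₁ b₁ : Bits
  a₁ = sw n 1 (iv s)
  b₁ = sw n 1 (iv t)
  arrow₁ : e (pairK K) 0 x₀ ≡ just (asc n a₁ , asc n (iv t))
  arrow₁ = trans (pair-spec {p = n} {1} (iv s) (iv t) (colA-spec0 k (iv s)) (colA-spec0 k (iv t)))
    (go (at n 1 (iv s)) (at n 1 (iv t)) (cong₂ _,_ ivs1 ivsn) (cong₂ _,_ ivt1 ivtn))
    where
    go : ∀ A B → A ≡ (true , false) → B ≡ (true , false) →
      (if 0 <ᵇ epW (A ∷ B ∷ []) then just (asc n (swB (pos E (A ∷ B ∷ []) ≡ᵇ 0) n 1 (iv s)) , asc n (swB (pos E (A ∷ B ∷ []) ≡ᵇ 1) n 1 (iv t))) else nothing) ≡ just (asc n a₁ , asc n (iv t))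
    go _ _ refl refl = refl
  arrow₂ : e (pairK K) 0 (asc n a₁ , asc n (iv t)) ≡ just (asc n a₁ , asc n b₁)
  arrow₂ = trans (pair-spec {p = n} {1} a₁ (iv t) (colA-spec0 k a₁) (colA-spec0 k (iv t)))
    (go (at n 1 a₁) (at n 1 (iv t)) (cong₂ _,_ (trans (sw-q n 1 (iv s)) ivsn) (trans (sw-p n 1 (iv s)) ivs1)) (cong₂ _,_ ivt1 ivtn))
    where
    go : ∀ A B → A ≡ (false , true) → B ≡ (true , false) →
      (if 0 <ᵇ epW (A ∷ B ∷ []) then just (asc n (swB (pos E (A ∷ B ∷ []) ≡ᵇ 0) n 1 a₁) , asc n (swB (pos E (A ∷ B ∷ []) ≡ᵇ 1) n 1 (iv t))) else nothing) ≡ just (asc n a₁ , asc n b₁)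
    go _ _ refl refl = refl
  v₁ : InPair K s t (asc n a₁ , asc n (iv t))
  v₁ = fromPair s t _ (IsCol-asc a₁ (trans (cn-sw (idx-site i0) (iv s)) (cn-iv n s (<⇒≤ s<n)))) (IsCol-asc (iv t) (cn-iv n t (<⇒≤ t<n)))

  ones : c 1 ≡ true × d 1 ≡ true
  ones = twice (idx-site i0) (Prop.A' {s} {t} hs ht i0 x₀ _ v₀ arrow₁) (Prop.A' {s} {t} hs ht i0 _ _ v₁ arrow₂)

  module At (i : ℕ) (lt : suc i < n) where
    SK = Sem-col {e0 = e0A n} {f0 = f0A n} (λ _ → refl) (Sem-letterA n i lt)
    open Strings {K} {σ} isR {s} {t} hs ht SK public
    φ-bits : ∀ {r r'} x → IsCol n r (proj₁ x) → IsCol n r' (proj₂ x) → φ₂ x ≡ φ₁ (at (suc i) (suc (suc i)) (χ (proj₁ x))) + (φ₁ (at (suc i) (suc (suc i)) (χ (proj₂ x))) ∸ ε₁ (at (suc i) (suc (suc i)) (χ (proj₁ x))))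
    φ-bits (l , r) (isCol el _) (isCol er _) = cong₂ _+_ (trans (cong (φc (colA n) (suc i)) el) (ColSpec.φS (sp (χ l))))
      (cong₂ _∸_ (trans (cong (φc (colA n) (suc i)) er) (ColSpec.φS (sp (χ r)))) (trans (cong (εc (colA n) (suc i)) el) (ColSpec.εS (sp (χ l)))))
      where sp = λ c → colA-spec n i c lt
    atχ : ∀ c → at (suc i) (suc (suc i)) (χ (asc n c)) ≡ at (suc i) (suc (suc i)) c
    atχ c = cong₂ _,_ (χ-asc n c (suc (suc i)) (s≤s z≤n) lt) (χ-asc n c (suc i) (s≤s z≤n) (<⇒≤ lt))
    φ-asc : ∀ {r r'} a b → cn n a ≡ r → cn n b ≡ r' → φ₂ (asc n a , asc n b) ≡ φ₁ (at (suc i) (suc (suc i)) a) + (φ₁ (at (suc i) (suc (suc i)) b) ∸ ε₁ (at (suc i) (suc (suc i)) a))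
    φ-asc a b sa sb = trans (φ-bits (asc n a , asc n b) (IsCol-asc a sa) (IsCol-asc b sb)) (cong₂ (λ A B → φ₁ A + (φ₁ B ∸ ε₁ A)) (atχ a) (atχ b))
    null : suc i ≢ s → suc i ≢ t → φ₁ (at (suc i) (suc (suc i)) c) + (φ₁ (at (suc i) (suc (suc i)) d) ∸ ε₁ (at (suc i) (suc (suc i)) c)) ≡ 0
    null ns nt = trans (sym (φ-bits (σ x₀) (proj₁ cols) (proj₂ cols))) (f-null x₀ v₀ (trans (φ-asc (iv s) (iv t) (cn-iv n s (<⇒≤ s<n)) (cn-iv n t (<⇒≤ t<n)))
      (cong₂ _+_ (iv-phi s (suc i) ns) (trans (cong (_∸ ε₁ (at (suc i) (suc (suc i)) (iv s))) (iv-phi t (suc i) nt)) (0∸n≡0 (ε₁ (at (suc i) (suc (suc i)) (iv s))))))))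

  c≗ : ∀ x → 1 ≤ x → x ≤ n → c x ≡ iv t x
  c≗ = full-size n c t (<⇒≤ t<n) pre (IsCol.size (proj₁ cols))
    where
    pre : ∀ x → 1 ≤ x → x ≤ t → c x ≡ true
    pre (suc zero) _ _ = proj₁ ones
    pre (suc (suc i)) _ le = φ₁-0 {c} (m+n≡0⇒m≡0 _ (At.null i (<-trans le t<n) (<⇒≢ (<-≤-trans le t≤s)) (<⇒≢ le))) (pre (suc i) (s≤s z≤n) (<⇒≤ le))

  d≗ : ∀ x → 1 ≤ x → x ≤ n → d x ≡ iv s x
  d≗ = full-size n d s (<⇒≤ s<n) pre (IsCol.size (proj₂ cols))
    where
    at-c : ∀ i → suc i < n → at (suc i) (suc (suc i)) c ≡ at (suc i) (suc (suc i)) (iv t)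
    at-c i lt = cong₂ _,_ (c≗ (suc (suc i)) (s≤s z≤n) lt) (c≗ (suc i) (s≤s z≤n) (<⇒≤ lt))
    next : ∀ i → suc (suc i) ≤ s → d (suc i) ≡ true → d (suc (suc i)) ≡ true
    next i le ih with suc i Data.Nat.≟ t
    ... | no ne = φ₁-0 {d} (n≤0⇒n≡0 (subst (φ₁ (at (suc i) (suc (suc i)) d) ≤_) (trans (cong ε₁ (at-c i (<-trans le s<n))) (iv-eps t (suc i)))
          (m∸n≡0⇒m≤n (m+n≡0⇒n≡0 (φ₁ (at (suc i) (suc (suc i)) c)) (At.null i (<-trans le s<n) (<⇒≢ le) ne))))) ih
    ... | yes refl = φ₁-0 {d} (subst (λ A → φ₁ A + (φ₁ (at (suc i) (suc (suc i)) d) ∸ ε₁ A) ≡ 1 → φ₁ (at (suc i) (suc (suc i)) d) ≡ 0) (sym (trans (at-c i lt) ivAt)) suc-injective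
          (trans (sym (φ-bits (σ x₀) (proj₁ cols) (proj₂ cols))) (f-once x₀ y vy φy ey))) ih
      where
      lt = <-trans le s<n
      open At i lt
      ivAt : at (suc i) (suc (suc i)) (iv t) ≡ (false , true)
      ivAt = cong₂ _,_ (≤ᵇ-no {suc (suc i)} ≤-refl) (≤ᵇ-yes {suc i} ≤-refl)
      ivsAt : at (suc i) (suc (suc i)) (iv s) ≡ (true , true)
      ivsAt = cong₂ _,_ (≤ᵇ-yes le) (≤ᵇ-yes (<⇒≤ le))
      b' : Bits
      b' = sw (suc i) (suc (suc i)) (iv t)
      b'At : at (suc i) (suc (suc i)) b' ≡ (true , false)
      b'At = cong₂ _,_ (trans (sw-q (suc i) (suc (suc i)) (iv t)) (cong proj₂ ivAt)) (trans (sw-p (suc i) (suc (suc i)) (iv t)) (cong proj₁ ivAt))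
      y : Pair
      y = asc n (iv s) , asc n b'
      sz : cn n b' ≡ t
      sz = trans (cn-sw (site-suc i lt) (iv t)) (cn-iv n t (<⇒≤ t<n))
      vy : InPair K s t y
      vy = fromPair s t y (IsCol-asc (iv s) (cn-iv n s (<⇒≤ s<n))) (IsCol-asc b' sz)
      φy : φ₂ y ≡ 0
      φy = trans (φ-asc (iv s) b' (cn-iv n s (<⇒≤ s<n)) sz) (cong₂ (λ A B → φ₁ A + (φ₁ B ∸ ε₁ A)) ivsAt b'At)
      ey : e (pairK K) (suc i) y ≡ just x₀
      ey = trans (pair-spec {p = suc i} {suc (suc i)} (iv s) b' (colA-spec n i (iv s) lt) (colA-spec n i b' lt)) (go _ _ ivsAt b'At)
        where
        go : ∀ A B → A ≡ (true , true) → B ≡ (true , false) →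
          (if 0 <ᵇ epW (A ∷ B ∷ []) then just (asc n (swB (pos E (A ∷ B ∷ []) ≡ᵇ 0) (suc i) (suc (suc i)) (iv s)) , asc n (swB (pos E (A ∷ B ∷ []) ≡ᵇ 1) (suc i) (suc (suc i)) b')) else nothing) ≡ just x₀
        go _ _ refl refl = cong (λ l → just (asc n (iv s) , l)) (asc-cong n λ x _ _ → sw-sw (site-suc i lt) (iv t) x)

    pre : ∀ x → 1 ≤ x → x ≤ s → d x ≡ true
    pre (suc zero) _ _ = proj₂ ones
    pre (suc (suc i)) _ le = next i le (pre (suc i) (s≤s z≤n) (<⇒≤ le))

  -- With nested intervals every carry vanishes.
  base : Inv x₀
  base = (λ _ → 0) , pass vt (1 , ≤-refl , s≤s z≤n , refl) , trans (cong H (cong₂ _,_ (asc-iv n s (<⇒≤ s<n)) (asc-iv n t (<⇒≤ t<n)))) (proj₂ (isE s t hs ht))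
    where
    V-iv : ∀ x → V 0 (iv s x) (iv t x) (iv t x) (iv s x) 0
    V-iv x with x ≤ᵇ t in q
    ... | true rewrite ≤ᵇ-yes {x} {s} (≤-trans (≤ᵇ-elim x t q) t≤s) = both
    ... | false with x ≤ᵇ s
    ...   | true = stay
    ...   | false = nn
    vt : ∀ a → 1 ≤ a → a ≤ n → V 0 (χ (asc n (iv s)) a) (χ (asc n (iv t)) a) (c a) (d a) 0
    vt a l h = V-cong refl (sym (χ-asc n (iv s) a l h)) (sym (χ-asc n (iv t) a l h)) (sym (c≗ a l h)) (sym (d≗ a l h)) refl (V-iv a)

  abstract
    all : ∀ x → InPair K s t x → Inv x
    all (l , r) v = let (a , b) = toPair s t (l , r) v in subst Inv (sym (cong₂ _,_ (IsCol.list a) (IsCol.list b)))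
      (ConnectA.Reduce.connected k σ H isR isE s t hs ht t≤s base (χ l) (χ r) (IsCol.size a , IsCol.size b))

-- Connectedness, type C

Split-cong : ∀ {n c d l g w} → c ≗[ 2 * n ] d → Split n c l g w → Split n d l g w
Split-cong {n} h (split vt tp bt) = split (λ z a b → let le = ≤-trans b (m≤m+n n _) ; (x , y) = bar-range n z a le in
  V-cong refl (cong not (h (bar n z) x y)) (h z a le) refl refl refl (vt z a b)) tp bt

Spl-cong : ∀ {n c d} → c ≗[ 2 * n ] d → Spl n c → Spl n d
Spl-cong h (spl l g w sp) = spl l g w (Split-cong h sp)

epW-2 : ∀ U X → epW (U ∷ X ∷ []) ≡ 0 → ε₁ X ≡ 0 × ε₁ U ≤ φ₁ X
epW-2 U X q = a , subst (ε₁ U ≤_) (trans (cong (λ h → φ₁ X + h) (0∸n≡0 (ε₁ X))) (+-identityʳ _)) (m∸n≡0⇒m≤n (m+n≡0⇒n≡0 (ε₁ X) q))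
  where
  a : ε₁ X ≡ 0
  a = m+n≡0⇒m≡0 (ε₁ X) q

cn-pre : ∀ c j → (∀ x → 1 ≤ x → x ≤ j → c x ≡ true) → cn j c ≡ j
cn-pre c zero h = refl
cn-pre c (suc j) h rewrite h (suc j) (s≤s z≤n) ≤-refl = cong suc (cn-pre c j λ x a b → h x a (m≤n⇒m≤1+n b))

cn-none : ∀ c j d → (∀ x → j < x → x ≤ d + j → c x ≡ false) → cn (d + j) c ≡ cn j c
cn-none c j zero h = refl
cn-none c j (suc d) h rewrite h (suc (d + j)) (s≤s (m≤n+m j d)) ≤-refl = cn-none c j d λ x a b → h x a (m≤n⇒m≤1+n b)

Nb-pos : ∀ n c z → 1 ≤ z → c (bar n z) ≡ true → 1 ≤ Nb n c z
Nb-pos n c (suc z) _ h rewrite h = s≤s z≤n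

prefix-bar : ∀ {n c} → Spl n c → ∀ j → j ≤ n → (∀ x → 1 ≤ x → x ≤ j → c x ≡ true) → ∀ z → 1 ≤ z → z ≤ j → c (bar n z) ≡ true → ⊥
prefix-bar {n} {c} s j j≤n pre z 1≤z z≤j h = <⇒≱ (≤-trans (≤-reflexive (sym (trans (cong (λ k → k + 1) (cn-pre c z λ x a b → pre x a (≤-trans b z≤j))) (+-comm z 1))))
  (+-monoʳ-≤ (cn z c) (Nb-pos n c z 1≤z h))) (Split⇒KN (Spl.isSplit s) z (≤-trans z≤j j≤n))

classical-null : ℕ → Bits → ℕ → Set
classical-null n c i = epW (at (2 * n ∸ i) (suc (2 * n ∸ i)) c ∷ at i (suc i) c ∷ []) ≡ 0

highest : ∀ n c r T → Spl n c → r ≤ n → T ≤ r → cn (2 * n) c ≡ r → (∀ x → 1 ≤ x → x ≤ T → c x ≡ true)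
  → (∀ i → 1 ≤ i → T < i → i < n → classical-null n c i) → (T < n → ε₁ (at n (suc n) c) ≡ 0) → c ≗[ 2 * n ] iv r
highest n c r T sp r≤n T≤r sz pre null nullₙ = full-size M c r (≤-trans r≤n (m≤m+n n _)) (λ x l h → prefix r ≤-refl x l h) sz
  where
  M = 2 * n
  next : ∀ j → T ≤ j → j < r → (∀ x → 1 ≤ x → x ≤ j → c x ≡ true) → c (suc j) ≡ true
  next j T≤j j<r pj with c (suc j) in cj
  ... | true = refl
  ... | false = ⊥-elim (<⇒≱ j<r (subst (_≤ j) (trans (sym (cn-none c j (M ∸ j) λ x a b → none x x ≤-refl a (subst (x ≤_) (m∸n+n≡m j≤M) b)))
        (trans (cong (λ h → cn h c) (m∸n+n≡m j≤M)) sz)) (cn-≤ j c)))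
    where
    j≤n = ≤-trans (<⇒≤ j<r) r≤n
    j≤M = ≤-trans j≤n (m≤m+n n _)
    none : ∀ y x → x ≤ y → j < x → x ≤ M → c x ≡ false
    none zero zero _ () _
    none (suc y) x x≤ j<x x≤M with m≤n⇒m<n∨m≡n x≤
    ... | inj₁ (s≤s lt) = none y x lt j<x x≤M
    ... | inj₂ refl with m≤n⇒m<n∨m≡n j<x
    ...   | inj₂ refl = cj
    ...   | inj₁ (s≤s j<y) with c (suc y) in cy
    ...     | false = refl
    ...     | true = ⊥-elim (case (<-cmp (suc y) (suc n)))
      where
      cy' : c y ≡ false
      cy' = none y y ≤-refl j<y (<⇒≤ x≤M)
      minus : ε₁ (at y (suc y) c) ≡ 1
      minus = cong ε₁ (cong₂ _,_ cy cy')
      case : Tri (suc y < suc n) (suc y ≡ suc n) (suc n < suc y) → ⊥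
      case (tri< (s≤s lt) _ _) = 1+n≢0 (trans (sym minus) (proj₁ (epW-2 (at (2 * n ∸ y) (suc (2 * n ∸ y)) c) (at y (suc y) c) (null y (≤-trans (s≤s z≤n) j<y) (≤-<-trans T≤j j<y) lt))))
      case (tri≈ _ refl _) = 1+n≢0 (trans (sym minus) (nullₙ (≤-<-trans T≤j j<y)))
      case (tri> _ _ (s≤s gt)) with z ≤? j
        where
        z = bar n (suc y)
      ... | yes z≤j = prefix-bar sp j j≤n pj (bar n (suc y)) (m<n⇒0<n∸m x≤M) z≤j (trans (cong c (bar-bar n (suc y) (m≤n⇒m≤1+n x≤M))) cy)
      ... | no z≰j = <⇒≱ (s≤s z≤n) (subst₂ _≤_ εU φX (proj₂ (epW-2 (at (2 * n ∸ z) (suc (2 * n ∸ z)) c) (at z (suc z) c) (null z 1≤z (≤-<-trans T≤j (≰⇒> z≰j)) z<n))))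
        where
        z = bar n (suc y)
        1≤z : 1 ≤ z
        1≤z = m<n⇒0<n∸m x≤M
        z<n : z < n
        z<n = ≤-trans (∸-monoʳ-< {M} gt (<⇒≤ x≤M)) (≤-reflexive (trans (m+n∸m≡n n (n + 0)) (+-identityʳ n)))
        u≡ : 2 * n ∸ z ≡ y
        u≡ = m∸[m∸n]≡n (<⇒≤ x≤M)
        εU : ε₁ (at (2 * n ∸ z) (suc (2 * n ∸ z)) c) ≡ 1
        εU = trans (cong (λ h → ε₁ (at h (suc h) c)) u≡) minus
        φX : φ₁ (at z (suc z) c) ≡ 0
        φX = trans (cong (λ h → φ₁ (c (suc z) , h)) (none y z (<⇒≤ (<-trans z<n gt)) (≰⇒> z≰j) (≤-trans (<⇒≤ z<n) (m≤m+n n _)))) refl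
  prefix : ∀ j → j ≤ r → ∀ x → 1 ≤ x → x ≤ j → c x ≡ true
  prefix zero _ (suc x) _ ()
  prefix (suc j) le x 1≤x x≤ with m≤n⇒m<n∨m≡n x≤
  ... | inj₁ (s≤s lt) = prefix j (<⇒≤ le) x 1≤x lt
  ... | inj₂ refl with T ≤? j
  ...   | yes T≤j = next j T≤j le (prefix j (<⇒≤ le))
  ...   | no T≰j = pre (suc j) 1≤x (≰⇒> T≰j)

nth : ℕ → List Two → Two
nth j []            = false , false
nth zero (c ∷ w)    = c
nth (suc j) (c ∷ w) = nth j w

nth-pos : ∀ w → 0 < epW w → nth (pos E w) w ≡ (true , false)
nth-pos (c ∷ w) en with phW w <ᵇ ε₁ c in q
... | true = ε₁-pos c (≤-<-trans z≤n (<ᵇ-elim (phW w) (ε₁ c) q))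
... | false = nth-pos w (enab-rest E c w en q)

mu-up : ∀ {M} i → 1 ≤ i → suc i ≤ M → ∀ c → c (suc i) ≡ false → c i ≡ true → mu M (sw i (suc i) c) ≡ suc (mu M c)
mu-up {M} i 1≤i le c cq cp = sym (trans (cong suc (mu-cong M λ x _ _ → sym (sw-sw (site⁺ 1≤i le) c x)))
  (mu-down i 1≤i le (sw i (suc i) c) (trans (sw-q i (suc i) c) cp) (trans (sw-p i (suc i) c) cq)))

mu-first : ∀ k {c d : Bits} → c 1 ≡ false → d 1 ≡ true → (∀ x → 2 ≤ x → x ≤ suc k → d x ≡ c x) → mu (suc k) d ≡ suc (mu (suc k) c)
mu-first zero c1 d1 h rewrite c1 | d1 = refl
mu-first (suc k) {c} c1 d1 h = trans (cong₂ (λ b m → (if b then suc (suc k) else 0) + m) (h (suc (suc k)) (s≤s (s≤s z≤n)) ≤-refl)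
  (mu-first k c1 d1 λ x a b → h x a (m≤n⇒m≤1+n b))) (+-suc (if c (suc (suc k)) then suc (suc k) else 0) _)

mu-affine : ∀ k {c} → let M = suc (suc k) in c 1 ≡ false → c M ≡ true → mu M (sw M 1 c) + M ≡ suc (mu M c)
mu-affine k {c} c1 cM = trans (cong₂ (λ b m → (if b then M else 0) + m + M) (trans (sw-p M 1 c) c1)
    (mu-first k c1 (trans (sw-q M 1 c) cM) λ x a b → sw-other M 1 c x (<⇒≢ (s≤s b)) (>⇒≢ a)))
  (cong suc (trans (+-comm (mu (suc k) c) M) (cong (λ b → (if b then M else 0) + mu (suc k) c) (sym cM))))
  where M = suc (suc k)

mu-tail : ∀ n d c → (∀ x → n < x → x ≤ d + n → c x ≡ false) → mu (d + n) c ≡ mu n c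
mu-tail n zero c h = refl
mu-tail n (suc d) c h rewrite h (suc (d + n)) (s≤s (m≤n+m n d)) ≤-refl = mu-tail n d c λ x a b → h x a (m≤n⇒m≤1+n b)

if-yes : ∀ {A : Set} {b} {x : A} → b ≡ true → (if b then just x else nothing) ≡ just x
if-yes refl = refl

module ConnectC (n' : ℕ) (σ : Pair → Pair) (H : Pair → ℤ) (isR : IsRMatrix (typeC (suc n')) σ) (isE : IsEnergy (typeC (suc n')) σ H)
  (s t : ℕ) (hs : HeightOK (typeC (suc n')) s) (ht : HeightOK (typeC (suc n')) t) (t≤s : t ≤ s) where
  open TypeC n' σ H isR isE

  s≤n : s ≤ n
  s≤n = ≤ᵇ-elim s n (proj₂ (∧-elim {1 ≤ᵇ s} (T→≡ hs)))
  1≤t : 1 ≤ t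
  1≤t = ≤ᵇ-elim 1 t (proj₁ (∧-elim {1 ≤ᵇ t} (T→≡ ht)))
  t≤n : t ≤ n
  t≤n = ≤-trans t≤s s≤n
  1≤n : 1 ≤ n
  1≤n = s≤s z≤n
  n≤M : n ≤ M
  n≤M = m≤m+n n _
  n<M : n < M
  n<M = Site.q≤M (Bd-site 1≤n bN)

  Q : Bits → Bits → Set
  Q a b = Inv LR (asc M a , asc M b) × Inv RL (asc M a , asc M b)

  record Vd (a b : Bits) : Set where
    constructor vd
    field
      sA : cn M a ≡ s
      sB : cn M b ≡ t
      spA : Spl n a
      spB : Spl n b

  R : Bits → Bits → Bits → Bits → Set
  R a b a' b' = Vd a b → Vd a' b' × (Q a b ⟺ Q a' b')

  _⊙_ : ∀ {a b c d c' d'} → R a b c d → R c d c' d' → R a b c' d'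
  (f ⊙ g) v = let (v' , q) = f v ; (v'' , q') = g v' in v'' , (q ⟫ q')

  R-≗ : ∀ {a a' b b'} → a ≗[ M ] a' → b ≗[ M ] b' → R a b a' b'
  R-≗ h h' (vd x y z w) = vd (trans (sym (cn-cong M h)) x) (trans (sym (cn-cong M h')) y) (Spl-cong h z) (Spl-cong h' w) ,
    ≡⟺ (cong₂ (λ l r → Inv LR (l , r) × Inv RL (l , r)) (asc-cong M h) (asc-cong M h'))

  R-refl : ∀ {a b} → R a b a b
  R-refl v = v , idⁱ

  idd : ∀ {c : Bits} → c ≗[ M ] c
  idd x _ _ = refl

  iterR : ∀ {B : Set} (f g : B → Bits) (P : ℕ → B) K → (∀ k → k < K → R (f (P k)) (g (P k)) (f (P (suc k))) (g (P (suc k)))) → R (f (P 0)) (g (P 0)) (f (P K)) (g (P K))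
  iterR f g P zero h = R-refl
  iterR f g P (suc K) h = iterR f g P K (λ k lt → h k (m<n⇒m<1+n lt)) ⊙ h K ≤-refl

  pairOK : ∀ {a b} → Vd a b → InPair K s t (asc M a , asc M b)
  pairOK {a} {b} (vd sA sB spA spB) = fromPair s t (asc M a , asc M b) (isColC (IsCol-asc a sA) (Spl-cong (λ x l h → sym (χ-asc M a x l h)) spA))
    (isColC (IsCol-asc b sB) (Spl-cong (λ x l h → sym (χ-asc M b x l h)) spB))

  eArrow : ∀ {i a b a' b'} → CArrow E n a b a' b' i → Vd a b → e (pairK K) i (asc M a , asc M b) ≡ just (asc M a' , asc M b')
  eArrow {i} {a} {b} (inner 1≤i i<n en ha hb) _ = trans pairSpec (trans (if-yes (<ᵇ-yes en))
      (cong just (cong₂ _,_ (trans (pick₁ (pos E W)) (asc-cong M λ x l h → sym (ha x l h))) (trans (pick₂ (pos E W) (pos-bound E W en)) (asc-cong M λ x l h → sym (hb x l h))))))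
    where
    open InnerPair i 1≤i i<n a b
  eArrow {_} {a} {b} (last en ha hb) _ = trans (pair-spec a b (colC-specN n' a) (colC-specN n' b)) (trans (if-yes (<ᵇ-yes en))
      (cong just (cong₂ _,_ (asc-cong M λ x l h → sym (ha x l h)) (asc-cong M λ x l h → sym (hb x l h)))))
  eArrow {_} {a} {b} (affine en ha hb) (vd _ _ spA spB) = trans (pair-spec a b (colC-spec0 n' a (no-pair-1 1≤n spA)) (colC-spec0 n' b (no-pair-1 1≤n spB)))
      (trans (if-yes (<ᵇ-yes en)) (cong just (cong₂ _,_ (asc-cong M λ x l h → sym (ha x l h)) (asc-cong M λ x l h → sym (hb x l h)))))

  newVd : ∀ op {i a b a' b'} → CArrow op n a b a' b' i → Vd a b → Vd a' b'
  newVd op {i} {a} {b} {a'} {b'} (inner 1≤i i<n en ha hb) (vd x y spA spB) = vd (trans (cn-cong M ha) (trans (cn-swB site-high (j ≡ᵇ 0) _) (trans (cn-swB site-low (j ≡ᵇ 1) a) x)))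
      (trans (cn-cong M hb) (trans (cn-swB site-high (j ≡ᵇ 2) _) (trans (cn-swB site-low (j ≡ᵇ 3) b) y))) sa' sb'
    where
    open Inner n i 1≤i i<n using (site-high; site-low)
    j = pos op (word-CC n i a b)
    open InnerStep.Enabled n i 1≤i i<n op a b a' b' spA spB en ha hb using (sa'; sb')
  newVd op {_} {a} {b} {a'} {b'} (last en ha hb) (vd x y spA spB) = vd (trans (cn-cong M ha) (trans (cn-swB (Bd-site 1≤n bN) (j ≡ᵇ 0) a) x)) (trans (cn-cong M hb) (trans (cn-swB (Bd-site 1≤n bN) (j ≡ᵇ 1) b) y)) sa' sb'
    where
    open BoundaryStep n n (suc n) n 1≤n bN op a b a' b' spA spB en ha hb using (sa'; sb'; j)
  newVd op {_} {a} {b} {a'} {b'} (affine en ha hb) (vd x y spA spB) = vd (trans (cn-cong M ha) (trans (cn-swB (Bd-site 1≤n b0) (j ≡ᵇ 0) a) x)) (trans (cn-cong M hb) (trans (cn-swB (Bd-site 1≤n b0) (j ≡ᵇ 1) b) y)) sa' sb'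
    where
    open BoundaryStep n M 1 1 1≤n b0 op a b a' b' spA spB en ha hb using (sa'; sb'; j)

  CArrow-≤ : ∀ {op a b a' b' i} → CArrow op n a b a' b' i → i ≤ n
  CArrow-≤ (inner _ lt _ _ _) = <⇒≤ lt
  CArrow-≤ (last _ _ _) = ≤-refl
  CArrow-≤ (affine _ _ _) = z≤n

  arrowQ : ∀ {i a b a' b'} → CArrow E n a b a' b' i → Vd a b → Q a b ⟺ Q a' b'
  arrowQ {i} {a} {b} {a'} {b'} A v = (λ (x , y) → P.forward LR x , P.forward RL y) , (λ (x , y) → P.backward LR x , P.backward RL y)
    where module P = Prop {s} {t} hs ht (CArrow-≤ A) (asc M a , asc M b) (asc M a' , asc M b') (pairOK v) (eArrow A v)

  ruleC : ∀ op {i a b a' b'} → CArrow op n a b a' b' i → R a b a' b'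
  ruleC E A v = newVd E A v , arrowQ A v
  ruleC F A v = let v' = newVd F A v ; (f , g) = arrowQ (reverseArrow F 1≤n A) v' in v' , (g , f)

  ruleI : ∀ op {i} → 1 ≤ i → i < n → ∀ {a b} w → word-CC n i a b ≡ w → 0 < stat op w → let u = 2 * n ∸ i ; j = pos op w in
    R a b (swB (j ≡ᵇ 0) u (suc u) (swB (j ≡ᵇ 1) i (suc i) a)) (swB (j ≡ᵇ 2) u (suc u) (swB (j ≡ᵇ 3) i (suc i) b))
  ruleI op 1≤i i<n w refl en = ruleC op (inner 1≤i i<n en (λ _ _ _ → refl) (λ _ _ _ → refl))

  ruleN : ∀ op {a b} w → at n (suc n) a ∷ at n (suc n) b ∷ [] ≡ w → 0 < stat op w → let j = pos op w in R a b (swB (j ≡ᵇ 0) n (suc n) a) (swB (j ≡ᵇ 1) n (suc n) b)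
  ruleN op w refl en = ruleC op (last en (λ _ _ _ → refl) (λ _ _ _ → refl))

  rule0 : ∀ op {a b} w → at M 1 a ∷ at M 1 b ∷ [] ≡ w → 0 < stat op w → let j = pos op w in R a b (swB (j ≡ᵇ 0) M 1 a) (swB (j ≡ᵇ 1) M 1 b)
  rule0 op w refl en = ruleC op (affine en (λ _ _ _ → refl) (λ _ _ _ → refl))

  ∷⁴ : ∀ {a b c d a' b' c' d' : Two} → a ≡ a' → b ≡ b' → c ≡ c' → d ≡ d' → _≡_ {A = List Two} (a ∷ b ∷ c ∷ d ∷ []) (a' ∷ b' ∷ c' ∷ d' ∷ [])
  ∷⁴ refl refl refl refl = refl

  ivHigh : ∀ x → n < x → iv t x ≡ false
  ivHigh x lt = ≤ᵇ-no (≤-<-trans t≤n lt)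

  -- Moving the smallest barred letter of L towards 1̄ while R = {1, …, t}
  module Bars where
    record At (i : ℕ) (a : Bits) : Set where
      field
        here : a (bar n i) ≡ true
        noneBelow : ∀ z → 1 ≤ z → z < i → a (bar n z) ≡ false
        above : t < i → a (suc t) ≡ true × a t ≡ false × (∀ x → t < x → x ≤ i → a x ≡ true)

    step : ∀ i → 1 ≤ i → i < n → ∀ a → At (suc i) a → ∃ λ a' → R a (iv t) a' (iv t) × At i a' × mu M a' ≤ mu M a + 2
    step i 1≤i i<n a A = go (a (suc i)) (a i) refl refl (<-cmp i t)
      where
      open Inner n i 1≤i i<n hiding (M)
      open At A
      n<su : n < su
      n<su = <-trans n<u ≤-refl
      U : at u su a ≡ (false , true)
      U = cong₂ _,_ (trans (cong a (sym bar-p)) (noneBelow i 1≤i ≤-refl)) here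
      U₀ : at u su (iv t) ≡ (false , false)
      U₀ = cong₂ _,_ (ivHigh su n<su) (ivHigh u n<u)
      moved : Bits → Bits
      moved c = sw u su c
      muRes : ∀ c → c su ≡ false → c u ≡ true → mu M (sw u su c) ≡ suc (mu M c)
      muRes = mu-up u (≤-<-trans z≤n n<u) su≤M
      belowRes : ∀ c → (∀ y → n < y → c y ≡ a y) → ∀ z → 1 ≤ z → z < i → sw u su c (bar n z) ≡ false
      belowRes c same z l lt = trans (sw-other u su c (bar n z) (λ h → <⇒≢ (m<n⇒m<1+n lt) (bar-inj n z q (z≤ lt) (s≤s i≤M) h))
          (λ h → <⇒≢ lt (bar-inj n z p (z≤ lt) (m≤n⇒m≤1+n i≤M) (trans h (sym bar-p)))))
        (trans (same (bar n z) (bar-high n z (<⇒≤ (<-trans lt i<n)))) (noneBelow z l (m<n⇒m<1+n lt)))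
        where
        z≤ : ∀ {z} → z < i → z ≤ suc M
        z≤ lt = m≤n⇒m≤1+n (≤-trans (<⇒≤ lt) i≤M)
      atRes : ∀ c → (∀ y → n < y → c y ≡ a y) → (t < i → ∀ x → x ≤ n → c x ≡ a x) → At i (moved c)
      atRes c same low = record
        { here = trans (cong (sw u su c) bar-p) (trans (sw-q u su c) (trans (same u n<u) here))
        ; noneBelow = belowRes c same
        ; above = λ t<i → let (x , y , z) = above (m<n⇒m<1+n t<i) ; lw = λ x le → trans (sw-other u su c x (<⇒≢ (≤-<-trans le n<u)) (<⇒≢ (≤-<-trans le n<su))) (low t<i x le) in
            trans (lw (suc t) (≤-trans t<i (<⇒≤ i<n))) x , trans (lw t t≤n) y , λ x' l le → trans (lw x' (≤-trans le (<⇒≤ i<n))) (z x' l (m≤n⇒m≤1+n le)) }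
      direct : ∀ {X B} → at p q a ≡ X → at p q (iv t) ≡ B → (∀ w → w ≡ (false , true) ∷ X ∷ (false , false) ∷ B ∷ [] → 0 < phW w × pos F w ≡ 0) →
        ∃ λ a' → R a (iv t) a' (iv t) × At i a' × mu M a' ≤ mu M a + 2
      direct {X} {B} hX hB k = let (en , p0) = k _ refl in moved a ,
        subst (λ j → R a (iv t) (swB (j ≡ᵇ 0) u su (swB (j ≡ᵇ 1) i (suc i) a)) (swB (j ≡ᵇ 2) u su (swB (j ≡ᵇ 3) i (suc i) (iv t)))) p0
          (ruleI F 1≤i i<n ((false , true) ∷ X ∷ (false , false) ∷ B ∷ []) (∷⁴ U hX U₀ hB) en) ,
        atRes a (λ _ _ → refl) (λ _ _ _ → refl) ,
        ≤-trans (≤-reflexive (trans (muRes a (cong proj₁ U) (cong proj₂ U)) (+-comm 1 _))) (+-monoʳ-≤ (mu M a) (s≤s z≤n))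
      lowB : i < t → at p q (iv t) ≡ (true , true)
      lowB lt = cong₂ _,_ (≤ᵇ-yes lt) (≤ᵇ-yes (<⇒≤ lt))
      highB : t < i → at p q (iv t) ≡ (false , false)
      highB lt = cong₂ _,_ (≤ᵇ-no (m<n⇒m<1+n lt)) (≤ᵇ-no lt)
      go : ∀ x y → a (suc i) ≡ x → a i ≡ y → _ → ∃ λ a' → R a (iv t) a' (iv t) × At i a' × mu M a' ≤ mu M a + 2
      go x y hx hy (tri≈ _ refl _) = let (x' , y' , _) = above ≤-refl in
        direct (cong₂ _,_ x' y') (cong₂ _,_ (≤ᵇ-no {suc i} ≤-refl) (≤ᵇ-yes {i} ≤-refl)) λ { _ refl → s≤s z≤n , refl }
      go x y hx hy (tri> _ _ gt) = let (_ , _ , z) = above (m<n⇒m<1+n gt) in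
        direct (cong₂ _,_ (z (suc i) (m<n⇒m<1+n gt) ≤-refl) (z i gt (n≤1+n i))) (highB gt) λ { _ refl → s≤s z≤n , refl }
      go true true hx hy (tri< lt _ _) = direct (cong₂ _,_ hx hy) (lowB lt) λ { _ refl → s≤s z≤n , refl }
      go false false hx hy (tri< lt _ _) = direct (cong₂ _,_ hx hy) (lowB lt) λ { _ refl → s≤s z≤n , refl }
      go true false hx hy (tri< lt _ _) = direct (cong₂ _,_ hx hy) (lowB lt) λ { _ refl → s≤s z≤n , refl }
      go false true hx hy (tri< lt _ _) = moved a₁ ,
          (ruleI F 1≤i i<n ((false , true) ∷ (false , true) ∷ (false , false) ∷ (true , true) ∷ []) (∷⁴ U (cong₂ _,_ hx hy) U₀ (lowB lt)) (s≤s z≤n)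
           ⊙ ruleI F 1≤i i<n ((false , true) ∷ (true , false) ∷ (false , false) ∷ (true , true) ∷ []) (∷⁴ U₁ (cong₂ _,_ (trans (sw-q p q a) hy) (trans (sw-p p q a) hx)) U₀ (lowB lt)) (s≤s z≤n)) ,
          atRes a₁ same (λ t<i → ⊥-elim (<⇒≱ lt (<⇒≤ t<i))) ,
          ≤-reflexive (trans (muRes a₁ (cong proj₁ U₁) (cong proj₂ U₁)) (trans (cong suc (mu-up p 1≤i (≤-trans i<n n≤M) a hx hy)) (+-comm 2 _)))
        where
        a₁ : Bits
        a₁ = sw p q a
        same : ∀ y → n < y → a₁ y ≡ a y
        same y lt = sw-other p q a y (>⇒≢ (<-trans i<n lt)) (>⇒≢ (≤-<-trans i<n lt))
        U₁ : at u su a₁ ≡ (false , true)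
        U₁ = trans (cong₂ _,_ (same su n<su) (same u n<u)) U

    down : ∀ i → 1 ≤ i → i ≤ n → ∀ a → At i a → ∃ λ a' → R a (iv t) a' (iv t) × At 1 a' × mu M a' + 2 ≤ mu M a + 2 * i
    down (suc zero) _ _ a A = a , R-refl , A , ≤-refl
    down (suc (suc i)) _ le a A = combine (step (suc i) (s≤s z≤n) le a A) λ a' A' → down (suc i) (s≤s z≤n) (<⇒≤ le) a' A'
      where
      open ≤-Reasoning
      combine : (∃ λ a' → R a (iv t) a' (iv t) × At (suc i) a' × mu M a' ≤ mu M a + 2)
        → (∀ a' → At (suc i) a' → ∃ λ a'' → R a' (iv t) a'' (iv t) × At 1 a'' × mu M a'' + 2 ≤ mu M a' + 2 * suc i)
        → ∃ λ a'' → R a (iv t) a'' (iv t) × At 1 a'' × mu M a'' + 2 ≤ mu M a + 2 * suc (suc i)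
      combine (a' , r , A' , m) rec with rec a' A'
      ... | a'' , r' , A'' , m' = a'' , (r ⊙ r') , A'' , (begin
        mu M a'' + 2 ≤⟨ m' ⟩
        mu M a' + 2 * suc i ≤⟨ +-monoˡ-≤ (2 * suc i) m ⟩
        mu M a + 2 + 2 * suc i ≡⟨ +-assoc (mu M a) 2 _ ⟩
        mu M a + (2 + 2 * suc i) ≡⟨ cong (λ h → mu M a + h) (sym (*-suc 2 (suc i))) ⟩
        mu M a + 2 * suc (suc i) ∎)

    finish : ∀ c → 1 ≤ c → c ≤ n → ∀ a → At c a → Vd a (iv t) → ∃ λ a' → Vd a' (iv t) × (Q a (iv t) ⟺ Q a' (iv t)) × mu M a' < mu M a
    finish c 1≤c c≤n a A v with down c 1≤c c≤n a A
    ... | a₁ , r , A₁ , m with r v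
    ... | v₁ , q₁ with rule0 F ((false , true) ∷ (true , false) ∷ []) (cong₂ (λ x y → x ∷ y ∷ []) (cong₂ _,_ a1 (At.here A₁)) (cong₂ _,_ (≤ᵇ-yes 1≤t) (ivHigh M n<M))) (s≤s z≤n) v₁
      where
      a1 : a₁ 1 ≡ false
      a1 with a₁ 1 in h
      ... | false = refl
      ... | true = ⊥-elim (no-pair-1 1≤n (Vd.spA v₁) (h , At.here A₁))
    ... | v₂ , q₂ = sw M 1 a₁ , v₂ , (q₁ ⟫ q₂) , fin
      where
      a1 : a₁ 1 ≡ false
      a1 with a₁ 1 in h
      ... | false = refl
      ... | true = ⊥-elim (no-pair-1 1≤n (Vd.spA v₁) (h , At.here A₁))
      k = n' + (n' + 0)
      M≡ : M ≡ suc (suc k)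
      M≡ = cong suc (+-suc n' (n' + 0))
      aff : mu M (sw M 1 a₁) + M ≡ suc (mu M a₁)
      aff = subst (λ m → a₁ m ≡ true → mu m (sw m 1 a₁) + m ≡ suc (mu m a₁)) (sym M≡) (mu-affine k a1) (At.here A₁)
      open ≤-Reasoning
      fin : mu M (sw M 1 a₁) < mu M a
      fin = +-cancelʳ-≤ M _ _ (begin
        suc (mu M (sw M 1 a₁)) + M ≡⟨ cong suc aff ⟩
        suc (suc (mu M a₁)) ≡⟨ +-comm 2 _ ⟩
        mu M a₁ + 2 ≤⟨ m ⟩
        mu M a + 2 * c ≤⟨ +-monoʳ-≤ (mu M a) (*-monoʳ-≤ 2 c≤n) ⟩
        mu M a + M ∎)

module ReduceC (n' : ℕ) (σ : Pair → Pair) (H : Pair → ℤ) (isR : IsRMatrix (typeC (suc n')) σ) (isE : IsEnergy (typeC (suc n')) σ H)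
  (s t : ℕ) (hs : HeightOK (typeC (suc n')) s) (ht : HeightOK (typeC (suc n')) t) (t≤s : t ≤ s) where
  open TypeC n' σ H isR isE using (n; M)
  open ConnectC n' σ H isR isE s t hs ht t≤s

  NoBars : Bits → Set
  NoBars a = ∀ x → n < x → x ≤ M → a x ≡ false

  -- L has no barred letters and avoids m + 1 ≤ t while R = {1, …, t}: as in type A, the letter 1 of R going once around.
  module Gap (a : Bits) (m : ℕ) (sm≤t : suc m ≤ t) (am : a (suc m) ≡ false) (sA : cn M a ≡ s) (nb : NoBars a)
    (closed : ∀ i → t < i → i < n → a (suc i) ≡ true → a i ≡ true) where
    m≤n' : m ≤ n'
    m≤n' = ≤-pred (≤-trans sm≤t t≤n)
    open GapData n' a m t sm≤t m≤n' am

    SD-nb : ∀ K → K ≤ n' → ∀ x → n < x → x ≤ M → SD K a₁ x ≡ false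
    SD-nb K le x lt h = trans (SD-high K a₁ x (≤-<-trans (s≤s le) lt)) (trans (shiftUp-high (suc m) a x (s≤s z≤n) (≤-<-trans (≤-trans sm≤t t≤n) lt)) (nb x lt h))

    at-bars : ∀ i (1≤i : 1 ≤ i) (i<n : i < n) c → (∀ x → n < x → x ≤ M → c x ≡ false) → at (2 * n ∸ i) (suc (2 * n ∸ i)) c ≡ (false , false)
    at-bars i 1≤i i<n c h = cong₂ _,_ (h su (<-trans n<u ≤-refl) su≤M) (h u n<u (<⇒≤ su≤M))
      where open Inner n i 1≤i i<n hiding (M)

    phase₁ : ∀ K → K ≤ m → R (SD K a₁) (iv t) a₁ (iv t)
    phase₁ zero _ = R-≗ (λ x l _ → SD-0 a₁ refl x l) idd
    phase₁ (suc K) lt = go (a₁ (suc (suc K))) refl ⊙ phase₁ K (<⇒≤ lt)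
      where
      K<n : suc K < n
      K<n = s≤s (≤-trans lt m≤n')
      go : ∀ v → a₁ (suc (suc K)) ≡ v → R (SD (suc K) a₁) (iv t) (SD K a₁) (iv t)
      go false h = R-≗ (λ x _ _ → sym (SD-step K a₁ false h x)) idd
      go true h = ruleI F (s≤s z≤n) K<n ((false , false) ∷ (false , true) ∷ (false , false) ∷ (true , true) ∷ [])
          (∷⁴ (at-bars (suc K) (s≤s z≤n) K<n (SD (suc K) a₁) (SD-nb (suc K) (≤-trans lt m≤n')))
              (cong₂ _,_ (SD-gap (suc K) a₁) (trans (SD-low (suc K) a₁ (suc K) ≤-refl) h))
              (at-bars (suc K) (s≤s z≤n) K<n (iv t) (λ x lt _ → ivHigh x lt))
              (cong₂ _,_ (≤ᵇ-yes (≤-trans (s≤s lt) sm≤t)) (≤ᵇ-yes (≤-trans (s≤s (<⇒≤ lt)) sm≤t)))) (s≤s z≤n)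
        ⊙ R-≗ (λ x l le → trans (swB-at true (suc K) (suc (suc K)) {SD (suc K) a₁} {sw (suc K) (suc (suc K)) (SD K a₁)} x (sym (SD-step K a₁ true h (suc K))) (sym (SD-step K a₁ true h (suc (suc K)))) (sym (SD-step K a₁ true h x)))
              (sw-sw (site-suc K (≤-trans K<n n≤M)) (SD K a₁) x)) idd

    Bst : ℕ → Bits
    Bst K = glue n (SD K (iv t)) (λ x → x ≡ᵇ bar n (suc K))

    Bst-low : ∀ K x → x ≤ n → Bst K x ≡ SD K (iv t) x
    Bst-low K x le = glue-low n (SD K (iv t)) (λ x → x ≡ᵇ bar n (suc K)) x le
    Bst-high : ∀ K x → n < x → Bst K x ≡ (x ≡ᵇ bar n (suc K))
    Bst-high K x lt = glue-high n (SD K (iv t)) (λ x → x ≡ᵇ bar n (suc K)) x lt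

    phase₂ : R a₁ (iv t) (SD 0 a₁) (Bst 0)
    phase₂ = rule0 E ((false , false) ∷ (true , false) ∷ [])
        (cong₂ (λ x y → x ∷ y ∷ []) (cong (false ,_) (trans (sym (SD-0 a₁ refl M (<-trans (s≤s z≤n) n<M))) (SD-nb 0 z≤n M n<M ≤-refl)))
          (cong₂ _,_ (≤ᵇ-yes 1≤t) (ivHigh M n<M))) (s≤s z≤n)
      ⊙ R-≗ (λ x l _ → sym (SD-0 a₁ refl x l)) conv
      where
      conv : sw M 1 (iv t) ≗[ M ] Bst 0
      conv x l le with x Data.Nat.≟ M | x Data.Nat.≟ 1
      ... | yes refl | _ = trans (sw-p M 1 (iv t)) (trans (≤ᵇ-yes 1≤t) (sym (trans (Bst-high 0 M n<M) (≡ᵇ-yes {M} refl))))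
      ... | no _ | yes refl = trans (sw-q M 1 (iv t)) (trans (ivHigh M n<M) (sym (trans (Bst-low 0 1 1≤n) (SD-gap 0 (iv t)))))
      ... | no x≢M | no x≢1 = trans (sw-other M 1 (iv t) x x≢M x≢1) (sym (go (<-cmp x (suc n))))
        where
        go : _ → Bst 0 x ≡ iv t x
        go (tri< (s≤s le') _ _) = trans (Bst-low 0 x le') (SD-high 0 (iv t) x (≤∧≢⇒< l (λ h → x≢1 (sym h))))
        go (tri≈ _ h _) = trans (Bst-high 0 x (≤-reflexive (sym h))) (trans (≡ᵇ-no x≢M) (sym (ivHigh x (≤-reflexive (sym h)))))
        go (tri> _ _ gt) = trans (Bst-high 0 x (<-trans ≤-refl gt)) (trans (≡ᵇ-no x≢M) (sym (ivHigh x (<-trans ≤-refl gt))))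

    phase₃ : R (SD 0 a₁) (Bst 0) (SD n' a₁) (Bst n')
    phase₃ = iterR (λ K → SD K a₁) Bst (λ K → K) n' step
      where
      step : ∀ K → K < n' → R (SD K a₁) (Bst K) (SD (suc K) a₁) (Bst (suc K))
      step K lt = moveL v refl ⊙ (moveBar ⊙ moveR v' refl)
        where
        i<n : suc K < n
        i<n = s≤s lt
        open Inner n (suc K) (s≤s z≤n) i<n hiding (M)
        v = a₁ (suc (suc K))
        v' = iv t (suc (suc K))
        aU : ∀ K' → K' ≤ n' → at u su (SD K' a₁) ≡ (false , false)
        aU K' le = at-bars (suc K) (s≤s z≤n) i<n (SD K' a₁) (SD-nb K' le)
        aX : at p q (SD K a₁) ≡ (v , false)
        aX = cong₂ _,_ (SD-high K a₁ (suc (suc K)) ≤-refl) (SD-gap K a₁)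
        aX' : at p q (SD (suc K) a₁) ≡ (false , v)
        aX' = cong₂ _,_ (SD-gap (suc K) a₁) (SD-low (suc K) a₁ (suc K) ≤-refl)
        bU : at u su (Bst K) ≡ (true , false)
        bU = trans (at-glue-high (SD K (iv t)) (λ x → x ≡ᵇ bar n (suc K))) (cong₂ _,_ (≡ᵇ-yes (sym bar-p)) (≡ᵇ-no (λ h → u≢su (trans h bar-p))))
        bX : at p q (Bst K) ≡ (v' , false)
        bX = trans (at-glue-low (SD K (iv t)) (λ x → x ≡ᵇ bar n (suc K))) (cong₂ _,_ (SD-high K (iv t) (suc (suc K)) ≤-refl) (SD-gap K (iv t)))
        Bmid : Bits
        Bmid = glue n (SD K (iv t)) (λ x → x ≡ᵇ bar n (suc (suc K)))
        mU : at u su Bmid ≡ (false , true)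
        mU = trans (at-glue-high (SD K (iv t)) (λ x → x ≡ᵇ bar n (suc (suc K)))) (cong₂ _,_ (≡ᵇ-no (λ h → u≢su (sym h))) (≡ᵇ-yes {u} refl))
        mX : at p q Bmid ≡ (v' , false)
        mX = trans (at-glue-low (SD K (iv t)) (λ x → x ≡ᵇ bar n (suc (suc K)))) (cong₂ _,_ (SD-high K (iv t) (suc (suc K)) ≤-refl) (SD-gap K (iv t)))
        moveL : ∀ w → v ≡ w → R (SD K a₁) (Bst K) (SD (suc K) a₁) (Bst K)
        moveL false h = R-≗ (λ x _ _ → SD-step K a₁ false h x) idd
        moveL true h = at₃ v' refl ⊙ R-≗ (λ x _ _ → SD-step K a₁ true h x) idd
          where
          at₃ : ∀ w → v' ≡ w → R (SD K a₁) (Bst K) (sw p q (SD K a₁)) (Bst K)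
          at₃ false h' = ruleI E (s≤s z≤n) i<n ((false , false) ∷ (true , false) ∷ (true , false) ∷ (false , false) ∷ [])
            (∷⁴ (aU K (<⇒≤ lt)) (trans aX (cong (_, false) h)) bU (trans bX (cong (_, false) h'))) (s≤s z≤n)
          at₃ true h' = ruleI E (s≤s z≤n) i<n ((false , false) ∷ (true , false) ∷ (true , false) ∷ (true , false) ∷ [])
            (∷⁴ (aU K (<⇒≤ lt)) (trans aX (cong (_, false) h)) bU (trans bX (cong (_, false) h'))) (s≤s z≤n)
        moveBar : R (SD (suc K) a₁) (Bst K) (SD (suc K) a₁) Bmid
        moveBar = at₄ v v' refl refl ⊙ R-≗ idd (λ x l le → sym (glue-flip false true (SD K (iv t)) (λ x → x ≡ᵇ bar n (suc K)) (SD K (iv t)) (λ x → x ≡ᵇ bar n (suc (suc K)))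
            (λ _ _ _ → refl) bars x l le))
          where
          at₄ : ∀ w w' → v ≡ w → v' ≡ w' → R (SD (suc K) a₁) (Bst K) (SD (suc K) a₁) (sw u su (Bst K))
          at₄ w w' h h' = go w w' (∷⁴ (aU (suc K) lt) (trans aX' (cong (false ,_) h)) bU (trans bX (cong (_, false) h')))
            where
            go : ∀ w w' → word-CC n (suc K) (SD (suc K) a₁) (Bst K) ≡ (false , false) ∷ (false , w) ∷ (true , false) ∷ (w' , false) ∷ [] → R (SD (suc K) a₁) (Bst K) (SD (suc K) a₁) (sw u su (Bst K))
            go true true h = ruleI E (s≤s z≤n) i<n _ h (s≤s z≤n)
            go true false h = ruleI E (s≤s z≤n) i<n _ h (s≤s z≤n)
            go false true h = ruleI E (s≤s z≤n) i<n _ h (s≤s z≤n)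
            go false false h = ruleI E (s≤s z≤n) i<n _ h (s≤s z≤n)
          bars : ∀ x → n < x → x ≤ M → (x ≡ᵇ bar n (suc (suc K))) ≡ sw u su (λ x → x ≡ᵇ bar n (suc K)) x
          bars x _ _ with x Data.Nat.≟ u | x Data.Nat.≟ su
          ... | yes refl | _ = trans (≡ᵇ-yes {u} refl) (sym (trans (sw-p u su (λ x → x ≡ᵇ bar n (suc K))) (≡ᵇ-yes (sym bar-p))))
          ... | no _ | yes refl = trans (≡ᵇ-no (λ h → u≢su (sym h))) (sym (trans (sw-q u su (λ x → x ≡ᵇ bar n (suc K))) (≡ᵇ-no (λ h → u≢su (trans h bar-p)))))
          ... | no x≢u | no x≢su = trans (≡ᵇ-no x≢u) (sym (trans (sw-other u su (λ x → x ≡ᵇ bar n (suc K)) x x≢u x≢su) (≡ᵇ-no (λ h → x≢su (trans h bar-p)))))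
        moveR : ∀ w → v' ≡ w → R (SD (suc K) a₁) Bmid (SD (suc K) a₁) (Bst (suc K))
        moveR w h = at₅ w v (∷⁴ (aU (suc K) lt) aX' mU (trans mX (cong (_, false) h)))
            ⊙ R-≗ idd (λ x l le → sym (glue-flip w false (SD K (iv t)) (λ x → x ≡ᵇ bar n (suc (suc K))) (SD (suc K) (iv t)) (λ x → x ≡ᵇ bar n (suc (suc K)))
              (λ y _ _ → sym (SD-step K (iv t) w h y)) (λ _ _ _ → refl) x l le))
          where
          at₅ : ∀ w v → word-CC n (suc K) (SD (suc K) a₁) Bmid ≡ (false , false) ∷ (false , v) ∷ (false , true) ∷ (w , false) ∷ [] → R (SD (suc K) a₁) Bmid (SD (suc K) a₁) (swB w p q Bmid)
          at₅ false _ _ = R-refl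
          at₅ true true h = ruleI E (s≤s z≤n) i<n _ h (s≤s z≤n)
          at₅ true false h = ruleI E (s≤s z≤n) i<n _ h (s≤s z≤n)

    phase₄ : R a₂ (Bst n') a₂ (travel t n)
    phase₄ = ruleN E ((false , false) ∷ (true , false) ∷ [])
        (cong₂ (λ x y → x ∷ y ∷ []) (cong₂ _,_ (SD-nb n' ≤-refl (suc n) ≤-refl n<M) (SD-gap n' a₁))
          (cong₂ _,_ (trans (Bst-high n' (suc n) ≤-refl) (≡ᵇ-yes (sym (bar-n n)))) (trans (Bst-low n' n ≤-refl) (SD-gap n' (iv t))))) (s≤s z≤n)
      ⊙ R-≗ idd conv
      where
      conv : sw n (suc n) (Bst n') ≗[ M ] travel t n
      conv x l le with <-cmp x n
      ... | tri≈ _ refl _ = trans (sw-p n (suc n) (Bst n')) (trans (trans (Bst-high n' (suc n) ≤-refl) (≡ᵇ-yes (sym (bar-n n)))) (sym (travel-at t n)))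
      ... | tri< lt ne _ = trans (sw-other n (suc n) (Bst n') x ne (<⇒≢ (m<n⇒m<1+n lt))) (trans (Bst-low n' x (<⇒≤ lt)) (trans (SD-low n' (iv t) x (≤-pred lt)) (sym (travel-low t n x ne))))
      ... | tri> _ ne gt with x Data.Nat.≟ suc n
      ...   | yes refl = trans (sw-q n (suc n) (Bst n')) (trans (trans (Bst-low n' n ≤-refl) (SD-gap n' (iv t))) (sym (travel-gap t n (suc n) (m≤n⇒m≤1+n t≤n) ne)))
      ...   | no ne' = trans (sw-other n (suc n) (Bst n') x ne ne') (trans (Bst-high n' x gt) (trans (≡ᵇ-no (λ h → ne' (trans h (bar-n n)))) (sym (travel-gap t n x (<⇒≤ (≤-<-trans t≤n gt)) ne))))

    phase₅ : R a₂ (travel t n) a₂ (iv t)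
    phase₅ = iterR (λ _ → a₂) (λ d → travel t (n ∸ d)) (λ d → d) (n ∸ t) step
        ⊙ R-≗ idd (λ x l _ → trans (cong (λ h → travel t h x) (m∸[m∸n]≡n t≤n)) (travel-iv t x l))
      where
      step : ∀ d → d < n ∸ t → R a₂ (travel t (n ∸ d)) a₂ (travel t (n ∸ suc d))
      step d lt = R-≗ idd (λ x _ _ → cong (λ h → travel t h x) y≡) ⊙ (go (at y (suc y) a₂) refl (ε0 (m≤n⇒m<n∨m≡n (m∸n≤m n' d))) ⊙ R-≗ idd (λ x _ _ → travel-sw t y t≤y x))
        where
        y = n' ∸ d
        d+t< : d + t < n
        d+t< = subst (suc (d + t) ≤_) (m∸n+n≡m t≤n) (+-monoˡ-≤ t lt)
        y≡ : n ∸ d ≡ suc y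
        y≡ = +-∸-assoc 1 (≤-trans (m≤m+n d t) (≤-pred d+t<))
        t≤y : t ≤ y
        t≤y = subst (_≤ y) (m+n∸m≡n d t) (∸-monoˡ-≤ d (≤-pred d+t<))
        y<n : y < n
        y<n = s≤s (m∸n≤m n' d)
        1≤y : 1 ≤ y
        1≤y = ≤-trans 1≤t t≤y
        ε0 : y < n' ⊎ y ≡ n' → ε₁ (at y (suc y) a₂) ≡ 0
        ε0 (inj₁ lt') = no-minus closed y t≤y lt'
        ε0 (inj₂ h) = cong (λ b → ε₁ (b , a₂ y)) (trans (cong (λ z → a₂ (suc z)) h) (SD-gap n' a₁))
        tb : ∀ x → n < x → x ≤ M → travel t (suc y) x ≡ false
        tb x lt _ = travel-gap t (suc y) x (<⇒≤ (≤-<-trans t≤n lt)) (>⇒≢ (≤-<-trans y<n lt))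
        go : ∀ X → at y (suc y) a₂ ≡ X → ε₁ X ≡ 0 → R a₂ (travel t (suc y)) a₂ (sw y (suc y) (travel t (suc y)))
        go X h e0 = kk X h e0 (∷⁴ (at-bars y 1≤y y<n a₂ (SD-nb n' ≤-refl)) h (at-bars y 1≤y y<n (travel t (suc y)) tb) (cong₂ _,_ (travel-at t (suc y)) (travel-gap t (suc y) y t≤y (<⇒≢ ≤-refl))))
          where
          kk : ∀ X → at y (suc y) a₂ ≡ X → ε₁ X ≡ 0 → word-CC n y a₂ (travel t (suc y)) ≡ (false , false) ∷ X ∷ (false , false) ∷ (true , false) ∷ [] → R a₂ (travel t (suc y)) a₂ (sw y (suc y) (travel t (suc y)))
          kk (false , false) _ _ h = ruleI E 1≤y y<n _ h (s≤s z≤n)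
          kk (false , true) _ _ h = ruleI E 1≤y y<n _ h (s≤s z≤n)
          kk (true , true) _ _ h = ruleI E 1≤y y<n _ h (s≤s z≤n)
          kk (true , false) _ () _

    reduce : R a (iv t) a₁ (iv t) → R a (iv t) a₂ (iv t)
    reduce r = r ⊙ (phase₂ ⊙ (phase₃ ⊙ (phase₄ ⊙ phase₅)))

    start : R a (iv t) a₁ (iv t)
    start = R-≗ (λ x l _ → sym (SD-shiftUp m a am x l)) idd ⊙ phase₁ m ≤-refl

    smallerM : mu M a₂ < mu M a
    smallerM = subst₂ _<_ (sym (tl a₂ (λ x lt h → SD-nb n' ≤-refl x lt h))) (sym (tl a nb))
        (smaller s (trans (sym (cn-none a n (n + 0) λ x lt le → nb x lt (subst (x ≤_) (sym M≡) le))) (trans (cong (λ k → cn k a) (sym M≡)) sA)) (≤-trans sm≤t t≤s))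
      where
      M≡ : M ≡ (n + 0) + n
      M≡ = +-comm n (n + 0)
      tl : ∀ c → NoBars c → mu M c ≡ mu n c
      tl c h = trans (cong (λ k → mu k c) M≡) (mu-tail n (n + 0) c λ x lt le → h x lt (subst (x ≤_) (sym M≡) le))

  module Main (base : Q (iv s) (iv t)) where
    word-N : Bits → Bits → List Two
    word-N a b = at n (suc n) a ∷ at n (suc n) b ∷ []

    test : Bits → Bits → ℕ → Bool
    test a b i = if i <ᵇ n then 0 <ᵇ epW (word-CC n i a b) else 0 <ᵇ epW (word-N a b)

    Lower : Bits → Bits → Set
    Lower a b = ∃ λ a' → ∃ λ b' → Vd a' b' × (Q a b ⟺ Q a' b') × mu M a' + mu M b' < mu M a + mu M b

    lowerI : ∀ i → 1 ≤ i → i < n → ∀ a b → 0 < epW (word-CC n i a b) → Vd a b → Lower a b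
    lowerI i 1≤i i<n a b en v = _ , _ , proj₁ r , proj₂ r , mv (pos E (word-CC n i a b)) (nth-pos (word-CC n i a b) en) (pos-bound E (word-CC n i a b) en)
      where
      open Inner n i 1≤i i<n hiding (M)
      r = ruleI E 1≤i i<n {a} {b} (word-CC n i a b) refl en v
      dn : ∀ c → at p q c ≡ (true , false) → suc (mu M (sw p q c)) ≡ mu M c
      dn c h = mu-down p 1≤i (≤-trans i<n n≤M) c (cong proj₁ h) (cong proj₂ h)
      dn' : ∀ c → at u su c ≡ (true , false) → suc (mu M (sw u su c)) ≡ mu M c
      dn' c h = mu-down u (≤-<-trans z≤n n<u) su≤M c (cong proj₁ h) (cong proj₂ h)
      mv : ∀ j → nth j (word-CC n i a b) ≡ (true , false) → j < 4 →
        mu M (swB (j ≡ᵇ 0) u su (swB (j ≡ᵇ 1) p q a)) + mu M (swB (j ≡ᵇ 2) u su (swB (j ≡ᵇ 3) p q b)) < mu M a + mu M b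
      mv 0 h _ = ≤-reflexive (cong (λ k → k + mu M b) (dn' a h))
      mv 1 h _ = ≤-reflexive (cong (λ k → k + mu M b) (dn a h))
      mv 2 h _ = ≤-reflexive (trans (sym (+-suc (mu M a) _)) (cong (λ k → mu M a + k) (dn' b h)))
      mv 3 h _ = ≤-reflexive (trans (sym (+-suc (mu M a) _)) (cong (λ k → mu M a + k) (dn b h)))
      mv (suc (suc (suc (suc _)))) _ (s≤s (s≤s (s≤s (s≤s ()))))

    lowerN : ∀ a b → 0 < epW (word-N a b) → Vd a b → Lower a b
    lowerN a b en v = _ , _ , proj₁ r , proj₂ r , mv (pos E (word-N a b)) (nth-pos (word-N a b) en) (pos-bound E (word-N a b) en)
      where
      r = ruleN E {a} {b} (word-N a b) refl en v
      dn : ∀ c → at n (suc n) c ≡ (true , false) → suc (mu M (sw n (suc n) c)) ≡ mu M c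
      dn c h = mu-down n 1≤n n<M c (cong proj₁ h) (cong proj₂ h)
      mv : ∀ j → nth j (word-N a b) ≡ (true , false) → j < 2 → mu M (swB (j ≡ᵇ 0) n (suc n) a) + mu M (swB (j ≡ᵇ 1) n (suc n) b) < mu M a + mu M b
      mv 0 h _ = ≤-reflexive (cong (λ k → k + mu M b) (dn a h))
      mv 1 h _ = ≤-reflexive (trans (sym (+-suc (mu M a) _)) (cong (λ k → mu M a + k) (dn b h)))
      mv (suc (suc _)) _ (s≤s (s≤s ()))

    -- R = {1, …, t} and L is annihilated by all e_i with i ≠ t.
    lowerHW : ∀ a → Vd a (iv t) → (∀ i → 1 ≤ i → i < n → i ≢ t → classical-null n a i) → (n ≢ t → ε₁ (at n (suc n) a) ≡ 0)
      → a ≗[ M ] iv s ⊎ ∃ λ a' → Vd a' (iv t) × (Q a (iv t) ⟺ Q a' (iv t)) × mu M a' < mu M a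
    lowerHW a v@(vd sA _ spA _) null nullₙ with search (λ x → not (a x)) t
    ... | inj₂ full = inj₁ (highest n a s t spA s≤n t≤s sA (λ x l h → not⁻ (full x l h)) (λ i l lt h → null i l h (>⇒≢ lt)) (λ lt → nullₙ (>⇒≢ lt)))
      where
      not⁻ : ∀ {b} → not b ≡ false → b ≡ true
      not⁻ {true} _ = refl
    ... | inj₁ (suc m , _ , sm≤t , am') = inj₂ (go (search (λ c → a (bar n c)) n))
      where
      notT : ∀ {b} → not b ≡ true → b ≡ false
      notT {false} _ = refl
      am : a (suc m) ≡ false
      am = notT am'
      downX : ∀ i → 1 ≤ i → i < n → i ≢ t → a (suc i) ≡ true → a i ≡ true
      downX i l lt ne = ConnectA-ε (proj₁ (epW-2 (at (2 * n ∸ i) (suc (2 * n ∸ i)) a) (at i (suc i) a) (null i l lt ne)))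
        where
        ConnectA-ε : ε₁ (at i (suc i) a) ≡ 0 → a (suc i) ≡ true → a i ≡ true
        ConnectA-ε h x with a (suc i) | a i
        ... | true | true = refl
        ConnectA-ε () x | true | false
        ConnectA-ε h () | false | _
      at≡f : a t ≡ false
      at≡f = up t sm≤t ≤-refl
        where
        up : ∀ j → suc m ≤ j → j ≤ t → a j ≡ false
        up (suc j) le h with m≤n⇒m<n∨m≡n le
        ... | inj₂ refl = am
        ... | inj₁ (s≤s lt) with a (suc j) in q
        ...   | false = refl
        ...   | true = ⊥-elim (true≢false (downX j (≤-trans (s≤s z≤n) lt) (≤-trans h t≤n) (<⇒≢ h) q) (up j lt (<⇒≤ h)))
      go : _ → ∃ λ a' → Vd a' (iv t) × (Q a (iv t) ⟺ Q a' (iv t)) × mu M a' < mu M a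
      go (inj₂ none) = G.a₂ , proj₁ r , proj₂ r , G.smallerM
        where
        nb : NoBars a
        nb x lt h = subst (λ y → a y ≡ false) (bar-bar n x (m≤n⇒m≤1+n h)) (none (bar n x) (proj₁ (bar-range n x (≤-<-trans z≤n lt) h)) (bar-low n x lt))
        module G where
          open Gap a m sm≤t am sA nb (λ i lt i<n → downX i (≤-<-trans z≤n lt) i<n (>⇒≢ lt)) public
          open GapData n' a m t sm≤t m≤n' am public using (a₂)
        r = G.reduce G.start v
      go (inj₁ (c₀ , 1≤c₀ , c₀≤n , bc₀)) = let (c , l , h , A) = least c₀ c₀ 1≤c₀ ≤-refl c₀≤n bc₀ in Bars.finish c l h a A v
        where
        -- every barred letter of index > t lies below an unbarred one
        cover : ∀ k d → d + k ≡ n → t < d → a (bar n d) ≡ true → ∃ λ j → d ≤ j × j ≤ n × a j ≡ true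
        cover zero d e t<d h = d , ≤-refl , ≤-reflexive d≡n , an (at n (suc n) a) refl (nullₙ (λ x → <⇒≢ t<d (trans (sym x) (sym d≡n))))
          where
          d≡n : d ≡ n
          d≡n = trans (sym (+-identityʳ d)) e
          an : ∀ X → at n (suc n) a ≡ X → ε₁ X ≡ 0 → a d ≡ true
          an (x , y) hX h0 = trans (cong a d≡n) (fin x y hX h0)
            where
            fin : ∀ x y → at n (suc n) a ≡ (x , y) → ε₁ (x , y) ≡ 0 → a n ≡ true
            fin x true hX _ = cong proj₂ hX
            fin true false _ ()
            fin false false hX _ = ⊥-elim (true≢false h (trans (cong a (trans (cong (bar n) d≡n) (bar-n n))) (cong proj₁ hX)))
        cover (suc k) d e t<d h with a d in ad
        ... | true = d , ≤-refl , subst (d ≤_) e (m≤m+n d (suc k)) , ad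
        ... | false with a (bar n (suc d)) in ad'
        ...   | true = let (j , x , y , z) = cover k (suc d) (trans (sym (+-suc d k)) e) (m<n⇒m<1+n t<d) ad' in j , <⇒≤ x , y , z
        ...   | false = ⊥-elim (<⇒≱ (s≤s z≤n) (subst₂ _≤_ εU φX (proj₂ (epW-2 (at u su a) (at d (suc d) a) (null d 1≤d d<n (>⇒≢ t<d))))))
          where
          1≤d : 1 ≤ d
          1≤d = ≤-<-trans z≤n t<d
          d<n : d < n
          d<n = subst (suc d ≤_) e (≤-trans (≤-reflexive (+-comm 1 d)) (+-monoʳ-≤ d (s≤s z≤n)))
          open Inner n d 1≤d d<n hiding (M)
          εU : ε₁ (at u su a) ≡ 1
          εU = cong ε₁ (cong₂ _,_ (trans (cong a (sym bar-p)) h) ad')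
          φX : φ₁ (at d (suc d) a) ≡ 0
          φX = cong (λ b → φ₁ (a (suc d) , b)) ad
        filled : ∀ k j → a j ≡ true → j ≤ n → ∀ x → t < x → k + x ≡ j → a x ≡ true
        filled zero j aj _ x _ refl = aj
        filled (suc k) j aj le x t<x e = downX x (≤-<-trans z≤n t<x) (≤-trans (subst (suc x ≤_) (trans (+-suc k x) e) (m≤n+m (suc x) k)) le) (>⇒≢ t<x)
          (filled k j aj le (suc x) (m<n⇒m<1+n t<x) (trans (+-suc k x) e))
        above : ∀ c → c ≤ n → a (bar n c) ≡ true → t < c → a (suc t) ≡ true × a t ≡ false × (∀ x → t < x → x ≤ c → a x ≡ true)
        above c c≤n bc t<c = fl (suc t) ≤-refl t<c , at≡f , fl
          where
          cv = cover (n ∸ c) c (m+[n∸m]≡n c≤n) t<c bc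
          fl : ∀ x → t < x → x ≤ c → a x ≡ true
          fl x lt le = let (j , cj , jn , aj) = cv in filled (j ∸ x) j aj jn x lt (m∸n+n≡m (≤-trans le cj))
        least : ∀ k c → 1 ≤ c → c ≤ k → c ≤ n → a (bar n c) ≡ true → ∃ λ c → 1 ≤ c × c ≤ n × Bars.At c a
        least (suc k) (suc c) l c≤k le h with search (λ z → a (bar n z)) c
        ... | inj₂ none = suc c , l , le , record { here = h ; noneBelow = λ z x y → none z x (≤-pred y) ; above = above (suc c) le h }
        ... | inj₁ (z , z1 , z≤ , hz) = least k z z1 (≤-trans z≤ (≤-pred c≤k)) (≤-trans z≤ (<⇒≤ le)) hz

    good : ∀ N a b → mu M a + mu M b < N → Vd a b → Q a b
    good (suc N) a b lt v = go (search (test a b) n)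
      where
      lower : Lower a b → Q a b
      lower (a' , b' , v' , q , l) = proj₂ q (good N a' b' (<-≤-trans l (≤-pred lt)) v')
      go : _ → Q a b
      go (inj₁ (i , 1≤i , i≤n , en)) with i <ᵇ n in q
      ... | true = lower (lowerI i 1≤i (<ᵇ-elim i n q) a b (<ᵇ-elim 0 _ en) v)
      ... | false = lower (lowerN a b (<ᵇ-elim 0 _ en) v)
      go (inj₂ none) = fin (lowerHW a v₀ nullA nullAN)
        where
        u : ℕ → ℕ
        u i = 2 * n ∸ i
        wA wB : ℕ → List Two
        wA i = at (u i) (suc (u i)) a ∷ at i (suc i) a ∷ []
        wB i = at (u i) (suc (u i)) b ∷ at i (suc i) b ∷ []
        eq0 : ∀ i → 1 ≤ i → i < n → epW (wB i) + (epW (wA i) ∸ phW (wB i)) ≡ 0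
        eq0 i l h = trans (sym (epW-++ (wA i) (wB i))) (n≤0⇒n≡0 (<ᵇ-elim-no 0 _ (subst (λ c → (if c then 0 <ᵇ epW (word-CC n i a b) else 0 <ᵇ epW (word-N a b)) ≡ false) (<ᵇ-yes h) (none i l (<⇒≤ h)))))
        eqN : epW (word-N a b) ≡ 0
        eqN = n≤0⇒n≡0 (<ᵇ-elim-no 0 _ (subst (λ c → (if c then 0 <ᵇ epW (word-CC n n a b) else 0 <ᵇ epW (word-N a b)) ≡ false) (<ᵇ-no {n} {n} ≤-refl) (none n 1≤n ≤-refl)))
        eqN₂ = epW-2 (at n (suc n) a) (at n (suc n) b) eqN
        b≗ : b ≗[ M ] iv t
        b≗ = highest n b t 0 (Vd.spB v) t≤n z≤n (Vd.sB v) (λ { (suc _) _ () }) (λ i l _ h → m+n≡0⇒m≡0 (epW (wB i)) (eq0 i l h)) (λ _ → proj₁ eqN₂)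
        v₀ : Vd a (iv t)
        v₀ = proj₁ (R-≗ idd b≗ v)
        nullA : ∀ i → 1 ≤ i → i < n → i ≢ t → classical-null n a i
        nullA i l h ne = n≤0⇒n≡0 (subst (epW (wA i) ≤_) (trans (cong phW wb≡) (ph0 ne)) (m∸n≡0⇒m≤n (m+n≡0⇒n≡0 (epW (wB i)) (eq0 i l h))))
          where
          open Inner n i l h using (p; q; su; n<u; su≤M; site-low; site-high) renaming (u to u')
          wb≡ : wB i ≡ (false , false) ∷ at i (suc i) (iv t) ∷ []
          wb≡ = cong₂ (λ x y → x ∷ y ∷ []) (trans (at-cong site-high b≗) (cong₂ _,_ (ivHigh su (<-trans n<u ≤-refl)) (ivHigh u' n<u))) (at-cong site-low b≗)
          ph0 : i ≢ t → phW ((false , false) ∷ at i (suc i) (iv t) ∷ []) ≡ 0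
          ph0 ne = trans (cong (λ h → h + (0 ∸ ε₁ (at i (suc i) (iv t)))) (iv-phi t i ne)) (0∸n≡0 (ε₁ (at i (suc i) (iv t))))
        nullAN : n ≢ t → ε₁ (at n (suc n) a) ≡ 0
        nullAN ne = n≤0⇒n≡0 (subst (ε₁ (at n (suc n) a) ≤_) (trans (cong φ₁ (at-cong (Bd-site 1≤n bN) b≗)) (iv-phi t n ne)) (proj₂ eqN₂))
        fin : _ → Q a b
        fin (inj₁ a≗) = proj₂ (proj₂ (R-≗ a≗ b≗ v)) base
        fin (inj₂ (a' , v' , q , l)) = proj₂ (proj₂ (R-≗ idd b≗ v)) (proj₂ q (good N a' (iv t)
          (<-≤-trans (+-monoˡ-< (mu M (iv t)) l) (≤-trans (≤-reflexive (cong (λ h → mu M a + h) (mu-cong M λ x l h → sym (b≗ x l h)))) (≤-pred lt))) v'))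

    connected : ∀ a b → Vd a b → Q a b
    connected a b v = good (suc (mu M a + mu M b)) a b ≤-refl v

nested : ∀ {M} {L R : Bits} → 1 ≤ M → (∀ x → 1 ≤ x → x ≤ M → R x ≡ true → L x ≡ true) → Pass M L R R L (λ _ → 0)
nested {M} {L} {R} 1≤M h = pass vt (1 , ≤-refl , 1≤M , refl)
  where
  vt : ∀ x → 1 ≤ x → x ≤ M → V 0 (L x) (R x) (R x) (L x) 0
  vt x a b with L x | R x | h x a b
  ... | true | true | _ = both
  ... | true | false | _ = stay
  ... | false | false | _ = nn
  ... | false | true | k = ⊥-elim (true≢false (k refl) refl)

epW-zeros : ∀ x y z w → ε₁ x ≡ 0 → ε₁ y ≡ 0 → ε₁ z ≡ 0 → ε₁ w ≡ 0 → epW (x ∷ y ∷ z ∷ w ∷ []) ≡ 0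
epW-zeros x y z w a b c d rewrite a | b | c | d | 0∸n≡0 (φ₁ w + 0) | 0∸n≡0 (φ₁ z + (φ₁ w + 0)) | 0∸n≡0 (φ₁ y + (φ₁ z + (φ₁ w + 0))) = refl

star-cong : ∀ {n} {c d : Bits} → c ≗[ 2 * n ] d → star n c ≗[ 2 * n ] star n d
star-cong {n} h x a b = let (k , l) = bar-range n x a b in cong not (h (bar n x) k l)

glue-cong : ∀ {n M} {f g f' g' : Bits} → f ≗[ M ] f' → g ≗[ M ] g' → glue n f g ≗[ M ] glue n f' g'
glue-cong {n} h h' x a b with x ≤ᵇ n
... | true = h x a b
... | false = h' x a b

emb₁-cong : ∀ φ {n c d l g} → c ≗[ 2 * n ] d → emb₁ φ n c l g ≗[ 2 * n ] emb₁ φ n d l g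
emb₁-cong LR {n} {l = l} h = glue-cong {n} {f = l} (λ _ _ _ → refl) h
emb₁-cong RL {n} {l = l} h = glue-cong {n} {g = star n l} (star-cong {n} h) (λ _ _ _ → refl)

emb₂-cong : ∀ φ {n c d l g} → c ≗[ 2 * n ] d → emb₂ φ n c l g ≗[ 2 * n ] emb₂ φ n d l g
emb₂-cong LR {n} {g = g} h = glue-cong {n} {f = g} (λ _ _ _ → refl) (star-cong {n} h)
emb₂-cong RL {n} {g = g} h = glue-cong {n} {g = star n g} h (λ _ _ _ → refl)

iv-⊆ : ∀ {s t} → t ≤ s → ∀ x → iv t x ≡ true → iv s x ≡ true
iv-⊆ {s} {t} le x h = ≤ᵇ-yes (≤-trans (≤ᵇ-elim x t h) le)

iv-split : ∀ n r → r ≤ n → Split n (iv r) (iv r) (λ _ → true) (λ _ → 0)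
iv-split n r le = split vt refl refl
  where
  vt : ∀ z → 1 ≤ z → z ≤ n → V 0 (star n (iv r) z) (iv r z) (iv r z) true 0
  vt z _ h rewrite ≤ᵇ-no {bar n z} {r} (≤-<-trans le (bar-high n z h)) with z ≤ᵇ r
  ... | true = both
  ... | false = stay

-- {1, …, M − r}
coiv : ℕ → ℕ → Bits
coiv n r = glue n (λ _ → true) (star n (iv r))

isLR : Emb → Bool
isLR LR = true
isLR RL = false

emb₁-iv : ∀ φ n r → r ≤ n → emb₁ φ n (iv r) (iv r) (λ _ → true) ≗[ 2 * n ] (λ x → if isLR φ then iv r x else coiv n r x)
emb₁-iv LR n r le x _ _ with x ≤ᵇ n
... | true = refl
... | false = refl
emb₁-iv RL n r le x _ _ with x ≤ᵇ n in q
... | true = cong not (≤ᵇ-no {bar n x} {r} (≤-<-trans le (bar-high n x (≤ᵇ-elim x n q))))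
... | false = refl

emb₂-iv : ∀ φ n r → r ≤ n → emb₂ φ n (iv r) (iv r) (λ _ → true) ≗[ 2 * n ] (λ x → if isLR φ then coiv n r x else iv r x)
emb₂-iv LR n r le x _ _ = refl
emb₂-iv RL n r le x _ _ with x ≤ᵇ n in q
... | true = refl
... | false = sym (≤ᵇ-no {x} {r} (≤-<-trans le (≤ᵇ-elim-no x n q)))

coiv-⊆ : ∀ n {s t} → t ≤ s → ∀ x → coiv n s x ≡ true → coiv n t x ≡ true
coiv-⊆ n {s} {t} le x h with x ≤ᵇ n
... | true = refl
... | false with iv t (bar n x) in q
...   | false = refl
...   | true rewrite iv-⊆ le (bar n x) q = h

iv-⊆-coiv : ∀ n {s t} → s ≤ n → ∀ x → iv s x ≡ true → coiv n t x ≡ true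
iv-⊆-coiv n {s} {t} le x h = glue-low n (λ _ → true) (star n (iv t)) x (≤-trans (≤ᵇ-elim x s h) le)

nestedChain : ∀ φ n s t → 1 ≤ n → t ≤ s → s ≤ n →
  Chain (2 * n) (emb₁ φ n (iv s) (iv s) (λ _ → true) , emb₂ φ n (iv s) (iv s) (λ _ → true) , emb₁ LR n (iv t) (iv t) (λ _ → true) , emb₂ LR n (iv t) (iv t) (λ _ → true))
          (emb₁ LR n (iv t) (iv t) (λ _ → true) , emb₂ LR n (iv t) (iv t) (λ _ → true) , emb₁ φ n (iv s) (iv s) (λ _ → true) , emb₂ φ n (iv s) (iv s) (λ _ → true)) (λ _ → 0) (λ _ → 0)
nestedChain φ n s t 1≤n t≤s s≤n = Chain-cong (eqQ (≗-sym (emb₁-iv φ n s s≤n)) (≗-sym (emb₂-iv φ n s s≤n)) (≗-sym (emb₁-iv LR n t t≤n)) (≗-sym (emb₂-iv LR n t t≤n)))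
    (eqQ (≗-sym (emb₁-iv LR n t t≤n)) (≗-sym (emb₂-iv LR n t t≤n)) (≗-sym (emb₁-iv φ n s s≤n)) (≗-sym (emb₂-iv φ n s s≤n))) (ch φ)
  where
  t≤n = ≤-trans t≤s s≤n
  1≤M : 1 ≤ 2 * n
  1≤M = ≤-trans 1≤n (m≤m+n n _)
  ≗-sym : ∀ {c d : Bits} → c ≗[ 2 * n ] d → d ≗[ 2 * n ] c
  ≗-sym h x a b = sym (h x a b)
  ii : Pass (2 * n) (iv s) (iv t) (iv t) (iv s) (λ _ → 0)
  ii = nested 1≤M λ x _ _ → iv-⊆ t≤s x
  ci : ∀ {r r'} → r ≤ n → Pass (2 * n) (coiv n r') (iv r) (iv r) (coiv n r') (λ _ → 0)
  ci {r} {r'} le = nested 1≤M λ x _ _ → iv-⊆-coiv n {r} {r'} le x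
  cc : Pass (2 * n) (coiv n t) (coiv n s) (coiv n s) (coiv n t) (λ _ → 0)
  cc = nested 1≤M λ x _ _ → coiv-⊆ n t≤s x
  in₁ in₂ : Emb → ℕ → Bits
  in₁ φ r x = if isLR φ then iv r x else coiv n r x
  in₂ φ r x = if isLR φ then coiv n r x else iv r x
  ch : ∀ φ → Chain (2 * n) (in₁ φ s , in₂ φ s , iv t , coiv n t) (iv t , coiv n t , in₁ φ s , in₂ φ s) (λ _ → 0) (λ _ → 0)
  ch LR = chain (ci t≤n) ii cc (ci s≤n)
  ch RL = chain ii (ci t≤n) (ci s≤n) cc

module BaseC (n' : ℕ) (σ : Pair → Pair) (H : Pair → ℤ) (isR : IsRMatrix (typeC (suc n')) σ) (isE : IsEnergy (typeC (suc n')) σ H)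
  (s t : ℕ) (hs : HeightOK (typeC (suc n')) s) (ht : HeightOK (typeC (suc n')) t) (t≤s : t ≤ s) where
  open TypeC n' σ H isR isE
  open ConnectC n' σ H isR isE s t hs ht t≤s
  open ReduceC n' σ H isR isE s t hs ht t≤s using (module Main)

  x₀ : Pair
  x₀ = asc M (iv s) , asc M (iv t)
  one : Bits
  one _ = true
  V₀ : Vd (iv s) (iv t)
  V₀ = vd (cn-iv M s (≤-trans s≤n n≤M)) (cn-iv M t (≤-trans t≤n n≤M)) (spl (iv s) one _ (iv-split n s s≤n)) (spl (iv t) one _ (iv-split n t t≤n))
  c d : Bits
  c = χ (proj₁ (σ x₀))
  d = χ (proj₂ (σ x₀))
  vσ : InPair K t s (σ x₀)
  vσ = proj₁ (isR s t hs ht) x₀ (pairOK V₀)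
  cols = toPair t s (σ x₀) vσ
  σ≡ : σ x₀ ≡ (asc M c , asc M d)
  σ≡ = cong₂ _,_ (IsCol.list (IsColC.col (proj₁ cols))) (IsCol.list (IsColC.col (proj₂ cols)))

  at₀ : ∀ {r} → 1 ≤ r → r ≤ n → at M 1 (iv r) ≡ (true , false)
  at₀ 1≤r r≤n = cong₂ _,_ (≤ᵇ-yes 1≤r) (≤ᵇ-no (≤-<-trans r≤n n<M))

  step₀ : ∀ j {a b} w → at M 1 a ∷ at M 1 b ∷ [] ≡ w → 0 < epW w → pos E w ≡ j → CArrow E n a b (swB (j ≡ᵇ 0) M 1 a) (swB (j ≡ᵇ 1) M 1 b) 0
  step₀ j w refl en refl = affine en (λ _ _ _ → refl) (λ _ _ _ → refl)

  arrow₁ : CArrow E n (iv s) (iv t) (sw M 1 (iv s)) (iv t) 0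
  arrow₁ = step₀ 0 _ (cong₂ (λ x y → x ∷ y ∷ []) (at₀ (≤-trans 1≤t t≤s) s≤n) (at₀ 1≤t t≤n)) (s≤s z≤n) refl
  arrow₂ : CArrow E n (sw M 1 (iv s)) (iv t) (sw M 1 (iv s)) (sw M 1 (iv t)) 0
  arrow₂ = step₀ 1 _ (cong₂ (λ x y → x ∷ y ∷ []) (trans (at-swB (SiteProps.p≢q (Bd-site 1≤n b0)) true (iv s)) (cong (swIf true) (at₀ (≤-trans 1≤t t≤s) s≤n))) (at₀ 1≤t t≤n)) (s≤s z≤n) refl

  arrowσ : ∀ {a b a' b'} → CArrow E n a b a' b' 0 → Vd a b → Arrow M M 1 (σ (asc M a , asc M b)) (σ (asc M a' , asc M b'))
  arrowσ {a} {b} {a'} {b'} A v = let (isColC (isCol el _) sl , isColC (isCol er _) sr) = P.cσ in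
    arrow el er (colC-spec0 n' _ (no-pair-1 1≤n sl)) (colC-spec0 n' _ (no-pair-1 1≤n sr)) P.eσ
    where module P = Prop {s} {t} hs ht z≤n (asc M a , asc M b) (asc M a' , asc M b') (pairOK v) (eArrow A v)

  c1 : c 1 ≡ true
  c1 = proj₁ (twice (Bd-site 1≤n b0) (arrowσ arrow₁ V₀) (arrowσ arrow₂ (newVd E arrow₁ V₀)))

  module At (i : ℕ) (lt : suc i < n) where
    j u : ℕ
    j = suc i
    u = 2 * n ∸ j
    open Inner n j (s≤s z≤n) lt using (site-low; site-high; n<u)
    open InnerPair j (s≤s z≤n) lt using (colWordSpec)
    SK = Sem-col {e0 = e0C n} {f0 = f0C n} (λ _ → refl) (LetterC.S n j (s≤s z≤n) (<⇒≤ lt) u refl)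
    open Strings {K} {σ} isR {s} {t} hs ht SK public
    wd : Bits → List Two
    wd c = at u (suc u) c ∷ at j (suc j) c ∷ []
    φ-bits : ∀ a b → φ₂ (asc M a , asc M b) ≡ phW (wd a) + (phW (wd b) ∸ epW (wd a))
    φ-bits a b = cong₂ _+_ (ColSpec.φS (sp a a b)) (cong₂ _∸_ (ColSpec.φS (sp b a b)) (ColSpec.εS (sp a a b)))
      where
      sp : ∀ c a b → _
      sp c a b = colWordSpec a b c
    wd-iv : ∀ r → r ≤ n → wd (iv r) ≡ (false , false) ∷ at j (suc j) (iv r) ∷ []
    wd-iv r le = cong (λ h → h ∷ at j (suc j) (iv r) ∷ []) (cong₂ _,_ (≤ᵇ-no (≤-<-trans le (<-trans n<u ≤-refl))) (≤ᵇ-no (≤-<-trans le n<u)))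
    ph-iv : ∀ r → r ≤ n → j ≢ r → phW (wd (iv r)) ≡ 0
    ph-iv r le ne = trans (cong phW (wd-iv r le)) (trans (cong (λ h → h + (0 ∸ ε₁ (at j (suc j) (iv r)))) (iv-phi r j ne)) (0∸n≡0 (ε₁ (at j (suc j) (iv r)))))
    f-zero : j ≢ s → j ≢ t → phW (wd c) ≡ 0
    f-zero ns nt = m+n≡0⇒m≡0 (phW (wd c)) (trans (sym (φ-bits c d)) (trans (cong φ₂ (sym σ≡)) (f-null x₀ (pairOK V₀)
      (trans (φ-bits (iv s) (iv t)) (cong₂ _+_ (ph-iv s s≤n ns) (trans (cong (λ h → h ∸ epW (wd (iv s))) (ph-iv t t≤n nt)) (0∸n≡0 (epW (wd (iv s))))))))))

  c-next : ∀ i → suc (suc i) ≤ t → (∀ x → 1 ≤ x → x ≤ suc i → c x ≡ true) → c (suc (suc i)) ≡ true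
  c-next i le pre with c (suc (suc i)) in cj
  ... | true = refl
  ... | false = ⊥-elim (prefix-bar (IsColC.sp (proj₁ cols)) (suc i) (<⇒≤ lt) pre (suc i) (s≤s z≤n) ≤-refl
      (trans (cong c (bar-suc n (suc i) (<⇒≤ lt))) (minus (at u (suc u) c) (at (suc i) (suc (suc i)) c) (cong₂ _,_ cj (pre (suc i) (s≤s z≤n) ≤-refl))
        (At.f-zero i lt (<⇒≢ (<-≤-trans le t≤s)) (<⇒≢ le)))))
    where
    lt = <-≤-trans le t≤n
    u = 2 * n ∸ suc i
    minus : ∀ U X → X ≡ (false , true) → phW (U ∷ X ∷ []) ≡ 0 → proj₁ U ≡ true
    minus (true , _) _ _ _ = refl
    minus (false , false) _ refl ()
    minus (false , true) _ refl ()

  c≗ : c ≗[ M ] iv t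
  c≗ = full-size M c t (≤-trans t≤n n≤M) (pre t ≤-refl) (IsCol.size (IsColC.col (proj₁ cols)))
    where
    pre : ∀ k → k ≤ t → ∀ x → 1 ≤ x → x ≤ k → c x ≡ true
    pre zero _ (suc x) _ ()
    pre (suc k) le x l h with m≤n⇒m<n∨m≡n h
    ... | inj₁ (s≤s h') = pre k (<⇒≤ le) x l h'
    ... | inj₂ refl = last-c k le (pre k (<⇒≤ le))
      where
      last-c : ∀ k → suc k ≤ t → (∀ x → 1 ≤ x → x ≤ k → c x ≡ true) → c (suc k) ≡ true
      last-c zero _ _ = c1
      last-c (suc k) = c-next k

  noE : ∀ i → e (pairK K) i x₀ ≡ nothing → e (pairK K) i (asc M c , asc M d) ≡ nothing
  noE i h = trans (cong (e (pairK K) i) (sym σ≡)) (trans (proj₁ (proj₂ (proj₂ (proj₂ (isR s t hs ht)))) i x₀ (pairOK V₀)) (cong (mapMaybe σ) h))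

  stuck : ∀ k {A : Set} {x : A} → (if 0 <ᵇ k then just x else nothing) ≡ nothing → k ≡ 0
  stuck zero _ = refl

  unstuck : ∀ {k} {A : Set} {x : A} → k ≡ 0 → (if 0 <ᵇ k then just x else nothing) ≡ nothing
  unstuck refl = refl

  d≗ : d ≗[ M ] iv s
  d≗ = highest n d s 0 (IsColC.sp (proj₂ cols)) s≤n z≤n (IsCol.size (IsColC.col (proj₂ cols))) (λ { (suc _) _ () }) null (λ _ → nullₙ)
    where
    null : ∀ i → 1 ≤ i → 0 < i → i < n → classical-null n d i
    null i 1≤i _ i<n = m+n≡0⇒m≡0 (epW (wd d)) (trans (sym (epW-++ (wd c) (wd d))) (stuck (epW (word-CC n i c d)) (trans (sym (InnerPair.pairSpec i 1≤i i<n c d))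
      (noE i (trans (InnerPair.pairSpec i 1≤i i<n (iv s) (iv t)) (unstuck
        (epW-zeros (at u (suc u) (iv s)) (at i (suc i) (iv s)) (at u (suc u) (iv t)) (at i (suc i) (iv t)) (hi s s≤n) (iv-eps s i) (hi t t≤n) (iv-eps t i))))))))
      where
      open Inner n i 1≤i i<n using (n<u; u)
      wd : Bits → List Two
      wd c = at u (suc u) c ∷ at i (suc i) c ∷ []
      hi : ∀ r → r ≤ n → ε₁ (at u (suc u) (iv r)) ≡ 0
      hi r le = iv-eps r u
    nullₙ : ε₁ (at n (suc n) d) ≡ 0
    nullₙ = proj₁ (epW-2 (at n (suc n) c) (at n (suc n) d) (stuck (epW (at n (suc n) c ∷ at n (suc n) d ∷ [])) (trans (sym (pair-spec c d (colC-specN n' c) (colC-specN n' d)))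
      (noE n (trans (pair-spec (iv s) (iv t) (colC-specN n' (iv s)) (colC-specN n' (iv t))) (unstuck
        (two (at n (suc n) (iv s)) (at n (suc n) (iv t)) (iv-eps s n) (iv-eps t n))))))))
      where
      two : ∀ A B → ε₁ A ≡ 0 → ε₁ B ≡ 0 → epW (A ∷ B ∷ []) ≡ 0
      two A B a b rewrite a | b = 0∸n≡0 (φ₁ B + 0)

  base : ∀ φ → Inv φ x₀
  base φ = 0 , inv₄ (on s≤n χs) (on t≤n χt) (on t≤n λ x l h → sym (c≗ x l h)) (on s≤n λ x l h → sym (d≗ x l h)) (λ _ → 0) (λ _ → 0)
      (Chain-cong (eqQ (e₁ φ s χs) (e₂ φ s χs) (e₁ LR t χt) (e₂ LR t χt))
        (eqQ (e₁ LR t λ x l h → sym (c≗ x l h)) (e₂ LR t λ x l h → sym (c≗ x l h)) (e₁ φ s λ x l h → sym (d≗ x l h)) (e₂ φ s λ x l h → sym (d≗ x l h)))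
        (nestedChain φ n s t 1≤n t≤s s≤n)) refl ,
    trans (cong H (cong₂ _,_ (asc-iv M s (≤-trans s≤n n≤M)) (asc-iv M t (≤-trans t≤n n≤M)))) (proj₂ (isE s t hs ht))
    where
    χs : iv s ≗[ M ] χ (asc M (iv s))
    χs x l h = sym (χ-asc M (iv s) x l h)
    χt : iv t ≗[ M ] χ (asc M (iv t))
    χt x l h = sym (χ-asc M (iv t) x l h)
    e₁ : ∀ φ r {c} → iv r ≗[ M ] c → emb₁ φ n (iv r) (iv r) one ≗[ M ] emb₁ φ n c (iv r) one
    e₁ φ r h = emb₁-cong φ {l = iv r} {g = one} h
    e₂ : ∀ φ r {c} → iv r ≗[ M ] c → emb₂ φ n (iv r) (iv r) one ≗[ M ] emb₂ φ n c (iv r) one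
    e₂ φ r h = emb₂-cong φ {l = iv r} {g = one} h
    on : ∀ {r c} → r ≤ n → iv r ≗[ M ] c → Spl n c
    on {r} le h = Spl-cong h (spl (iv r) one (λ _ → 0) (iv-split n r le))

  abstract
    all : ∀ x → InPair K s t x → Inv LR x × Inv RL x
    all (l , r) v = let (isColC a sa , isColC b sb) = toPair s t (l , r) v in
      subst (λ y → Inv LR y × Inv RL y) (sym (cong₂ _,_ (IsCol.list a) (IsCol.list b)))
        (Main.connected (base LR , base RL) (χ l) (χ r) (vd (IsCol.size a) (IsCol.size b) sa sb))

-- Charge and energy as sums over columns

lastOf : List ℕ → List (List ℕ) → List ℕ
lastOf d []       = d
lastOf d (x ∷ xs) = lastOf x xs

lastOf-snoc : ∀ d xs y → lastOf d (xs ++ y ∷ []) ≡ y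
lastOf-snoc d [] y = refl
lastOf-snoc d (x ∷ xs) y = lastOf-snoc x xs y

gammaFrom-snoc : ∀ M p xs y → gammaFrom M p (xs ++ y ∷ []) ≡ gammaFrom M p xs ++ nextCol M (lastOf p (gammaFrom M p xs)) y ∷ []
gammaFrom-snoc M p [] y = refl
gammaFrom-snoc M p (x ∷ xs) y = cong (λ h → nextCol M p x ∷ h) (gammaFrom-snoc M (nextCol M p x) xs y)

-- The filling γ of columns listed from right to left, and its rightmost column
fullArr : ℕ → List (List ℕ) → List ℕ
fullArr M []             = []
fullArr M (β ∷ [])       = β
fullArr M (β ∷ (α ∷ cs)) = nextCol M (fullArr M (α ∷ cs)) β

filling : ℕ → List (List ℕ) → List (List ℕ)
filling M []             = []
filling M (β ∷ [])       = β ∷ []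
filling M (β ∷ (α ∷ cs)) = filling M (α ∷ cs) ++ fullArr M (β ∷ (α ∷ cs)) ∷ []

filling-last : ∀ M d β cs → lastOf d (filling M (β ∷ cs)) ≡ fullArr M (β ∷ cs)
filling-last M d β [] = refl
filling-last M d β (α ∷ cs) = lastOf-snoc d (filling M (α ∷ cs)) _

gamma-filling : ∀ M cs → gamma M (reverse cs) ≡ filling M cs
gamma-filling M [] = refl
gamma-filling M (β ∷ []) = refl
gamma-filling M (β ∷ (α ∷ cs)) = trans (cong (gamma M) (unfold-reverse β (α ∷ cs))) (go (reverse (α ∷ cs)) refl (gamma-filling M (α ∷ cs)))
  where
  go : ∀ xs → reverse (α ∷ cs) ≡ xs → gamma M (reverse (α ∷ cs)) ≡ filling M (α ∷ cs) → gamma M (xs ++ β ∷ []) ≡ filling M (β ∷ (α ∷ cs))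
  go [] e _ = ⊥-elim (<⇒≢ {0} {suc (length cs)} (s≤s z≤n) (trans (cong length (sym e)) (length-reverse (α ∷ cs))))
  go (x ∷ xs) e ih = trans (cong (λ h → x ∷ h) (gammaFrom-snoc M x xs β)) (cong₂ (λ h g → h ++ nextCol M g β ∷ []) eq
      (trans (cong (lastOf []) eq) (filling-last M [] α cs)))
    where
    eq : gamma M (x ∷ xs) ≡ filling M (α ∷ cs)
    eq = trans (cong (gamma M) (sym e)) ih

dsum : (ℕ → ℕ) → List ℕ → List ℕ → ℕ
dsum w (x ∷ xs) (y ∷ ys) = when (y <ᵇ x) (w 0) + dsum (λ i → w (suc i)) xs ys
dsum w _ _ = 0

sumArms-dsum : ∀ c c' cs → sumArms (c ∷ c' ∷ cs) ≡ dsum (λ i → countLongerThan i (c' ∷ cs)) c c' + sumArms (c' ∷ cs)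
sumArms-dsum c c' cs = cong (λ h → h + sumArms (c' ∷ cs)) (go (λ i → i) c c')
  where
  w : ℕ → ℕ
  w i = countLongerThan i (c' ∷ cs)
  go : ∀ f c c' → foldr _+_ 0 (map (λ t → when (proj₂ (proj₂ t) <ᵇ proj₁ (proj₂ t)) (w (proj₁ t))) (zip (applyUpTo f (length c)) (zip c c'))) ≡ dsum (λ i → w (f i)) c c'
  go f [] c' = refl
  go f (x ∷ c) [] = refl
  go f (x ∷ c) (y ∷ c') = cong (λ h → when (y <ᵇ x) (w (f 0)) + h) (go (λ i → f (suc i)) c c')

dsum-+ : ∀ w v xs ys → dsum (λ i → w i + v i) xs ys ≡ dsum w xs ys + dsum v xs ys
dsum-+ w v [] ys = refl
dsum-+ w v (x ∷ xs) [] = refl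
dsum-+ w v (x ∷ xs) (y ∷ ys) = trans (cong₂ _+_ (one (y <ᵇ x)) (dsum-+ (λ i → w (suc i)) (λ i → v (suc i)) xs ys))
  (interchange (when (y <ᵇ x) (w 0)) (when (y <ᵇ x) (v 0)) (dsum (λ i → w (suc i)) xs ys) (dsum (λ i → v (suc i)) xs ys))
  where
  one : ∀ b → when b (w 0 + v 0) ≡ when b (w 0) + when b (v 0)
  one true = refl
  one false = refl

dsum-cong : ∀ {w v} xs ys → (∀ i → w i ≡ v i) → dsum w xs ys ≡ dsum v xs ys
dsum-cong [] ys h = refl
dsum-cong (x ∷ xs) [] h = refl
dsum-cong (x ∷ xs) (y ∷ ys) h = cong₂ (λ a b → when (y <ᵇ x) a + b) (h 0) (dsum-cong xs ys λ i → h (suc i))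

dsum-take : ∀ h xs ys → dsum (λ i → b2n (i <ᵇ h)) xs ys ≡ desc# (take h xs) (take h ys)
dsum-take zero [] ys = refl
dsum-take zero (x ∷ xs) [] = refl
dsum-take zero (x ∷ xs) (y ∷ ys) = cong₂ _+_ (none (y <ᵇ x)) (dsum-take zero xs ys)
  where
  none : ∀ b → when b 0 ≡ 0
  none true = refl
  none false = refl
dsum-take (suc h) [] ys = refl
dsum-take (suc h) (x ∷ xs) [] = refl
dsum-take (suc h) (x ∷ xs) (y ∷ ys) = cong₂ _+_ (when-1 (y <ᵇ x)) (dsum-take h xs ys)

longer-snoc : ∀ i cs g → countLongerThan i (cs ++ g ∷ []) ≡ countLongerThan i cs + b2n (i <ᵇ length g)
longer-snoc i [] g with i <ᵇ length g
... | true = refl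
... | false = refl
longer-snoc i (c ∷ cs) g with i <ᵇ length c
... | true = cong suc (longer-snoc i cs g)
... | false = longer-snoc i cs g

trunc : ℕ → List (List ℕ) → ℕ
trunc h (c ∷ (c' ∷ cs)) = desc# (take h c) (take h c') + trunc h (c' ∷ cs)
trunc h _ = 0

sumArms-snoc : ∀ c cs g → sumArms (c ∷ cs ++ g ∷ []) ≡ sumArms (c ∷ cs) + trunc (length g) (c ∷ cs ++ g ∷ [])
sumArms-snoc c [] g = trans (sumArms-dsum c g []) (cong (λ h → h + 0) (trans (dsum-cong c g λ i → longer-snoc i [] g) (dsum-take (length g) c g)))
sumArms-snoc c (c' ∷ cs) g = begin
  sumArms (c ∷ c' ∷ cs ++ g ∷ []) ≡⟨ sumArms-dsum c c' (cs ++ g ∷ []) ⟩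
  dsum (λ i → countLongerThan i (c' ∷ cs ++ g ∷ [])) c c' + sumArms (c' ∷ cs ++ g ∷ [])
    ≡⟨ cong₂ _+_ (trans (dsum-cong c c' λ i → longer-snoc i (c' ∷ cs) g) (trans (dsum-+ w (λ i → b2n (i <ᵇ length g)) c c') (cong (λ h → dsum w c c' + h) (dsum-take (length g) c c'))))
        (sumArms-snoc c' cs g) ⟩
  (dsum w c c' + desc# (take (length g) c) (take (length g) c')) + (sumArms (c' ∷ cs) + trunc (length g) (c' ∷ cs ++ g ∷ []))
    ≡⟨ interchange (dsum w c c') _ (sumArms (c' ∷ cs)) _ ⟩
  (dsum w c c' + sumArms (c' ∷ cs)) + (desc# (take (length g) c) (take (length g) c') + trunc (length g) (c' ∷ cs ++ g ∷ []))
    ≡⟨ cong (λ h → h + trunc (length g) (c ∷ c' ∷ cs ++ g ∷ [])) (sym (sumArms-dsum c c' cs)) ⟩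
  sumArms (c ∷ c' ∷ cs) + trunc (length g) (c ∷ c' ∷ cs ++ g ∷ []) ∎
  where
  open ≡-Reasoning
  w : ℕ → ℕ
  w i = countLongerThan i (c' ∷ cs)

trunc-snoc : ∀ h c cs g → trunc h (c ∷ cs ++ g ∷ []) ≡ trunc h (c ∷ cs) + desc# (take h (lastOf c cs)) (take h g)
trunc-snoc h c [] g = +-identityʳ _
trunc-snoc h c (c' ∷ cs) g = trans (cong (λ k → desc# (take h c) (take h c') + k) (trunc-snoc h c' cs g)) (sym (+-assoc (desc# (take h c) (take h c')) _ _))

nextCol-take : ∀ M h xs β → take h (nextCol M xs β) ≡ nextCol M (take h xs) β
nextCol-take M zero xs β = refl
nextCol-take M (suc h) [] β = refl
nextCol-take M (suc h) (x ∷ xs) [] = refl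
nextCol-take M (suc h) (x ∷ xs) (y ∷ ys) = cong (λ k → cmin M x y ys ∷ k) (nextCol-take M h xs (removeOne (cmin M x y ys) (y ∷ ys)))

fullArr-take : ∀ M h cs → take h (fullArr M cs) ≡ arr M h cs
fullArr-take M zero [] = refl
fullArr-take M (suc h) [] = refl
fullArr-take M h (β ∷ []) = refl
fullArr-take M h (β ∷ (α ∷ cs)) = trans (nextCol-take M h (fullArr M (α ∷ cs)) β) (cong (λ k → nextCol M k β) (fullArr-take M h (α ∷ cs)))

trunc-filling : ∀ M h cs → trunc h (filling M cs) ≡ adj M h cs
trunc-filling M h [] = refl
trunc-filling M h (β ∷ []) = refl
trunc-filling M h (β ∷ (α ∷ cs)) = go (filling M (α ∷ cs)) refl (trunc-filling M h (α ∷ cs))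
  where
  go : ∀ xs → filling M (α ∷ cs) ≡ xs → trunc h (filling M (α ∷ cs)) ≡ adj M h (α ∷ cs) → trunc h (xs ++ fullArr M (β ∷ (α ∷ cs)) ∷ []) ≡ adj M h (β ∷ (α ∷ cs))
  go [] e _ = ⊥-elim (ne cs e)
    where
    snoc-ne : ∀ (xs : List (List ℕ)) {y} → xs ++ y ∷ [] ≡ [] → ⊥
    snoc-ne [] ()
    snoc-ne (x ∷ xs) ()
    ne : ∀ cs → filling M (α ∷ cs) ≡ [] → ⊥
    ne [] ()
    ne (γ ∷ cs) e = snoc-ne (filling M (γ ∷ cs)) e
  go (x ∷ xs) e ih = trans (trunc-snoc h x xs _) (cong₂ _+_ (trans (cong (trunc h) (sym e)) ih)
    (cong₂ desc# (trans (cong (take h) (trans (cong (lastOf []) (sym e)) (filling-last M [] α cs))) (fullArr-take M h (α ∷ cs))) (fullArr-take M h (β ∷ (α ∷ cs)))))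

arms : ℕ → List (List ℕ) → ℕ
arms M cs = sumArms (gamma M (reverse cs))

arms-∷ : ∀ M β cs → arms M (β ∷ cs) ≡ arms M cs + adj M (length (fullArr M (β ∷ cs))) (β ∷ cs)
arms-∷ M β [] = refl
arms-∷ M β (α ∷ cs) rewrite gamma-filling M (β ∷ (α ∷ cs)) | gamma-filling M (α ∷ cs) = trans (go (filling M (α ∷ cs)) refl)
    (cong (λ k → sumArms (filling M (α ∷ cs)) + k) (trunc-filling M (length (fullArr M (β ∷ (α ∷ cs)))) (β ∷ (α ∷ cs))))
  where
  g = fullArr M (β ∷ (α ∷ cs))
  go : ∀ xs → filling M (α ∷ cs) ≡ xs → sumArms (xs ++ g ∷ []) ≡ sumArms xs + trunc (length g) (xs ++ g ∷ [])
  go [] e = refl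
  go (x ∷ xs) e = sumArms-snoc x xs g

travelE : (Pair → Pair) → (Pair → ℤ) → Column → List Column → ℤ
travelE σ H Y []       = + 0
travelE σ H Y (β ∷ cs) = H (β , Y) +ℤ travelE σ H (proj₁ (σ (β , Y))) cs

Sz : ℕ → (ℕ → ℤ) → ℤ
Sz zero    g = + 0
Sz (suc N) g = g 0 +ℤ Sz N (λ i → g (suc i))

Sz-cong : ∀ N {g h} → (∀ i → g i ≡ h i) → Sz N g ≡ Sz N h
Sz-cong zero e = refl
Sz-cong (suc N) e = cong₂ _+ℤ_ (e 0) (Sz-cong N λ i → e (suc i))

Sz-last : ∀ N {g} → g N ≡ + 0 → Sz (suc N) g ≡ Sz N g
Sz-last zero e = trans (ℤₚ.+-identityʳ _) e
Sz-last (suc N) {g} e = cong (λ h → g 0 +ℤ h) (Sz-last N e)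

sumℤ-++ : ∀ xs ys → sumℤ (xs ++ ys) ≡ sumℤ xs +ℤ sumℤ ys
sumℤ-++ [] ys = sym (ℤₚ.+-identityˡ _)
sumℤ-++ (x ∷ xs) ys = trans (cong (λ h → x +ℤ h) (sumℤ-++ xs ys)) (sym (ℤₚ.+-assoc x _ _))

sumℤ-concatMap : ∀ (f : ℕ → List ℤ) k N → sumℤ (concatMap f (applyUpTo k N)) ≡ Sz N (λ i → sumℤ (f (k i)))
sumℤ-concatMap f k zero = refl
sumℤ-concatMap f k (suc N) = trans (sumℤ-++ (f (k 0)) _) (cong (λ h → sumℤ (f (k 0)) +ℤ h) (sumℤ-concatMap f (λ i → k (suc i)) N))

module Energy (σ : Pair → Pair) (H : Pair → ℤ) where
  term : List Column → ℕ → ℕ → ℤ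
  term c m d = sumℤ (if (m + d + 2) ≤ᵇ length c then run σ H m d c ∷ [] else [])

  energy-Sz : ∀ c → energyD σ H c ≡ Sz (length c) (λ m → Sz (length c) (term c m))
  energy-Sz c = trans (sumℤ-concatMap (λ m → concatMap (λ d → if (m + d + 2) ≤ᵇ length c then run σ H m d c ∷ [] else []) (upTo (length c))) (λ i → i) (length c))
    (Sz-cong (length c) λ m → sumℤ-concatMap (λ d → if (m + d + 2) ≤ᵇ length c then run σ H m d c ∷ [] else []) (λ i → i) (length c))

  run-tail : ∀ d m x cs → run σ H (suc m) d (x ∷ cs) ≡ run σ H m d cs
  run-tail zero m x cs = refl
  run-tail (suc d) m x cs = run-tail d (suc m) x (sigAt σ m cs)

  <ᵇ-suc : ∀ x y → (x <ᵇ suc y) ≡ (x ≤ᵇ y)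
  <ᵇ-suc zero y = refl
  <ᵇ-suc (suc x) y = refl

  term-tail : ∀ m d x cs → term (x ∷ cs) (suc m) d ≡ term cs m d
  term-tail m d x cs rewrite <ᵇ-suc (m + d + 2) (length cs) | run-tail d m x cs = refl

  first : ∀ Y cs → Sz (suc (length cs)) (term (Y ∷ cs) 0) ≡ travelE σ H Y cs
  first Y [] = refl
  first Y (β ∷ cs) = cong₂ _+ℤ_ (ℤₚ.+-identityʳ (H (β , Y))) (trans (Sz-cong (suc (length cs)) next) (first (proj₁ (σ (β , Y))) cs))
    where
    next : ∀ d → term (Y ∷ β ∷ cs) 0 (suc d) ≡ term (proj₁ (σ (β , Y)) ∷ cs) 0 d
    next d rewrite <ᵇ-suc (d + 2) (suc (length cs)) | run-tail d 0 (proj₂ (σ (β , Y))) (proj₁ (σ (β , Y)) ∷ cs) = refl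

  energy-∷ : ∀ Y cs → energyD σ H (Y ∷ cs) ≡ travelE σ H Y cs +ℤ energyD σ H cs
  energy-∷ Y cs = trans (energy-Sz (Y ∷ cs)) (cong₂ _+ℤ_ (first Y cs)
    (trans (Sz-cong (length cs) λ m → trans (Sz-cong (suc (length cs)) λ d → term-tail m d Y cs) (Sz-last (length cs) (last₀ m))) (sym (energy-Sz cs))))
    where
    last₀ : ∀ m → term cs m (length cs) ≡ + 0
    last₀ m rewrite ≤ᵇ-no {m + length cs + 2} {length cs} (≤-trans (≤-reflexive (+-comm 1 (length cs))) (+-mono-≤ (m≤n+m (length cs) m) (s≤s z≤n))) = refl

Sorted : List ℕ → Set
Sorted []       = ⊤
Sorted (x ∷ xs) = (∀ y → 1 ≤ mult y xs → x ≤ y) × Sorted xs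

mult-cases : ∀ y x xs → 1 ≤ mult y (x ∷ xs) → y ≡ x ⊎ 1 ≤ mult y xs
mult-cases y x xs m with y ≡ᵇ x in q
... | true = inj₁ (≡ᵇ-elim y x q)
... | false = inj₂ m

sorted-∷ : ∀ {x} y ys → x < y → Sorted (y ∷ ys) → Sorted (x ∷ y ∷ ys)
sorted-∷ {x} y ys lt (l , s) = least , l , s
  where
  least : ∀ z → 1 ≤ mult z (y ∷ ys) → x ≤ z
  least z m with mult-cases z y ys m
  ... | inj₁ refl = <⇒≤ lt
  ... | inj₂ m' = ≤-trans (<⇒≤ lt) (l z m')

strictInc-sorted : ∀ xs → strictInc xs ≡ true → Sorted xs
strictInc-sorted [] _ = tt
strictInc-sorted (x ∷ []) _ = (λ _ ()) , tt
strictInc-sorted (x ∷ y ∷ ys) h = let (p , q) = ∧-elim {x <ᵇ y} h in sorted-∷ y ys (<ᵇ-elim x y p) (strictInc-sorted (y ∷ ys) q)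

insert-sorted : ∀ x xs → Sorted xs → Sorted (insertℕ x xs)
insert-sorted x [] _ = (λ _ ()) , tt
insert-sorted x (y ∷ ys) (l , s) with x ≤ᵇ y in q
... | true = (λ z m → case z (mult-cases z y ys m)) , l , s
  where
  case : ∀ z → z ≡ y ⊎ 1 ≤ mult z ys → x ≤ z
  case z (inj₁ refl) = ≤ᵇ-elim x y q
  case z (inj₂ m) = ≤-trans (≤ᵇ-elim x y q) (l z m)
... | false = (λ z m → case z (mult-cases z x ys (subst (1 ≤_) (sumBy-insert (λ v → b2n (z ≡ᵇ v)) x ys) m))) , insert-sorted x ys s
  where
  case : ∀ z → z ≡ x ⊎ 1 ≤ mult z ys → y ≤ z
  case z (inj₁ refl) = <⇒≤ (≤ᵇ-elim-no x y q)
  case z (inj₂ m) = l z m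

sort-sorted : ∀ xs → Sorted (sortℕ xs)
sort-sorted [] = tt
sort-sorted (x ∷ xs) = insert-sorted x (sortℕ xs) (sort-sorted xs)

sorted-first : ∀ β → Sorted β → ∀ h Z → Z ⊑ β → size' Z ≡ h → ∀ a → below a Z ≤ below a (take h β)
sorted-first β s zero [] sub sz a = z≤n
sorted-first [] s (suc h) (z ∷ Z) sub sz a = ⊥-elim (<⇒≱ (mult-self z Z) (sub z))
sorted-first (x ∷ xs) (l , s) (suc h) (z ∷ Z) sub sz a with mult x (z ∷ Z) in q
... | suc _ = ≤-trans (≤-reflexive (sumBy-remove (λ y → b2n (y ≤ᵇ a)) x (z ∷ Z) mx)) (+-monoʳ-≤ (b2n (x ≤ᵇ a))
      (sorted-first xs s h (removeOne x (z ∷ Z)) (λ y → +-cancelˡ-≤ (b2n (y ≡ᵇ x)) _ _ (≤-trans (≤-reflexive (sym (sumBy-remove (λ v → b2n (y ≡ᵇ v)) x (z ∷ Z) mx))) (sub y)))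
        (suc-injective (trans (sym (sumBy-remove (λ _ → 1) x (z ∷ Z) mx)) sz)) a))
  where
  mx : 1 ≤ mult x (z ∷ Z)
  mx = subst (1 ≤_) (sym q) (s≤s z≤n)
... | zero = +-mono-≤ head' (sorted-first xs s h Z (λ y → ≤-trans (m≤n+m _ (b2n (y ≡ᵇ z))) (sub' y)) (suc-injective sz) a)
  where
  sub' : (z ∷ Z) ⊑ xs
  sub' y with y ≡ᵇ x in e
  ... | true = ≤-trans (≤-reflexive (subst (λ v → mult v (z ∷ Z) ≡ 0) (sym (≡ᵇ-elim y x e)) q)) z≤n
  ... | false = ≤-trans (sub y) (≤-reflexive (cong (λ b → b2n b + mult y xs) e))
  head' : b2n (z ≤ᵇ a) ≤ b2n (x ≤ᵇ a)
  head' with z ≤ᵇ a in e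
  ... | false = z≤n
  ... | true rewrite ≤ᵇ-yes {x} {a} (≤-trans (l z (≤-trans (mult-self z Z) (sub' z))) (≤ᵇ-elim z a e)) = ≤-refl

nextCol-short : ∀ M X β → size' β ≤ size' X → size' (nextCol M X β) ≡ size' β
nextCol-short M [] [] h = refl
nextCol-short M (a ∷ X) [] h = refl
nextCol-short M (a ∷ X) (y ∷ ys) (s≤s h) = trans (cong suc (nextCol-short M X (removeOne (cmin M a y ys) (y ∷ ys)) (≤-trans (≤-reflexive (sym left)) h))) (cong suc (sym left))
  where
  left : size' ys ≡ size' (removeOne (cmin M a y ys) (y ∷ ys))
  left = suc-injective (sumBy-remove (λ _ → 1) (cmin M a y ys) (y ∷ ys) (cmin-mem M a y ys))

data Increasing : List (List ℕ) → Set where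
  []  : Increasing []
  single : ∀ {β} → Increasing (β ∷ [])
  _∷_ : ∀ {β α cs} → size' β ≤ size' α → Increasing (α ∷ cs) → Increasing (β ∷ α ∷ cs)

fullArr-size : ∀ M β cs → Increasing (β ∷ cs) → size' (fullArr M (β ∷ cs)) ≡ size' β
fullArr-size M β [] _ = refl
fullArr-size M β (α ∷ cs) (le ∷ inc) = nextCol-short M (fullArr M (α ∷ cs)) β (≤-trans le (≤-reflexive (sym (fullArr-size M α cs inc))))

fullArr-length : ∀ M β cs → Increasing (β ∷ cs) → length (fullArr M (β ∷ cs)) ≡ size' β
fullArr-length M β cs inc = trans (sym (size'-length (fullArr M (β ∷ cs)))) (fullArr-size M β cs inc)

sortedCol : ∀ {M c β h} → Lists M c β → Sorted β → h ≤ size' β → Col M h β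
sortedCol {β = β} {h} r s le = record { bounded = ListsProps.bounded r ; big = le ; first = sorted-first β s h }

pass-⊂ : ∀ {M L R R' L' u} → Pass M L R R' L' u → ∀ x → 1 ≤ x → x ≤ M → R' x ≡ true → L x ≡ true
pass-⊂ (pass vt _) x a b h = go (vt x a b) h
  where
  go : ∀ {k l r r' l' k'} → V k l r r' l' k' → r' ≡ true → l ≡ true
  go drop _ = refl
  go both _ = refl
  go nn ()
  go pick ()
  go stay ()

neg-+ : ∀ a k → - (+ k) +ℤ - (+ a) ≡ - (+ (a + k))
neg-+ a k = trans (sym (ℤₚ.neg-distrib-+ (+ k) (+ a))) (cong (λ h → - (+ h)) (+-comm k a))

HeightLe : ℕ → List Column → Set
HeightLe h = All (λ β → h ≤ length β)

heights : ∀ K h β cs → h ≤ length β → T (heightsInc K (β ∷ cs)) → HeightLe h (β ∷ cs)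
heights K h β [] le _ = le ∷ []
heights K h β (α ∷ cs) le inc = let (p , q) = ∧-elim {length β ≤ᵇ length α} (T→≡ inc) in le ∷ heights K h α cs (≤-trans le (≤ᵇ-elim (length β) (length α) p)) (≡→T q)

incTail : ∀ K β cs → T (heightsInc K (β ∷ cs)) → T (heightsInc K cs)
incTail K β [] _ = tt
incTail K β (α ∷ cs) inc = ≡→T (proj₂ (∧-elim {length β ≤ᵇ length α} (T→≡ inc)))

increasing : ∀ K cs → T (heightsInc K cs) → Increasing cs
increasing K [] _ = []
increasing K (β ∷ []) _ = single
increasing K (β ∷ α ∷ cs) inc = let (p , q) = ∧-elim {length β ≤ᵇ length α} (T→≡ inc) in
  subst₂ _≤_ (sym (size'-length β)) (sym (size'-length α)) (≤ᵇ-elim (length β) (length α) p) ∷ increasing K (α ∷ cs) (≡→T q)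

module ChargeA (k : ℕ) (σ : Pair → Pair) (H : Pair → ℤ) (isR : IsRMatrix (typeA (suc (suc k))) σ) (isE : IsEnergy (typeA (suc (suc k))) σ H) where
  open TypeA k σ H isR isE
  open Energy σ H

  Good : Column → Set
  Good β = HeightOK K (length β) × T (valid K (length β) β)

  colOf : ∀ β → Good β → IsCol n (length β) β
  colOf β (_ , v) = toCol (length β) β v

  listed : ∀ {h β} → IsCol n h β → Lists n (χ β) β
  listed {β = β} c = subst (Lists n (χ β)) (sym (IsCol.list c)) (asc-lists n (χ β))

  column : ∀ {h} β → Good β → h ≤ length β → Col n h β
  column β gd le = sortedCol (listed c) (subst Sorted (sym (IsCol.list c)) (strictInc-sorted (asc n (χ β)) (asc-strict n (χ β)))) (≤-trans le (≤-reflexive (sym (size'-length β))))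
    where c = colOf β gd

  columns : ∀ {h} cs → All Good cs → HeightLe h cs → Cols n h cs
  columns [] _ _ = []
  columns (β ∷ cs) (gd ∷ gs) (le ∷ ls) = column β gd le ∷ columns cs gs ls

  moveLeft : ∀ h → HeightOK K h → ∀ cs → All Good cs → HeightLe h cs → ∀ Y → IsCol n h Y → travelE σ H Y cs ≡ - (+ adj n h (Y ∷ cs))
  moveLeft h hh [] _ _ Y cY = refl
  moveLeft h hh (β ∷ cs) (gd ∷ gs) (le ∷ ls) Y cY = trans (cong₂ _+ℤ_ (proj₂ (proj₂ inv)) (moveLeft h hh cs gs ls (proj₁ (σ (β , Y))) cY'))
      (trans (neg-+ (adj n h (proj₁ (σ (β , Y)) ∷ cs)) (u n)) (cong (λ m → - (+ m)) (sym (swap-step cs step (column β gd le ∷ columns cs gs ls)))))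
    where
    s = length β
    x : Pair
    x = β , Y
    vx : InPair K s h x
    vx = fromPair s h x (colOf β gd) cY
    inv = BaseA.all k σ H isR isE s h (proj₁ gd) hh le x vx
    u = proj₁ inv
    P = proj₁ (proj₂ inv)
    cY' : IsCol n h (proj₁ (σ x))
    cY' = proj₁ (toPair h s (σ x) (proj₁ (isR s h (proj₁ gd) hh) x vx))
    step : Step n h β Y (proj₁ (σ x)) (u n)
    step = subst (λ j → Step n j β Y (proj₁ (σ x)) (u n)) (IsCol.size cY)
      (passStep P (listed (colOf β gd)) (listed cY) (listed cY') (λ _ _ _ e → e) (pass-⊂ P) (subst₂ _≤_ (sym (IsCol.size cY)) (sym (IsCol.size (colOf β gd))) le))

  charge : ∀ cs → All Good cs → T (heightsInc K cs) → energyD σ H cs ≡ - (+ arms n cs)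
  charge [] _ _ = refl
  charge (Y ∷ cs) (gd ∷ gs) inc = trans (energy-∷ Y cs) (trans (cong₂ _+ℤ_ (moveLeft (length Y) (proj₁ gd) cs gs (above cs inc) Y (colOf Y gd)) (charge cs gs (incTail K Y cs inc)))
      (trans (neg-+ (arms n cs) (adj n (length Y) (Y ∷ cs))) (cong (λ m → - (+ m)) (sym (trans (arms-∷ n Y cs)
        (cong (λ h → arms n cs + adj n h (Y ∷ cs)) (trans (fullArr-length n Y cs (increasing K (Y ∷ cs) inc)) (size'-length Y))))))))
    where
    above : ∀ cs → T (heightsInc K (Y ∷ cs)) → HeightLe (length Y) cs
    above cs inc with heights K (length Y) Y cs ≤-refl inc
    ... | _ ∷ ls = ls

V-det : ∀ {k s y l g k' l₂ g₂ k₂} → V k s y l g k' → V k s y l₂ g₂ k₂ → l ≡ l₂ × k' ≡ k₂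
V-det nn nn = refl , refl
V-det pick pick = refl , refl
V-det stay stay = refl , refl
V-det drop drop = refl , refl
V-det both both = refl , refl

split-unique : ∀ {n c l g w l₂ g₂ w₂} → Split n c l g w → Split n c l₂ g₂ w₂ → ∀ z → 1 ≤ z → z ≤ n → l z ≡ l₂ z
split-unique {n} {c} {l} {g} {w} {l₂} {g₂} {w₂} p q z a b = proj₁ (V-det (Split.vert p z a b) (V-cong (sym (carry z b)) refl refl refl refl refl (Split.vert q z a b)))
  where
  down : ∀ d → d ≤ n → w (n ∸ d) ≡ w₂ (n ∸ d)
  down zero _ = trans (Split.top p) (sym (Split.top q))
  down (suc d) le = subst (λ m → w m ≡ w₂ m) (pred[m∸n]≡m∸[1+n] n d) (proj₂ (V-det (Split.vert p (n ∸ d) (m<n⇒0<n∸m le) (m∸n≤m n d))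
    (V-cong (sym (down d (<⇒≤ le))) refl refl refl refl refl (Split.vert q (n ∸ d) (m<n⇒0<n∸m le) (m∸n≤m n d)))))
  carry : ∀ z → z ≤ n → w z ≡ w₂ z
  carry z le = subst (λ m → w m ≡ w₂ m) (m∸[m∸n]≡n le) (down (n ∸ z) (m∸n≤m n z))

lists-cong : ∀ {M b b' xs} → b ≗[ M ] b' → Lists M b xs → Lists M b' xs
lists-cong {M} e r = lists λ g → trans (Lists.sums r g) (sumTo-cong M λ x p q → cong (λ v → when v (g x)) (e x p q))

leftHalf rightHalf : ∀ {n c} → Spl n c → Bits
leftHalf {n} {c} s  = glue n (Spl.l s) c
rightHalf {n} {c} s = glue n c (star n (Spl.g s))

left-unique : ∀ {n c} (s s' : Spl n c) → leftHalf s ≗[ 2 * n ] leftHalf s'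
left-unique {n} {c} s s' x a _ with <-≤-connex n x
... | inj₁ lt = trans (glue-high n (Spl.l s) c x lt) (sym (glue-high n (Spl.l s') c x lt))
... | inj₂ le = trans (glue-low n (Spl.l s) c x le) (trans (split-unique (Spl.isSplit s) (Spl.isSplit s') x a le) (sym (glue-low n (Spl.l s') c x le)))

-- The left half contains no pair z, z̄.
left-⊂-star : ∀ {n c} (s : Spl n c) x → 1 ≤ x → x ≤ 2 * n → leftHalf s x ≡ true → glue n (star n c) (star n (Spl.l s)) x ≡ true
left-⊂-star {n} {c} (spl l g w sp) x a b h with <-≤-connex n x
... | inj₂ le = trans (glue-low n (star n c) (star n l) x le) (go (Split.vert sp x a le) (trans (sym (glue-low n l c x le)) h))
  where
  go : ∀ {k s y l' g' k'} → V k s y l' g' k' → l' ≡ true → s ≡ true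
  go drop _ = refl
  go both _ = refl
  go nn ()
  go pick ()
  go stay ()
... | inj₁ lt = trans (glue-high n (star n c) (star n l) x lt) (go (Split.vert sp z (proj₁ zr) (bar-low n x lt)) (cong not (trans (cong c (bar-bar n x (m≤n⇒m≤1+n b))) (trans (sym (glue-high n l c x lt)) h))))
  where
  z = bar n x
  zr = bar-range n x a b
  go : ∀ {k s y l' g' k'} → V k s y l' g' k' → s ≡ false → not l' ≡ true
  go nn _ = refl
  go pick _ = refl
  go stay ()
  go drop ()
  go both ()

right-below-left : ∀ {n c} (s : Spl n c) a → a ≤ 2 * n → cn a (rightHalf s) ≤ cn a (leftHalf s)
right-below-left {n} {c} (spl l g w sp) a a≤M = compare (≤-total a n)
  where
  L R : Bits
  L = glue n l c
  R = glue n c (star n g)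
  flowLow : ∀ a → a ≤ n → cn a L ≡ w a + cn a R
  flowLow zero _ = trans (sym (Split.bot sp)) (sym (+-identityʳ (w 0)))
  flowLow (suc a) le = trans (cong (λ v → b2n v + cn a L) (glue-low n l c (suc a) le)) (trans (go (Split.vert sp (suc a) (s≤s z≤n) le) (flowLow a (<⇒≤ le)))
      (cong (λ v → w (suc a) + (b2n v + cn a R)) (sym (glue-low n c (star n g) (suc a) le))))
    where
    go : ∀ {k s y l' g' k' p q} → V k s y l' g' k' → p ≡ k' + q → b2n l' + p ≡ k + (b2n y + q)
    go nn e' = e'
    go {k} {q = q} pick e' = trans e' (sym (+-suc k q))
    go stay e' = e'
    go drop e' = cong suc e'
    go {k} {q = q} both e' = trans (cong suc e') (sym (+-suc k q))
  flowHigh : ∀ d → d ≤ n → cn (d + n) L ≡ w (n ∸ d) + cn (d + n) R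
  flowHigh zero _ = flowLow n ≤-refl
  flowHigh (suc d) le = trans (cong (λ v → b2n v + cn (d + n) L) (glue-high n l c x n<x)) (trans (subst (λ k → b2n (c x) + cn (d + n) L ≡ w k + (b2n (not (g z)) + cn (d + n) R)) (pred[m∸n]≡m∸[1+n] n d)
        (go (subst (λ v → V (w z) (not v) (c z) (l z) (g z) (w (pred z))) (cong c z̄) (Split.vert sp z (m<n⇒0<n∸m le) (m∸n≤m n d))) (flowHigh d (<⇒≤ le))))
      (cong (λ v → w (n ∸ suc d) + (b2n v + cn (d + n) R)) (sym (trans (glue-high n c (star n g) x n<x) (cong (λ v → not (g v)) x̄)))))
    where
    x z : ℕ
    x = suc (d + n)
    z = n ∸ d
    n<x : n < x
    n<x = s≤s (m≤n+m n d)
    x̄ : bar n x ≡ z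
    x̄ = trans (cong₂ _∸_ (cong (λ k → n + k) (+-identityʳ n)) (+-comm d n)) ([m+n]∸[m+o]≡n∸o n n d)
    z̄ : bar n z ≡ x
    z̄ = trans (cong (bar n) (sym x̄)) (bar-bar n x (s≤s (≤-trans (+-monoˡ-≤ n (<⇒≤ le)) (≤-reflexive (cong (λ k → n + k) (sym (+-identityʳ n)))))))
    go : ∀ {k v y l' g' k' p q} → V k (not v) y l' g' k' → p ≡ k + q → b2n v + p ≡ k' + (b2n (not g') + q)
    go {k} {true} {q = q} nn e' = trans (cong suc e') (sym (+-suc k q))
    go {k} {true} pick e' = cong suc e'
    go {v = false} stay e' = e'
    go {v = false} {k' = k'} {q = q} drop e' = trans e' (sym (+-suc k' q))
    go {v = false} both e' = e'
  compare : a ≤ n ⊎ n ≤ a → cn a R ≤ cn a L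
  compare (inj₁ le) = ≤-trans (m≤n+m _ (w a)) (≤-reflexive (sym (flowLow a le)))
  compare (inj₂ ge) = subst (λ m → cn m R ≤ cn m L) (m∸n+n≡m ge) (≤-trans (m≤n+m _ (w (n ∸ (a ∸ n))))
    (≤-reflexive (sym (flowHigh (a ∸ n) (≤-trans (∸-monoˡ-≤ n a≤M) (≤-reflexive (trans (m+n∸m≡n n (n + 0)) (+-identityʳ n))))))))

module ChargeC (n' : ℕ) (σ : Pair → Pair) (H : Pair → ℤ) (isR : IsRMatrix (typeC (suc n')) σ) (isE : IsEnergy (typeC (suc n')) σ H) where
  open TypeC n' σ H isR isE
  open Energy σ H

  Good : Column → Set
  Good β = HeightOK K (length β) × T (valid K (length β) β)

  colOf : ∀ β → Good β → IsColC n (length β) β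
  colOf β (_ , v) = toColC n (length β) β v

  halves : List Column → List Column
  halves []       = []
  halves (β ∷ cs) = colR n β ∷ colL n β ∷ halves cs

  splitLR-++ : ∀ xs ys → splitLR n (xs ++ ys) ≡ splitLR n xs ++ splitLR n ys
  splitLR-++ [] ys = refl
  splitLR-++ (x ∷ xs) ys = cong (λ h → colL n x ∷ colR n x ∷ h) (splitLR-++ xs ys)

  splitLR-halves : ∀ cs → splitLR n (reverse cs) ≡ reverse (halves cs)
  splitLR-halves [] = refl
  splitLR-halves (β ∷ cs) = begin
    splitLR n (reverse (β ∷ cs)) ≡⟨ cong (splitLR n) (unfold-reverse β cs) ⟩
    splitLR n (reverse cs ++ β ∷ []) ≡⟨ splitLR-++ (reverse cs) (β ∷ []) ⟩
    splitLR n (reverse cs) ++ colL n β ∷ colR n β ∷ [] ≡⟨ cong (λ h → h ++ colL n β ∷ colR n β ∷ []) (splitLR-halves cs) ⟩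
    reverse (halves cs) ++ colL n β ∷ colR n β ∷ [] ≡⟨ sym (++-assoc (reverse (halves cs)) (colL n β ∷ []) (colR n β ∷ [])) ⟩
    (reverse (halves cs) ++ colL n β ∷ []) ++ colR n β ∷ [] ≡⟨ cong (λ h → h ++ colR n β ∷ []) (sym (unfold-reverse (colL n β) (halves cs))) ⟩
    reverse (colL n β ∷ halves cs) ++ colR n β ∷ [] ≡⟨ sym (unfold-reverse (colR n β) (colL n β ∷ halves cs)) ⟩
    reverse (halves (β ∷ cs)) ∎
    where open ≡-Reasoning

  left-lists : ∀ {h β} (k : IsColC n h β) → Lists M (leftHalf (IsColC.sp k)) (colL n β)
  left-lists {β = β} (isColC c (spl l g w sp)) = Halves.colL-lists n β (IsCol.list c) l g w sp

  right-lists : ∀ {h β} (k : IsColC n h β) → Lists M (rightHalf (IsColC.sp k)) (colR n β)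
  right-lists {β = β} (isColC c (spl l g w sp)) = Halves.colR-lists n β (IsCol.list c) l g w sp

  colL-size : ∀ β → size' (colL n β) ≡ length β
  colL-size β = trans (sumBy-sort (λ _ → 1) (map (replL n β) β)) (trans (sumBy-map (λ _ → 1) (replL n β) β) (size'-length β))

  colR-size : ∀ β → size' (colR n β) ≡ length β
  colR-size β = trans (sumBy-sort (λ _ → 1) (map (replR n β) β)) (trans (sumBy-map (λ _ → 1) (replR n β) β) (size'-length β))

  columns : ∀ {h} cs → All Good cs → HeightLe h cs → Cols M h (halves cs)
  columns [] _ _ = []
  columns (β ∷ cs) (gd ∷ gs) (le ∷ ls) = sortedCol (right-lists (colOf β gd)) (sort-sorted (map (replR n β) β)) (≤-trans le (≤-reflexive (sym (colR-size β))))
    ∷ sortedCol (left-lists (colOf β gd)) (sort-sorted (map (replL n β) β)) (≤-trans le (≤-reflexive (sym (colL-size β)))) ∷ columns cs gs ls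

  -- R passes the two halves of a column β; only the second pass takes place in (β^L)*,
  -- and its result is confined to β^L by the other embedding of the same pair.
  module Two (s h : ℕ) (hs : HeightOK K s) (hh : HeightOK K h) (h≤s : h ≤ s) (β Y : Column) (cβ : IsColC n s β) (cY : IsColC n h Y)
    (sY : Spl n (χ Y)) (YL : List ℕ) (rY : Lists M (leftHalf sY) YL) (len : size' YL ≡ h) where
    x : Pair
    x = β , Y
    vx : InPair K s h x
    vx = fromPair s h x cβ cY
    Y' : Column
    Y' = proj₁ (σ x)
    cY' : IsColC n h Y'
    cY' = proj₁ (toPair h s (σ x) (proj₁ (isR s h hs hh) x vx))

    record Result : Set where
      field
        k₁ k₂ : ℕ
        o : List ℕ
        sY' : Spl n (χ Y')
        step₁ : Step M h (colR n β) YL o k₁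
        step₂ : Step M h (colL n β) o (asc M (leftHalf sY')) k₂
        energy : H x ≡ - (+ (k₁ + k₂))

    result : Inv LR x → Inv RL x → Result
    result (_ , inv₄ ta tb tc td _ _ (chain _ Q₂ _ _) _ , _) (_ , inv₄ sa sb sc sd u₁ u₂ (chain {T₁ = T₁} P₁ P₂ _ _) refl , Hx) = record
      { k₁ = u₁ M ; k₂ = u₂ M ; o = asc M T₁ ; sY' = sc ; energy = Hx
      ; step₁ = subst (λ j → Step M j (colR n β) YL (asc M T₁) (u₁ M)) sz₁ st₁
      ; step₂ = subst (λ j → Step M j (colL n β) (asc M T₁) (asc M (leftHalf sc)) (u₂ M)) sz₂
          (passStep P₂ (left-lists cβ') (asc-lists M T₁) (asc-lists M (leftHalf sc)) (left-⊂-star sa) inside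
            (≤-trans (≤-reflexive sz₂) (≤-trans h≤s (≤-reflexive (sym (sizeOf (left-lists cβ') (colL-size β))))))) }
      where
      cβ' : IsColC n s β
      cβ' = isColC (IsColC.col cβ) sa
      lenβ : length β ≡ s
      lenβ = trans (cong length (IsCol.list (IsColC.col cβ))) (trans (length-asc M (χ β)) (IsCol.size (IsColC.col cβ)))
      sizeOf : ∀ {c xs} → Lists M c xs → size' xs ≡ length β → cn M c ≡ s
      sizeOf r e' = trans (sym (ListsProps.sizeAt r)) (trans e' lenβ)
      rYb : Lists M (leftHalf sb) YL
      rYb = lists-cong (left-unique sY sb) rY
      sz₁ : cn M (leftHalf sb) ≡ h
      sz₁ = trans (sym (ListsProps.sizeAt rYb)) len
      st₁ : Step M (cn M (leftHalf sb)) (colR n β) YL (asc M T₁) (u₁ M)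
      st₁ = passStep P₁ (right-lists cβ') rYb (asc-lists M T₁) (λ _ _ _ t → t) (pass-⊂ P₁)
        (≤-trans (≤-reflexive sz₁) (≤-trans h≤s (≤-reflexive (sym (sizeOf (right-lists cβ') (colR-size β))))))
      sz₂ : cn M T₁ ≡ h
      sz₂ = trans (sym (ListsProps.sizeAt (asc-lists M T₁))) (trans (Step.sizeY' st₁) sz₁)
      inside : ∀ y → 1 ≤ y → y ≤ M → leftHalf sc y ≡ true → leftHalf sa y ≡ true
      inside y a b t = trans (left-unique sa ta y a b) (pass-⊂ Q₂ y a b (trans (sym (left-unique sc tc y a b)) t))

  moveLeft : ∀ h → HeightOK K h → ∀ cs → All Good cs → HeightLe h cs → ∀ Y → IsColC n h Y → (sY : Spl n (χ Y)) → ∀ YL → Lists M (leftHalf sY) YL → size' YL ≡ h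
    → travelE σ H Y cs ≡ - (+ adj M h (YL ∷ halves cs))
  moveLeft h hh [] _ _ Y cY sY YL rY len = refl
  moveLeft h hh (β ∷ cs) (gd ∷ gs) (le ∷ ls) Y cY sY YL rY len = go (columns (β ∷ cs) (gd ∷ gs) (le ∷ ls)) (T.result (proj₁ inv) (proj₂ inv))
    where
    module T = Two (length β) h (proj₁ gd) hh le β Y (colOf β gd) cY sY YL rY len
    inv : Inv LR T.x × Inv RL T.x
    inv = BaseC.all n' σ H isR isE (length β) h (proj₁ gd) hh le T.x T.vx
    go : Cols M h (colR n β ∷ colL n β ∷ halves cs) → T.Result → travelE σ H Y (β ∷ cs) ≡ - (+ adj M h (YL ∷ colR n β ∷ colL n β ∷ halves cs))
    go (c₁ ∷ c₂ ∷ ok) r = trans (cong₂ _+ℤ_ R.energy (moveLeft h hh cs gs ls T.Y' T.cY' R.sY' (asc M (leftHalf R.sY')) (asc-lists M (leftHalf R.sY')) (Step.sizeY' R.step₂)))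
        (trans (neg-+ (adj M h (asc M (leftHalf R.sY') ∷ halves cs)) (R.k₁ + R.k₂)) (cong (λ m → - (+ m)) (sym costs)))
      where
      module R = T.Result r
      costs : adj M h (YL ∷ colR n β ∷ colL n β ∷ halves cs) ≡ adj M h (asc M (leftHalf R.sY') ∷ halves cs) + (R.k₁ + R.k₂)
      costs = trans (swap-step (colL n β ∷ halves cs) R.step₁ (c₁ ∷ c₂ ∷ ok)) (trans (cong (λ m → m + R.k₁) (swap-step (halves cs) R.step₂ (c₂ ∷ ok)))
        (trans (+-assoc _ R.k₂ R.k₁) (cong (λ m → adj M h (asc M (leftHalf R.sY') ∷ halves cs) + m) (+-comm R.k₂ R.k₁))))

  no-descent : ∀ β δ → Good β → Cols M (length β) δ → adj M (length β) (colR n β ∷ colL n β ∷ δ) ≡ adj M (length β) (colL n β ∷ δ)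
  no-descent β δ gd ok = trans (cong (λ m → adj M h (colL n β ∷ δ) + m) (n≤0⇒n≡0 (cost-least M X (colR n β) 0 bX (ListsProps.bounded rR) (trans sX (sym (colR-size β))) reach))) (+-identityʳ _)
    where
    h = length β
    rL = left-lists (colOf β gd)
    rR = right-lists (colOf β gd)
    X = arr M h (colL n β ∷ δ)
    cL : Col M h (colL n β)
    cL = sortedCol rL (sort-sorted (map (replL n β) β)) (≤-reflexive (sym (colL-size β)))
    sX = proj₁ (arr-ok (colL n β) δ (cL ∷ ok))
    bX = proj₂ (arr-ok (colL n β) δ (cL ∷ ok))
    arr-⊑ : ∀ δ → arr M h (colL n β ∷ δ) ⊑ colL n β
    arr-⊑ [] = take-⊑ h (colL n β)
    arr-⊑ (α ∷ δ) = nextCol-⊑ M (arr M h (α ∷ δ)) (colL n β)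
    reach : Reach 0 X (colR n β)
    reach a = subst (_≤ below a X + 0) (+-identityʳ _) (everywhere (colR n β) X 0 0 (ListsProps.bounded rR) bX (λ a le → +-monoˡ-≤ 0
      (≤-trans (≤-reflexive (ListsProps.belowAt rR a le)) (≤-trans (right-below-left (IsColC.sp (colOf β gd)) a le)
        (≤-reflexive (trans (sym (ListsProps.belowAt rL a le)) (sym (⊑-full X (colL n β) (arr-⊑ δ) (trans sX (sym (colL-size β))) (λ y → b2n (y ≤ᵇ a))))))))) a)

  halves-increasing : ∀ cs → T (heightsInc K cs) → Increasing (halves cs)
  halves-increasing [] _ = []
  halves-increasing (β ∷ []) _ = ≤-reflexive (trans (colR-size β) (sym (colL-size β))) ∷ single
  halves-increasing (β ∷ α ∷ cs) inc = let (p , q) = ∧-elim {length β ≤ᵇ length α} (T→≡ inc) in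
    ≤-reflexive (trans (colR-size β) (sym (colL-size β))) ∷ (subst₂ _≤_ (sym (colL-size β)) (sym (colR-size α)) (≤ᵇ-elim (length β) (length α) p) ∷ halves-increasing (α ∷ cs) (≡→T q))

  arms-halves : ∀ β cs → All Good (β ∷ cs) → T (heightsInc K (β ∷ cs)) → arms M (halves (β ∷ cs)) ≡ (arms M (halves cs) + adj M (length β) (colL n β ∷ halves cs)) + adj M (length β) (colL n β ∷ halves cs)
  arms-halves β cs (gd ∷ gs) inc = trans (arms-∷ M (colR n β) (colL n β ∷ halves cs)) (cong₂ _+_
      (trans (arms-∷ M (colL n β) (halves cs)) (cong (λ h → arms M (halves cs) + adj M h (colL n β ∷ halves cs)) (trans (fullArr-length M (colL n β) (halves cs) incL) (colL-size β))))
      (trans (cong (λ h → adj M h (colR n β ∷ colL n β ∷ halves cs)) (trans (fullArr-length M (colR n β) (colL n β ∷ halves cs) incR) (colR-size β)))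
        (no-descent β (halves cs) gd (columns cs gs (above cs inc)))))
    where
    incR = halves-increasing (β ∷ cs) inc
    incL : Increasing (colL n β ∷ halves cs)
    incL with incR
    ... | _ ∷ i = i
    above : ∀ cs → T (heightsInc K (β ∷ cs)) → HeightLe (length β) cs
    above cs inc with heights K (length β) β cs ≤-refl inc
    ... | _ ∷ ls = ls

  charge : ∀ cs → All Good cs → T (heightsInc K cs) → energyD σ H cs +ℤ energyD σ H cs ≡ - (+ arms M (halves cs))
  charge [] _ _ = refl
  charge (Y ∷ cs) (gd ∷ gs) inc = begin
    energyD σ H (Y ∷ cs) +ℤ energyD σ H (Y ∷ cs) ≡⟨ cong (λ v → v +ℤ v) (trans (energy-∷ Y cs) (cong (λ v → v +ℤ D) moved)) ⟩
    (- (+ t) +ℤ D) +ℤ (- (+ t) +ℤ D) ≡⟨ ℤ-swap4 (- (+ t)) D ⟩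
    (- (+ t) +ℤ - (+ t)) +ℤ (D +ℤ D) ≡⟨ cong₂ _+ℤ_ (neg-+ t t) (charge cs gs (incTail K Y cs inc)) ⟩
    - (+ (t + t)) +ℤ - (+ arms M (halves cs)) ≡⟨ neg-+ (arms M (halves cs)) (t + t) ⟩
    - (+ (arms M (halves cs) + (t + t))) ≡⟨ cong (λ v → - (+ v)) (trans (sym (+-assoc (arms M (halves cs)) t t)) (sym (arms-halves Y cs (gd ∷ gs) inc))) ⟩
    - (+ arms M (halves (Y ∷ cs))) ∎
    where
    open ≡-Reasoning
    D : ℤ
    D = energyD σ H cs
    t : ℕ
    t = adj M (length Y) (colL n Y ∷ halves cs)
    above : ∀ cs → T (heightsInc K (Y ∷ cs)) → HeightLe (length Y) cs
    above cs inc with heights K (length Y) Y cs ≤-refl inc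
    ... | _ ∷ ls = ls
    moved : travelE σ H Y cs ≡ - (+ t)
    moved = moveLeft (length Y) (proj₁ gd) cs gs (above cs inc) Y (colOf Y gd) (IsColC.sp (colOf Y gd)) (colL n Y) (left-lists (colOf Y gd)) (colL-size Y)
    ℤ-swap4 : ∀ a b → (a +ℤ b) +ℤ (a +ℤ b) ≡ (a +ℤ a) +ℤ (b +ℤ b)
    ℤ-swap4 a b = trans (ℤₚ.+-assoc a b (a +ℤ b)) (trans (cong (λ v → a +ℤ v) (trans (sym (ℤₚ.+-assoc b a b)) (trans (cong (λ v → v +ℤ b) (ℤₚ.+-comm b a)) (ℤₚ.+-assoc a b b)))) (sym (ℤₚ.+-assoc a a (b +ℤ b))))

double : ∀ x → (+ 2) Data.Integer.* x ≡ x +ℤ x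
double x = trans (ℤₚ.*-distribʳ-+ x (+ 1) (+ 1)) (cong₂ _+ℤ_ (ℤₚ.*-identityˡ x) (ℤₚ.*-identityˡ x))

theorem1p1 : (∀ (n : ℕ) → 2 ≤ n → EnergyIsMinusCharge (typeA n))
           × (∀ (n : ℕ) → 1 ≤ n → EnergyIsMinusCharge (typeC n))
theorem1p1 = typeA-charge , typeC-charge
  where
  typeA-charge : ∀ (n : ℕ) → 2 ≤ n → EnergyIsMinusCharge (typeA n)
  typeA-charge (suc (suc k)) _ σ H isR isE c (good , inc) = trans (ℤₚ.*-identityˡ (energyD σ H c)) (ChargeA.charge k σ H isR isE c good inc)
  typeA-charge (suc zero) (s≤s ())
  typeC-charge : ∀ (n : ℕ) → 1 ≤ n → EnergyIsMinusCharge (typeC n)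
  typeC-charge (suc n') _ σ H isR isE c (good , inc) = trans (double (energyD σ H c)) (trans (charge c good inc)
      (cong (λ d → - (+ sumArms (gamma M d))) (sym (splitLR-halves c))))
    where
    open ChargeC n' σ H isR isE
    M = 2 * suc n'
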